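{- Let $\mathcal{C}$ be a class of polytime computable functions from $\mathbb{R}^2$ to $\mathbb{R}$ that approximates the class of polytime computable integer functions. Let $f:\mathbb{R}\to\mathbb{R}$ be locally poly-Lipschitz. Then $f$ is polytime computable if and only if $f$ is $\mathcal{C}$-definable.
   Context: Dyadic numbers: $\mathbb{D}=\{a/2^b : a\in\mathbb{Z}, b\in\mathbb{N}\}$. For $x\in\mathbb{R}$, $CF_x$ is the set of functions $\varphi:\mathbb{N}\to\mathbb{D}$ with $|x-\varphi(n)|\le 2^{ -n}$ for all $n\in\mathbb{N}$. A function $f:\mathbb{R}^d\to\mathbb{R}$ is computable if there is an oracle Turing machine $M$ (with $d$ oracles) such that for all $(x_1,\dots,x_d)\in\mathbb{R}^d$, all $\varphi_i\in CF_{x_i}$ and all $n\in\mathbb{N}$, $|M^{\varphi_1,\dots,\varphi_d}(n)-f(x_1,\dots,x_d)|\le 2^{ -n}$. It is polytime computable if moreover there is a polynomial $p$ such that the running time of $M^{\varphi_1,\dots,\varphi_d}(n)$ is at most $p(k,n)$, where $k=\min\{j\in\mathbb{N} : x_1,\dots,x_d\in[-2^j,2^j]\}$. An integer function $h:\mathbb{Z}^2\to\mathbb{Z}$ is polytime computable if it is computable by a Turing machine in time polynomial in the lengths of the binary representations of its arguments. $f:\mathbb{R}\to\mathbb{R}$ is locally Lipschitz if it is Lipschitz on every compact subset of $\mathbb{R}$. With $C_i=[-2^i,2^i]$, $f$ is locally poly-Lipschitz if it is locally Lipschitz and there is a sequence $(K_{C_i})_{i\in\mathbb{N}}$ of natural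 numbers, $K_{C_i}$ being a Lipschitz constant of $f$ on $C_i$, and a Turing machine that on input $i$ computes $K_{C_i}$ in time $p(i)$ for some polynomial $p$. A class $\mathcal{C}$ of functions $\mathbb{R}^2\to\mathbb{R}$ approximates a class $\mathcal{D}$ of functions $\mathbb{Z}^2\to\mathbb{Z}$ if for every $g\in\mathcal{D}$ there is $\tilde g\in\mathcal{C}$ with $|\tilde g(x,y)-g(x,y)|\le 1/4$ for all $x,y\in\mathbb{Z}$. Here $\mathcal{D}$ is the class of polytime computable functions $\mathbb{Z}^2\to\mathbb{Z}$. $f:\mathbb{R}\to\mathbb{R}$ is $\mathcal{C}$-definable if there is $\tilde g\in\mathcal{C}$ such that $|\tilde g(x,y)-y f(x/y)|\le 3$ for all $x\in\mathbb{Z}$ and all integers $y\ge 1$. -}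

module Defs where

open import Data.Bool.Base using (Bool; true; false)
open import Data.Fin.Base using (Fin; zero; suc; _↑ˡ_)
open import Data.Integer.Base using (ℤ; +_; -[1+_])
import Data.Integer.Base as ℤ
open import Data.List.Base using (List; []; _∷_; [_]; _++_; length; map; replicate; reverse)
open import Data.List.Relation.Unary.Any using (Any)
open import Data.Maybe using (Maybe; just; nothing; maybe′; Is-just)
import Data.Maybe as Maybe
open import Data.Nat.Base as ℕ using (ℕ; zero; suc; NonZero)
import Data.Nat.Properties as ℕ
open import Data.Nat.DivMod using (_/_)
open import Data.Product.Base using (∃-syntax; Σ-syntax; _×_; _,_; proj₂)
open import Data.Rational.Base as ℚ using (ℚ; 0ℚ; 1ℚ; ½; Positive; NonNegative)
import Data.Rational.Properties as ℚ
open import Data.Sum.Base using (inj₁; inj₂)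
open import Data.Vec.Base using (Vec; []; _∷_; _[_]≔_; lookup; zipWith)
import Data.Vec.Base as Vec
import Data.Vec.Functional as F
import Data.Vec.Functional.Relation.Binary.Equality.Setoid as FunctionalVector
open import Function.Bundles using (Func; _↔_)
open import Level using (0ℓ; Level; _⊔_)
open import Relation.Binary.Bundles using (Setoid)
open import Relation.Binary.Definitions using (_Respects_)
open import Relation.Binary.PropositionalEquality using (_≡_; refl; sym; trans; cong; cong₂; subst)
open import Relation.Nullary.Decidable using (dec⇒maybe)
open import Relation.Unary using (Pred)
open import Tactic.RingSolver using (solve-∀)
open import Tactic.RingSolver.Core.AlmostCommutativeRing using (AlmostCommutativeRing; fromCommutativeRing)

private
  variable
    a b : Level

-- Reals are Cauchy sequences of rationals; equality of reals is _≈_.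

Eventually : Pred ℕ a → Set a
Eventually P = ∃[ N ] (∀ n → N ℕ.≤ n → P n)

IsCauchy : (ℕ → ℚ) → Set
IsCauchy s = ∀ ε → .{{Positive ε}} →
  ∃[ N ] (∀ m n → N ℕ.≤ m → N ℕ.≤ n → ℚ.∣ s m ℚ.- s n ∣ ℚ.≤ ε)

record ℝ : Set where
  constructor mkℝ
  field
    seq    : ℕ → ℚ
    cauchy : IsCauchy seq
open ℝ public

infix 4 _≈_ _≤_ _<_

_≈_ : ℝ → ℝ → Set
x ≈ y = ∀ ε → .{{Positive ε}} → Eventually λ n → ℚ.∣ seq x n ℚ.- seq y n ∣ ℚ.≤ ε

_≤_ : ℝ → ℝ → Set
x ≤ y = ∀ ε → .{{Positive ε}} → Eventually λ n → seq x n ℚ.≤ seq y n ℚ.+ ε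

_<_ : ℝ → ℝ → Set
x < y = Σ[ ε ∈ ℚ ] (Positive ε × Eventually λ n → seq x n ℚ.+ ε ℚ.≤ seq y n)

private
  ℚ-ring : AlmostCommutativeRing 0ℓ 0ℓ
  ℚ-ring = fromCommutativeRing ℚ.+-*-commutativeRing λ p → dec⇒maybe (0ℚ ℚ.≟ p)

  p-q≡-[q-p] : ∀ p q → p ℚ.- q ≡ ℚ.- (q ℚ.- p)
  p-q≡-[q-p] = solve-∀ ℚ-ring

  p-q+q≡p : ∀ p q → (p ℚ.- q) ℚ.+ q ≡ p
  p-q+q≡p = solve-∀ ℚ-ring

  p+q-q≡p : ∀ p q → (p ℚ.+ q) ℚ.- q ≡ p
  p+q-q≡p = solve-∀ ℚ-ring

  q-p≡-p-[-q] : ∀ p q → q ℚ.- p ≡ (ℚ.- p) ℚ.- (ℚ.- q)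
  q-p≡-p-[-q] = solve-∀ ℚ-ring

  telescope : ∀ p q r → (p ℚ.- q) ℚ.+ (q ℚ.- r) ≡ p ℚ.- r
  telescope = solve-∀ ℚ-ring

  regroup : ∀ p q r s → (p ℚ.- q) ℚ.+ (r ℚ.- s) ≡ (p ℚ.+ r) ℚ.- (q ℚ.+ s)
  regroup = solve-∀ ℚ-ring

  expand : ∀ p q r s → p ℚ.* q ℚ.- r ℚ.* s ≡ p ℚ.* (q ℚ.- s) ℚ.+ s ℚ.* (p ℚ.- r)
  expand = solve-∀ ℚ-ring

  swap : ∀ p q r → p ℚ.* (q ℚ.* r) ≡ q ℚ.* (p ℚ.* r)
  swap = solve-∀ ℚ-ring

  half : ℚ → ℚ
  half ε = ½ ℚ.* ε

  half-pos : ∀ ε → .{{Positive ε}} → Positive (half ε)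
  half-pos ε = ℚ.pos*pos⇒pos ½ ε

  half+half : ∀ ε → half ε ℚ.+ half ε ≡ ε
  half+half ε = trans (sym (ℚ.*-distribʳ-+ ε ½ ½)) (ℚ.*-identityˡ ε)

  ∣p-p∣≤ε : ∀ p ε → .{{Positive ε}} → ℚ.∣ p ℚ.- p ∣ ℚ.≤ ε
  ∣p-p∣≤ε p ε rewrite ℚ.+-inverseʳ p = ℚ.<⇒≤ (ℚ.positive⁻¹ ε)

  ∣p-q∣≡∣q-p∣ : ∀ p q → ℚ.∣ p ℚ.- q ∣ ≡ ℚ.∣ q ℚ.- p ∣
  ∣p-q∣≡∣q-p∣ p q = trans (cong ℚ.∣_∣ (p-q≡-[q-p] p q)) (ℚ.∣-p∣≡∣p∣ (q ℚ.- p))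

  ∣∣-triangle : ∀ p q r → ℚ.∣ p ℚ.- r ∣ ℚ.≤ ℚ.∣ p ℚ.- q ∣ ℚ.+ ℚ.∣ q ℚ.- r ∣
  ∣∣-triangle p q r = subst (ℚ._≤ ℚ.∣ p ℚ.- q ∣ ℚ.+ ℚ.∣ q ℚ.- r ∣) (cong ℚ.∣_∣ (telescope p q r))
    (ℚ.∣p+q∣≤∣p∣+∣q∣ (p ℚ.- q) (q ℚ.- r))

  ∣p∣-∣q∣≤∣p-q∣ : ∀ p q → ℚ.∣ p ∣ ℚ.- ℚ.∣ q ∣ ℚ.≤ ℚ.∣ p ℚ.- q ∣
  ∣p∣-∣q∣≤∣p-q∣ p q = subst (ℚ.∣ p ∣ ℚ.- ℚ.∣ q ∣ ℚ.≤_)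
    (p+q-q≡p ℚ.∣ p ℚ.- q ∣ ℚ.∣ q ∣)
    (ℚ.+-monoˡ-≤ (ℚ.- ℚ.∣ q ∣)
      (subst (ℚ._≤ ℚ.∣ p ℚ.- q ∣ ℚ.+ ℚ.∣ q ∣) (cong ℚ.∣_∣ (p-q+q≡p p q))
        (ℚ.∣p+q∣≤∣p∣+∣q∣ (p ℚ.- q) q)))

  ∣∣p∣-∣q∣∣≤∣p-q∣ : ∀ p q → ℚ.∣ ℚ.∣ p ∣ ℚ.- ℚ.∣ q ∣ ∣ ℚ.≤ ℚ.∣ p ℚ.- q ∣
  ∣∣p∣-∣q∣∣≤∣p-q∣ p q with ℚ.∣p∣≡p∨∣p∣≡-p (ℚ.∣ p ∣ ℚ.- ℚ.∣ q ∣)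
  ... | inj₁ eq = subst (ℚ._≤ ℚ.∣ p ℚ.- q ∣) (sym eq) (∣p∣-∣q∣≤∣p-q∣ p q)
  ... | inj₂ eq = subst (ℚ._≤ ℚ.∣ p ℚ.- q ∣)
      (sym (trans eq (sym (p-q≡-[q-p] ℚ.∣ q ∣ ℚ.∣ p ∣))))
      (subst (ℚ.∣ q ∣ ℚ.- ℚ.∣ p ∣ ℚ.≤_) (∣p-q∣≡∣q-p∣ q p) (∣p∣-∣q∣≤∣p-q∣ q p))

  *-mono-≤-nonNeg : ∀ {p q r s} → .{{NonNegative q}} → .{{NonNegative r}} →
                    p ℚ.≤ q → r ℚ.≤ s → p ℚ.* r ℚ.≤ q ℚ.* s
  *-mono-≤-nonNeg {p} {q} {r} {s} p≤q r≤s =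
    ℚ.≤-trans (ℚ.*-monoʳ-≤-nonNeg r p≤q) (ℚ.*-monoˡ-≤-nonNeg q r≤s)

≈-refl : ∀ {x} → x ≈ x
≈-refl {x} ε = 0 , λ n _ → ∣p-p∣≤ε (seq x n) ε

≈-sym : ∀ {x y} → x ≈ y → y ≈ x
≈-sym {x} {y} x≈y ε with x≈y ε
... | N , h = N , λ n N≤n → subst (ℚ._≤ ε) (∣p-q∣≡∣q-p∣ (seq x n) (seq y n)) (h n N≤n)

≈-trans : ∀ {x y z} → x ≈ y → y ≈ z → x ≈ z
≈-trans {x} {y} {z} x≈y y≈z ε
  with x≈y (half ε) {{half-pos ε}} | y≈z (half ε) {{half-pos ε}}
... | M , h | N , k = M ℕ.+ N , λ n le →
  ℚ.≤-trans (∣∣-triangle (seq x n) (seq y n) (seq z n))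
    (subst (_ ℚ.≤_) (half+half ε)
      (ℚ.+-mono-≤ (h n (ℕ.≤-trans (ℕ.m≤m+n M N) le)) (k n (ℕ.≤-trans (ℕ.m≤n+m N M) le))))

ℝ-setoid : Setoid 0ℓ 0ℓ
ℝ-setoid = record
  { Carrier       = ℝ
  ; _≈_           = _≈_
  ; isEquivalence = record
    { refl  = λ {x} → ≈-refl {x}
    ; sym   = λ {x} {y} → ≈-sym {x} {y}
    ; trans = λ {x} {y} {z} → ≈-trans {x} {y} {z}
    }
  }

infixl 6 _+_ _-_
infixl 7 _*_
infix  8 -_

fromℚ : ℚ → ℝ
fromℚ q = mkℝ (λ _ → q) λ ε → 0 , λ _ _ _ _ → ∣p-p∣≤ε q ε

fromℤ : ℤ → ℝ
fromℤ i = fromℚ (i ℚ./ 1)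

fromℕ : ℕ → ℝ
fromℕ n = fromℤ (+ n)

_+_ : ℝ → ℝ → ℝ
seq (x + y) n = seq x n ℚ.+ seq y n
cauchy (x + y) ε with cauchy x (half ε) {{half-pos ε}} | cauchy y (half ε) {{half-pos ε}}
... | M , h | N , k = M ℕ.+ N , λ m n p q →
  subst (ℚ._≤ ε) (cong ℚ.∣_∣ (regroup (seq x m) (seq x n) (seq y m) (seq y n)))
    (ℚ.≤-trans (ℚ.∣p+q∣≤∣p∣+∣q∣ (seq x m ℚ.- seq x n) (seq y m ℚ.- seq y n))
      (subst (_ ℚ.≤_) (half+half ε)
        (ℚ.+-mono-≤
          (h m n (ℕ.≤-trans (ℕ.m≤m+n M N) p) (ℕ.≤-trans (ℕ.m≤m+n M N) q))
          (k m n (ℕ.≤-trans (ℕ.m≤n+m N M) p) (ℕ.≤-trans (ℕ.m≤n+m N M) q)))))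

-_ : ℝ → ℝ
seq (- x) n = ℚ.- seq x n
cauchy (- x) ε with cauchy x ε
... | N , h = N , λ m n p q →
  subst (ℚ._≤ ε)
    (trans (∣p-q∣≡∣q-p∣ (seq x m) (seq x n)) (cong ℚ.∣_∣ (q-p≡-p-[-q] (seq x m) (seq x n))))
    (h m n p q)

_-_ : ℝ → ℝ → ℝ
x - y = x + (- y)

∣_∣ : ℝ → ℝ
seq ∣ x ∣ n = ℚ.∣ seq x n ∣
cauchy ∣ x ∣ ε with cauchy x ε
... | N , h = N , λ m n p q → ℚ.≤-trans (∣∣p∣-∣q∣∣≤∣p-q∣ (seq x m) (seq x n)) (h m n p q)

private
  eventually-bounded : ∀ x →
    Σ[ B ∈ ℚ ] (Positive B × Eventually λ n → ℚ.∣ seq x n ∣ ℚ.≤ B)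
  eventually-bounded x with cauchy x 1ℚ
  ... | N , h =
      1ℚ ℚ.+ ℚ.∣ seq x N ∣
    , ℚ.pos+nonNeg⇒pos 1ℚ ℚ.∣ seq x N ∣ {{ℚ.∣-∣-nonNeg (seq x N)}}
    , N , λ n N≤n →
      subst (ℚ._≤ 1ℚ ℚ.+ ℚ.∣ seq x N ∣) (cong ℚ.∣_∣ (p-q+q≡p (seq x n) (seq x N)))
        (ℚ.≤-trans (ℚ.∣p+q∣≤∣p∣+∣q∣ (seq x n ℚ.- seq x N) (seq x N))
          (ℚ.+-monoˡ-≤ ℚ.∣ seq x N ∣ (h n N N≤n ℕ.≤-refl)))

  divide : ∀ C ε → .{{Positive C}} → .{{Positive ε}} → Σ[ δ ∈ ℚ ] (Positive δ × C ℚ.* δ ≡ ε)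
  divide C ε =
      ε ℚ.* C⁻¹
    , ℚ.pos*pos⇒pos ε C⁻¹ {{ℚ.1/pos⇒pos C}}
    , trans (swap C ε C⁻¹) (trans (cong (ε ℚ.*_) (ℚ.*-inverseʳ C {{ℚ.pos⇒nonZero C}})) (ℚ.*-identityʳ ε))
    where
    C⁻¹ : ℚ
    C⁻¹ = (ℚ.1/ C) {{ℚ.pos⇒nonZero C}}

  *-close : ∀ {A B δ} → .{{Positive A}} → .{{Positive B}} → ∀ x x′ y y′ →
            ℚ.∣ x ∣ ℚ.≤ A → ℚ.∣ y′ ∣ ℚ.≤ B →
            ℚ.∣ x ℚ.- x′ ∣ ℚ.≤ δ → ℚ.∣ y ℚ.- y′ ∣ ℚ.≤ δ →
            ℚ.∣ x ℚ.* y ℚ.- x′ ℚ.* y′ ∣ ℚ.≤ (A ℚ.+ B) ℚ.* δ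
  *-close {A} {B} {δ} x x′ y y′ ∣x∣≤A ∣y′∣≤B x~x′ y~y′ = begin
    ℚ.∣ x ℚ.* y ℚ.- x′ ℚ.* y′ ∣
      ≡⟨ cong ℚ.∣_∣ (expand x y x′ y′) ⟩
    ℚ.∣ x ℚ.* (y ℚ.- y′) ℚ.+ y′ ℚ.* (x ℚ.- x′) ∣
      ≤⟨ ℚ.∣p+q∣≤∣p∣+∣q∣ (x ℚ.* (y ℚ.- y′)) (y′ ℚ.* (x ℚ.- x′)) ⟩
    ℚ.∣ x ℚ.* (y ℚ.- y′) ∣ ℚ.+ ℚ.∣ y′ ℚ.* (x ℚ.- x′) ∣
      ≡⟨ cong₂ ℚ._+_ (ℚ.∣p*q∣≡∣p∣*∣q∣ x (y ℚ.- y′)) (ℚ.∣p*q∣≡∣p∣*∣q∣ y′ (x ℚ.- x′)) ⟩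
    ℚ.∣ x ∣ ℚ.* ℚ.∣ y ℚ.- y′ ∣ ℚ.+ ℚ.∣ y′ ∣ ℚ.* ℚ.∣ x ℚ.- x′ ∣
      ≤⟨ ℚ.+-mono-≤
           (*-mono-≤-nonNeg {{ℚ.pos⇒nonNeg A}} {{ℚ.∣-∣-nonNeg (y ℚ.- y′)}} ∣x∣≤A y~y′)
           (*-mono-≤-nonNeg {{ℚ.pos⇒nonNeg B}} {{ℚ.∣-∣-nonNeg (x ℚ.- x′)}} ∣y′∣≤B x~x′) ⟩
    A ℚ.* δ ℚ.+ B ℚ.* δ
      ≡⟨ ℚ.*-distribʳ-+ δ A B ⟨
    (A ℚ.+ B) ℚ.* δ ∎
    where open ℚ.≤-Reasoning

  *-cauchy : ∀ x y → IsCauchy (λ n → seq x n ℚ.* seq y n)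
  *-cauchy x y ε =
    let A , A>0 , M , h = eventually-bounded x
        B , B>0 , N , k = eventually-bounded y
        δ , δ>0 , [A+B]δ≡ε = divide (A ℚ.+ B) ε {{ℚ.pos+pos⇒pos A {{A>0}} B {{B>0}}}}
        M′ , h′ = cauchy x δ {{δ>0}}
        N′ , k′ = cauchy y δ {{δ>0}}
        L = M ℕ.⊔ N ; L′ = M′ ℕ.⊔ N′
        L≤ = ℕ.m≤m⊔n L L′ ; L′≤ = ℕ.m≤n⊔m L L′
    in L ℕ.⊔ L′ , λ m n p q →
      subst (ℚ.∣ seq x m ℚ.* seq y m ℚ.- seq x n ℚ.* seq y n ∣ ℚ.≤_) [A+B]δ≡ε
        (*-close {A} {B} {δ} {{A>0}} {{B>0}} (seq x m) (seq x n) (seq y m) (seq y n)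
          (h m (ℕ.≤-trans (ℕ.≤-trans (ℕ.m≤m⊔n M N) L≤) p))
          (k n (ℕ.≤-trans (ℕ.≤-trans (ℕ.m≤n⊔m M N) L≤) q))
          (h′ m n (ℕ.≤-trans (ℕ.≤-trans (ℕ.m≤m⊔n M′ N′) L′≤) p)
                  (ℕ.≤-trans (ℕ.≤-trans (ℕ.m≤m⊔n M′ N′) L′≤) q))
          (k′ m n (ℕ.≤-trans (ℕ.≤-trans (ℕ.m≤n⊔m M′ N′) L′≤) p)
                  (ℕ.≤-trans (ℕ.≤-trans (ℕ.m≤n⊔m M′ N′) L′≤) q)))

_*_ : ℝ → ℝ → ℝ
x * y = mkℝ (λ n → seq x n ℚ.* seq y n) (*-cauchy x y)

ℝ^_ : ℕ → Setoid 0ℓ 0ℓ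
ℝ^ d = FunctionalVector.≋-setoid ℝ-setoid d

-- Respecting _≈_ makes these the functions on ℝ^d itself rather than on sequences.
RealFunction : ℕ → Set
RealFunction d = Func (ℝ^ d) ℝ-setoid

apply₁ : RealFunction 1 → ℝ → ℝ
apply₁ f x = Func.to f (x F.∷ F.[])

apply₂ : RealFunction 2 → ℝ → ℝ → ℝ
apply₂ g x y = Func.to g (x F.∷ y F.∷ F.[])

infix 7 _/2^_

-- Different pairs may denote the same number.
record 𝔻 : Set where
  constructor _/2^_
  field
    numerator : ℤ
    exponent  : ℕ

toℚ : 𝔻 → ℚ
toℚ (a /2^ b) = (a ℚ./ (2 ℕ.^ b)) {{ℕ.m^n≢0 2 b}}

toℝ : 𝔻 → ℝ
toℝ d = fromℚ (toℚ d)

2^-_ : ℕ → ℝ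
2^- n = toℝ (+ 1 /2^ n)

CF : ℝ → Pred (ℕ → 𝔻) 0ℓ
CF x φ = ∀ n → ∣ x - toℝ (φ n) ∣ ≤ 2^- n

data Sym : Set where
  bit             : Bool → Sym
  minus point sep : Sym

unary : ℕ → List Sym
unary n = replicate n (bit true)

-- Least significant bit first.
increment : List Bool → List Bool
increment []           = true ∷ []
increment (false ∷ bs) = true ∷ bs
increment (true  ∷ bs) = false ∷ increment bs

bits : ℕ → List Bool
bits zero    = []
bits (suc n) = increment (bits n)

-- Most significant bit first, without leading zeros (so 0 is the empty string).
binary : ℕ → List Sym
binary n = map bit (reverse (bits n))

sign : ℤ → List Sym
sign (+ _)    = []
sign -[1+ _ ] = [ minus ]

encodeℤ : ℤ → List Sym
encodeℤ i = sign i ++ binary ℤ.∣ i ∣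

odd : ℕ → Bool
odd zero          = false
odd (suc zero)    = true
odd (suc (suc n)) = odd n

-- The b lowest-order bits of n, most significant first.
lowBits : ℕ → ℕ → List Sym
lowBits zero    n = []
lowBits (suc b) n = bit (odd ((n / (2 ℕ.^ b)) {{ℕ.m^n≢0 2 b}})) ∷ lowBits b n

-- Positional notation: sign, integer part, binary point, b fractional digits.
encode𝔻 : 𝔻 → List Sym
encode𝔻 (a /2^ b) =
  sign a ++ binary ((ℤ.∣ a ∣ / (2 ℕ.^ b)) {{ℕ.m^n≢0 2 b}}) ++ point ∷ lowBits b ℤ.∣ a ∣

data Cell (Aux : Set) : Set where
  blank  : Cell Aux
  symbol : Sym → Cell Aux
  aux    : Aux → Cell Aux

data Move : Set where
  left stay right : Move

-- A two-way infinite tape, blank outside the recorded part. The cells to the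
-- left of the head are listed from the head outwards.
record Tape (Aux : Set) : Set where
  constructor tape
  field
    before : List (Cell Aux)
    head   : Cell Aux
    after  : List (Cell Aux)

module _ {Aux : Set} where

  write : Cell Aux → Tape Aux → Tape Aux
  write c (tape ls _ rs) = tape ls c rs

  move : Move → Tape Aux → Tape Aux
  move left  (tape []       c rs)       = tape []       blank (c ∷ rs)
  move left  (tape (l ∷ ls) c rs)       = tape ls       l     (c ∷ rs)
  move stay  t                          = t
  move right (tape ls       c [])       = tape (c ∷ ls) blank []
  move right (tape ls       c (r ∷ rs)) = tape (c ∷ ls) r     rs

  load : List Sym → Tape Aux
  load []      = tape [] blank []
  load (s ∷ w) = tape [] (symbol s) (map symbol w)

  symbols : List (Cell Aux) → List Sym
  symbols (symbol s ∷ cs) = s ∷ symbols cs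
  symbols _               = []

  -- The string written from the head rightwards, up to the first cell that
  -- holds no element of Sym.
  contents : Tape Aux → List Sym
  contents (tape _ c rs) = symbols (c ∷ rs)

leadingOnes : List Sym → ℕ
leadingOnes (bit true ∷ w) = suc (leadingOnes w)
leadingOnes _              = 0

data Instruction (State Aux : Set) (oracles tapes : ℕ) : Set where
  halt  : Instruction State Aux oracles tapes
  step  : State → Vec (Cell Aux × Move) tapes → Instruction State Aux oracles tapes
  query : Fin oracles → State → Instruction State Aux oracles tapes

Finite : Set → Set
Finite A = ∃[ n ] (A ↔ Fin n)

-- The tapes are, in this order: the input tape, the output tape, one tape for
-- each oracle, and the work tapes.
record OracleTM (oracles : ℕ) : Set₁ where
  field
    State Aux    : Set
    finite-State : Finite State
    finite-Aux   : Finite Aux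
    work         : ℕ

  tapes : ℕ
  tapes = 2 ℕ.+ (oracles ℕ.+ work)

  field
    start : State
    δ     : State → Vec (Cell Aux) tapes → Instruction State Aux oracles tapes

  Tapes : Set
  Tapes = Vec (Tape Aux) tapes

  initial : List Sym → Tapes
  initial w = load w ∷ Vec.replicate _ (load [])

  output : Tapes → List Sym
  output (_ ∷ out ∷ _) = contents out

  oracleTape : Fin oracles → Fin tapes
  oracleTape i = suc (suc (i ↑ˡ work))

  -- The query "n" is the string 1ⁿ on the oracle's tape; the answer replaces it.
  ask : (Fin oracles → ℕ → 𝔻) → Fin oracles → Tapes → Tapes
  ask φ i ts =
    ts [ oracleTape i ]≔ load (encode𝔻 (φ i (leadingOnes (contents (lookup ts (oracleTape i))))))

  execute : (Fin oracles → ℕ → 𝔻) → Tapes →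
            Instruction State Aux oracles tapes → Maybe (State × Tapes)
  execute φ ts halt          = nothing
  execute φ ts (step s acts) = just (s , zipWith (λ (c , m) T → move m (write c T)) acts ts)
  execute φ ts (query i s)   = just (s , ask φ i ts)

  next : (Fin oracles → ℕ → 𝔻) → State × Tapes → Maybe (State × Tapes)
  next φ (s , ts) = execute φ ts (δ s (Vec.map Tape.head ts))

  -- The final tapes, if the machine halts after at most t steps.
  run : (Fin oracles → ℕ → 𝔻) → (t : ℕ) → State × Tapes → Maybe Tapes
  run φ zero    c = maybe′ (λ _ → nothing) (just (proj₂ c)) (next φ c)
  run φ (suc t) c = maybe′ (run φ t)       (just (proj₂ c)) (next φ c)

  result : (Fin oracles → ℕ → 𝔻) → List Sym → (t : ℕ) → Maybe (List Sym)
  result φ w t = Maybe.map output (run φ t (start , initial w))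

TuringMachine : Set₁
TuringMachine = OracleTM 0

module TuringMachine (M : TuringMachine) where

  result : List Sym → (t : ℕ) → Maybe (List Sym)
  result = OracleTM.result M λ ()

-- Natural coefficients lose no generality, as polynomials serve only as upper bounds.
data Polynomial (v : ℕ) : Set where
  con     : ℕ → Polynomial v
  var     : Fin v → Polynomial v
  _⊕_ _⊗_ : Polynomial v → Polynomial v → Polynomial v

eval : ∀ {v} → Polynomial v → Vec ℕ v → ℕ
eval (con c) ρ = c
eval (var i) ρ = lookup ρ i
eval (p ⊕ q) ρ = eval p ρ ℕ.+ eval q ρ
eval (p ⊗ q) ρ = eval p ρ ℕ.* eval q ρ

C[_] : ℕ → Pred ℝ 0ℓ
C[ i ] x = (- fromℕ (2 ℕ.^ i)) ≤ x × x ≤ fromℕ (2 ℕ.^ i)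

IsLeast : Pred ℕ 0ℓ → Pred ℕ 0ℓ
IsLeast P k = P k × (∀ j → P j → k ℕ.≤ j)

Computes : ∀ {d} → OracleTM d → RealFunction d → Set
Computes {d} M f =
  (x : F.Vector ℝ d) (φ : Fin d → ℕ → 𝔻) → (∀ i → CF (x i) (φ i)) → (n : ℕ) →
  Σ[ t ∈ ℕ ] Σ[ y ∈ 𝔻 ]
    (OracleTM.result M φ (unary n) t ≡ just (encode𝔻 y) × ∣ toℝ y - Func.to f x ∣ ≤ 2^- n)

RunsInTime : ∀ {d} → OracleTM d → Polynomial 2 → Set
RunsInTime {d} M p =
  (x : F.Vector ℝ d) (φ : Fin d → ℕ → 𝔻) → (∀ i → CF (x i) (φ i)) → (n k : ℕ) →
  IsLeast (λ j → ∀ i → C[ j ] (x i)) k →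
  Is-just (OracleTM.result M φ (unary n) (eval p (k ∷ n ∷ [])))

PolytimeComputable : ∀ {d} → RealFunction d → Set₁
PolytimeComputable {d} f =
  Σ[ M ∈ OracleTM d ] (Computes M f × Σ[ p ∈ Polynomial 2 ] RunsInTime M p)

PolytimeComputableℤ : (ℤ → ℤ → ℤ) → Set₁
PolytimeComputableℤ h =
  Σ[ M ∈ TuringMachine ] Σ[ p ∈ Polynomial 2 ] (∀ x y →
    TuringMachine.result M (encodeℤ x ++ sep ∷ encodeℤ y)
                           (eval p (length (encodeℤ x) ∷ length (encodeℤ y) ∷ []))
      ≡ just (encodeℤ (h x y)))

-- Unary input because the time bound is polynomial in i, not in its length.
PolytimeSequence : (ℕ → ℕ) → Set₁
PolytimeSequence K =
  Σ[ M ∈ TuringMachine ] Σ[ p ∈ Polynomial 1 ] (∀ i →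
    TuringMachine.result M (unary i) (eval p (i ∷ [])) ≡ just (binary (K i)))

Open : Pred ℝ 0ℓ → Set
Open U = ∀ x → U x → Σ[ r ∈ ℚ ] (Positive r × (∀ y → ∣ x - y ∣ < fromℚ r → U y))

Compact : Pred ℝ 0ℓ → Set₁
Compact S =
  (I : Set) (U : I → Pred ℝ 0ℓ) → (∀ i → Open (U i)) → (∀ x → S x → ∃[ i ] U i x) →
  Σ[ is ∈ List I ] (∀ x → S x → Any (λ i → U i x) is)

IsLipschitzConstant : RealFunction 1 → Pred ℝ 0ℓ → ℝ → Set
IsLipschitzConstant f S L = ∀ x y → S x → S y → ∣ apply₁ f x - apply₁ f y ∣ ≤ L * ∣ x - y ∣

LocallyLipschitz : RealFunction 1 → Set₁
LocallyLipschitz f =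
  (S : Pred ℝ 0ℓ) → S Respects _≈_ → Compact S → Σ[ L ∈ ℝ ] IsLipschitzConstant f S L

LocallyPolyLipschitz : RealFunction 1 → Set₁
LocallyPolyLipschitz f =
  LocallyLipschitz f ×
  Σ[ K ∈ (ℕ → ℕ) ] ((∀ i → IsLipschitzConstant f C[ i ] (fromℕ (K i))) × PolytimeSequence K)

_Approximates_ : Pred (RealFunction 2) a → Pred (ℤ → ℤ → ℤ) b → Set (a ⊔ b)
𝒞 Approximates 𝒟 = ∀ g → 𝒟 g →
  Σ[ g̃ ∈ RealFunction 2 ] (𝒞 g̃ ×
    (∀ x y → ∣ apply₂ g̃ (fromℤ x) (fromℤ y) - fromℤ (g x y) ∣ ≤ fromℚ (+ 1 ℚ./ 4)))

_-Definable_ : Pred (RealFunction 2) a → RealFunction 1 → Set a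
𝒞 -Definable f =
  Σ[ g̃ ∈ RealFunction 2 ] (𝒞 g̃ ×
    (∀ (x : ℤ) (y : ℕ) → .{{_ : NonZero y}} →
      ∣ apply₂ g̃ (fromℤ x) (fromℕ y) - fromℕ y * apply₁ f (fromℚ (x ℚ./ y)) ∣ ≤ fromℕ 3))

{-# OPTIONS --safe #-}
-- Left to right: for y ≥ 1 the machine of f is run on x / y, whose binary expansion
-- is produced by long division whenever the machine asks for it, with a precision n
-- such that y ≤ 2^n. If z is the output, then y z truncated to an integer differs
-- from y f(x / y) by at most 2, and it is a polytime function of (x , y), so some
-- element of 𝒞 comes within 1/4 of it.
--
-- Right to left: an approximation of x with error 1 bounds |x|, hence tells which
-- Lipschitz constant K applies. Take m = n + 3 + (number of digits of K), y = 2^(m+1)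
-- and an integer a with |x - a / y| ≤ 2^(1-m). The machine of g̃ is run on (a , y)
-- with constant oracles, giving z with |z - y f(a / y)| ≤ 4, and the answer z / y is
-- obtained by moving the binary point. The error is at most 4 / y + K 2^(1-m) ≤ 2^-n.
--
-- Machines are written as programs on stacks: a tape is a stack with its top under
-- the head, and a tape of a simulated machine is a pair of stacks, the cells left of
-- its head and the others. This makes the simulation exact and composable.
module Submission where

open import Data.Bool.Base using (Bool; true; false; if_then_else_)
open import Data.Empty using (⊥-elim)
open import Data.Fin.Base using (Fin; zero; suc; _↑ˡ_; _↑ʳ_)
open import Data.Fin.Patterns
import Data.Fin.Properties as Fin
open import Data.Integer.Base as ℤ using (ℤ; +_; -[1+_]; +≤+)
import Data.Integer.Properties as ℤ
import Data.Integer.Tactic.RingSolver as ℤ-Solver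
open import Data.List.Base as List using (List; []; _∷_; [_]; _++_; length; replicate; reverse; _ʳ++_)
import Data.List.Properties as List
open import Data.Maybe using (Is-just)
open import Data.Maybe.Base as Maybe using (Maybe; just; nothing; maybe′)
open import Data.Maybe.Relation.Unary.Any using (just)
open import Data.Nat.Base as ℕ using (ℕ; zero; suc; _+_; _*_; _^_; _≤_; _<_; z≤n; s≤s; NonZero)
open import Data.Nat.Divisibility using (divides-refl)
open import Data.Nat.DivMod using (_/_; _%_)
import Data.Nat.DivMod as ℕ
import Data.Nat.Properties as ℕ
open import Data.Nat.Tactic.RingSolver using (solve-∀)
open import Data.Product.Base using (Σ-syntax; _×_; _,_; proj₁; proj₂)
open import Data.Product.Function.Dependent.Propositional using (Σ-↔)
open import Data.Rational.Base as ℚ using (ℚ; Positive; 0ℚ; ½)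
import Data.Rational.Properties as ℚ
open import Data.Rational.Unnormalised.Base as ℚᵘ using (mkℚᵘ; *≡*; *≤*)
import Data.Rational.Unnormalised.Properties as ℚᵘ
open import Data.Sum.Base using (_⊎_; inj₁; inj₂)
open import Data.Sum.Function.Propositional using (_⊎-↔_)
open import Data.Unit.Base using (⊤; tt)
open import Data.Vec.Base as Vec using (Vec; []; _∷_; lookup; zipWith; _[_]≔_)
import Data.Vec.Functional as F
import Data.Vec.Properties as Vec
open import Defs hiding (_+_; _-_; _*_; -_; _≤_; _<_; ∣_∣)
import Defs as ℝ
open import Function.Base using (_∘_; id; const)
open import Function.Bundles using (Func; _↔_; _⇔_; mk↔ₛ′; mk⇔; Inverse)
open import Function.Construct.Composition using (_↔-∘_)
open import Function.Construct.Symmetry using (↔-sym)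
open import Function.Properties.Inverse using (↔-refl)
open import Level using (Level)
open import Relation.Binary.PropositionalEquality using (_≡_; refl; sym; trans; cong; cong₂; subst; module ≡-Reasoning)
open import Relation.Nullary using (yes; no; Dec)
open import Relation.Nullary.Decidable using (dec⇒maybe; from-yes)
open import Relation.Unary using (Pred)
import Tactic.RingSolver as Ring
open import Tactic.RingSolver.Core.AlmostCommutativeRing using (AlmostCommutativeRing; fromCommutativeRing)

-- Finite types

-- An oracle may answer a query with a dyadic of any length: the size of the argument bounds the
-- integer part, but nothing bounds the number of fractional digits, whereas the time allowed
-- depends on `k` and `n` only. Hence the machine for `f` never traverses an answer. It reads the
-- sign, the integer digits and at most `m` fractional digits, and leaves the rest on its stack.
-- Simulated machines, in contrast, are fed answers of controlled length: the digits of a quotient,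
-- or constants that are exact integers.
--
-- Time bounds refer to the least `k` with all arguments in [-2^k , 2^k]. For a real argument this
-- `k` cannot be found constructively. It has to be found only for the runs of simulated machines,
-- and their arguments are rational, so membership is decidable.
--
-- The output of an oracle machine may depend on the approximations supplied, not just on the real
-- they approximate. To obtain an integer function of (x , y), one particular family of
-- approximations of x / y is fixed.

finite-↔ : ∀ {A B : Set} → A ↔ B → Finite B → Finite A
finite-↔ A↔B (n , B↔n) = n , (B↔n ↔-∘ A↔B)

finite-⊤ : Finite ⊤
finite-⊤ = 1 , ↔-sym Fin.1↔⊤

finite-⊎ : ∀ {A B : Set} → Finite A → Finite B → Finite (A ⊎ B)
finite-⊎ (m , A↔m) (n , B↔n) = m + n , (↔-sym Fin.+↔⊎ ↔-∘ (A↔m ⊎-↔ B↔n))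

finite-Bool : Finite Bool
finite-Bool = finite-↔ (mk↔ₛ′ (λ { false → inj₁ tt ; true → inj₂ tt }) (λ { (inj₁ _) → false ; (inj₂ _) → true })
  (λ { (inj₁ _) → refl ; (inj₂ _) → refl }) (λ { false → refl ; true → refl })) (finite-⊎ finite-⊤ finite-⊤)

finite-Maybe : ∀ {A : Set} → Finite A → Finite (Maybe A)
finite-Maybe fin = finite-↔ (mk↔ₛ′ (λ { nothing → inj₁ tt ; (just a) → inj₂ a }) (λ { (inj₁ _) → nothing ; (inj₂ a) → just a })
  (λ { (inj₁ _) → refl ; (inj₂ _) → refl }) (λ { nothing → refl ; (just _) → refl })) (finite-⊎ finite-⊤ fin)

finite-Sym : Finite Sym
finite-Sym = finite-↔ (mk↔ₛ′
  (λ { (bit b) → inj₁ b ; minus → inj₂ nothing ; point → inj₂ (just true) ; sep → inj₂ (just false) })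
  (λ { (inj₁ b) → bit b ; (inj₂ nothing) → minus ; (inj₂ (just true)) → point ; (inj₂ (just false)) → sep })
  (λ { (inj₁ b) → refl ; (inj₂ nothing) → refl ; (inj₂ (just true)) → refl ; (inj₂ (just false)) → refl })
  (λ { (bit b) → refl ; minus → refl ; point → refl ; sep → refl }))
  (finite-⊎ finite-Bool (finite-Maybe finite-Bool))

finite-Cell : ∀ {A : Set} → Finite A → Finite (Cell A)
finite-Cell fin = finite-↔ (mk↔ₛ′
  (λ { blank → nothing ; (symbol s) → just (inj₁ s) ; (aux a) → just (inj₂ a) })
  (λ { nothing → blank ; (just (inj₁ s)) → symbol s ; (just (inj₂ a)) → aux a })
  (λ { nothing → refl ; (just (inj₁ s)) → refl ; (just (inj₂ a)) → refl })
  (λ { blank → refl ; (symbol s) → refl ; (aux a) → refl }))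
  (finite-Maybe (finite-⊎ finite-Sym fin))

finite-Σ-Fin : ∀ n {B : Fin n → Set} → (∀ i → Finite (B i)) → Finite (Σ[ i ∈ Fin n ] B i)
finite-Σ-Fin zero    fin = 0 , mk↔ₛ′ (λ ()) (λ ()) (λ ()) (λ ())
finite-Σ-Fin (suc n) fin = finite-↔
  (mk↔ₛ′ (λ { (zero , b) → inj₁ b ; (suc i , b) → inj₂ (i , b) })
         (λ { (inj₁ b) → zero , b ; (inj₂ (i , b)) → suc i , b })
         (λ { (inj₁ b) → refl ; (inj₂ (i , b)) → refl })
         (λ { (zero , b) → refl ; (suc i , b) → refl }))
  (finite-⊎ (fin zero) (finite-Σ-Fin n (fin ∘ suc)))

finite-Σ : ∀ {A : Set} {B : A → Set} → Finite A → (∀ a → Finite (B a)) → Finite (Σ[ a ∈ A ] B a)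
finite-Σ (n , A↔n) fin =
  finite-↔ (↔-sym (Σ-↔ (↔-sym A↔n) ↔-refl)) (finite-Σ-Fin n (λ i → fin (Inverse.from A↔n i)))

-- Tops of stacks; runs are deterministic and stable under larger time bounds

top : ∀ {A : Set} → List A → Maybe A
top []      = nothing
top (x ∷ _) = just x

below : ∀ {A : Set} → List A → List A
below []       = []
below (_ ∷ xs) = xs

mapInstruction : ∀ {S S′ B : Set} {o n} → (S → S′) → Instruction S B o n → Instruction S′ B o n
mapInstruction f halt          = halt
mapInstruction f (step s acts) = step (f s) acts
mapInstruction f (query i s)   = query i (f s)

module _ {o} (M : OracleTM o) (φ : Fin o → ℕ → 𝔻) where
  open OracleTM M using (run; next; result)

  run-mono : ∀ {t t′ c ts} → t ≤ t′ → run φ t c ≡ just ts → run φ t′ c ≡ just ts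
  run-mono {zero} {zero}   {c} _ eq = eq
  run-mono {zero} {suc t′} {c} _ eq with next φ c | eq
  ... | nothing | eq = eq
  run-mono {suc t} {suc t′} {c} (s≤s le) eq with next φ c
  ... | nothing = eq
  ... | just c′ = run-mono le eq

  result-mono : ∀ {t t′ u v} → t ≤ t′ → result φ u t ≡ just v → result φ u t′ ≡ just v
  result-mono {t} {t′} {u} le eq with run φ t (OracleTM.start M , OracleTM.initial M u) in eq′
  ... | just ts rewrite run-mono le eq′ = eq

  result-unique : ∀ {t t′ u v v′} → result φ u t ≡ just v → result φ u t′ ≡ just v′ → v ≡ v′
  result-unique {t} {t′} {u} eq eq′ with trans (sym (result-mono (ℕ.m≤m⊔n t t′) eq)) (result-mono (ℕ.m≤n⊔m t t′) eq′)
  ... | refl = refl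

halted : ∀ {o} {M : OracleTM o} (m : Maybe (OracleTM.Tapes M)) {w} → Maybe.map (OracleTM.output M) m ≡ just w →
         Σ[ ts ∈ OracleTM.Tapes M ] (m ≡ just ts × OracleTM.output M ts ≡ w)
halted (just ts) refl = ts , refl , refl

-- Stack programs and their compilation to oracle machines

module StackMachine (o w : ℕ) (A : Set) (finA : Finite A) where

  stacks : ℕ
  stacks = 2 + (o + w)

  Store : Set
  Store = Vec (List (Cell A)) stacks

  oracleStack : Fin o → Fin stacks
  oracleStack i = suc (suc (i ↑ˡ w))

  -- Continuations are functions, so whatever value is passed to one has to be remembered in the
  -- control state of the compiled machine. This is why `bind` and `loop` carry a proof that the
  -- type of that value is finite.
  data Prog (R : Set) : Set₁ where
    ret  : R → Prog R
    push : Fin stacks → Cell A → Prog R → Prog R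
    pop  : Fin stacks → (Maybe (Cell A) → Prog R) → Prog R
    call : Fin o → Prog R → Prog R
    bind : {B : Set} → Finite B → Prog B → (B → Prog R) → Prog R
    loop : {B : Set} → Finite B → (B → Prog (B ⊎ R)) → B → Prog R

  infixr 1 _>>_
  _>>_ : ∀ {R} → Prog ⊤ → Prog R → Prog R
  p >> q = bind finite-⊤ p (const q)

  Oracles : Set
  Oracles = Fin o → ℕ → 𝔻

  answer : Oracles → Fin o → List (Cell A) → List (Cell A)
  answer φ i s = List.map symbol (encode𝔻 (φ i (leadingOnes (symbols s))))

  -- A relation and not an evaluator, since a `loop` need not terminate. The number is an upper
  -- bound for the steps of the compiled machine, so that runs can be weakened; a `push` costs 2
  -- because the head has to move before it writes.
  data Run (φ : Oracles) : {R : Set} → Prog R → Store → ℕ → R → Store → Set₁ where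
    ret   : ∀ {R} {r : R} {S t} → Run φ (ret r) S (suc t) r S
    push  : ∀ {R} {r : R} {p S S′ t i c} →
            Run φ p (S [ i ]≔ (c ∷ lookup S i)) t r S′ → Run φ (push i c p) S (2 + t) r S′
    pop   : ∀ {R} {r : R} {k S S′ t i} →
            Run φ (k (top (lookup S i))) (S [ i ]≔ below (lookup S i)) t r S′ → Run φ (pop i k) S (suc t) r S′
    call  : ∀ {R} {r : R} {p S S′ t i} →
            Run φ p (S [ oracleStack i ]≔ answer φ i (lookup S (oracleStack i))) t r S′ →
            Run φ (call i p) S (suc t) r S′
    bind  : ∀ {R} {r : R} {B} {fin : Finite B} {p k b S S₁ S′ t₁ t₂ t} →
            Run φ p S t₁ b S₁ → Run φ (k b) S₁ t₂ r S′ → t₁ + t₂ ≤ t → Run φ (bind fin p k) S t r S′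
    done  : ∀ {R} {r : R} {B} {fin : Finite B} {f b S S′ t} →
            Run φ (f b) S t (inj₂ r) S′ → Run φ (loop fin f b) S t r S′
    again : ∀ {R} {r : R} {B} {fin : Finite B} {f b b′ S S₁ S′ t₁ t₂ t} →
            Run φ (f b) S t₁ (inj₁ b′) S₁ → Run φ (loop fin f b′) S₁ t₂ r S′ → t₁ + t₂ ≤ t →
            Run φ (loop fin f b) S t r S′

  weaken : ∀ {φ R} {r : R} {p S S′ t t′} → t ≤ t′ → Run φ p S t r S′ → Run φ p S t′ r S′
  weaken (s≤s _)           ret             = ret
  weaken (s≤s (s≤s le))    (push run)      = push (weaken le run)
  weaken (s≤s le)          (pop run)       = pop (weaken le run)
  weaken (s≤s le)          (call run)      = call (weaken le run)
  weaken le (bind run₁ run₂ le′)           = bind run₁ run₂ (ℕ.≤-trans le′ le)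
  weaken le (done run)                     = done (weaken le run)
  weaken le (again run₁ run₂ le′)          = again run₁ run₂ (ℕ.≤-trans le′ le)

  run-push : ∀ {φ R} {r : R} {p S S₁ S′ t i c s} → lookup S i ≡ s → S [ i ]≔ (c ∷ s) ≡ S₁ →
             Run φ p S₁ t r S′ → Run φ (push i c p) S (2 + t) r S′
  run-push refl refl = push

  run-pop : ∀ {φ R} {r : R} {k S S₁ S′ t i s} → lookup S i ≡ s → S [ i ]≔ below s ≡ S₁ →
            Run φ (k (top s)) S₁ t r S′ → Run φ (pop i k) S (suc t) r S′
  run-pop refl refl = pop

  run-starts : ∀ {φ R} {r : R} {p S₁ S₂ S′ t} → S₂ ≡ S₁ → Run φ p S₁ t r S′ → Run φ p S₂ t r S′
  run-starts refl run = run

  run-ends : ∀ {φ R} {r : R} {p S S₁ S₂ t} → S₁ ≡ S₂ → Run φ p S t r S₁ → Run φ p S t r S₂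
  run-ends refl run = run

  infixr 5 _⨾_
  _⨾_ : ∀ {φ R} {r : R} {B} {fin : Finite B} {p k b S S₁ S′ t₁ t₂} →
        Run φ p S t₁ b S₁ → Run φ (k b) S₁ t₂ r S′ → Run φ (bind fin p k) S (t₁ + t₂) r S′
  run₁ ⨾ run₂ = bind run₁ run₂ ℕ.≤-refl

  -- A stack is kept on a tape with its top under the head; it ends at the first
  -- blank, and whatever lies left of the head or beyond that blank is garbage.

  Letter : Set
  Letter = Cell (Maybe A)

  Tapes : Set
  Tapes = Vec (Tape (Maybe A)) stacks

  -- Simulated machines put blanks on stacks, and these must differ from the blank that ends a
  -- stack. The extra auxiliary symbol `nothing` stands for such a stored blank.
  letter : Cell A → Letter
  letter blank      = aux nothing
  letter (symbol s) = symbol s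
  letter (aux a)    = aux (just a)

  readLetter : Letter → Maybe (Cell A)
  readLetter blank          = nothing
  readLetter (symbol s)     = just (symbol s)
  readLetter (aux nothing)  = just blank
  readLetter (aux (just a)) = just (aux a)

  stack : List Letter → List (Cell A)
  stack []       = []
  stack (l ∷ ls) = maybe′ (λ c → c ∷ stack ls) [] (readLetter l)

  view : Tape (Maybe A) → List (Cell A)
  view (tape _ l ls) = stack (l ∷ ls)

  Action : Set
  Action = Letter × Move

  only : Fin stacks → Action → Vec Letter stacks → Vec Action stacks
  only i a ls = Vec.map (λ l → l , stay) ls [ i ]≔ a

  -- One copy of the states of a continuation for every value that it may receive. A `push` has two
  -- states of its own: an instruction writes first and moves afterwards, so reaching the cell on
  -- the left and filling it takes two instructions.
  State : ∀ {R} → Prog R → Set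
  State (ret r)               = ⊤
  State (push i c p)          = Bool ⊎ State p
  State (pop i k)             = ⊤ ⊎ (Σ[ c ∈ Maybe (Cell A) ] State (k c))
  State (call i p)            = ⊤ ⊎ State p
  State (bind {B} fin p k)    = State p ⊎ (Σ[ b ∈ B ] State (k b))
  State (loop {B} fin f b)    = Σ[ b′ ∈ B ] State (f b′)

  finite-State : ∀ {R} (p : Prog R) → Finite (State p)
  finite-State (ret r)        = finite-⊤
  finite-State (push i c p)   = finite-⊎ finite-Bool (finite-State p)
  finite-State (pop i k)      =
    finite-⊎ finite-⊤ (finite-Σ (finite-Maybe (finite-Cell finA)) (λ c → finite-State (k c)))
  finite-State (call i p)     = finite-⊎ finite-⊤ (finite-State p)
  finite-State (bind fin p k) = finite-⊎ (finite-State p) (finite-Σ fin (λ b → finite-State (k b)))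
  finite-State (loop fin f b) = finite-Σ fin (λ b → finite-State (f b))

  entry : ∀ {R} (p : Prog R) → State p
  entry (ret r)        = tt
  entry (push i c p)   = inj₁ false
  entry (pop i k)      = inj₁ tt
  entry (call i p)     = inj₁ tt
  entry (bind fin p k) = inj₁ (entry p)
  entry (loop fin f b) = b , entry (f b)

  -- Leaving a program with a result is not yet a state: the surrounding construct decides where the
  -- last step leads. Thus sequencing needs no extra step.
  Code : Set → Set → Set
  Code Q R = Q → Vec Letter stacks → Instruction (Q ⊎ R) (Maybe A) o stacks

  -- Popping an empty stack must not move the head, since beyond the blank lies garbage that would
  -- come back as stack contents.
  popMove : Letter → Move
  popMove blank = stay
  popMove _     = right

  afterBind : ∀ {R B} (fin : Finite B) (p : Prog B) (k : B → Prog R) →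
              State p ⊎ B → State (bind fin p k) ⊎ R
  afterBind fin p k (inj₁ q) = inj₁ (inj₁ q)
  afterBind fin p k (inj₂ b) = inj₁ (inj₂ (b , entry (k b)))

  afterBody : ∀ {R B} (fin : Finite B) (f : B → Prog (B ⊎ R)) (b₀ b : B) →
              State (f b) ⊎ (B ⊎ R) → State (loop fin f b₀) ⊎ R
  afterBody fin f b₀ b (inj₁ q)         = inj₁ (b , q)
  afterBody fin f b₀ b (inj₂ (inj₁ b′)) = inj₁ (b′ , entry (f b′))
  afterBody fin f b₀ b (inj₂ (inj₂ r))  = inj₂ r

  within : ∀ {Q Q′ R : Set} → (Q → Q′) → Q ⊎ R → Q′ ⊎ R
  within ι (inj₁ q) = inj₁ (ι q)
  within ι (inj₂ r) = inj₂ r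

  code : ∀ {R} (p : Prog R) → Code (State p) R
  code (ret r) tt ls = step (inj₂ r) (Vec.map (λ l → l , stay) ls)
  code (push i c p) (inj₁ false) ls = step (inj₁ (inj₁ true)) (only i (lookup ls i , left) ls)
  code (push i c p) (inj₁ true)  ls = step (inj₁ (inj₂ (entry p))) (only i (letter c , stay) ls)
  code (push i c p) (inj₂ q) ls = mapInstruction (within inj₂) (code p q ls)
  code (pop i k) (inj₁ tt) ls =
    step (inj₁ (inj₂ (readLetter (lookup ls i) , entry (k (readLetter (lookup ls i))))))
         (only i (lookup ls i , popMove (lookup ls i)) ls)
  code (pop i k) (inj₂ (c , q)) ls = mapInstruction (within (λ q → inj₂ (c , q))) (code (k c) q ls)
  code (call i p) (inj₁ tt) ls = query i (inj₁ (inj₂ (entry p)))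
  code (call i p) (inj₂ q) ls = mapInstruction (within inj₂) (code p q ls)
  code (bind fin p k) (inj₁ q) ls = mapInstruction (afterBind fin p k) (code p q ls)
  code (bind fin p k) (inj₂ (b , q)) ls = mapInstruction (within (λ q → inj₂ (b , q))) (code (k b) q ls)
  code (loop fin f b₀) (b , q) ls = mapInstruction (afterBody fin f b₀ b) (code (f b) q ls)

  perform : Action → Tape (Maybe A) → Tape (Maybe A)
  perform (l , m) T = move m (write l T)

  exec : ∀ {Q : Set} → Oracles → Tapes → Instruction Q (Maybe A) o stacks → Maybe (Q × Tapes)
  exec φ ts halt          = nothing
  exec φ ts (step q acts) = just (q , zipWith perform acts ts)
  exec φ ts (query i q)   = just (q , ts [ oracleStack i ]≔
    load (encode𝔻 (φ i (leadingOnes (contents (lookup ts (oracleStack i)))))))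

  module _ (φ : Oracles) where

    data Reach {Q R} (δ : Code Q R) : Q → Tapes → ℕ → R → Tapes → Set where
      last : ∀ {q r ts ts′ t} → exec φ ts (δ q (Vec.map Tape.head ts)) ≡ just (inj₂ r , ts′) →
             Reach δ q ts (suc t) r ts′
      more : ∀ {q q′ r ts ts₁ ts′ t} → exec φ ts (δ q (Vec.map Tape.head ts)) ≡ just (inj₁ q′ , ts₁) →
             Reach δ q′ ts₁ t r ts′ → Reach δ q ts (suc t) r ts′

    Resume : ∀ {Q R} (δ : Code Q R) → Q ⊎ R → Tapes → ℕ → R → Tapes → Set
    Resume δ (inj₁ q) ts t r ts′ = Reach δ q ts t r ts′
    Resume δ (inj₂ r₀) ts t r ts′ = (r₀ ≡ r) × (ts ≡ ts′)

    later : ∀ {Q R} {δ : Code Q R} {q r ts ts′ t t′} → t ≤ t′ → Reach δ q ts t r ts′ → Reach δ q ts t′ r ts′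
    later (s≤s _)  (last eq)    = last eq
    later (s≤s le) (more eq re) = more eq (later le re)

    resume : ∀ {Q R} {δ : Code Q R} {q x r ts ts₁ ts′ t} →
             exec φ ts (δ q (Vec.map Tape.head ts)) ≡ just (x , ts₁) →
             Resume δ x ts₁ t r ts′ → Reach δ q ts (suc t) r ts′
    resume {x = inj₁ q} eq re            = more eq re
    resume {x = inj₂ r} eq (refl , refl) = last eq

    exec-map : ∀ {Q Q′ : Set} (f : Q → Q′) ts I {q ts′} → exec φ ts I ≡ just (q , ts′) →
               exec φ ts (mapInstruction f I) ≡ just (f q , ts′)
    exec-map f ts (step q acts) refl = refl
    exec-map f ts (query i q)   refl = refl

    -- The common core of `bind` and `loop`. The steps of the inner code are relabelled by `g`, and
    -- its exit step is at the same time the step into the state from which the outer code resumes,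
    -- so the two times simply add up.
    splice : ∀ {Q Q′ R R′} {δ : Code Q R} {δ′ : Code Q′ R′} (ι : Q → Q′) (g : Q ⊎ R → Q′ ⊎ R′) →
             (∀ q → g (inj₁ q) ≡ inj₁ (ι q)) →
             (∀ q ls → δ′ (ι q) ls ≡ mapInstruction g (δ q ls)) →
             ∀ {q ts t r ts₁ t′ r′ ts′} → Reach δ q ts t r ts₁ → Resume δ′ (g (inj₂ r)) ts₁ t′ r′ ts′ →
             Reach δ′ (ι q) ts (t + t′) r′ ts′
    splice {δ = δ} ι g g-ι eq {q} {ts} {t′ = t′} (last {t = t} step≡) re =
      later (s≤s (ℕ.m≤n+m t′ t))
        (resume (trans (cong (exec φ ts) (eq q _)) (exec-map g ts (δ q _) step≡)) re)
    splice {δ = δ} {δ′} ι g g-ι eq {q} {ts} (more {q′ = q′} step≡ reach) re =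
      more (trans (cong (exec φ ts) (eq q _)) (trans (exec-map g ts (δ q _) step≡) (cong (λ x → just (x , _)) (g-ι q′))))
           (splice ι g g-ι eq reach re)

    exit : ∀ {Q Q′ R R′} {δ : Code Q R} {δ′ : Code Q′ R′} (ι : Q → Q′) (g : Q ⊎ R → Q′ ⊎ R′) →
           (∀ q → g (inj₁ q) ≡ inj₁ (ι q)) →
           (∀ q ls → δ′ (ι q) ls ≡ mapInstruction g (δ q ls)) →
           ∀ {q ts t r r′ ts′} → g (inj₂ r) ≡ inj₂ r′ → Reach δ q ts t r ts′ → Reach δ′ (ι q) ts t r′ ts′
    exit {δ′ = δ′} ι g g-ι eq {ts = ts} {t} {r} {r′} {ts′} g-r reach =
      subst (λ t → Reach δ′ _ ts t r′ ts′) (ℕ.+-identityʳ t)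
        (splice ι g g-ι eq reach (subst (λ x → Resume δ′ x ts′ 0 r′ ts′) (sym g-r) (refl , refl)))

    embed : ∀ {Q Q′ R} {δ : Code Q R} {δ′ : Code Q′ R} (ι : Q → Q′) →
            (∀ q ls → δ′ (ι q) ls ≡ mapInstruction (within ι) (δ q ls)) →
            ∀ {q ts t r ts′} → Reach δ q ts t r ts′ → Reach δ′ (ι q) ts t r ts′
    embed ι eq = exit ι (within ι) (λ _ → refl) eq refl

    -- The starting value of a loop selects only the entry state. `afterBody` ignores it, but is
    -- stuck on the successor of an unknown instruction, so the instruction has to be split before
    -- the two sides agree. Needed for `again`, where the remaining run belongs to the loop started
    -- at another value.
    code-base : ∀ {B R} (fin : Finite B) (f : B → Prog (B ⊎ R)) b b′ q ls →
                code (loop fin f b) q ls ≡ code (loop fin f b′) q ls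
    code-base fin f b b′ (b₁ , q) ls with code (f b₁) q ls
    ... | halt                    = refl
    ... | step (inj₁ _) _         = refl
    ... | step (inj₂ (inj₁ _)) _  = refl
    ... | step (inj₂ (inj₂ _)) _  = refl
    ... | query _ (inj₁ _)        = refl
    ... | query _ (inj₂ (inj₁ _)) = refl
    ... | query _ (inj₂ (inj₂ _)) = refl

    rebase : ∀ {B R} (fin : Finite B) (f : B → Prog (B ⊎ R)) b b′ {q ts t r ts′} →
             Reach (code (loop fin f b′)) q ts t r ts′ → Reach (code (loop fin f b)) q ts t r ts′
    rebase fin f b b′ (last eq)    = last (trans (cong (exec φ _) (code-base fin f b b′ _ _)) eq)
    rebase fin f b b′ (more eq re) =
      more (trans (cong (exec φ _) (code-base fin f b b′ _ _)) eq) (rebase fin f b b′ re)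

    perform-stay : ∀ {n} (ts : Vec (Tape (Maybe A)) n) →
                   zipWith perform (Vec.map (λ l → l , stay) (Vec.map Tape.head ts)) ts ≡ ts
    perform-stay []       = refl
    perform-stay (t ∷ ts) = cong (t ∷_) (perform-stay ts)

    perform-only : ∀ {n} (ts : Vec (Tape (Maybe A)) n) i a →
                   zipWith perform (Vec.map (λ l → l , stay) (Vec.map Tape.head ts) [ i ]≔ a) ts
                     ≡ ts [ i ]≔ perform a (lookup ts i)
    perform-only (t ∷ ts) zero    a = cong (perform a t ∷_) (perform-stay ts)
    perform-only (t ∷ ts) (suc i) a = cong (t ∷_) (perform-only ts i a)

    read-letter : ∀ c → readLetter (letter c) ≡ just c
    read-letter blank      = refl
    read-letter (symbol s) = refl
    read-letter (aux a)    = refl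

    view-push : ∀ c T → view (write (letter c) (move left (write (Tape.head T) T))) ≡ c ∷ view T
    view-push c (tape []       l ls) rewrite read-letter c = refl
    view-push c (tape (_ ∷ _)  l ls) rewrite read-letter c = refl

    view-pop : ∀ T → view (move (popMove (Tape.head T)) (write (Tape.head T) T)) ≡ below (view T)
    view-pop (tape bs blank          ls)       = refl
    view-pop (tape bs (symbol s)     [])       = refl
    view-pop (tape bs (symbol s)     (l ∷ ls)) = refl
    view-pop (tape bs (aux nothing)  [])       = refl
    view-pop (tape bs (aux nothing)  (l ∷ ls)) = refl
    view-pop (tape bs (aux (just a)) [])       = refl
    view-pop (tape bs (aux (just a)) (l ∷ ls)) = refl

    read-view : ∀ T → readLetter (Tape.head T) ≡ top (view T)
    read-view (tape bs blank          ls) = refl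
    read-view (tape bs (symbol s)     ls) = refl
    read-view (tape bs (aux nothing)  ls) = refl
    read-view (tape bs (aux (just a)) ls) = refl

    stack-symbols : ∀ w → stack (List.map symbol w) ≡ List.map symbol w
    stack-symbols []      = refl
    stack-symbols (s ∷ w) = cong (symbol s ∷_) (stack-symbols w)

    view-load : ∀ w → view (load w) ≡ List.map symbol w
    view-load []      = refl
    view-load (s ∷ w) = cong (symbol s ∷_) (stack-symbols w)

    symbols-stack : ∀ ls → symbols (stack ls) ≡ symbols ls
    symbols-stack []                  = refl
    symbols-stack (blank ∷ ls)        = refl
    symbols-stack (symbol s ∷ ls)     = cong (s ∷_) (symbols-stack ls)
    symbols-stack (aux nothing ∷ ls)  = refl
    symbols-stack (aux (just a) ∷ ls) = refl

    contents-view : ∀ T → contents T ≡ symbols (view T)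
    contents-view (tape bs l ls) = sym (symbols-stack (l ∷ ls))

    views : Tapes → Store
    views = Vec.map view

    views-update : ∀ ts i {T s} → view T ≡ s → views (ts [ i ]≔ T) ≡ views ts [ i ]≔ s
    views-update ts i refl = Vec.map-[]≔ view ts i

    lookup-views : ∀ ts i → lookup (views ts) i ≡ view (lookup ts i)
    lookup-views ts i = Vec.lookup-map i view ts

    lookup-heads : ∀ (ts : Tapes) i → lookup (Vec.map Tape.head ts) i ≡ Tape.head (lookup ts i)
    lookup-heads ts i = Vec.lookup-map i Tape.head ts

    Compiled : ∀ {R} → Prog R → Tapes → ℕ → R → Store → Set
    Compiled p ts t r S = Σ[ ts′ ∈ Tapes ] (views ts′ ≡ S × Reach (code p) (entry p) ts t r ts′)

    -- Induction on the run. The store is prescribed only through `views`: the garbage on the tapes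
    -- depends on the history, so the final tapes are existentially quantified.
    compile : ∀ {R} {p : Prog R} {S t r S′} → Run φ p S t r S′ → ∀ ts → views ts ≡ S → Compiled p ts t r S′
    compile ret ts refl = ts , refl , last (cong (λ ts′ → just (_ , ts′)) (perform-stay ts))
    compile {p = push i c p} (push run) ts refl =
      let ts₁ = ts [ i ]≔ move left (write (Tape.head T) T)
          T₁ = lookup ts₁ i
          ts₂ = ts₁ [ i ]≔ write (letter c) T₁
          eq₁ : T₁ ≡ move left (write (Tape.head T) T)
          eq₁ = Vec.lookup∘update i ts _
          ts′ , v , re = compile run ts₂ (begin
            views ts₂ ≡⟨ views-update ts₁ i refl ⟩
            views ts₁ [ i ]≔ view (write (letter c) T₁)
              ≡⟨ cong (_[ i ]≔ view (write (letter c) T₁)) (views-update ts i refl) ⟩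
            (views ts [ i ]≔ _) [ i ]≔ view (write (letter c) T₁) ≡⟨ Vec.[]≔-idempotent (views ts) i ⟩
            views ts [ i ]≔ view (write (letter c) T₁) ≡⟨ cong (λ T → views ts [ i ]≔ view (write (letter c) T)) eq₁ ⟩
            views ts [ i ]≔ view (write (letter c) (move left (write (Tape.head T) T)))
              ≡⟨ cong (views ts [ i ]≔_) (view-push c T) ⟩
            views ts [ i ]≔ (c ∷ view T) ≡⟨ cong (λ s → views ts [ i ]≔ (c ∷ s)) (sym (lookup-views ts i)) ⟩
            views ts [ i ]≔ (c ∷ lookup (views ts) i) ∎)
      in ts′ , v ,
         more (cong (λ ts → just (_ , ts)) (trans (perform-only ts i _)
                (cong (λ l → ts [ i ]≔ perform (l , left) T) (lookup-heads ts i))))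
        (more (cong (λ ts → just (_ , ts)) (perform-only ts₁ i _))
        (embed inj₂ (λ _ _ → refl) re))
      where open ≡-Reasoning ; T = lookup ts i
    compile {p = pop i k} (pop run) ts refl =
      let ts₁ = ts [ i ]≔ move (popMove (Tape.head T)) (write (Tape.head T) T)
          hd : readLetter (lookup (Vec.map Tape.head ts) i) ≡ top (lookup (views ts) i)
          hd = trans (cong readLetter (lookup-heads ts i)) (trans (read-view T) (cong top (sym (lookup-views ts i))))
          ts′ , v , re = compile run ts₁
            (trans (views-update ts i refl) (cong (views ts [ i ]≔_)
              (trans (view-pop T) (cong below (sym (lookup-views ts i))))))
      in ts′ , v ,
         more (cong₂ (λ c ts → just (inj₁ (inj₂ (c , entry (k c))) , ts)) hd
                (trans (perform-only ts i _)
                  (cong (λ l → ts [ i ]≔ perform (l , popMove l) T) (lookup-heads ts i))))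
        (embed (λ q → inj₂ (_ , q)) (λ _ _ → refl) re)
      where T = lookup ts i
    compile {p = call i p} (call run) ts refl =
      let j = oracleStack i
          w = encode𝔻 (φ i (leadingOnes (contents (lookup ts j))))
          ts′ , v , re = compile run (ts [ j ]≔ load w)
            (trans (views-update ts j (view-load w))
              (cong (λ u → views ts [ j ]≔ List.map symbol (encode𝔻 (φ i (leadingOnes u))))
                (trans (contents-view (lookup ts j)) (cong symbols (sym (lookup-views ts j))))))
      in ts′ , v , more refl (embed inj₂ (λ _ _ → refl) re)
    compile {p = bind fin p k} (bind {b = b} {t₂ = t₂} run₁ run₂ le) ts eq =
      let ts₁ , v₁ , re₁ = compile run₁ ts eq
          ts₂ , v₂ , re₂ = compile run₂ ts₁ v₁
      in ts₂ , v₂ , later le (splice inj₁ (afterBind fin p k) (λ _ → refl) (λ _ _ → refl) re₁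
           (embed {δ = code (k b)} (λ q → inj₂ (b , q)) (λ _ _ → refl) re₂))
    compile {p = loop fin f b} (done run) ts eq =
      let ts′ , v , re = compile run ts eq
      in ts′ , v , exit (λ q → b , q) (afterBody fin f b b) (λ _ → refl) (λ _ _ → refl) refl re
    compile {p = loop fin f b} (again {b′ = b′} run₁ run₂ le) ts eq =
      let ts₁ , v₁ , re₁ = compile run₁ ts eq
          ts₂ , v₂ , re₂ = compile run₂ ts₁ v₁
      in ts₂ , v₂ , later le (splice (λ q → b , q) (afterBody fin f b b) (λ _ → refl) (λ _ _ → refl) re₁
           (rebase fin f b b′ re₂))

  machine : Prog ⊤ → OracleTM o
  machine p = record
    { State        = State p ⊎ ⊤
    ; Aux          = Maybe A
    ; finite-State = finite-⊎ (finite-State p) finite-⊤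
    ; finite-Aux   = finite-Maybe finA
    ; work         = w
    ; start        = inj₁ (entry p)
    ; δ            = λ { (inj₁ q) ls → code p q ls ; (inj₂ _) _ → halt }
    }

  initialStore : List Sym → Store
  initialStore u = List.map symbol u ∷ Vec.replicate _ []

  machine-result : ∀ φ p u {t S} → Run φ p (initialStore u) t tt S →
                   OracleTM.result (machine p) φ u t ≡ just (symbols (lookup S (suc zero)))
  machine-result φ p u run = finish (compile φ run _ views-initial)
    where
    open OracleTM (machine p) using (next; result; output; initial) renaming (run to runTM)

    views-initial : views φ (initial u) ≡ initialStore u
    views-initial = cong₂ _∷_ (view-load φ u) (Vec.map-replicate view (load []) _)

    next-exec : ∀ q ts → next φ (inj₁ q , ts) ≡ exec φ ts (code p q (Vec.map Tape.head ts))
    next-exec q ts with code p q (Vec.map Tape.head ts)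
    ... | halt        = refl
    ... | step _ _    = refl
    ... | query _ _   = refl

    stopped : ∀ t r ts → runTM φ t (inj₂ r , ts) ≡ just ts
    stopped zero    r ts = refl
    stopped (suc t) r ts = refl

    reach-run : ∀ {q ts t r ts′} → Reach φ (code p) q ts t r ts′ → runTM φ t (inj₁ q , ts) ≡ just ts′
    -- The extra halting state is recognised even with no time left, hence the bound carries over
    -- unchanged.
    reach-run {q} {ts} (last {t = t} eq)    rewrite next-exec q ts | eq = stopped t _ _
    reach-run {q} {ts} (more eq re) rewrite next-exec q ts | eq = reach-run re

    output-view : ∀ ts → output ts ≡ symbols (lookup (views φ ts) (suc zero))
    output-view (_ ∷ T ∷ _) = contents-view φ T

    finish : ∀ {t S} → Compiled φ p (initial u) t tt S → result φ u t ≡ just (symbols (lookup S (suc zero)))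
    finish (ts , refl , re) rewrite reach-run re = cong just (output-view ts)

  record Outputs (φ : Oracles) (p : Prog ⊤) (u : List Sym) (t : ℕ) (v : List Sym) : Set where
    constructor outputs
    field
      result≡ : OracleTM.result (machine p) φ u t ≡ just v

  run-outputs : ∀ {φ p u t S v} → Run φ p (initialStore u) t tt S → symbols (lookup S (suc zero)) ≡ v →
                Outputs φ p u t v
  run-outputs {φ} {p} {u} run eq = outputs (trans (machine-result φ p u run) (cong just eq))

  outputs-mono : ∀ {φ p u t t′ v} → t ≤ t′ → Outputs φ p u t v → Outputs φ p u t′ v
  outputs-mono {φ} {p} le (outputs eq) = outputs (result-mono (machine p) φ le eq)

-- Simulating a machine by a stack program

double : ℕ → ℕ
double zero    = zero
double (suc k) = suc (suc (double k))

leftSide rightSide : ∀ {k} → Fin k → Fin (double k)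
leftSide  zero    = zero
leftSide  (suc j) = suc (suc (leftSide j))
rightSide zero    = suc zero
rightSide (suc j) = suc (suc (rightSide j))

module Simulation (o w : ℕ) (A : Set) (finA : Finite A) where
  open StackMachine o w A finA

  Sides : Set
  Sides = List (Cell A) × List (Cell A)

  -- The laws that allow the sides of `k` simulated tapes to sit at arbitrary places of a larger
  -- store. They make the simulation independent of the layout, so that two machines can share one
  -- store.
  record Block {k} (L R : Fin k → Fin stacks) (ctx : Vec Sides k → Store) : Set where
    field
      getL : ∀ b j → lookup (ctx b) (L j) ≡ proj₁ (lookup b j)
      getR : ∀ b j → lookup (ctx b) (R j) ≡ proj₂ (lookup b j)
      putL : ∀ b j l → ctx b [ L j ]≔ l ≡ ctx (b [ j ]≔ (l , proj₂ (lookup b j)))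
      putR : ∀ b j r → ctx b [ R j ]≔ r ≡ ctx (b [ j ]≔ (proj₁ (lookup b j) , r))

  tailBlock : ∀ {k} {L R : Fin (suc k) → Fin stacks} {ctx} → Block L R ctx → ∀ p →
              Block (L ∘ suc) (R ∘ suc) (λ b → ctx (p ∷ b))
  tailBlock B p = record
    { getL = λ b j → getL (p ∷ b) (suc j) ; getR = λ b j → getR (p ∷ b) (suc j)
    ; putL = λ b j → putL (p ∷ b) (suc j) ; putR = λ b j → putR (p ∷ b) (suc j) }
    where open Block B

  Bounded : ∀ {k} → ℕ → Vec Sides k → Set
  Bounded n b = ∀ j → length (proj₁ (lookup b j)) ≤ n × length (proj₂ (lookup b j)) ≤ n

  module _ {o′} (N : OracleTM o′) (u : Cell A → Cell (OracleTM.Aux N)) (v : Cell (OracleTM.Aux N) → Cell A)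
           (u-v : ∀ c → u (v c) ≡ c) where
    open OracleTM N using (Aux; tapes; δ; ask; next) renaming (State to NState; finite-State to finite-NState; run to runN)

    tapeFrom : List (Cell Aux) → List (Cell Aux) → Tape Aux
    tapeFrom bs []       = tape bs blank []
    tapeFrom bs (c ∷ cs) = tape bs c cs

    tapeOf : Sides → Tape Aux
    tapeOf (l , r) = tapeFrom (List.map u l) (List.map u r)

    headOf : List (Cell A) → Cell Aux
    headOf r = maybe′ u blank (top r)

    head-tapeOf : ∀ p → Tape.head (tapeOf p) ≡ headOf (proj₂ p)
    head-tapeOf (l , [])    = refl
    head-tapeOf (l , c ∷ r) = refl

    act : Cell Aux × Move → Sides → Sides
    act (c , left)  (l , r) = below l , maybe′ id (v blank) (top l) ∷ v c ∷ below r
    act (c , stay)  (l , r) = l , v c ∷ below r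
    act (c , right) (l , r) = v c ∷ l , below r

    act-tapeOf : ∀ a p → tapeOf (act a p) ≡ move (proj₂ a) (write (proj₁ a) (tapeOf p))
    act-tapeOf (c , left)  ([] , [])         rewrite u-v c | u-v blank = refl
    act-tapeOf (c , left)  (_ ∷ _ , [])      rewrite u-v c = refl
    act-tapeOf (c , left)  ([] , _ ∷ _)      rewrite u-v c | u-v blank = refl
    act-tapeOf (c , left)  (_ ∷ _ , _ ∷ _)   rewrite u-v c = refl
    act-tapeOf (c , stay)  (_ , [])          rewrite u-v c = refl
    act-tapeOf (c , stay)  (_ , _ ∷ _)       rewrite u-v c = refl
    act-tapeOf (c , right) (_ , [])          rewrite u-v c = refl
    act-tapeOf (c , right) (_ , _ ∷ [])      rewrite u-v c = refl
    act-tapeOf (c , right) (_ , _ ∷ _ ∷ _)   rewrite u-v c = refl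

    length-below : ∀ {B : Set} (xs : List B) → length (below xs) ≤ length xs
    length-below []       = z≤n
    length-below (_ ∷ xs) = ℕ.n≤1+n _

    -- The 2 is attained on an empty right side: a move to the left then leaves two cells there, the
    -- one just written and the new head.
    act-bounded : ∀ {n} a p → length (proj₁ p) ≤ n × length (proj₂ p) ≤ n →
                  length (proj₁ (act a p)) ≤ 2 + n × length (proj₂ (act a p)) ≤ 2 + n
    act-bounded (c , left)  (l , r) (l≤ , r≤) =
      ℕ.≤-trans (length-below l) (ℕ.m≤n⇒m≤o+n 2 l≤) , s≤s (s≤s (ℕ.≤-trans (length-below r) r≤))
    act-bounded (c , stay)  (l , r) (l≤ , r≤) =
      ℕ.m≤n⇒m≤o+n 2 l≤ , s≤s (ℕ.m≤n⇒m≤o+n 1 (ℕ.≤-trans (length-below r) r≤))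
    act-bounded (c , right) (l , r) (l≤ , r≤) =
      s≤s (ℕ.m≤n⇒m≤o+n 1 l≤) , ℕ.m≤n⇒m≤o+n 2 (ℕ.≤-trans (length-below r) r≤)

    mutual
      readHeads : ∀ {X} k → (Fin k → Fin stacks) → (Vec (Cell Aux) k → Prog X) → Prog X
      readHeads zero    R f = f []
      readHeads (suc k) R f = pop (R zero) (readHead k R f)

      readHead : ∀ {X} k → (Fin (suc k) → Fin stacks) → (Vec (Cell Aux) (suc k) → Prog X) → Maybe (Cell A) → Prog X
      readHead k R f nothing  = readHeads k (R ∘ suc) (λ cs → f (blank ∷ cs))
      readHead k R f (just c) = push (R zero) c (readHeads k (R ∘ suc) (λ cs → f (u c ∷ cs)))

    doAct : ∀ {X} → Fin stacks → Fin stacks → Cell Aux × Move → Prog X → Prog X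
    doAct L R (c , left)  p = pop R λ _ → push R (v c) (pop L λ x → push R (maybe′ id (v blank) x) p)
    doAct L R (c , stay)  p = pop R λ _ → push R (v c) p
    doAct L R (c , right) p = pop R λ _ → push L (v c) p

    doActs : ∀ {X} k → (L R : Fin k → Fin stacks) → Vec (Cell Aux × Move) k → Prog X → Prog X
    doActs zero    L R []         p = p
    doActs (suc k) L R (a ∷ acts) p = doAct (L zero) (R zero) a (doActs k (L ∘ suc) (R ∘ suc) acts p)

    module _ (L R : Fin tapes → Fin stacks) (reply : Fin o′ → Prog ⊤) where

      obey : Instruction NState Aux o′ tapes → Prog (NState ⊎ ⊤)
      obey halt          = ret (inj₂ tt)
      obey (step s acts) = doActs tapes L R acts (ret (inj₁ s))
      obey (query i s)   = reply i >> ret (inj₁ s)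

      -- The control state of the simulated machine is the loop variable; this is where its
      -- finiteness enters.
      simulate : NState → Prog ⊤
      simulate = loop finite-NState λ s → readHeads tapes R (λ cs → obey (δ s cs))

    module _ (φ : Oracles) where

      restore : ∀ {m} (S : Vec (List (Cell A)) m) i {c cs} → lookup S i ≡ c ∷ cs →
                (S [ i ]≔ cs) [ i ]≔ (c ∷ lookup (S [ i ]≔ cs) i) ≡ S
      restore (s ∷ S) zero    refl = refl
      restore (s ∷ S) (suc i) eq   = cong (s ∷_) (restore S i eq)

      unchanged : ∀ {m} (S : Vec (List (Cell A)) m) i → lookup S i ≡ [] → S [ i ]≔ [] ≡ S
      unchanged S i eq = trans (cong (S [ i ]≔_) (sym eq)) (Vec.[]≔-lookup S i)

      run-readHeads : ∀ {X} {x : X} k R f S {t S′} →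
        Run φ (f (Vec.tabulate (λ j → headOf (lookup S (R j))))) S t x S′ →
        Run φ (readHeads k R f) S (k * 3 + t) x S′
      run-readHeads zero R f S run = run
      run-readHeads {x = x} (suc k) R f S {t} {S′} run = pop (go (lookup S (R zero)) refl run)
        where
        go : ∀ s → lookup S (R zero) ≡ s →
             Run φ (f (headOf s ∷ Vec.tabulate (λ j → headOf (lookup S (R (suc j)))))) S t x S′ →
             Run φ (readHead k R f (top s)) (S [ R zero ]≔ below s) (2 + (k * 3 + t)) x S′
        go [] eq run rewrite unchanged S (R zero) eq = weaken (ℕ.m≤n+m _ 2) (run-readHeads k (R ∘ suc) _ S run)
        go (c ∷ s) eq run = run-push refl (restore S (R zero) eq) (run-readHeads k (R ∘ suc) _ S run)

      run-doAct : ∀ {X} {x : X} {k} {L R : Fin (suc k) → Fin stacks} {ctx} → Block L R ctx → ∀ a p b prog {t S′} →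
        Run φ prog (ctx (act a p ∷ b)) t x S′ → Run φ (doAct (L zero) (R zero) a prog) (ctx (p ∷ b)) (6 + t) x S′
      run-doAct {L = L} {R} {ctx} B (c , left) (l , r) b prog run =
        run-pop (getR _ zero) (putR _ zero _) (run-push (getR _ zero) (putR _ zero _)
          (run-pop (getL _ zero) (putL _ zero _) (run-push (getR _ zero) (putR _ zero _) run)))
        where open Block B
      run-doAct {L = L} {R} {ctx} B (c , stay) (l , r) b prog run =
        weaken (ℕ.m≤n+m _ 3) (run-pop (getR _ zero) (putR _ zero _) (run-push (getR _ zero) (putR _ zero _) run))
        where open Block B
      run-doAct {L = L} {R} {ctx} B (c , right) (l , r) b prog run =
        weaken (ℕ.m≤n+m _ 3) (run-pop (getR _ zero) (putR _ zero _) (run-push (getL _ zero) (putL _ zero _) run))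
        where open Block B

      run-doActs : ∀ {X} {x : X} k {L R : Fin k → Fin stacks} {ctx} → Block L R ctx → ∀ acts b prog {t S′} →
        Run φ prog (ctx (zipWith act acts b)) t x S′ → Run φ (doActs k L R acts prog) (ctx b) (k * 6 + t) x S′
      run-doActs zero    B []         []      prog run = run
      run-doActs (suc k) {L} {R} B (a ∷ acts) (p ∷ b) prog run =
        run-doAct B a p b _ (run-doActs k (tailBlock B (act a p)) acts b prog run)

      module _ {L R : Fin tapes → Fin stacks} {ctx : Vec Sides tapes → Store} (B : Block L R ctx)
               (ψ : Fin o′ → ℕ → 𝔻) (reply : Fin o′ → Prog ⊤) (growth : ℕ) (replyTime : ℕ → ℕ)
               (2≤growth : 2 ≤ growth)
               (run-reply : ∀ i b n → Bounded n b → Σ[ b′ ∈ Vec Sides tapes ]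
                 (Run φ (reply i) (ctx b) (replyTime n) tt (ctx b′) ×
                  Vec.map tapeOf b′ ≡ ask ψ i (Vec.map tapeOf b) × Bounded (growth + n) b′)) where
        open Block B

        stepTime : ℕ → ℕ
        stepTime n = tapes * 3 + (tapes * 6 + (replyTime n + 1))

        simulationTime : ℕ → ℕ → ℕ
        simulationTime zero    n = stepTime n
        simulationTime (suc T) n = stepTime n + simulationTime T (growth + n)

        heads-ctx : ∀ b → Vec.tabulate (λ j → headOf (lookup (ctx b) (R j))) ≡ Vec.map Tape.head (Vec.map tapeOf b)
        heads-ctx b = trans (Vec.tabulate-cong λ j → trans (cong headOf (getR b j))
            (trans (sym (head-tapeOf (lookup b j))) (sym (Vec.lookup-map j (Tape.head ∘ tapeOf) b))))
          (trans (Vec.tabulate∘lookup _) (Vec.map-∘ Tape.head tapeOf b))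

        acts-tapeOf : ∀ {k} (acts : Vec (Cell Aux × Move) k) b →
          Vec.map tapeOf (zipWith act acts b) ≡ zipWith (λ (c , m) T → move m (write c T)) acts (Vec.map tapeOf b)
        acts-tapeOf []         []      = refl
        acts-tapeOf (a ∷ acts) (p ∷ b) = cong₂ _∷_ (act-tapeOf a p) (acts-tapeOf acts b)

        body : NState → Prog (NState ⊎ ⊤)
        body s = readHeads tapes R (λ cs → obey L R reply (δ s cs))

        -- Discovering that the machine has halted takes one execution of the body as well; it reads
        -- the heads, restores them and leaves the store as it was.
        Step : NState → ℕ → Vec Sides tapes → Maybe (NState × Vec (Tape Aux) tapes) → Set₁
        Step s n b nothing          = Run φ (body s) (ctx b) (stepTime n) (inj₂ tt) (ctx b)
        Step s n b (just (s′ , ts)) = Σ[ b′ ∈ Vec Sides tapes ]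
          (Run φ (body s) (ctx b) (stepTime n) (inj₁ s′) (ctx b′) × Vec.map tapeOf b′ ≡ ts × Bounded (growth + n) b′)

        run-step : ∀ s n b → Bounded n b → Step s n b (next ψ (s , Vec.map tapeOf b))
        run-step s n b b≤n = go (δ s (Vec.map Tape.head (Vec.map tapeOf b))) refl
          where
          enter : ∀ {I x S′ t} → δ s (Vec.map Tape.head (Vec.map tapeOf b)) ≡ I → t ≤ tapes * 6 + (replyTime n + 1) →
                  Run φ (obey L R reply I) (ctx b) t x S′ → Run φ (body s) (ctx b) (stepTime n) x S′
          enter refl le run = weaken (ℕ.+-monoʳ-≤ (tapes * 3) le) (run-readHeads tapes R _ (ctx b)
            (subst (λ hs → Run φ (obey L R reply (δ s hs)) (ctx b) _ _ _) (sym (heads-ctx b)) run))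
          go : ∀ I → δ s (Vec.map Tape.head (Vec.map tapeOf b)) ≡ I →
               Step s n b (OracleTM.execute N ψ (Vec.map tapeOf b) I)
          go halt eq = enter eq (ℕ.≤-trans (ℕ.m≤n+m 1 (replyTime n)) (ℕ.m≤n+m _ (tapes * 6))) ret
          go (step s′ acts) eq = zipWith act acts b
            , enter eq (ℕ.+-monoʳ-≤ (tapes * 6) (ℕ.m≤n+m 1 (replyTime n))) (run-doActs tapes B acts b _ ret)
            , acts-tapeOf acts b
            , λ j → subst (λ p → length (proj₁ p) ≤ growth + n × length (proj₂ p) ≤ growth + n)
                (sym (Vec.lookup-zipWith act j acts b))
                (let l≤ , r≤ = act-bounded (lookup acts j) (lookup b j) (b≤n j)
                 in ℕ.≤-trans l≤ (ℕ.+-monoˡ-≤ n 2≤growth) , ℕ.≤-trans r≤ (ℕ.+-monoˡ-≤ n 2≤growth))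
          go (query i s′) eq =
            let b′ , run , tapes≡ , b′≤ = run-reply i b n b≤n
            in b′ , enter eq (ℕ.m≤n+m _ (tapes * 6)) (bind run ret ℕ.≤-refl) , tapes≡ , b′≤

        run-simulate : ∀ T s n b {ts} → Bounded n b → runN ψ T (s , Vec.map tapeOf b) ≡ just ts →
          Σ[ b′ ∈ Vec Sides tapes ] (Run φ (simulate L R reply s) (ctx b) (simulationTime T n) tt (ctx b′) ×
            Vec.map tapeOf b′ ≡ ts × Bounded (T * growth + n) b′)
        run-simulate zero s n b b≤n eq with next ψ (s , Vec.map tapeOf b) | run-step s n b b≤n
        run-simulate zero s n b b≤n refl | nothing | run = b , done run , refl , b≤n
        run-simulate (suc T) s n b b≤n eq with next ψ (s , Vec.map tapeOf b) | run-step s n b b≤n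
        run-simulate (suc T) s n b b≤n refl | nothing | run =
          b , weaken (ℕ.m≤m+n _ _) (done run) , refl
            , λ j → let l≤ , r≤ = b≤n j in ℕ.m≤n⇒m≤o+n (suc T * growth) l≤ , ℕ.m≤n⇒m≤o+n (suc T * growth) r≤
        run-simulate (suc T) s n b b≤n eq | just (s′ , ts) | b₁ , run₁ , refl , b₁≤ =
          let b₂ , run₂ , eq₂ , b₂≤ = run-simulate T s′ (growth + n) b₁ b₁≤ eq
          in b₂ , again run₁ run₂ ℕ.≤-refl , eq₂
           , subst (λ m → Bounded m b₂) (trans (sym (ℕ.+-assoc (T * growth) growth n)) (cong (_+ n) (ℕ.+-comm (T * growth) growth))) b₂≤

        module _ (replyTime-mono : ∀ {m n} → m ≤ n → replyTime m ≤ replyTime n) where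

          stepTime-mono : ∀ {m n} → m ≤ n → stepTime m ≤ stepTime n
          stepTime-mono le = ℕ.+-monoʳ-≤ (tapes * 3) (ℕ.+-monoʳ-≤ (tapes * 6) (ℕ.+-monoˡ-≤ 1 (replyTime-mono le)))

          -- The height bound only grows, so each of the `suc T` rounds is charged at the final one,
          -- `T * growth + n`. This turns the recursion into a closed form that is polynomial
          -- whenever `replyTime` is.
          simulationTime-bound : ∀ T n → simulationTime T n ≤ suc T * stepTime (T * growth + n)
          simulationTime-bound zero    n = ℕ.≤-reflexive (sym (ℕ.+-identityʳ _))
          simulationTime-bound (suc T) n = ℕ.+-mono-≤ (stepTime-mono (ℕ.m≤n+m n (suc T * growth)))
            (subst (λ m → simulationTime T (growth + n) ≤ suc T * stepTime m)
              (trans (sym (ℕ.+-assoc (T * growth) growth n)) (cong (_+ n) (ℕ.+-comm (T * growth) growth)))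
              (simulationTime-bound T (growth + n)))

  flat : ∀ {k} → Vec Sides k → Vec (List (Cell A)) (double k)
  flat []            = []
  flat ((l , r) ∷ b) = l ∷ r ∷ flat b

  lookup-leftSide : ∀ {k} (b : Vec Sides k) j → lookup (flat b) (leftSide j) ≡ proj₁ (lookup b j)
  lookup-leftSide (_ ∷ b) zero    = refl
  lookup-leftSide (_ ∷ b) (suc j) = lookup-leftSide b j

  lookup-rightSide : ∀ {k} (b : Vec Sides k) j → lookup (flat b) (rightSide j) ≡ proj₂ (lookup b j)
  lookup-rightSide (_ ∷ b) zero    = refl
  lookup-rightSide (_ ∷ b) (suc j) = lookup-rightSide b j

  update-leftSide : ∀ {k} (b : Vec Sides k) j l →
                    flat b [ leftSide j ]≔ l ≡ flat (b [ j ]≔ (l , proj₂ (lookup b j)))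
  update-leftSide (_ ∷ b)       zero    l  = refl
  update-leftSide ((l , r) ∷ b) (suc j) l′ = cong (λ v → l ∷ r ∷ v) (update-leftSide b j l′)

  update-rightSide : ∀ {k} (b : Vec Sides k) j r →
                     flat b [ rightSide j ]≔ r ≡ flat (b [ j ]≔ (proj₁ (lookup b j) , r))
  update-rightSide (_ ∷ b)       zero    r  = refl
  update-rightSide ((l , r) ∷ b) (suc j) r′ = cong (λ v → l ∷ r ∷ v) (update-rightSide b j r′)

  flat-empty : ∀ k → flat (Vec.replicate k ([] , [])) ≡ Vec.replicate (double k) []
  flat-empty zero    = refl
  flat-empty (suc k) = cong (λ v → [] ∷ [] ∷ v) (flat-empty k)

-- Loops of stack programs

strip : List Bool → List Bool
strip []           = []
strip (false ∷ ds) = strip ds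
strip (true  ∷ ds) = true ∷ ds

ʳ++-undo : ∀ {B : Set} (xs ys : List B) → (xs ʳ++ []) ʳ++ ys ≡ xs ++ ys
ʳ++-undo xs ys = List.ʳ++-ʳ++ xs

length-rev : ∀ {B : Set} (xs : List B) {n} → length xs ≤ n → length (xs ʳ++ []) ≤ n
length-rev xs le = subst (_≤ _) (sym (trans (List.length-ʳ++ xs) (ℕ.+-identityʳ _))) le

foldl-push : ∀ {B C : Set} (c : C) (xs : List B) s →
             List.foldl (λ s _ → c ∷ s) s xs ≡ replicate (length xs) c ++ s
foldl-push c []       s = refl
foldl-push c (x ∷ xs) s = trans (foldl-push c xs (c ∷ s)) (slide (length xs))
  where
  slide : ∀ n → replicate n c ++ c ∷ s ≡ c ∷ replicate n c ++ s
  slide zero    = refl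
  slide (suc n) = cong (c ∷_) (slide n)

length-strip : ∀ ds → length (strip ds) ≤ length ds
length-strip []           = z≤n
length-strip (false ∷ ds) = ℕ.m≤n⇒m≤1+n (length-strip ds)
length-strip (true  ∷ ds) = ℕ.≤-refl

signSymbols : Bool → List Sym
signSymbols false = []
signSymbols true  = [ minus ]

isMinus : ∀ {A} → Maybe (Cell A) → Bool
isMinus (just (symbol minus)) = true
isMinus _                     = false

bitCells : ∀ {A} → List Bool → List (Cell A)
bitCells = List.map (symbol ∘ bit)

stopsAt : ∀ {A : Set} → (Cell A → Bool) → List (Cell A) → Bool
stopsAt stop cs = maybe′ stop true (top cs)

module Loops (o w : ℕ) (A : Set) (finA : Finite A) where
  open StackMachine o w A finA

  -- The i-th stack of ctx s is s and the others do not depend on s; for a store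
  -- that is written out this is refl.
  Lens : Fin stacks → (List (Cell A) → Store) → Set
  Lens i ctx = (λ s → ctx [] [ i ]≔ s) ≡ ctx

  get : ∀ {i ctx} → Lens i ctx → ∀ s → lookup (ctx s) i ≡ s
  get {i} {ctx} at s = trans (cong (λ f → lookup (f s) i) (sym at)) (Vec.lookup∘update i (ctx []) s)

  put : ∀ {i ctx} → Lens i ctx → ∀ s s′ → ctx s [ i ]≔ s′ ≡ ctx s′
  put {i} {ctx} at s s′ = trans (cong (λ f → f s [ i ]≔ s′) (sym at))
    (trans (Vec.[]≔-idempotent (ctx []) i) (cong (λ f → f s′) at))

  -- The cell at which the scan stops is consumed too, which conveniently removes a point or a
  -- separator. An empty stack also ends the scan.
  scan : Fin stacks → (Cell A → Bool) → (Cell A → Prog ⊤) → Prog ⊤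
  scan i stop f = loop finite-⊤ (λ _ → pop i visit) tt
    module scan where
    visitCell : Bool → Cell A → Prog (⊤ ⊎ ⊤)
    visitCell true  c = ret (inj₂ tt)
    visitCell false c = f c >> ret (inj₁ tt)

    visit : Maybe (Cell A) → Prog (⊤ ⊎ ⊤)
    visit nothing  = ret (inj₂ tt)
    visit (just c) = visitCell (stop c) c

  never : Cell A → Bool
  never _ = false

  transfer : Fin stacks → Fin stacks → Prog ⊤
  transfer i j = scan i never (λ c → push j c (ret tt))

  drain : Fin stacks → Prog ⊤
  drain i = scan i never (λ _ → ret tt)

  popSign : Fin stacks → Prog Bool
  popSign i = pop i visit
    module popSign where
    visit : Maybe (Cell A) → Prog Bool
    visit nothing               = ret false
    visit (just (symbol minus)) = ret true
    visit (just c)              = push i c (ret false)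

  -- The result tells whether a digit 1 was found. It serves to suppress the sign of a number that
  -- turns out to be 0.
  stripZeros : Fin stacks → Prog Bool
  stripZeros i = loop finite-⊤ (λ _ → pop i visit) tt
    module stripZeros where
    visit : Maybe (Cell A) → Prog (⊤ ⊎ Bool)
    visit nothing                    = ret (inj₂ false)
    visit (just (symbol (bit true))) = push i (symbol (bit true)) (ret (inj₂ true))
    visit (just _)                   = ret (inj₁ tt)

  pushSign : Fin stacks → Bool → Prog ⊤
  pushSign i true  = push i (symbol minus) (ret tt)
  pushSign i false = ret tt

  module _ (φ : Oracles) where

    module _ {B σ : Set} {e : B → Cell A} {ctx : List (Cell A) → σ → Store}
             {i : Fin stacks} {stop : Cell A → Bool} {f : Cell A → Prog ⊤}
             (at : (λ cs s → ctx [] s [ i ]≔ cs) ≡ ctx) (next : σ → B → σ) (Good : ℕ → σ → Set) (K : ℕ)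
             (continues : ∀ b → stop (e b) ≡ false)
             (run-f : ∀ {j s} b cs → Good (suc j) s →
                      Run φ (f (e b)) (ctx cs s) K tt (ctx cs (next s b)) × Good j (next s b)) where

      private
        at′ : ∀ s → Lens i (λ cs → ctx cs s)
        at′ s = cong (λ f cs → f cs s) at

      -- `s` collects all that changes in the rest of the store. `Good` is indexed by the number of
      -- cells still to come, so that an invariant can carry a budget for numbers that get longer
      -- with every cell.
      run-scan : ∀ xs rest {n s} → stopsAt stop rest ≡ true → length xs ≤ n → Good (length xs) s →
        Run φ (scan i stop f) (ctx (List.map e xs ++ rest) s) (n * (2 + K) + 2) tt
              (ctx (below rest) (List.foldl next s xs))
      run-scan [] rest {n} {s} stops _ _ = weaken (ℕ.m≤n+m 2 (n * (2 + K)))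
        (done (run-pop (get (at′ s) rest) (put (at′ s) rest (below rest)) (leave rest stops)))
        where
        leave : ∀ rest {S} → stopsAt stop rest ≡ true → Run φ (scan.visit i stop f (top rest)) S 1 (inj₂ tt) S
        leave []      _                = ret
        leave (c ∷ _) stops rewrite stops = ret
      run-scan (x ∷ xs) rest {suc n} {s} stops (s≤s le) good =
        again (run-pop (get (at′ s) _) (put (at′ s) _ _) continue)
          (run-scan xs rest stops le (proj₂ (run-f x [] good)))
          (ℕ.≤-reflexive (sym (ℕ.+-assoc (2 + K) (n * (2 + K)) 2)))
        where
        continue : Run φ (scan.visit i stop f (just (e x))) (ctx (List.map e xs ++ rest) s) (1 + K) (inj₁ tt)
                     (ctx (List.map e xs ++ rest) (next s x))
        continue rewrite continues x =
          bind (proj₁ (run-f x (List.map e xs ++ rest) good)) ret (ℕ.≤-reflexive (ℕ.+-comm K 1))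

      run-scan-all : ∀ xs {n s} → length xs ≤ n → Good (length xs) s →
        Run φ (scan i stop f) (ctx (List.map e xs) s) (n * (2 + K) + 2) tt (ctx [] (List.foldl next s xs))
      run-scan-all xs le good = subst (λ cs → Run φ (scan i stop f) (ctx cs _) _ tt _)
        (List.++-identityʳ (List.map e xs)) (run-scan xs [] refl le good)

    module _ {i j : Fin stacks} {ctx : List (Cell A) → List (Cell A) → Store}
             (at-i : (λ cs s → ctx [] s [ i ]≔ cs) ≡ ctx) (at-j : (λ cs s → ctx cs [] [ j ]≔ s) ≡ ctx) where

      private
        at-j′ : ∀ cs → Lens j (ctx cs)
        at-j′ cs = cong (λ f → f cs) at-j

      run-transfer : ∀ cs {n s} → length cs ≤ n →
        Run φ (transfer i j) (ctx cs s) (n * 5 + 2) tt (ctx [] (cs ʳ++ s))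
      run-transfer cs {n} {s} le = subst (λ cs₁ → Run φ (transfer i j) (ctx cs₁ s) _ tt (ctx [] (cs ʳ++ s))) (List.map-id cs)
        (run-scan-all {e = id} at-i (λ s c → c ∷ s) (λ _ _ → ⊤) 3 (λ _ → refl)
          (λ {_} {s} c cs _ → run-push (get (at-j′ cs) s) (put (at-j′ cs) s (c ∷ s)) ret , tt) cs le tt)

      run-transfer-bits : ∀ ds {n es} → length ds ≤ n →
        Run φ (transfer i j) (ctx (bitCells ds) (bitCells es)) (n * 5 + 2) tt (ctx [] (bitCells (ds ʳ++ es)))
      run-transfer-bits ds {n} {es} le =
        subst (λ cs → Run φ (transfer i j) (ctx (bitCells ds) (bitCells es)) _ tt (ctx [] cs))
          (sym (List.map-ʳ++ (symbol ∘ bit) ds))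
          (run-transfer (bitCells ds) (subst (_≤ n) (sym (List.length-map (symbol ∘ bit) ds)) le))

    run-drain : ∀ {i} {ctx : List (Cell A) → Store} → Lens i ctx → ∀ cs {n} → length cs ≤ n →
                Run φ (drain i) (ctx cs) (n * 3 + 2) tt (ctx [])
    run-drain {i} {ctx} at cs le = subst (λ cs₁ → Run φ (drain i) (ctx cs₁) _ tt (ctx [])) (List.map-id cs)
      (run-scan-all {e = id} {ctx = λ cs (_ : ⊤) → ctx cs} (cong (λ f cs _ → f cs) at) (λ s _ → s) (λ _ _ → ⊤) 1 (λ _ → refl)
        (λ _ _ _ → ret , tt) cs le tt)

    run-drain-bits : ∀ {i} {ctx : List (Cell A) → Store} → Lens i ctx → ∀ ds {n} → length ds ≤ n →
                     Run φ (drain i) (ctx (bitCells ds)) (n * 3 + 2) tt (ctx [])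
    run-drain-bits at ds {n} le =
      run-drain at (bitCells ds) (subst (_≤ n) (sym (List.length-map (symbol ∘ bit) ds)) le)

    run-popSign : ∀ {i} {ctx : List (Cell A) → Store} → Lens i ctx → ∀ neg cs → isMinus (top cs) ≡ false →
                  Run φ (popSign i) (ctx (List.map symbol (signSymbols neg) ++ cs)) 4 neg (ctx cs)
    run-popSign at true  cs _  = run-pop (get at _) (put at _ _) ret
    run-popSign {i} at false [] _ = run-pop (get at _) (put at _ _) ret
    run-popSign {i} {ctx} at false (c ∷ cs) ¬minus = run-pop (get at _) (put at _ _) (replace c ¬minus)
      where
      replace : ∀ c → isMinus (just c) ≡ false → Run φ (popSign.visit i (just c)) (ctx cs) 3 false (ctx (c ∷ cs))
      replace blank            _ = run-push (get at _) (put at _ _) ret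
      replace (symbol (bit _)) _ = run-push (get at _) (put at _ _) ret
      replace (symbol point)   _ = run-push (get at _) (put at _ _) ret
      replace (symbol sep)     _ = run-push (get at _) (put at _ _) ret
      replace (aux _)          _ = run-push (get at _) (put at _ _) ret

    run-stripZeros : ∀ {i} {ctx : List (Cell A) → Store} → Lens i ctx → ∀ ds rest {n ds′} →
      strip ds ≡ true ∷ ds′ → length ds ≤ n →
      Run φ (stripZeros i) (ctx (bitCells ds ++ rest)) (n * 2 + 4) true (ctx (bitCells (strip ds) ++ rest))
    run-stripZeros at (false ∷ ds) rest eq (s≤s le) =
      again (run-pop (get at _) (put at _ _) (ret {t = 0})) (run-stripZeros at ds rest eq le) ℕ.≤-refl
    run-stripZeros at (true ∷ ds) rest eq le =
      done (weaken (ℕ.m≤n+m 4 _) (run-pop (get at _) (put at _ _) (run-push (get at _) (put at _ _) ret)))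

    run-stripZeros-0 : ∀ {i} {ctx : List (Cell A) → Store} → Lens i ctx → ∀ ds {n} →
      strip ds ≡ [] → length ds ≤ n →
      Run φ (stripZeros i) (ctx (bitCells ds)) (n * 2 + 4) false (ctx [])
    run-stripZeros-0 at [] eq le = done (weaken (ℕ.m≤n+m 4 _) (run-pop (get at _) (put at _ _) ret))
    run-stripZeros-0 at (false ∷ ds) eq (s≤s le) =
      again (run-pop (get at _) (put at _ _) (ret {t = 0})) (run-stripZeros-0 at ds eq le) ℕ.≤-refl

    run-pushSign : ∀ {i} {ctx : List (Cell A) → Store} → Lens i ctx → ∀ neg cs →
      Run φ (pushSign i neg) (ctx cs) 3 tt (ctx (List.map symbol (signSymbols neg) ++ cs))
    run-pushSign at true  cs = run-push (get at _) (put at _ _) ret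
    run-pushSign at false cs = ret

-- Binary numerals

digit : Bool → ℕ
digit false = 0
digit true  = 1

val : List Bool → ℕ
val []       = 0
val (d ∷ ds) = digit d + 2 * val ds

-- Horner evaluation, most significant digit first. The accumulator makes concatenation of digit
-- strings a composition of evaluations, as `msb-++` records.
msb : ℕ → List Bool → ℕ
msb a []       = a
msb a (d ∷ ds) = msb (digit d + 2 * a) ds

bitSymbols : List Bool → List Sym
bitSymbols = List.map bit

signed : Bool → ℕ → ℤ
signed false n       = + n
signed true  zero    = + 0
signed true  (suc n) = -[1+ n ]

isNegative : ℤ → Bool
isNegative (+ _)    = false
isNegative -[1+ _ ] = true

msb-++ : ∀ a ds es → msb a (ds ++ es) ≡ msb (msb a ds) es
msb-++ a []       es = refl
msb-++ a (d ∷ ds) es = msb-++ _ ds es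

val-ʳ++ : ∀ ds es → val (ds ʳ++ es) ≡ msb (val es) ds
val-ʳ++ []       es = refl
val-ʳ++ (d ∷ ds) es = val-ʳ++ ds (d ∷ es)

val-increment : ∀ ds → val (increment ds) ≡ suc (val ds)
val-increment []           = refl
val-increment (false ∷ ds) = refl
val-increment (true ∷ ds)  rewrite val-increment ds = ℕ.*-suc 2 (val ds)

val-bits : ∀ n → val (bits n) ≡ n
val-bits zero    = refl
val-bits (suc n) = trans (val-increment (bits n)) (cong suc (val-bits n))

-- Stated for `suc n` since the numeral of 0 is empty and must not be extended by a zero. Adding 2
-- to an even number is `increment` twice, which acts on the tail alone.
bits-even : ∀ n → bits (2 * suc n) ≡ false ∷ bits (suc n)
bits-even zero    = refl
bits-even (suc n) = trans (cong bits (ℕ.*-suc 2 (suc n))) (cong (increment ∘ increment) (bits-even n))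

bits-digit : ∀ d n → bits (digit d + 2 * suc n) ≡ d ∷ bits (suc n)
bits-digit false n = bits-even n
bits-digit true  n = cong increment (bits-even n)

reverse-bits-msb : ∀ n ds → reverse (bits (msb (suc n) ds)) ≡ reverse (bits (suc n)) ++ ds
reverse-bits-msb n []       = sym (List.++-identityʳ _)
reverse-bits-msb n (d ∷ ds) with digit d + 2 * suc n in eq | bits-digit d n
... | zero  | _  with () ← ℕ.m+n≡0⇒n≡0 (digit d) eq
... | suc m | bs = begin
  reverse (bits (msb (suc m) ds))    ≡⟨ reverse-bits-msb m ds ⟩
  reverse (bits (suc m)) ++ ds       ≡⟨ cong (λ xs → reverse xs ++ ds) bs ⟩
  reverse (d ∷ bits (suc n)) ++ ds   ≡⟨ cong (_++ ds) (List.unfold-reverse d (bits (suc n))) ⟩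
  (reverse (bits (suc n)) ++ [ d ]) ++ ds ≡⟨ List.++-assoc (reverse (bits (suc n))) [ d ] ds ⟩
  reverse (bits (suc n)) ++ d ∷ ds   ∎
  where open ≡-Reasoning

-- Leading zeros leave the accumulator at 0; from the first 1 on, every further digit is appended to
-- the numeral. This ties the digit strings held by a program to the numerals demanded by the
-- encodings.
reverse-bits : ∀ ds → reverse (bits (msb 0 ds)) ≡ strip ds
reverse-bits []           = refl
reverse-bits (false ∷ ds) = reverse-bits ds
reverse-bits (true  ∷ ds) = reverse-bits-msb 0 ds

binary-msb : ∀ ds → binary (msb 0 ds) ≡ bitSymbols (strip ds)
binary-msb ds = cong bitSymbols (reverse-bits ds)

msb-reverse-bits : ∀ n → msb 0 (reverse (bits n)) ≡ n
msb-reverse-bits n = begin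
  msb 0 (reverse (bits n))             ≡⟨ val-ʳ++ (reverse (bits n)) [] ⟨
  val (reverse (bits n) ʳ++ [])   ≡⟨⟩
  val (reverse (reverse (bits n)))     ≡⟨ cong val (List.reverse-involutive (bits n)) ⟩
  val (bits n)                         ≡⟨ val-bits n ⟩
  n ∎
  where open ≡-Reasoning

strip-reverse-bits : ∀ n → strip (reverse (bits n)) ≡ reverse (bits n)
strip-reverse-bits n = trans (sym (reverse-bits (reverse (bits n)))) (cong (reverse ∘ bits) (msb-reverse-bits n))

infixl 7 _÷2^_

_÷2^_ : ℕ → ℕ → ℕ
n ÷2^ b = (n / 2 ^ b) {{ℕ.m^n≢0 2 b}}

msb-split : ∀ a ds → msb a ds ≡ a * 2 ^ length ds + msb 0 ds
msb-split a []       = sym (trans (ℕ.+-identityʳ _) (ℕ.*-identityʳ a))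
msb-split a (d ∷ ds) = begin
  msb (digit d + 2 * a) ds ≡⟨ msb-split (digit d + 2 * a) ds ⟩
  (digit d + 2 * a) * p + msb 0 ds ≡⟨ lemma (digit d) a p (msb 0 ds) ⟩
  a * (2 * p) + ((digit d + 0) * p + msb 0 ds) ≡⟨ cong (λ m → a * (2 * p) + m) (msb-split (digit d + 0) ds) ⟨
  a * (2 * p) + msb (digit d + 0) ds ∎
  where
  open ≡-Reasoning
  p = 2 ^ length ds
  lemma : ∀ d a p m → (d + 2 * a) * p + m ≡ a * (2 * p) + ((d + 0) * p + m)
  lemma = solve-∀

digit≤1 : ∀ d → digit d ≤ 1
digit≤1 false = z≤n
digit≤1 true  = s≤s z≤n

msb-< : ∀ ds → msb 0 ds < 2 ^ length ds
msb-< []       = s≤s z≤n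
msb-< (d ∷ ds) = begin-strict
  msb (digit d + 0) ds             ≡⟨ msb-split (digit d + 0) ds ⟩
  (digit d + 0) * p + msb 0 ds     <⟨ ℕ.+-monoʳ-< ((digit d + 0) * p) (msb-< ds) ⟩
  (digit d + 0) * p + p            ≤⟨ ℕ.+-monoˡ-≤ p (ℕ.*-monoˡ-≤ p (ℕ.+-monoˡ-≤ 0 (digit≤1 d))) ⟩
  1 * p + p                        ≡⟨ lemma p ⟩
  2 * p                            ∎
  where
  open ℕ.≤-Reasoning
  p = 2 ^ length ds
  lemma : ∀ p → 1 * p + p ≡ 2 * p
  lemma = solve-∀

div-unique : ∀ q r d .{{_ : NonZero d}} → r < d → (q * d + r) / d ≡ q
div-unique q r d r<d = begin
  (q * d + r) / d     ≡⟨ ℕ.+-distrib-/-∣ˡ r (divides-refl q) ⟩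
  q * d / d + r / d   ≡⟨ cong₂ _+_ (ℕ.m*n/n≡m q d) (ℕ.m<n⇒m/n≡0 r<d) ⟩
  q + 0               ≡⟨ ℕ.+-identityʳ q ⟩
  q ∎
  where open ≡-Reasoning

msb-/ : ∀ a ds → msb a ds ÷2^ length ds ≡ a
msb-/ a ds = trans (cong (_÷2^ length ds) (msb-split a ds)) (div-unique a _ _ {{ℕ.m^n≢0 2 (length ds)}} (msb-< ds))

odd-double : ∀ a → odd (2 * a) ≡ false
odd-double zero    = refl
odd-double (suc a) = trans (cong odd (ℕ.*-suc 2 a)) (odd-double a)

odd-suc-double : ∀ a → odd (suc (2 * a)) ≡ true
odd-suc-double zero    = refl
odd-suc-double (suc a) = trans (cong (odd ∘ suc) (ℕ.*-suc 2 a)) (odd-suc-double a)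

odd-digit : ∀ d a → odd (digit d + 2 * a) ≡ d
odd-digit false = odd-double
odd-digit true  = odd-suc-double

lowBits-msb : ∀ a ds → lowBits (length ds) (msb a ds) ≡ bitSymbols ds
lowBits-msb a []       = refl
lowBits-msb a (d ∷ ds) = cong₂ _∷_
  (cong bit (trans (cong odd (msb-/ (digit d + 2 * a) ds)) (odd-digit d a)))
  (lowBits-msb (digit d + 2 * a) ds)

lowDigits : ℕ → ℕ → List Bool
lowDigits zero    n = []
lowDigits (suc b) n = odd (n ÷2^ b) ∷ lowDigits b n

lowBits-lowDigits : ∀ b n → lowBits b n ≡ bitSymbols (lowDigits b n)
lowBits-lowDigits zero    n = refl
lowBits-lowDigits (suc b) n = cong (bit (odd (n ÷2^ b)) ∷_) (lowBits-lowDigits b n)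

length-lowDigits : ∀ b n → length (lowDigits b n) ≡ b
length-lowDigits zero    n = refl
length-lowDigits (suc b) n = cong suc (length-lowDigits b n)

odd-/ : ∀ n → digit (odd n) + 2 * (n / 2) ≡ n
odd-/ zero          = refl
odd-/ (suc zero)    = refl
odd-/ (suc (suc n)) = begin
  digit (odd n) + 2 * (suc (suc n) / 2)  ≡⟨ cong (λ q → digit (odd n) + 2 * q) (ℕ.m/n≡1+[m∸n]/n {suc (suc n)} {2} (s≤s (s≤s z≤n))) ⟩
  digit (odd n) + 2 * suc (n / 2)        ≡⟨ lemma (digit (odd n)) (n / 2) ⟩
  2 + (digit (odd n) + 2 * (n / 2))      ≡⟨ cong (λ m → suc (suc m)) (odd-/ n) ⟩
  suc (suc n) ∎
  where
  open ≡-Reasoning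
  lemma : ∀ d q → d + 2 * (1 + q) ≡ 2 + (d + 2 * q)
  lemma = solve-∀

msb-lowDigits : ∀ b n → msb (n ÷2^ b) (lowDigits b n) ≡ n
msb-lowDigits zero    n = ℕ.n/1≡n n
msb-lowDigits (suc b) n = trans (cong (λ a → msb a (lowDigits b n)) eq) (msb-lowDigits b n)
  where
  2^b*2≢0 : NonZero (2 ^ b * 2)
  2^b*2≢0 = ℕ.m*n≢0 (2 ^ b) 2 {{ℕ.m^n≢0 2 b}}
  eq : digit (odd (n ÷2^ b)) + 2 * (n ÷2^ suc b) ≡ n ÷2^ b
  eq = trans (cong (λ q → digit (odd (n ÷2^ b)) + 2 * q)
         (trans (ℕ./-congʳ {{ℕ.m^n≢0 2 (suc b)}} {{2^b*2≢0}} (ℕ.*-comm 2 (2 ^ b)))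
           (sym (ℕ.m/n/o≡m/[n*o] n (2 ^ b) 2 {{ℕ.m^n≢0 2 b}} {{_}} {{2^b*2≢0}}))))
         (odd-/ (n ÷2^ b))

∣signed∣ : ∀ neg n → ℤ.∣ signed neg n ∣ ≡ n
∣signed∣ false n       = refl
∣signed∣ true  zero    = refl
∣signed∣ true  (suc n) = refl

signed-isNegative : ∀ i → signed (isNegative i) ℤ.∣ i ∣ ≡ i
signed-isNegative (+ _)    = refl
signed-isNegative -[1+ _ ] = refl

sign-isNegative : ∀ i → sign i ≡ signSymbols (isNegative i)
sign-isNegative (+ _)    = refl
sign-isNegative -[1+ _ ] = refl

-- A negative zero has no encoding.
Signable : Bool → ℕ → Set
Signable neg n = neg ≡ true → 0 < n

sign-signed : ∀ neg n → Signable neg n → sign (signed neg n) ≡ signSymbols neg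
sign-signed false n       _  = refl
sign-signed true  zero    ok with () ← ok refl
sign-signed true  (suc n) ok = refl

-- A program holds digit strings and never numbers, so outputs are recognised through this equation.
-- The exponent is the number of fractional digits actually written, hence trailing zeros are part
-- of the value of type `𝔻`.
encode-digits : ∀ neg I F → Signable neg (msb 0 (I ++ F)) →
  encode𝔻 (signed neg (msb 0 (I ++ F)) /2^ length F) ≡ signSymbols neg ++ bitSymbols (strip I) ++ point ∷ bitSymbols F
encode-digits neg I F ok = cong₂ _++_ (sign-signed neg _ ok) (cong₂ (λ u v → u ++ point ∷ v)
  (trans (cong (λ n → binary (n ÷2^ length F)) n≡)
    (trans (cong binary (msb-/ (msb 0 I) F)) (binary-msb I)))
  (trans (cong (lowBits (length F)) n≡) (lowBits-msb (msb 0 I) F)))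
  where
  n≡ : ℤ.∣ signed neg (msb 0 (I ++ F)) ∣ ≡ msb (msb 0 I) F
  n≡ = trans (∣signed∣ neg _) (msb-++ 0 I F)

intDigits : 𝔻 → List Bool
intDigits (a /2^ b) = reverse (bits (ℤ.∣ a ∣ ÷2^ b))

fracDigits : 𝔻 → List Bool
fracDigits (a /2^ b) = lowDigits b ℤ.∣ a ∣

encode-form : ∀ d → encode𝔻 d ≡
  signSymbols (isNegative (𝔻.numerator d)) ++ bitSymbols (intDigits d) ++ point ∷ bitSymbols (fracDigits d)
encode-form (a /2^ b) = cong₂ _++_ (sign-isNegative a)
  (cong (λ v → binary (ℤ.∣ a ∣ ÷2^ b) ++ point ∷ v) (lowBits-lowDigits b ℤ.∣ a ∣))

msb-digits : ∀ d → msb 0 (intDigits d ++ fracDigits d) ≡ ℤ.∣ 𝔻.numerator d ∣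
msb-digits (a /2^ b) = trans (msb-++ 0 (intDigits (a /2^ b)) _)
  (trans (cong (λ n → msb n (lowDigits b ℤ.∣ a ∣)) (msb-reverse-bits (ℤ.∣ a ∣ ÷2^ b)))
    (msb-lowDigits b ℤ.∣ a ∣))

-- Addition, subtraction, long division and multiplication of digit strings

BitOp : Set
BitOp = Bool → Bool → Bool → Bool × Bool

addBit : BitOp
addBit false false r     = false , r
addBit false true  false = false , true
addBit false true  true  = true  , false
addBit true  false false = false , true
addBit true  false true  = true  , false
addBit true  true  r     = true  , r

subBit : BitOp
subBit false false r     = false , r
subBit false true  false = true  , true
subBit false true  true  = false , false
subBit true  false false = true  , true
subBit true  false true  = false , false
subBit true  true  r     = true  , r

-- The operation receives the carry, a digit of `ys` and a digit of `rs`, and returns the new carry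
-- and the digit of the result; the shorter operand is continued with zeros. For `subBit` the result
-- is `rs` minus `ys` and the carry is a borrow.
outDigits : BitOp → Bool → List Bool → List Bool → List Bool
outDigits op c []       []       = []
outDigits op c (y ∷ ys) []       = proj₂ (op c y false) ∷ outDigits op (proj₁ (op c y false)) ys []
outDigits op c []       (r ∷ rs) = proj₂ (op c false r) ∷ outDigits op (proj₁ (op c false r)) [] rs
outDigits op c (y ∷ ys) (r ∷ rs) = proj₂ (op c y r) ∷ outDigits op (proj₁ (op c y r)) ys rs

outCarry : BitOp → Bool → List Bool → List Bool → Bool
outCarry op c []       []       = c
outCarry op c (y ∷ ys) []       = outCarry op (proj₁ (op c y false)) ys []
outCarry op c []       (r ∷ rs) = outCarry op (proj₁ (op c false r)) [] rs
outCarry op c (y ∷ ys) (r ∷ rs) = outCarry op (proj₁ (op c y r)) ys rs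

length-outDigits : ∀ op c ys rs → length (outDigits op c ys rs) ≡ length ys ℕ.⊔ length rs
length-outDigits op c []       []       = refl
length-outDigits op c (y ∷ ys) []       = cong suc (trans (length-outDigits op _ ys []) (ℕ.⊔-identityʳ _))
length-outDigits op c []       (r ∷ rs) = cong suc (length-outDigits op _ [] rs)
length-outDigits op c (y ∷ ys) (r ∷ rs) = cong suc (length-outDigits op _ ys rs)

length-outDigits-≤ : ∀ op c ys rs {k n} → length ys + k ≤ n → length rs + k ≤ n →
                     length (outDigits op c ys rs) + k ≤ n
length-outDigits-≤ op c ys rs {k} ys≤ rs≤ =
  subst (λ l → l + k ≤ _) (sym (length-outDigits op c ys rs))
    (subst (_≤ _) (sym (ℕ.+-distribʳ-⊔ k (length ys) (length rs))) (ℕ.⊔-lub ys≤ rs≤))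

addBit-digits : ∀ c y r → digit (proj₂ (addBit c y r)) + 2 * digit (proj₁ (addBit c y r)) ≡ digit r + digit y + digit c
addBit-digits false false false = refl
addBit-digits false false true  = refl
addBit-digits false true  false = refl
addBit-digits false true  true  = refl
addBit-digits true  false false = refl
addBit-digits true  false true  = refl
addBit-digits true  true  false = refl
addBit-digits true  true  true  = refl

subBit-digits : ∀ c y r → digit r + 2 * digit (proj₁ (subBit c y r)) ≡ digit (proj₂ (subBit c y r)) + digit y + digit c
subBit-digits false false false = refl
subBit-digits false false true  = refl
subBit-digits false true  false = refl
subBit-digits false true  true  = refl
subBit-digits true  false false = refl
subBit-digits true  false true  = refl
subBit-digits true  true  false = refl
subBit-digits true  true  true  = refl

private
  add-step : ∀ {s c′ r y c V P C R Y : ℕ} → s + 2 * c′ ≡ r + y + c → V + P * C ≡ R + Y + c′ →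
             (s + 2 * V) + (2 * P) * C ≡ (r + 2 * R) + (y + 2 * Y) + c
  add-step {s} {c′} {r} {y} {c} {V} {P} {C} {R} {Y} eq₁ eq₂ = begin
    (s + 2 * V) + (2 * P) * C      ≡⟨ l₁ s V P C ⟩
    s + 2 * (V + P * C)            ≡⟨ cong (λ e → s + 2 * e) eq₂ ⟩
    s + 2 * (R + Y + c′)           ≡⟨ l₂ s R Y c′ ⟩
    (s + 2 * c′) + (2 * R + 2 * Y) ≡⟨ cong (_+ (2 * R + 2 * Y)) eq₁ ⟩
    (r + y + c) + (2 * R + 2 * Y)  ≡⟨ l₃ r y c R Y ⟩
    (r + 2 * R) + (y + 2 * Y) + c  ∎
    where
    open ≡-Reasoning
    l₁ : ∀ s V P C → (s + 2 * V) + (2 * P) * C ≡ s + 2 * (V + P * C)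
    l₁ = solve-∀
    l₂ : ∀ s R Y c → s + 2 * (R + Y + c) ≡ (s + 2 * c) + (2 * R + 2 * Y)
    l₂ = solve-∀
    l₃ : ∀ r y c R Y → (r + y + c) + (2 * R + 2 * Y) ≡ (r + 2 * R) + (y + 2 * Y) + c
    l₃ = solve-∀

  -- The identity for a subtraction is that of an addition in which the output and `rs` have changed
  -- places.
  sub-step : ∀ {s c′ r y c V P C R Y : ℕ} → r + 2 * c′ ≡ s + y + c → R + P * C ≡ V + Y + c′ →
             (r + 2 * R) + (2 * P) * C ≡ (s + 2 * V) + (y + 2 * Y) + c
  sub-step {s} {c′} {r} {y} {c} {V} {P} {C} {R} {Y} = add-step {r} {c′} {s} {y} {c} {R} {P} {C} {V} {Y}

val-add : ∀ c ys rs → val (outDigits addBit c ys rs) + 2 ^ length (outDigits addBit c ys rs) * digit (outCarry addBit c ys rs)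
                    ≡ val rs + val ys + digit c
val-add c [] [] = ℕ.*-identityˡ (digit c)
val-add c (y ∷ ys) [] =
  add-step {s = digit (proj₂ (addBit c y false))} {c′ = digit (proj₁ (addBit c y false))} {r = digit false} {y = digit y} {c = digit c} {V = val (outDigits addBit (proj₁ (addBit c y false)) ys [])}
           {P = 2 ^ length (outDigits addBit (proj₁ (addBit c y false)) ys [])} {C = digit (outCarry addBit (proj₁ (addBit c y false)) ys [])}
           {R = val []} {Y = val ys} (addBit-digits c y false) (val-add (proj₁ (addBit c y false)) ys [])
val-add c [] (r ∷ rs) =
  add-step {s = digit (proj₂ (addBit c false r))} {c′ = digit (proj₁ (addBit c false r))} {r = digit r} {y = digit false} {c = digit c} {V = val (outDigits addBit (proj₁ (addBit c false r)) [] rs)}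
           {P = 2 ^ length (outDigits addBit (proj₁ (addBit c false r)) [] rs)} {C = digit (outCarry addBit (proj₁ (addBit c false r)) [] rs)}
           {R = val rs} {Y = val []} (addBit-digits c false r) (val-add (proj₁ (addBit c false r)) [] rs)
val-add c (y ∷ ys) (r ∷ rs) =
  add-step {s = digit (proj₂ (addBit c y r))} {c′ = digit (proj₁ (addBit c y r))} {r = digit r} {y = digit y} {c = digit c} {V = val (outDigits addBit (proj₁ (addBit c y r)) ys rs)}
           {P = 2 ^ length (outDigits addBit (proj₁ (addBit c y r)) ys rs)} {C = digit (outCarry addBit (proj₁ (addBit c y r)) ys rs)}
           {R = val rs} {Y = val ys} (addBit-digits c y r) (val-add (proj₁ (addBit c y r)) ys rs)

val-sub : ∀ c ys rs → val rs + 2 ^ length (outDigits subBit c ys rs) * digit (outCarry subBit c ys rs)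
                    ≡ val (outDigits subBit c ys rs) + val ys + digit c
val-sub c [] [] = ℕ.*-identityˡ (digit c)
val-sub c (y ∷ ys) [] =
  sub-step {s = digit (proj₂ (subBit c y false))} {c′ = digit (proj₁ (subBit c y false))} {r = digit false} {y = digit y} {c = digit c} {V = val (outDigits subBit (proj₁ (subBit c y false)) ys [])}
           {P = 2 ^ length (outDigits subBit (proj₁ (subBit c y false)) ys [])} {C = digit (outCarry subBit (proj₁ (subBit c y false)) ys [])}
           {R = val []} {Y = val ys} (subBit-digits c y false) (val-sub (proj₁ (subBit c y false)) ys [])
val-sub c [] (r ∷ rs) =
  sub-step {s = digit (proj₂ (subBit c false r))} {c′ = digit (proj₁ (subBit c false r))} {r = digit r} {y = digit false} {c = digit c} {V = val (outDigits subBit (proj₁ (subBit c false r)) [] rs)}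
           {P = 2 ^ length (outDigits subBit (proj₁ (subBit c false r)) [] rs)} {C = digit (outCarry subBit (proj₁ (subBit c false r)) [] rs)}
           {R = val rs} {Y = val []} (subBit-digits c false r) (val-sub (proj₁ (subBit c false r)) [] rs)
val-sub c (y ∷ ys) (r ∷ rs) =
  sub-step {s = digit (proj₂ (subBit c y r))} {c′ = digit (proj₁ (subBit c y r))} {r = digit r} {y = digit y} {c = digit c} {V = val (outDigits subBit (proj₁ (subBit c y r)) ys rs)}
           {P = 2 ^ length (outDigits subBit (proj₁ (subBit c y r)) ys rs)} {C = digit (outCarry subBit (proj₁ (subBit c y r)) ys rs)}
           {R = val rs} {Y = val ys} (subBit-digits c y r) (val-sub (proj₁ (subBit c y r)) ys rs)

val-++ : ∀ ds es → val (ds ++ es) ≡ val ds + 2 ^ length ds * val es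
val-++ []       es = sym (ℕ.*-identityˡ (val es))
val-++ (d ∷ ds) es = trans (cong (λ v → digit d + 2 * v) (val-++ ds es)) (lemma (digit d) (val ds) (2 ^ length ds) (val es))
  where
  lemma : ∀ d v p e → d + 2 * (v + p * e) ≡ d + 2 * v + 2 * p * e
  lemma = solve-∀

val-< : ∀ ds → val ds < 2 ^ length ds
val-< ds = subst (λ v → v < 2 ^ length ds)
  (trans (sym (val-ʳ++ (reverse ds) [])) (cong val (List.reverse-involutive ds)))
  (subst (λ l → msb 0 (reverse ds) < 2 ^ l) (List.length-reverse ds) (msb-< (reverse ds)))

carryDigits : Bool → List Bool
carryDigits true  = [ true ]
carryDigits false = []

addDigits : List Bool → List Bool → List Bool
addDigits ys rs = outDigits addBit false ys rs ++ carryDigits (outCarry addBit false ys rs)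

val-addDigits : ∀ ys rs → val (addDigits ys rs) ≡ val rs + val ys
val-addDigits ys rs = trans (val-++ (outDigits addBit false ys rs) _)
  (trans (cong (λ v → val (outDigits addBit false ys rs) + 2 ^ length (outDigits addBit false ys rs) * v) (val-carry _))
    (trans (val-add false ys rs) (ℕ.+-identityʳ _)))
  where
  val-carry : ∀ c → val (carryDigits c) ≡ digit c
  val-carry false = refl
  val-carry true  = refl

length-addDigits : ∀ ys rs {k n} → length ys + suc k ≤ n → length rs + suc k ≤ n → length (addDigits ys rs) + k ≤ n
length-addDigits ys rs {k} {n} ys≤ rs≤ = begin
  length (os ++ cs) + k        ≡⟨ cong (_+ k) (List.length-++ os) ⟩
  length os + length cs + k    ≤⟨ ℕ.+-monoˡ-≤ k (ℕ.+-monoʳ-≤ (length os) (length-carry (outCarry addBit false ys rs))) ⟩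
  length os + 1 + k            ≡⟨ ℕ.+-assoc (length os) 1 k ⟩
  length os + suc k            ≤⟨ length-outDigits-≤ addBit false ys rs ys≤ rs≤ ⟩
  n ∎
  where
  open ℕ.≤-Reasoning
  os = outDigits addBit false ys rs
  cs = carryDigits (outCarry addBit false ys rs)
  length-carry : ∀ c → length (carryDigits c) ≤ 1
  length-carry false = z≤n
  length-carry true  = s≤s z≤n

-- A zero is suppressed only while nothing has been written. Once the point is on the stack all
-- zeros are kept, so the integer part comes out without leading zeros and the fractional part in
-- full length.
emitDigit : List Sym → Bool → List Sym
emitDigit []       false = []
emitDigit []       true  = [ bit true ]
emitDigit (s ∷ q) d      = bit d ∷ s ∷ q

emit-nonempty : ∀ s q ds → List.foldl emitDigit (s ∷ q) ds ≡ bitSymbols ds ʳ++ (s ∷ q)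
emit-nonempty s q []       = refl
emit-nonempty s q (d ∷ ds) = emit-nonempty (bit d) (s ∷ q) ds

emit-empty : ∀ ds → List.foldl emitDigit [] ds ≡ bitSymbols (strip ds) ʳ++ []
emit-empty []           = refl
emit-empty (false ∷ ds) = emit-empty ds
emit-empty (true ∷ ds)  = emit-nonempty (bit true) [] ds

-- One digit of long division by ys: the remainder is kept least significant
-- digit first, so that bringing down a digit is a push.
borrows : List Bool → Bool → List Bool → Bool
borrows ys d r = outCarry subBit false ys (d ∷ r)

divRemainder : List Bool → Bool → List Bool → List Bool
divRemainder ys d r = if borrows ys d r then d ∷ r else outDigits subBit false ys (d ∷ r)

divDigit : List Bool → Bool → List Bool → Bool
divDigit ys d r = if borrows ys d r then false else true

-- The point passes from the dividend into the quotient and leaves the remainder alone; thus one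
-- loop produces the integer and the fractional digits.
divNext : List Bool → List Bool × List Sym → Sym → List Bool × List Sym
divNext ys (r , q) (bit d) = divRemainder ys d r , emitDigit q (divDigit ys d r)
divNext ys (r , q) s       = r , s ∷ q

-- The trial subtraction ends with a borrow exactly if the divisor does not fit. If it fits, a
-- single subtraction is enough, because `val r < val ys` gives `1 + 2 * val r < 2 * val ys`.
divStep-spec : ∀ ys d r → val r < val ys →
  (val ys * digit (divDigit ys d r) + val (divRemainder ys d r) ≡ digit d + 2 * val r) × val (divRemainder ys d r) < val ys
divStep-spec ys d r r<y with outCarry subBit false ys (d ∷ r) in eq
-- With a borrow, `val-sub` says that `val (d ∷ r) + p` is `val os + val ys`, while `val os < p`.
... | true  = cong (_+ (digit d + 2 * val r)) (ℕ.*-zeroʳ (val ys)) , ℕ.+-cancelʳ-< p _ _ (begin-strict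
    val (d ∷ r) + p        ≡⟨ cong (λ n → val (d ∷ r) + n) (ℕ.*-identityʳ p) ⟨
    val (d ∷ r) + p * 1    ≡⟨ cong (λ c → val (d ∷ r) + p * digit c) eq ⟨
    val (d ∷ r) + p * digit (outCarry subBit false ys (d ∷ r)) ≡⟨ val-sub false ys (d ∷ r) ⟩
    val os + val ys + 0    ≡⟨ ℕ.+-identityʳ _ ⟩
    val os + val ys        <⟨ ℕ.+-monoˡ-< (val ys) (val-< os) ⟩
    p + val ys             ≡⟨ ℕ.+-comm p (val ys) ⟩
    val ys + p ∎)
  where
  open ℕ.≤-Reasoning
  os = outDigits subBit false ys (d ∷ r)
  p = 2 ^ length os
... | false = trans (cong (_+ val os) (ℕ.*-identityʳ (val ys))) (trans (ℕ.+-comm (val ys) (val os)) (sym sub≡)) ,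
  ℕ.+-cancelʳ-< (val ys) _ _ (begin-strict
    val os + val ys        ≡⟨ sub≡ ⟨
    digit d + 2 * val r    ≤⟨ ℕ.+-monoˡ-≤ (2 * val r) (digit≤1 d) ⟩
    1 + 2 * val r          <⟨ ℕ.n<1+n _ ⟩
    2 + 2 * val r          ≡⟨ ℕ.*-suc 2 (val r) ⟨
    2 * suc (val r)        ≤⟨ ℕ.*-monoʳ-≤ 2 r<y ⟩
    2 * val ys             ≡⟨ cong (λ m → val ys + m) (ℕ.+-identityʳ (val ys)) ⟩
    val ys + val ys        ∎)
  where
  open ℕ.≤-Reasoning
  os = outDigits subBit false ys (d ∷ r)
  p = 2 ^ length os
  sub≡ : val (d ∷ r) ≡ val os + val ys
  sub≡ = trans (sym (trans (cong (λ c → val (d ∷ r) + p * digit c) eq)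
    (trans (cong (λ n → val (d ∷ r) + n) (ℕ.*-zeroʳ p)) (ℕ.+-identityʳ _))))
    (trans (val-sub false ys (d ∷ r)) (ℕ.+-identityʳ _))

-- `exact` holds for every quotient `a` obtained so far, so that the division of the fractional part
-- can continue from the integer quotient and the remainder left by the first one.
record Division (ys : List Bool) (r : List Bool) (ds : List Bool) (q : List Sym) : Set where
  field
    quotient  : List Bool
    remainder : List Bool
    folds     : List.foldl (divNext ys) (r , q) (bitSymbols ds) ≡ (remainder , List.foldl emitDigit q quotient)
    length≡   : length quotient ≡ length ds
    small     : val remainder < val ys
    exact     : ∀ a → val ys * msb a quotient + val remainder ≡ msb (val ys * a + val r) ds

divide : ∀ ys r ds q → val r < val ys → Division ys r ds q
divide ys r [] q r<y = record
  { quotient = [] ; remainder = r ; folds = refl ; length≡ = refl ; small = r<y ; exact = λ _ → refl }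
divide ys r (d ∷ ds) q r<y = record
  { quotient = divDigit ys d r ∷ quotient ; remainder = remainder ; folds = folds ; length≡ = cong suc length≡
  ; small = small ; exact = λ a → trans (exact (digit (divDigit ys d r) + 2 * a)) (cong (λ n → msb n ds) (bring a)) }
  where
  open Division (divide ys (divRemainder ys d r) ds (emitDigit q (divDigit ys d r)) (proj₂ (divStep-spec ys d r r<y)))
  bring : ∀ a → val ys * (digit (divDigit ys d r) + 2 * a) + val (divRemainder ys d r) ≡ digit d + 2 * (val ys * a + val r)
  bring a = trans (l₁ (val ys) (digit (divDigit ys d r)) a (val (divRemainder ys d r)))
    (trans (cong (_+ 2 * (val ys * a)) (proj₁ (divStep-spec ys d r r<y))) (l₂ (digit d) (val r) (val ys * a)))
    where
    l₁ : ∀ y b a r → y * (b + 2 * a) + r ≡ (y * b + r) + 2 * (y * a)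
    l₁ = solve-∀
    l₂ : ∀ d r e → d + 2 * r + 2 * e ≡ d + 2 * (e + r)
    l₂ = solve-∀

-- Remainders are not normalised and may get longer by one digit per step; `k` counts the steps that
-- remain within the budget `n`.
length-divRemainder : ∀ ys d r {k n} → length ys + k ≤ n → length r + suc k ≤ n → length (divRemainder ys d r) + k ≤ n
length-divRemainder ys d r {k} {n} ys≤ r≤ with outCarry subBit false ys (d ∷ r)
... | true  = subst (_≤ n) (ℕ.+-suc (length r) k) r≤
... | false = length-outDigits-≤ subBit false ys (d ∷ r) ys≤ (subst (_≤ n) (ℕ.+-suc (length r) k) r≤)

-- One Horner step: `r` is doubled by a new lowest digit 0, and `ys` is added if the digit of the
-- other factor is 1.
mulNext : List Bool → List Bool → Bool → List Bool
mulNext ys r d = if d then addDigits ys (false ∷ r) else false ∷ r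

mul-fold : ∀ ys r ds a → val r ≡ val ys * a → val (List.foldl (mulNext ys) r ds) ≡ val ys * msb a ds
mul-fold ys r []           a eq = eq
mul-fold ys r (false ∷ ds) a eq = mul-fold ys (false ∷ r) ds (2 * a) (trans (cong (2 *_) eq) (lemma (val ys) a))
  where
  lemma : ∀ y a → 2 * (y * a) ≡ y * (2 * a)
  lemma = solve-∀
mul-fold ys r (true ∷ ds)  a eq = mul-fold ys (addDigits ys (false ∷ r)) ds (1 + 2 * a)
  (trans (val-addDigits ys (false ∷ r)) (trans (cong (λ v → 2 * v + val ys) eq) (lemma (val ys) a)))
  where
  lemma : ∀ y a → 2 * (y * a) + y ≡ y * (1 + 2 * a)
  lemma = solve-∀

-- Two digits of the budget are spent per step, one on the doubling and one on the final carry.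
length-mulNext : ∀ ys r d {k n} → length ys + (2 + k) ≤ n → length r + (2 + k) ≤ n → length (mulNext ys r d) + k ≤ n
length-mulNext ys r false {k} {n} ys≤ r≤ = ℕ.≤-trans (ℕ.n≤1+n _)
  (subst (_≤ n) (trans (ℕ.+-suc (length r) (suc k)) (cong suc (ℕ.+-suc (length r) k))) r≤)
length-mulNext ys r true  {k} {n} ys≤ r≤ = length-addDigits ys (false ∷ r)
  (ℕ.≤-trans (ℕ.+-monoʳ-≤ (length ys) (ℕ.n≤1+n (suc k))) ys≤)
  (subst (_≤ n) (ℕ.+-suc (length r) (suc k)) r≤)

val-below : ∀ ds → val (below ds) ≡ val ds / 2
val-below []       = refl
val-below (d ∷ ds) = sym (trans (cong (_/ 2) (trans (ℕ.+-comm (digit d) (2 * val ds)) (cong (_+ digit d) (ℕ.*-comm 2 (val ds)))))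
  (div-unique (val ds) (digit d) 2 (s≤s (digit≤1 d))))

dropDigits : ∀ {B : Set} → List Bool → List B → List Bool
dropDigits = List.foldl (λ r _ → below r)

÷2^-suc : ∀ n b → n / 2 ÷2^ b ≡ n ÷2^ suc b
÷2^-suc n b = ℕ.m/n/o≡m/[n*o] n 2 (2 ^ b) {{_}} {{ℕ.m^n≢0 2 b}} {{ℕ.m^n≢0 2 (suc b)}}

val-dropDigits : ∀ {B : Set} r (xs : List B) → val (dropDigits r xs) ≡ val r ÷2^ length xs
val-dropDigits r []       = sym (ℕ.n/1≡n (val r))
val-dropDigits r (x ∷ xs) = trans (val-dropDigits (below r) xs)
  (trans (cong (_÷2^ length xs) (val-below r)) (÷2^-suc (val r) (length xs)))

-- Reading encodings off a stack

isPoint notBit isSep : ∀ {A} → Cell A → Bool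
isPoint (symbol point)  = true
isPoint _               = false
notBit (symbol (bit _)) = false
notBit _                = true
isSep (symbol sep)      = true
isSep _                 = false

record SplitSymbols {A} (cs : List (Cell A)) : Set where
  field
    rest     : List (Cell A)
    split    : cs ≡ List.map symbol (symbols cs) ++ rest
    no-rest  : symbols rest ≡ []

splitSymbols : ∀ {A} (cs : List (Cell A)) → SplitSymbols cs
splitSymbols []              = record { rest = [] ; split = refl ; no-rest = refl }
splitSymbols (blank ∷ cs)    = record { rest = blank ∷ cs ; split = refl ; no-rest = refl }
splitSymbols (aux x ∷ cs)    = record { rest = aux x ∷ cs ; split = refl ; no-rest = refl }
splitSymbols (symbol s ∷ cs) = record { rest = rest ; split = cong (symbol s ∷_) split ; no-rest = no-rest }
  where open SplitSymbols (splitSymbols cs)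

no-symbols-stop : ∀ {A} (cs : List (Cell A)) → symbols cs ≡ [] → stopsAt notBit cs ≡ true
no-symbols-stop []           _ = refl
no-symbols-stop (blank ∷ cs) _ = refl
no-symbols-stop (aux x ∷ cs) _ = refl

symbols-map : ∀ {A} w → symbols (List.map (symbol {A}) w) ≡ w
symbols-map []      = refl
symbols-map (s ∷ w) = cong (s ∷_) (symbols-map w)

strip-[] : ∀ ds → strip ds ≡ [] → msb 0 ds ≡ 0
strip-[] ds eq = trans (sym (msb-reverse-bits (msb 0 ds))) (cong (msb 0) (trans (reverse-bits ds) eq))

data StripView (ds : List Bool) : Set where
  zeros      : strip ds ≡ [] → StripView ds
  leadingOne : ∀ {ds′} → strip ds ≡ true ∷ ds′ → StripView ds

stripView : ∀ ds → StripView ds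
stripView []           = zeros refl
stripView (true ∷ ds)  = leadingOne refl
stripView (false ∷ ds) with stripView ds
... | zeros eq      = zeros eq
... | leadingOne eq = leadingOne eq

encodeℤ-digits : ∀ neg ds {ds′} → strip ds ≡ true ∷ ds′ →
                 encodeℤ (signed neg (msb 0 ds)) ≡ signSymbols neg ++ bitSymbols (strip ds)
encodeℤ-digits neg ds eq = cong₂ _++_ (sign-signed neg _ (λ _ → positive _ refl))
  (trans (cong binary (∣signed∣ neg _)) (binary-msb ds))
  where
  positive : ∀ n → msb 0 ds ≡ n → 0 < n
  positive zero    eq′ with () ← trans (sym (trans (reverse-bits ds) eq)) (cong (reverse ∘ bits) eq′)
  positive (suc n) _   = s≤s z≤n

isMinus-bits : ∀ {A} ds (cs : List (Cell A)) → isMinus (top cs) ≡ false → isMinus (top (bitCells ds ++ cs)) ≡ false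
isMinus-bits []       cs eq = eq
isMinus-bits (_ ∷ ds) cs eq = refl

-- A simulated machine may leave anything behind its output. `rest` is empty or begins with a cell
-- that holds no symbol, so a scan over digits stops there; the last two fields bound the digit
-- strings by the height of the stack.
record EncodedCells {A} (z : 𝔻) (cs : List (Cell A)) : Set where
  field
    rest    : List (Cell A)
    no-rest : symbols rest ≡ []
    split   : cs ≡ List.map symbol (signSymbols (isNegative (𝔻.numerator z))) ++
                   (bitCells (intDigits z) ++ symbol point ∷ (bitCells (fracDigits z) ++ rest))
    int≤    : length (intDigits z) ≤ length cs
    frac≤   : length (fracDigits z) ≤ length cs

encodedCells : ∀ {A} z (cs : List (Cell A)) → symbols cs ≡ encode𝔻 z → EncodedCells z cs
encodedCells {A} z cs eq = record
  { rest = rest ; no-rest = no-rest ; split = split≡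
  ; int≤ = ℕ.m+n≤o⇒m≤o (length I) digits≤
  ; frac≤ = ℕ.≤-trans (ℕ.n≤1+n _) (ℕ.m+n≤o⇒n≤o (length I) digits≤) }
  where
  open SplitSymbols (splitSymbols cs)
  σ = List.map (symbol {A})
  S = signSymbols (isNegative (𝔻.numerator z))
  I = intDigits z
  F = fracDigits z
  split≡ : cs ≡ σ S ++ (bitCells I ++ symbol point ∷ (bitCells F ++ rest))
  split≡ = begin
    cs ≡⟨ split ⟩
    σ (symbols cs) ++ rest ≡⟨ cong (λ w → σ w ++ rest) (trans eq (encode-form z)) ⟩
    σ (S ++ bitSymbols I ++ point ∷ bitSymbols F) ++ rest
      ≡⟨ cong (_++ rest) (trans (List.map-++ symbol S _) (cong (σ S ++_) (trans (List.map-++ symbol (bitSymbols I) _)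
           (cong₂ (λ u v → u ++ symbol point ∷ v) (sym (List.map-∘ I)) (sym (List.map-∘ F)))))) ⟩
    (σ S ++ (bitCells I ++ symbol point ∷ bitCells F)) ++ rest
      ≡⟨ trans (List.++-assoc (σ S) _ rest) (cong (σ S ++_) (List.++-assoc (bitCells I) _ rest)) ⟩
    σ S ++ (bitCells I ++ symbol point ∷ (bitCells F ++ rest)) ∎
    where open ≡-Reasoning
  digits≤ : length I + suc (length F) ≤ length cs
  digits≤ = begin
    length I + suc (length F)  ≤⟨ ℕ.+-monoʳ-≤ (length I) (s≤s (ℕ.m≤m+n (length F) (length rest))) ⟩
    length I + suc (length F + length rest)
      ≡⟨ cong₂ (λ p q → p + suc q) (sym (List.length-map _ I))
           (trans (cong (_+ length rest) (sym (List.length-map _ F))) (sym (List.length-++ (bitCells F)))) ⟩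
    length (bitCells {A} I) + suc (length (bitCells F ++ rest)) ≡⟨ List.length-++ (bitCells I) ⟨
    length (bitCells I ++ symbol point ∷ (bitCells F ++ rest)) ≤⟨ ℕ.m≤n+m _ (length (σ S)) ⟩
    length (σ S) + length (bitCells I ++ symbol point ∷ (bitCells F ++ rest)) ≡⟨ List.length-++ (σ S) ⟨
    length (σ S ++ (bitCells I ++ symbol point ∷ (bitCells F ++ rest))) ≡⟨ cong length split≡ ⟨
    length cs ∎
    where open ℕ.≤-Reasoning

length-sign : ∀ neg → length (signSymbols neg) ≤ 1
length-sign false = z≤n
length-sign true  = s≤s z≤n

length-below-≤ : ∀ {B : Set} (xs : List B) {n} → length xs ≤ n → length (below xs) ≤ n
length-below-≤ []       le = le
length-below-≤ (_ ∷ xs) le = ℕ.≤-trans (ℕ.n≤1+n _) le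

-- The machine for x , y ↦ y f(x / y)

-- The oracle for ± X / y handed to the simulated machine. The trailing digit 1
-- keeps the numerator away from 0, so that the sign can always be written.
quotientOracle : Bool → ℕ → (y : ℕ) → .{{NonZero y}} → ℕ → 𝔻
quotientOracle neg X y m = signed neg (suc (2 * (X * 2 ^ m / y))) /2^ suc m

digitOracle : Bool → (x ys : List Bool) → 0 < val ys → ℕ → 𝔻
digitOracle neg x ys 0<y = quotientOracle neg (val x) (val ys) {{ℕ.>-nonZero 0<y}}

msb-zeros : ∀ a m → msb a (replicate m false) ≡ a * 2 ^ m
msb-zeros a zero    = sym (ℕ.*-identityʳ a)
msb-zeros a (suc m) = trans (msb-zeros (2 * a) m) (lemma a (2 ^ m))
  where
  lemma : ∀ a p → 2 * a * p ≡ a * (2 * p)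
  lemma = solve-∀

module Division-encoding (neg : Bool) (x ys : List Bool) (m : ℕ) (0<y : 0 < val ys) where

  open Division (divide ys [] (reverse x) [] 0<y) public renaming
    (quotient to I; remainder to rem₁; folds to folds₁; length≡ to length-I; small to small₁; exact to exact₁)
  open Division (divide ys rem₁ (replicate m false) (point ∷ List.foldl emitDigit [] I) small₁) public renaming
    (quotient to F; remainder to rem₂; folds to folds₂; length≡ to length-F; small to small₂; exact to exact₂)

  instance
    ys≢0 : NonZero (val ys)
    ys≢0 = ℕ.>-nonZero 0<y

  -- The dividend in the order of consumption: the digits of `x` from the most significant one, the
  -- point, and a zero for every fractional digit wanted.
  feed : List Sym
  feed = bitSymbols x ʳ++ (point ∷ replicate m (bit false))

  emitted : List Sym
  emitted = bitSymbols F ʳ++ (point ∷ bitSymbols (strip I) ʳ++ [])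

  divide-feed : List.foldl (divNext ys) ([] , []) feed ≡ (rem₂ , emitted)
  divide-feed = begin
    foldl ([] , []) feed
      ≡⟨ cong (foldl ([] , [])) (trans (List.ʳ++-defn (bitSymbols x)) (cong (_++ _) (sym (List.reverse-map bit x)))) ⟩
    foldl ([] , []) (bitSymbols (reverse x) ++ point ∷ replicate m (bit false))
      ≡⟨ List.foldl-++ (divNext ys) ([] , []) (bitSymbols (reverse x)) _ ⟩
    foldl (foldl ([] , []) (bitSymbols (reverse x))) (point ∷ replicate m (bit false))
      ≡⟨ cong₂ (λ s ds → foldl (divNext ys s point) ds) folds₁ (sym (List.map-replicate bit m false)) ⟩
    foldl (rem₁ , point ∷ List.foldl emitDigit [] I) (bitSymbols (replicate m false))
      ≡⟨ folds₂ ⟩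
    (rem₂ , List.foldl emitDigit (point ∷ List.foldl emitDigit [] I) F)
      ≡⟨ cong (rem₂ ,_) (emit-nonempty point _ F) ⟩
    (rem₂ , bitSymbols F ʳ++ (point ∷ List.foldl emitDigit [] I))
      ≡⟨ cong (λ q → rem₂ , bitSymbols F ʳ++ (point ∷ q)) (emit-empty I) ⟩
    (rem₂ , emitted) ∎
    where
    open ≡-Reasoning
    foldl = List.foldl (divNext ys)

  -- Feeding `m` zeros multiplies the dividend by `2 ^ m`, so both phases together divide
  -- `val x * 2 ^ m` by `val ys` and `msb (msb 0 I) F` is the rounded quotient; the last digit turns
  -- q into 2 q + 1.
  digits≡ : msb 0 (I ++ F ++ [ true ]) ≡ suc (2 * (val x * 2 ^ m / val ys))
  digits≡ = begin
    msb 0 (I ++ F ++ [ true ])           ≡⟨ trans (msb-++ 0 I _) (msb-++ (msb 0 I) F _) ⟩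
    suc (2 * msb (msb 0 I) F)            ≡⟨ cong (λ q → suc (2 * q)) (sym (div-unique (msb (msb 0 I) F) (val rem₂) (val ys) small₂)) ⟩
    suc (2 * ((msb (msb 0 I) F * val ys + val rem₂) / val ys))
      ≡⟨ cong (λ n → suc (2 * (n / val ys))) total ⟩
    suc (2 * (val x * 2 ^ m / val ys)) ∎
    where
    open ≡-Reasoning
    total : msb (msb 0 I) F * val ys + val rem₂ ≡ val x * 2 ^ m
    total = begin
      msb (msb 0 I) F * val ys + val rem₂   ≡⟨ cong (_+ val rem₂) (ℕ.*-comm (msb (msb 0 I) F) (val ys)) ⟩
      val ys * msb (msb 0 I) F + val rem₂   ≡⟨ exact₂ (msb 0 I) ⟩
      msb (val ys * msb 0 I + val rem₁) (replicate m false) ≡⟨ msb-zeros _ m ⟩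
      (val ys * msb 0 I + val rem₁) * 2 ^ m ≡⟨ cong (_* 2 ^ m) (exact₁ 0) ⟩
      msb (val ys * 0 + 0) (reverse x) * 2 ^ m
        ≡⟨ cong (λ a → msb a (reverse x) * 2 ^ m) (trans (ℕ.+-identityʳ _) (ℕ.*-zeroʳ (val ys))) ⟩
      msb 0 (reverse x) * 2 ^ m             ≡⟨ cong (_* 2 ^ m) (val-ʳ++ (reverse x) []) ⟨
      val (reverse (reverse x)) * 2 ^ m     ≡⟨ cong (λ ds → val ds * 2 ^ m) (List.reverse-involutive x) ⟩
      val x * 2 ^ m ∎

  encoding : encode𝔻 (quotientOracle neg (val x) (val ys) m) ≡
             signSymbols neg ++ bitSymbols (strip I) ++ point ∷ bitSymbols F ++ [ bit true ]
  encoding = begin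
    encode𝔻 (signed neg (suc (2 * (val x * 2 ^ m / val ys))) /2^ suc m)
      ≡⟨ cong₂ (λ n b → encode𝔻 (signed neg n /2^ b)) digits≡ length≡ ⟨
    encode𝔻 (signed neg (msb 0 (I ++ F ++ [ true ])) /2^ length (F ++ [ true ]))
      ≡⟨ encode-digits neg I (F ++ [ true ]) (λ _ → subst (0 <_) (sym digits≡) (s≤s z≤n)) ⟩
    signSymbols neg ++ bitSymbols (strip I) ++ point ∷ bitSymbols (F ++ [ true ])
      ≡⟨ cong (λ v → signSymbols neg ++ bitSymbols (strip I) ++ point ∷ v) (List.map-++ bit F [ true ]) ⟩
    signSymbols neg ++ bitSymbols (strip I) ++ point ∷ bitSymbols F ++ [ bit true ] ∎
    where
    open ≡-Reasoning
    length≡ : length (F ++ [ true ]) ≡ suc m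
    length≡ = trans (List.length-++ F) (trans (ℕ.+-comm (length F) 1) (cong suc (trans length-F (List.length-replicate m))))

  reversed : (bit true ∷ emitted) ʳ++ [] ≡ bitSymbols (strip I) ++ point ∷ bitSymbols F ++ [ bit true ]
  reversed = trans (List.ʳ++-ʳ++ (bitSymbols F)) (ʳ++-undo (bitSymbols (strip I)) _)

data Ones {A : Set} : List (Cell A) → Set where
  ones : ∀ m rest → leadingOnes (symbols rest) ≡ 0 → Ones (replicate m (symbol (bit true)) ++ rest)

splitOnes : ∀ {A} (cs : List (Cell A)) → Ones cs
splitOnes []                         = ones 0 [] refl
splitOnes (blank ∷ cs)               = ones 0 _ refl
splitOnes (aux a ∷ cs)               = ones 0 _ refl
splitOnes (symbol minus ∷ cs)        = ones 0 _ refl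
splitOnes (symbol point ∷ cs)        = ones 0 _ refl
splitOnes (symbol sep ∷ cs)          = ones 0 _ refl
splitOnes (symbol (bit false) ∷ cs)  = ones 0 _ refl
splitOnes (symbol (bit true) ∷ cs)   with splitOnes cs
... | ones m rest eq = ones (suc m) rest eq

leadingOnes-ones : ∀ {A} m (rest : List (Cell A)) → leadingOnes (symbols rest) ≡ 0 →
                   leadingOnes (symbols (replicate m (symbol (bit true)) ++ rest)) ≡ m
leadingOnes-ones zero    rest eq = eq
leadingOnes-ones (suc m) rest eq = cong suc (leadingOnes-ones m rest eq)

notOne : ∀ {A} → Cell A → Bool
notOne (symbol (bit true)) = false
notOne _                   = true

module DefinabilityMachine (N : OracleTM 1) where
  open OracleTM N using (Aux; finite-Aux; tapes; start) renaming (work to workN)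

  workTapes : ℕ
  workTapes = 8 + double tapes

  open StackMachine 0 workTapes Aux finite-Aux
    using (Prog; ret; push; pop; bind; loop; _>>_; stacks)
  open Simulation 0 workTapes Aux finite-Aux
  open Loops 0 workTapes Aux finite-Aux

  -- `X` and `Y` keep the digits of |x| and y, lowest on top; `R` is the remainder or the partial
  -- product, `T₁`, `T₂`, `T₃` are scratch, `FEED` is the dividend and `Q` the quotient. From index
  -- 10 on every tape of `N` has two stacks: `R₀` is its input, `R₁` its output, and `L₂`, `R₂` form
  -- its oracle tape.
  IN OUT X Y R T₁ T₂ T₃ FEED Q R₀ R₁ L₂ R₂ : Fin stacks
  IN   = 0F
  OUT  = 1F
  X    = 2F
  Y    = 3F
  R    = 4F
  T₁   = 5F
  T₂   = 6F
  T₃   = 7F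
  FEED = 8F
  Q    = 9F
  R₀   = suc (suc 9F)
  R₁   = suc (suc (suc (suc 9F)))
  L₂   = suc (suc (suc (suc (suc 9F))))
  R₂   = suc (suc (suc (suc (suc (suc 9F)))))

  cellBit : Cell Aux → Bool
  cellBit (symbol (bit b)) = b
  cellBit _                = false

  bitCell : Bool → Cell Aux
  bitCell b = symbol (bit b)

  -- The digits of both operands are saved on `T₁` and `T₂` while the result grows on `T₃`, so that
  -- either operand can be recovered afterwards.
  zipStep : BitOp → Bool → Maybe (Cell Aux) → Maybe (Cell Aux) → Prog (Bool ⊎ Bool)
  zipStep op c nothing  nothing  = ret (inj₂ c)
  zipStep op c (just y) nothing  = let c′ , s = op c (cellBit y) false in
    push T₁ y (push T₃ (bitCell s) (ret (inj₁ c′)))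
  zipStep op c nothing  (just r) = let c′ , s = op c false (cellBit r) in
    push T₂ r (push T₃ (bitCell s) (ret (inj₁ c′)))
  zipStep op c (just y) (just r) = let c′ , s = op c (cellBit y) (cellBit r) in
    push T₁ y (push T₂ r (push T₃ (bitCell s) (ret (inj₁ c′))))

  arith : BitOp → Prog Bool
  arith op = bind finite-Bool (loop finite-Bool (λ c → pop Y λ y → pop R λ r → zipStep op c y r) false) λ c →
    transfer T₁ Y >> ret c

  pushCarry : Bool → Prog ⊤ → Prog ⊤
  pushCarry true  p = push T₃ (bitCell true) p
  pushCarry false p = p

  add : Prog ⊤
  add = bind finite-Bool (arith addBit) λ c → drain T₂ >> pushCarry c (transfer T₃ R)

  -- After a borrow the old remainder is restored from `T₂`; otherwise the difference on `T₃`
  -- replaces it.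
  settle : Bool → Prog Bool
  settle true  = drain T₃ >> (transfer T₂ R >> ret true)
  settle false = drain T₂ >> (transfer T₃ R >> ret false)

  sub : Prog Bool
  sub = bind finite-Bool (arith subBit) settle

  emitCell : Maybe (Cell Aux) → Bool → Prog ⊤
  emitCell nothing  false = ret tt
  emitCell nothing  true  = push Q (bitCell true) (ret tt)
  emitCell (just s) d     = push Q s (push Q (bitCell d) (ret tt))

  divCell : Cell Aux → Prog ⊤
  divCell (symbol (bit d)) = push R (bitCell d) (bind finite-Bool sub λ borrow →
    pop Q λ s → emitCell s (if borrow then false else true))
  divCell c                = push Q c (ret tt)

  -- `FEED` is filled from its far end: a zero for each 1 of the query, then the point, then the
  -- digits of `X`, lowest first. After the division the digit 1 is put behind the quotient, whose
  -- transfer to `R₂` reverses it into reading order.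
  reply : Bool → Fin 1 → Prog ⊤
  reply neg _ =
    scan R₂ notOne (λ _ → push FEED (bitCell false) (ret tt)) >> (
    drain R₂ >> (
    drain L₂ >> push FEED (symbol point) (
    scan X never (λ c → push FEED c (push T₁ c (ret tt))) >> (
    transfer T₁ X >> (
    scan FEED never divCell >> push Q (bitCell true) (
    drain R >> (
    transfer Q R₂ >>
    pushSign R₂ neg)))))))

  mulCell : Cell Aux → Prog ⊤
  mulCell (symbol (bit true)) = push R (bitCell false) add
  mulCell _                   = push R (bitCell false) (ret tt)

  -- All digits of z drive the same Horner multiplication by y. Each fractional digit leaves a mark
  -- on `FEED`, and each mark later removes the lowest digit of the product, which divides by the
  -- power of 2 and truncates.
  post : Prog ⊤
  post = bind finite-Bool (popSign R₁) λ neg →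
    scan R₁ isPoint mulCell >> (
    scan R₁ notBit (λ c → mulCell c >> push FEED c (ret tt)) >> (
    scan FEED never (λ _ → pop R λ _ → ret tt) >> (
    transfer R OUT >>
    -- Truncation can turn a negative number into 0, whose encoding is empty; then the sign is
    -- dropped.
    bind finite-Bool (stripZeros OUT) λ nonZero → pushSign OUT (if nonZero then neg else false))))

  leftN rightN : Fin tapes → Fin stacks
  leftN  j = 10 ↑ʳ leftSide j
  rightN j = 10 ↑ʳ rightSide j

  -- An empty stack means y = 0. The output is then left empty, which encodes 0; the same happens
  -- for negative y. A digit that was popped for this test is put back.
  withDivisor : Bool → Maybe (Cell Aux) → Prog ⊤
  withDivisor neg nothing  = ret tt
  withDivisor neg (just c) = push Y c (simulate N id id (λ _ → refl) leftN rightN (reply neg) start >> post)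

  -- While y is read, each of its digits contributes a 1 to the input of `N`. The precision asked
  -- for is thus the number of binary digits of y, which makes y smaller than 2 to that power.
  afterSign : Bool → Bool → Prog ⊤
  afterSign neg true  = ret tt
  afterSign neg false =
    scan IN never (λ c → push Y c (push R₀ (bitCell true) (ret tt))) >> pop Y (withDivisor neg)

  program : Prog ⊤
  program = bind finite-Bool (popSign IN) λ neg → scan IN isSep (λ c → push X c (ret tt)) >>
    bind finite-Bool (popSign IN) (afterSign neg)

  -- The time bounds copy the shape of the programs, one summand per `bind`, so that runs composed
  -- with `_⨾_` fit with little arithmetic.
  arithTime : ℕ → ℕ
  arithTime n = (n * 9 + 3) + ((n * 5 + 2) + 1)

  addTime : ℕ → ℕ
  addTime n = arithTime n + ((n * 3 + 2) + (2 + (suc n * 5 + 2)))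

  subTime : ℕ → ℕ
  subTime n = arithTime n + ((n * 3 + 2) + ((n * 5 + 2) + 1))

  divCellTime : ℕ → ℕ
  divCellTime n = 2 + (subTime n + 6)

  feedSize : ℕ → ℕ → ℕ
  feedSize n k = n + suc k

  replyTime : ℕ → ℕ → ℕ
  replyTime n k =
    (k * 5 + 2) + ((k * 3 + 2) + ((k * 3 + 2) + (2 + ((n * 7 + 2) + ((n * 5 + 2) +
    ((feedSize n k * (2 + divCellTime (n + feedSize n k)) + 2) + (2 + (((n + feedSize n k) * 3 + 2) +
    ((suc (feedSize n k) * 5 + 2) + 3)))))))))

  mulCellTime : ℕ → ℕ
  mulCellTime n = 2 + (addTime n + 1)

  -- The digits of y, and two more for each of the at most `k + k` digits of z.
  postSize : ℕ → ℕ → ℕ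
  postSize n k = n + (k + k) * 2

  postTime : ℕ → ℕ → ℕ
  postTime n k =
    4 + ((k * (2 + mulCellTime (postSize n k)) + 2) + ((k * (2 + (mulCellTime (postSize n k) + 3)) + 2) +
    ((k * 4 + 2) + ((postSize n k * 5 + 2) + ((postSize n k * 2 + 4) + 3)))))

  -- Rounds towards zero, because the sign is split off before the division.
  productℤ : ℕ → 𝔻 → ℤ
  productℤ y (a /2^ b) = signed (isNegative a) (y * ℤ.∣ a ∣ ÷2^ b)

  programTime : ℕ → ℕ → ℕ
  programTime n t = 4 + ((n * 5 + 2) + (4 + t))

  -- Heights start below `n` and gain at most `3 + n` per simulated step, the increase caused by an
  -- answer; see `length-oracle`.
  blocksBound : ℕ → ℕ → ℕ
  blocksBound n T = T * (3 + n) + n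

  simTime : ℕ → ℕ → ℕ
  simTime n T = suc T * (tapes * 3 + (tapes * 6 + (replyTime n (blocksBound n T) + 1)))

  coreTime : ℕ → ℕ → ℕ
  coreTime n T = 1 + (2 + (simTime n T + postTime n (blocksBound n T)))

-- Runs of the machine for x , y ↦ y f(x / y)

module DefinabilityCorrectness (N : OracleTM 1) (φ : Fin 0 → ℕ → 𝔻) where
  open OracleTM N using (Aux; finite-Aux; tapes; start) renaming (work to workN)
  open DefinabilityMachine N
  open StackMachine 0 workTapes Aux finite-Aux
    using (ret; push; pop; bind; loop; _>>_; _⨾_; Run; Store; weaken; done; again; run-ends; run-starts; initialStore; Outputs; run-outputs)
  open Simulation 0 workTapes Aux finite-Aux
  open Loops 0 workTapes Aux finite-Aux

  raw : (a b c d e f g h i j : List (Cell Aux)) → Vec Sides tapes → Store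
  raw a b c d e f g h i j t = a ∷ b ∷ c ∷ d ∷ e ∷ f ∷ g ∷ h ∷ i ∷ j ∷ flat t

  module _ (a b c i j : List (Cell Aux)) (t : Vec Sides tapes) where

    arithStore : (y r t₁ t₂ t₃ : List Bool) → Store
    arithStore y r t₁ t₂ t₃ =
      raw a b c (bitCells y) (bitCells r) (bitCells t₁) (bitCells t₂) (bitCells t₃) i j t

    run-zip : ∀ op k ys rs t₁ t₂ t₃ {n} → length ys ≤ n → length rs ≤ n →
      Run φ (loop finite-Bool (λ c → pop Y λ y → pop R λ r → zipStep op c y r) k) (arithStore ys rs t₁ t₂ t₃)
        (n * 9 + 3) (outCarry op k ys rs)
        (arithStore [] [] (ys ʳ++ t₁) (rs ʳ++ t₂) (outDigits op k ys rs ʳ++ t₃))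
    run-zip op k []       []       t₁ t₂ t₃ {n} _ _ = weaken (ℕ.m≤n+m 3 (n * 9)) (done (pop (pop ret)))
    run-zip op k (y ∷ ys) []       t₁ t₂ t₃ (s≤s p) q =
      again (pop (pop (push (push (ret {t = 2}))))) (run-zip op _ ys [] _ _ _ p z≤n) ℕ.≤-refl
    run-zip op k []       (r ∷ rs) t₁ t₂ t₃ p (s≤s q) =
      again (pop (pop (push (push (ret {t = 2}))))) (run-zip op _ [] rs _ _ _ z≤n q) ℕ.≤-refl
    run-zip op k (y ∷ ys) (r ∷ rs) t₁ t₂ t₃ (s≤s p) (s≤s q) =
      again (pop (pop (push (push (push (ret {t = 0})))))) (run-zip op _ ys rs _ _ _ p q) ℕ.≤-refl

    run-arith : ∀ op ys rs {n} → length ys ≤ n → length rs ≤ n →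
      Run φ (arith op) (arithStore ys rs [] [] []) (arithTime n) (outCarry op false ys rs)
        (arithStore ys [] [] (rs ʳ++ []) (outDigits op false ys rs ʳ++ []))
    run-arith op ys rs {n} p q = run-zip op false ys rs [] [] [] p q ⨾ (subst (λ ys′ → Run φ (transfer T₁ Y) (arithStore [] [] (ys ʳ++ []) t₂ t₃) (n * 5 + 2) tt
                            (arithStore ys′ [] [] t₂ t₃))
        (trans (ʳ++-undo ys []) (List.++-identityʳ ys))
        (run-transfer-bits φ {ctx = λ f d → raw a b c d [] f (bitCells t₂) (bitCells t₃) i j t}
          refl refl
          (ys ʳ++ []) (length-rev ys p))) ⨾
      ret
      where
      t₂ = rs ʳ++ []
      t₃ = outDigits op false ys rs ʳ++ []

    length-out : ∀ op k ys rs {n} → length ys ≤ n → length rs ≤ n → length (outDigits op k ys rs) ≤ n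
    length-out op k ys rs p q = subst (_≤ _) (ℕ.+-identityʳ _) (length-outDigits-≤ op k ys rs {0}
      (subst (_≤ _) (sym (ℕ.+-identityʳ _)) p) (subst (_≤ _) (sym (ℕ.+-identityʳ _)) q))

    run-add : ∀ ys rs {n} → length ys ≤ n → length rs ≤ n →
      Run φ add (arithStore ys rs [] [] []) (addTime n) tt (arithStore ys (addDigits ys rs) [] [] [])
    run-add ys rs {n} p q = run-arith addBit ys rs p q ⨾ run-drain-bits φ {ctx = λ g → raw a b c (bitCells ys) [] [] g (bitCells (os ʳ++ [])) i j t}
        refl (rs ʳ++ [])
        (length-rev rs q) ⨾
      (carry (outCarry addBit false ys rs))
      where
      os = outDigits addBit false ys rs
      os≤n = length-out addBit false ys rs p q
      shift : ∀ ds {n} → length ds ≤ n → Run φ (transfer T₃ R) (arithStore ys [] [] [] ds) (n * 5 + 2) tt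
                                          (arithStore ys (ds ʳ++ []) [] [] [])
      shift ds = run-transfer-bits φ {ctx = λ h e → raw a b c (bitCells ys) e [] [] h i j t}
        refl refl ds
      carry : ∀ k → Run φ (pushCarry k (transfer T₃ R)) (arithStore ys [] [] [] (os ʳ++ [])) (2 + (suc n * 5 + 2)) tt
                      (arithStore ys (os ++ carryDigits k) [] [] [])
      carry true = push (run-ends (cong (λ ds → arithStore ys ds [] [] []) (ʳ++-undo os [ true ]))
        (shift (true ∷ (os ʳ++ [])) (s≤s (length-rev os os≤n))))
      carry false = weaken (ℕ.m≤n+m _ 2) (run-ends (cong (λ ds → arithStore ys ds [] [] []) (ʳ++-undo os []))
        (shift (os ʳ++ []) (ℕ.m≤n⇒m≤1+n (length-rev os os≤n))))

    run-sub : ∀ ys rs {n} → length ys ≤ n → length rs ≤ n →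
      Run φ sub (arithStore ys rs [] [] []) (subTime n) (outCarry subBit false ys rs)
        (arithStore ys (if outCarry subBit false ys rs then rs else outDigits subBit false ys rs) [] [] [])
    run-sub ys rs {n} p q = run-arith subBit ys rs p q ⨾ (finish (outCarry subBit false ys rs))
      where
      os = outDigits subBit false ys rs
      os≤n = length-out subBit false ys rs p q
      undo : ∀ (ds : List Bool) → (ds ʳ++ []) ʳ++ [] ≡ ds
      undo ds = trans (ʳ++-undo ds []) (List.++-identityʳ ds)
      finish : ∀ k → Run φ (settle k) (arithStore ys [] [] (rs ʳ++ []) (os ʳ++ []))
                       ((n * 3 + 2) + ((n * 5 + 2) + 1)) k (arithStore ys (if k then rs else os) [] [] [])
      finish true = run-drain-bits φ {ctx = λ h → raw a b c (bitCells ys) [] [] (bitCells (rs ʳ++ [])) h i j t}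
          refl (os ʳ++ [])
          (length-rev os os≤n) ⨾
        (subst (λ ds → Run φ (transfer T₂ R) (arithStore ys [] [] (rs ʳ++ []) []) (n * 5 + 2) tt (arithStore ys ds [] [] []))
                (undo rs)
                (run-transfer-bits φ {ctx = λ g e → raw a b c (bitCells ys) e [] g [] i j t}
                  refl refl
                  (rs ʳ++ []) (length-rev rs q))) ⨾
          ret
      finish false = run-drain-bits φ {ctx = λ g → raw a b c (bitCells ys) [] [] g (bitCells (os ʳ++ [])) i j t}
          refl (rs ʳ++ [])
          (length-rev rs q) ⨾
        (subst (λ ds → Run φ (transfer T₃ R) (arithStore ys [] [] [] (os ʳ++ [])) (n * 5 + 2) tt (arithStore ys ds [] [] []))
                (undo os)
                (run-transfer-bits φ {ctx = λ h e → raw a b c (bitCells ys) e [] [] h i j t}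
                  refl refl
                  (os ʳ++ []) (length-rev os os≤n))) ⨾
          ret

  run-emit : ∀ a b c d e f q t u → Run φ (pop Q λ s → emitCell s u) (raw a b c d e [] [] [] f (List.map symbol q) t) 6 tt
               (raw a b c d e [] [] [] f (List.map symbol (emitDigit q u)) t)
  run-emit a b c d e f []      t false = pop ret
  run-emit a b c d e f []      t true  = pop (push ret)
  run-emit a b c d e f (s ∷ q) t u     = pop (push (push ret))

  module _ (a b c : List (Cell Aux)) (ys : List Bool) (t : Vec Sides tapes) where

    divStore : List (Cell Aux) → List Bool × List Sym → Store
    divStore cs (r , q) = raw a b c (bitCells ys) (bitCells r) [] [] [] cs (List.map symbol q) t

    DivGood : ℕ → ℕ → List Bool × List Sym → Set
    DivGood n k (r , q) = length ys + k ≤ n × length r + k ≤ n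

    run-divCell : ∀ n {k s} sy cs → DivGood n (suc k) s →
      Run φ (divCell (symbol sy)) (divStore cs s) (divCellTime n) tt (divStore cs (divNext ys s sy))
        × DivGood n k (divNext ys s sy)
    run-divCell n {k} {r , q} (bit d) cs (ys≤ , r≤) =
        push (run-sub a b c cs (List.map symbol q) t ys (d ∷ r) (ℕ.m+n≤o⇒m≤o _ ys≤)
                (ℕ.≤-trans (ℕ.≤-trans (s≤s (ℕ.m≤m+n (length r) k)) (ℕ.≤-reflexive (sym (ℕ.+-suc (length r) k)))) r≤) ⨾
              run-emit a b c (bitCells ys) (bitCells (divRemainder ys d r)) cs q t _)
      , ℕ.≤-trans (ℕ.+-monoʳ-≤ (length ys) (ℕ.n≤1+n k)) ys≤
      , length-divRemainder ys d r (ℕ.≤-trans (ℕ.+-monoʳ-≤ (length ys) (ℕ.n≤1+n k)) ys≤) r≤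
    run-divCell n {k} {r , q} minus cs (ys≤ , r≤) = weaken (s≤s (s≤s (ℕ.≤-trans (ℕ.m≤n+m 1 5) (ℕ.m≤n+m 6 (subTime n))))) (push ret)
        , ℕ.≤-trans (ℕ.+-monoʳ-≤ (length ys) (ℕ.n≤1+n k)) ys≤ , ℕ.≤-trans (ℕ.+-monoʳ-≤ (length r) (ℕ.n≤1+n k)) r≤
    run-divCell n {k} {r , q} point cs (ys≤ , r≤) = weaken (s≤s (s≤s (ℕ.≤-trans (ℕ.m≤n+m 1 5) (ℕ.m≤n+m 6 (subTime n))))) (push ret)
        , ℕ.≤-trans (ℕ.+-monoʳ-≤ (length ys) (ℕ.n≤1+n k)) ys≤ , ℕ.≤-trans (ℕ.+-monoʳ-≤ (length r) (ℕ.n≤1+n k)) r≤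
    run-divCell n {k} {r , q} sep cs (ys≤ , r≤) = weaken (s≤s (s≤s (ℕ.≤-trans (ℕ.m≤n+m 1 5) (ℕ.m≤n+m 6 (subTime n))))) (push ret)
        , ℕ.≤-trans (ℕ.+-monoʳ-≤ (length ys) (ℕ.n≤1+n k)) ys≤ , ℕ.≤-trans (ℕ.+-monoʳ-≤ (length r) (ℕ.n≤1+n k)) r≤

  leadingOnes-stop : ∀ (cs : List (Cell Aux)) → leadingOnes (symbols cs) ≡ 0 → stopsAt notOne cs ≡ true
  leadingOnes-stop []                        _ = refl
  leadingOnes-stop (blank ∷ cs)              _ = refl
  leadingOnes-stop (aux a ∷ cs)              _ = refl
  leadingOnes-stop (symbol minus ∷ cs)       _ = refl
  leadingOnes-stop (symbol point ∷ cs)       _ = refl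
  leadingOnes-stop (symbol sep ∷ cs)         _ = refl
  leadingOnes-stop (symbol (bit false) ∷ cs) _ = refl

  copyNext : List Sym × List Bool → Bool → List Sym × List Bool
  copyNext (f , s) d = bit d ∷ f , d ∷ s

  foldl-copy : ∀ xs f s → List.foldl copyNext (f , s) xs ≡ (bitSymbols xs ʳ++ f , xs ʳ++ s)
  foldl-copy []       f s = refl
  foldl-copy (x ∷ xs) f s = foldl-copy xs _ _

  module _ (neg : Bool) (a b : List (Cell Aux)) (x ys : List Bool) (0<y : 0 < val ys) where

    simStore : Vec Sides tapes → Store
    simStore = raw a b (bitCells x) (bitCells ys) [] [] [] [] [] []

    module _ (n k : ℕ) (p₀ p₁ : Sides) (tw : Vec Sides workN) (x≤n : length x ≤ n) (ys≤n : length ys ≤ n) where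

      run-replyProgram : ∀ l₂ r₂ → length l₂ ≤ k → length r₂ ≤ k →
        Run φ (reply neg 0F) (simStore (p₀ ∷ p₁ ∷ (l₂ , r₂) ∷ tw)) (replyTime n k) tt
          (simStore (p₀ ∷ p₁ ∷ ([] , List.map symbol (encode𝔻 (digitOracle neg x ys 0<y (leadingOnes (symbols r₂))))) ∷ tw))
      run-replyProgram l₂ r₂ l≤ r≤ with splitOnes r₂
      ... | ones m rest eq rewrite leadingOnes-ones m rest eq =
        run-starts (cong (λ cs → simStore (p₀ ∷ p₁ ∷ (l₂ , cs ++ rest) ∷ tw)) (sym (List.map-replicate (λ _ → bitCell true) m tt)))
               (run-ends (cong (λ f → raw a b X₁ Y₁ [] [] [] [] (List.map symbol f) [] (p₀ ∷ p₁ ∷ (l₂ , below rest) ∷ tw)) zeros≡)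
               (run-scan φ {e = λ (_ : ⊤) → bitCell true}
                 {ctx = λ cs f → raw a b X₁ Y₁ [] [] [] [] (List.map symbol f) [] (p₀ ∷ p₁ ∷ (l₂ , cs) ∷ tw)}
                 refl (λ f _ → bit false ∷ f) (λ _ _ → ⊤) 3 (λ _ → refl)
                 (λ _ _ _ → push ret , tt) (replicate m tt) rest (leadingOnes-stop rest eq)
                 (subst (_≤ k) (sym (List.length-replicate m)) m≤k) tt)) ⨾
        -- Only the leading ones form the query, yet `ask` replaces the whole oracle tape, so
        -- whatever follows them and whatever lies left of the head has to go.
        run-drain φ {ctx = λ cs → raw a b X₁ Y₁ [] [] [] [] (List.map symbol Z) [] (p₀ ∷ p₁ ∷ (l₂ , cs) ∷ tw)}
                refl (below rest) (length-below-≤ rest rest≤k) ⨾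
        run-drain φ {ctx = λ cs → raw a b X₁ Y₁ [] [] [] [] (List.map symbol Z) [] (p₀ ∷ p₁ ∷ (cs , []) ∷ tw)}
                refl l₂ l≤ ⨾
        push
        (run-ends (cong (λ s → raw a b [] Y₁ [] (bitCells (proj₂ s)) [] [] (List.map symbol (proj₁ s)) [] t₀)
                          (foldl-copy x (point ∷ Z) []))
                (run-scan-all φ {σ = List Sym × List Bool} {e = bitCell}
                  {ctx = λ cs s → raw a b cs Y₁ [] (bitCells (proj₂ s)) [] [] (List.map symbol (proj₁ s)) [] t₀}
                  refl copyNext (λ _ _ → ⊤) 5 (λ _ → refl)
                  (λ _ _ _ → push (push ret) , tt) x x≤n tt) ⨾
        run-ends (cong (λ x → raw a b (bitCells x) Y₁ [] [] [] [] (List.map symbol feed) [] t₀)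
                          (trans (ʳ++-undo x []) (List.++-identityʳ x)))
                (run-transfer-bits φ {ctx = λ s x → raw a b x Y₁ [] s [] [] (List.map symbol feed) [] t₀}
                  refl refl
                  (x ʳ++ []) (length-rev x x≤n)) ⨾
        run-ends (cong (divStore a b X₁ ys t₀ []) divide-feed)
                (run-scan-all φ {e = symbol} {ctx = divStore a b X₁ ys t₀}
                  refl (divNext ys) (DivGood a b X₁ ys t₀ (n + feedSize n k))
                  (divCellTime (n + feedSize n k)) (λ _ → refl)
                  (run-divCell a b X₁ ys t₀ (n + feedSize n k)) feed feed≤
                  (ℕ.+-mono-≤ ys≤n feed≤ , ℕ.m≤n⇒m≤o+n n feed≤)) ⨾
        push
        (run-drain-bits φ {ctx = λ r → raw a b X₁ Y₁ r [] [] [] [] (List.map symbol (bit true ∷ emitted)) t₀}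
                refl rem₂ rem≤ ⨾
        run-ends (cong (λ r → raw a b X₁ Y₁ [] [] [] [] [] [] (p₀ ∷ p₁ ∷ ([] , r) ∷ tw))
                          (trans (sym (List.map-ʳ++ symbol (bit true ∷ emitted))) (cong (List.map symbol) reversed)))
                (run-transfer φ {ctx = λ q r → raw a b X₁ Y₁ [] [] [] [] [] q (p₀ ∷ p₁ ∷ ([] , r) ∷ tw)}
                  refl refl
                  (List.map symbol (bit true ∷ emitted)) (subst (_≤ suc (feedSize n k)) (sym (List.length-map symbol (bit true ∷ emitted))) (s≤s emitted≤))) ⨾
          run-ends (cong (λ r → raw a b X₁ Y₁ [] [] [] [] [] [] (p₀ ∷ p₁ ∷ ([] , r) ∷ tw))
              (trans (sym (List.map-++ symbol (signSymbols neg) _)) (cong (List.map symbol) (sym encoding))))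
            (run-pushSign φ {ctx = λ r → raw a b X₁ Y₁ [] [] [] [] [] [] (p₀ ∷ p₁ ∷ ([] , r) ∷ tw)}
              refl neg _)))
        where
        open Division-encoding neg x ys m 0<y
        X₁ Y₁ : List (Cell Aux)
        X₁ = bitCells x
        Y₁ = bitCells ys
        Z : List Sym
        Z = replicate m (bit false)
        t₀ : Vec Sides tapes
        t₀ = p₀ ∷ p₁ ∷ ([] , []) ∷ tw
        split≤k : m + length rest ≤ k
        split≤k = subst (_≤ k) (trans (List.length-++ (replicate m (bitCell true)))
          (cong (_+ length rest) (List.length-replicate m))) r≤
        m≤k : m ≤ k
        m≤k = ℕ.m+n≤o⇒m≤o m split≤k
        rest≤k : length rest ≤ k
        rest≤k = ℕ.m+n≤o⇒n≤o m split≤k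
        zeros≡ : List.foldl (λ f _ → bit false ∷ f) [] (replicate m tt) ≡ Z
        zeros≡ = trans (foldl-push (bit false) (replicate m tt) [])
          (trans (List.++-identityʳ _) (cong (λ l → replicate l (bit false)) (List.length-replicate m)))
        feed≤ : length feed ≤ feedSize n k
        feed≤ = subst (_≤ feedSize n k) (sym (trans (List.length-ʳ++ (bitSymbols x))
            (cong₂ (λ p q → p + suc q) (List.length-map bit x) (List.length-replicate m))))
          (ℕ.+-mono-≤ x≤n (s≤s m≤k))
        emitted≤ : length emitted ≤ feedSize n k
        emitted≤ = begin
          length emitted ≡⟨ List.length-ʳ++ (bitSymbols F) ⟩
          length (bitSymbols F) + suc (length (bitSymbols (strip I) ʳ++ []))
            ≡⟨ cong₂ (λ p q → p + suc q) (trans (List.length-map bit F) (trans length-F (List.length-replicate m)))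
                 (trans (List.length-ʳ++ (bitSymbols (strip I))) (trans (ℕ.+-identityʳ _) (List.length-map bit (strip I)))) ⟩
          m + suc (length (strip I)) ≤⟨ ℕ.+-mono-≤ m≤k (s≤s (ℕ.≤-trans (length-strip I)
              (ℕ.≤-trans (ℕ.≤-reflexive (trans length-I (List.length-reverse x))) x≤n))) ⟩
          k + suc n ≡⟨ trans (ℕ.+-suc k n) (trans (cong suc (ℕ.+-comm k n)) (sym (ℕ.+-suc n k))) ⟩
          n + suc k ∎
          where open ℕ.≤-Reasoning
        -- The budget that accompanies `run-divCell` is folded along the feed a second time, now
        -- only for the length of the last remainder.
        rem≤ : length rem₂ ≤ n + feedSize n k
        rem≤ = subst (λ s → length (proj₁ s) ≤ n + feedSize n k) divide-feed
          (fold≤ feed ([] , []) (ℕ.+-mono-≤ ys≤n feed≤) (ℕ.m≤n⇒m≤o+n n feed≤))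
          where
          fold≤ : ∀ f s → length ys + length f ≤ n + feedSize n k → length (proj₁ s) + length f ≤ n + feedSize n k →
                  length (proj₁ (List.foldl (divNext ys) s f)) ≤ n + feedSize n k
          fold≤ []       s ys≤ r≤ = ℕ.≤-trans (ℕ.m≤m+n _ 0) r≤
          fold≤ (sy ∷ f) s ys≤ r≤ =
            let ys≤′ , r≤′ = proj₂ (run-divCell a b X₁ ys t₀ _ {s = s} sy [] (ys≤ , r≤)) in fold≤ f (divNext ys s sy) ys≤′ r≤′

  -- `k` digits of the multiplier remain, at two digits each, in accordance with `length-mulNext`.
  record MulGood (ys : List Bool) (n k : ℕ) (r : List Bool) : Set where
    constructor mulGood
    field
      divisor≤ : length ys + k * 2 ≤ n
      sum≤     : length r + k * 2 ≤ n

  mulGood-next : ∀ ys n {k r} d → MulGood ys n (suc k) r → MulGood ys n k (mulNext ys r d)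
  mulGood-next ys n {k} {r} d (mulGood ys≤ r≤) =
    mulGood (ℕ.≤-trans (ℕ.+-monoʳ-≤ (length ys) (ℕ.m≤n+m (k * 2) 2)) ys≤) (length-mulNext ys r d ys≤ r≤)

  mulGood-fold : ∀ ys n ds {k r} → MulGood ys n (length ds + k) r → MulGood ys n k (List.foldl (mulNext ys) r ds)
  mulGood-fold ys n []       good = good
  mulGood-fold ys n (d ∷ ds) good = mulGood-fold ys n ds (mulGood-next ys n d good)

  run-mulCell : ∀ a b c i j t ys n {k r} d → MulGood ys n (suc k) r →
    Run φ (mulCell (bitCell d)) (raw a b c (bitCells ys) (bitCells r) [] [] [] i j t) (mulCellTime n) tt
      (raw a b c (bitCells ys) (bitCells (mulNext ys r d)) [] [] [] i j t)
  run-mulCell a b c i j t ys n false good = push (weaken (ℕ.m≤n+m 1 (addTime n)) ret)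
  run-mulCell a b c i j t ys n {k} {r} true (mulGood ys≤ r≤) =
    push (weaken (ℕ.m≤m+n _ 1) (run-add a b c i j t ys (false ∷ r) (ℕ.m+n≤o⇒m≤o _ ys≤)
      (ℕ.≤-trans (ℕ.≤-trans (s≤s (ℕ.m≤m+n (length r) (suc (k * 2)))) (ℕ.≤-reflexive (sym (ℕ.+-suc (length r) (suc (k * 2)))))) r≤)))

  fracNext : List Bool → List Bool × List Sym → Bool → List Bool × List Sym
  fracNext ys (r , f) d = mulNext ys r d , bit d ∷ f

  foldl-frac : ∀ ys ds r f → List.foldl (fracNext ys) (r , f) ds ≡ (List.foldl (mulNext ys) r ds , bitSymbols ds ʳ++ f)
  foldl-frac ys []       r f = refl
  foldl-frac ys (d ∷ ds) r f = foldl-frac ys ds _ _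

  length-dropDigits : ∀ {B : Set} r (xs : List B) {n} → length r ≤ n → length (dropDigits r xs) ≤ n
  length-dropDigits r []       le = le
  length-dropDigits r (x ∷ xs) le = length-dropDigits (below r) xs (length-below-≤ r le)

  module _ (a c : List (Cell Aux)) (ys : List Bool) (n k : ℕ) (p₀ : Sides) (l₁ : List (Cell Aux))
           (tw : Vec Sides (suc workN)) (ys≤n : length ys ≤ n) (z : 𝔻) where

    private
      I = intDigits z
      F = fracDigits z
      neg = isNegative (𝔻.numerator z)
      Y₁ = bitCells {Aux} ys
      r₁ = List.foldl (mulNext ys) [] I
      r₂ = List.foldl (mulNext ys) r₁ F
      marks = bitSymbols F ʳ++ []
      r₃ = dropDigits r₂ marks

      value : val r₃ ≡ val ys * ℤ.∣ 𝔻.numerator z ∣ ÷2^ 𝔻.exponent z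
      value = begin
        val r₃                            ≡⟨ val-dropDigits r₂ marks ⟩
        val r₂ ÷2^ length marks           ≡⟨ cong₂ _÷2^_ product marks≡ ⟩
        val ys * ℤ.∣ 𝔻.numerator z ∣ ÷2^ 𝔻.exponent z ∎
        where
        open ≡-Reasoning
        marks≡ : length marks ≡ 𝔻.exponent z
        marks≡ = trans (List.length-ʳ++ (bitSymbols F)) (trans (ℕ.+-identityʳ _)
          (trans (List.length-map bit F) (length-lowDigits (𝔻.exponent z) _)))
        product : val r₂ ≡ val ys * ℤ.∣ 𝔻.numerator z ∣
        product = trans (mul-fold ys r₁ F (msb 0 I) (mul-fold ys [] I 0 (sym (ℕ.*-zeroʳ (val ys)))))
          (cong (val ys *_) (trans (sym (msb-++ 0 I F)) (msb-digits z)))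

      msb-r₃ : msb 0 (r₃ ʳ++ []) ≡ val r₃
      msb-r₃ = trans (sym (val-ʳ++ (r₃ ʳ++ []) [])) (cong val (trans (ʳ++-undo r₃ []) (List.++-identityʳ r₃)))

      finalStore : List (Cell Aux) → List (Cell Aux) → Store
      finalStore out rest = raw a out c Y₁ [] [] [] [] [] [] (p₀ ∷ (l₁ , rest) ∷ tw)

    run-post : ∀ cs → length cs ≤ k → symbols cs ≡ encode𝔻 z → Σ[ rest ∈ List (Cell Aux) ]
      Run φ post (raw a [] c Y₁ [] [] [] [] [] [] (p₀ ∷ (l₁ , cs) ∷ tw)) (postTime n k) tt
        (finalStore (List.map symbol (encodeℤ (productℤ (val ys) z))) rest)
    run-post cs cs≤k eq with encodedCells z cs eq
    ... | record { rest = rest ; no-rest = no-rest ; split = refl ; int≤ = int≤ ; frac≤ = frac≤ } = below rest ,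
      run-popSign φ {ctx = λ r → raw a [] c Y₁ [] [] [] [] [] [] (p₀ ∷ (l₁ , r) ∷ tw)}
             refl neg _ (isMinus-bits I _ refl) ⨾
      run-scan φ {e = bitCell} {ctx = λ cs r → raw a [] c Y₁ (bitCells r) [] [] [] [] [] (p₀ ∷ (l₁ , cs) ∷ tw)}
              refl (mulNext ys) (MulGood ys s) (mulCellTime s) (λ _ → refl)
              (λ d cs good → run-mulCell a [] c [] [] (p₀ ∷ (l₁ , cs) ∷ tw) ys s d good , mulGood-next ys s d good)
              I (symbol point ∷ (bitCells F ++ rest)) refl I≤k
              (good₀ (length I) (ℕ.≤-trans I≤k (ℕ.m≤m+n k k))) ⨾
      run-ends (cong (λ s → raw a [] c Y₁ (bitCells (proj₁ s)) [] [] [] (List.map symbol (proj₂ s)) [] (p₀ ∷ (l₁ , below rest) ∷ tw))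
                        (foldl-frac ys F r₁ []))
              (run-scan φ {σ = List Bool × List Sym} {e = bitCell}
              {ctx = λ cs s → raw a [] c Y₁ (bitCells (proj₁ s)) [] [] [] (List.map symbol (proj₂ s)) [] (p₀ ∷ (l₁ , cs) ∷ tw)}
              refl (fracNext ys) (λ j s₁ → MulGood ys s j (proj₁ s₁)) (mulCellTime s + 3) (λ _ → refl)
              (λ {_} {s₁} d cs good → run-mulCell a [] c (List.map symbol (proj₂ s₁)) [] (p₀ ∷ (l₁ , cs) ∷ tw) ys s d good ⨾ push ret
                , mulGood-next ys s d good)
              F rest (no-symbols-stop rest no-rest) F≤k
              (mulGood-fold ys s I (good₀ (length I + length F) (ℕ.+-mono-≤ I≤k F≤k)))) ⨾
      run-scan-all φ {e = symbol} {ctx = λ cs r → raw a [] c Y₁ (bitCells r) [] [] [] cs [] (p₀ ∷ (l₁ , below rest) ∷ tw)}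
              refl (λ r _ → below r) (λ _ _ → ⊤) 2 (λ _ → refl)
              (λ {_} {r} _ cs _ → pop-R r cs , tt) marks marks≤k tt ⨾
      run-transfer-bits φ {ctx = λ r o → raw a o c Y₁ r [] [] [] [] [] (p₀ ∷ (l₁ , below rest) ∷ tw)}
              refl refl r₃ r₃≤ ⨾
        (finish (stripView (r₃ ʳ++ [])))
      where
      s = postSize n k
      I≤k : length I ≤ k
      I≤k = ℕ.≤-trans int≤ cs≤k
      F≤k : length F ≤ k
      F≤k = ℕ.≤-trans frac≤ cs≤k
      good₀ : ∀ q → q ≤ k + k → MulGood ys s q []
      good₀ q q≤ = mulGood (ℕ.+-mono-≤ ys≤n (ℕ.*-monoˡ-≤ 2 q≤)) (ℕ.m≤n⇒m≤o+n n (ℕ.*-monoˡ-≤ 2 q≤))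
      marks≤k : length marks ≤ k
      marks≤k = length-rev (bitSymbols F) (subst (_≤ k) (sym (List.length-map bit F)) F≤k)
      r₃≤ : length r₃ ≤ s
      r₃≤ = length-dropDigits r₂ marks (subst (_≤ s) (ℕ.+-identityʳ _)
        (MulGood.sum≤ (mulGood-fold ys s F {0} (mulGood-fold ys s I (good₀ (length I + (length F + 0))
          (ℕ.+-mono-≤ I≤k (subst (_≤ k) (sym (ℕ.+-identityʳ _)) F≤k)))))))
      pop-R : ∀ r cs → Run φ (pop R λ _ → ret tt) (raw a [] c Y₁ (bitCells r) [] [] [] cs [] (p₀ ∷ (l₁ , below rest) ∷ tw)) 2 tt
                (raw a [] c Y₁ (bitCells (below r)) [] [] [] cs [] (p₀ ∷ (l₁ , below rest) ∷ tw))
      pop-R []      cs = pop ret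
      pop-R (_ ∷ r) cs = pop ret
      out : List Bool
      out = r₃ ʳ++ []
      finish : StripView out → Run φ (bind finite-Bool (stripZeros OUT) λ nonZero → pushSign OUT (if nonZero then neg else false))
        (finalStore (bitCells out) (below rest)) ((s * 2 + 4) + 3) tt
        (finalStore (List.map symbol (encodeℤ (productℤ (val ys) z))) (below rest))
      finish (zeros eq) = run-stripZeros-0 φ {ctx = λ o → finalStore o (below rest)} refl out eq (length-rev r₃ r₃≤) ⨾
        run-ends (cong (λ w → finalStore (List.map symbol w) (below rest)) (sym zero≡)) ret
        where
        zero≡ : encodeℤ (productℤ (val ys) z) ≡ []
        zero≡ = trans (cong (λ v → encodeℤ (signed neg v)) (trans (sym value) (trans (sym msb-r₃) (strip-[] out eq)))) (none neg)
          where
          none : ∀ neg → encodeℤ (signed neg 0) ≡ []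
          none false = refl
          none true  = refl
      finish (leadingOne eq) = run-starts (cong (λ cs → finalStore cs (below rest)) (sym (List.++-identityʳ (bitCells out))))
          (run-stripZeros φ {ctx = λ o → finalStore o (below rest)} refl out [] eq (length-rev r₃ r₃≤)) ⨾
        run-ends (cong (λ w → finalStore w (below rest)) (begin
            σ (signSymbols neg) ++ (bitCells (strip out) ++ []) ≡⟨ cong (σ (signSymbols neg) ++_) (List.++-identityʳ _) ⟩
            σ (signSymbols neg) ++ bitCells (strip out)         ≡⟨ cong (σ (signSymbols neg) ++_) (List.map-∘ (strip out)) ⟩
            σ (signSymbols neg) ++ σ (bitSymbols (strip out))   ≡⟨ List.map-++ symbol (signSymbols neg) _ ⟨
            σ (signSymbols neg ++ bitSymbols (strip out))       ≡⟨ cong σ (encodeℤ-digits neg out eq) ⟨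
            σ (encodeℤ (signed neg (msb 0 out)))                ≡⟨ cong (λ v → σ (encodeℤ (signed neg v))) (trans msb-r₃ value) ⟩
            σ (encodeℤ (productℤ (val ys) z))                   ∎))
          (run-pushSign φ {ctx = λ o → finalStore o (below rest)} refl neg _)
        where
        open ≡-Reasoning
        σ = List.map (symbol {Aux})

  block : ∀ a b c d e f g h i j → Block leftN rightN (raw a b c d e f g h i j)
  block a b c d e f g h i j = record
    { getL = lookup-leftSide
    ; getR = lookup-rightSide
    ; putL = λ t k l → cong (λ v → a ∷ b ∷ c ∷ d ∷ e ∷ f ∷ g ∷ h ∷ i ∷ j ∷ v) (update-leftSide t k l)
    ; putR = λ t k r → cong (λ v → a ∷ b ∷ c ∷ d ∷ e ∷ f ∷ g ∷ h ∷ i ∷ j ∷ v) (update-rightSide t k r)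
    }

  tapeN : Sides → Tape Aux
  tapeN = tapeOf N id id (λ _ → refl)

  tapeN-load : ∀ w → tapeN ([] , List.map symbol w) ≡ load w
  tapeN-load []      = refl
  tapeN-load (s ∷ w) = cong (tape [] (symbol s)) (List.map-id _)

  contents-tapeN : ∀ l r → contents (tapeN (l , r)) ≡ symbols r
  contents-tapeN l []      = refl
  contents-tapeN l (c ∷ r) = cong (λ cs → symbols (c ∷ cs)) (List.map-id r)

  leadingOnes-≤ : ∀ (cs : List (Cell Aux)) → leadingOnes (symbols cs) ≤ length cs
  leadingOnes-≤ cs with splitOnes cs
  ... | ones m rest eq rewrite leadingOnes-ones m rest eq | List.length-++ (replicate m (bitCell true)) {rest}
                             | List.length-replicate m {bitCell true} = ℕ.m≤m+n m (length rest)

  arithTime-mono : ∀ {m n} → m ≤ n → arithTime m ≤ arithTime n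
  arithTime-mono le = ℕ.+-mono-≤ (ℕ.+-monoˡ-≤ 3 (ℕ.*-monoˡ-≤ 9 le)) (ℕ.+-monoˡ-≤ 1 (ℕ.+-monoˡ-≤ 2 (ℕ.*-monoˡ-≤ 5 le)))

  subTime-mono : ∀ {m n} → m ≤ n → subTime m ≤ subTime n
  subTime-mono le = ℕ.+-mono-≤ (arithTime-mono le) (ℕ.+-mono-≤ (ℕ.+-monoˡ-≤ 2 (ℕ.*-monoˡ-≤ 3 le))
    (ℕ.+-monoˡ-≤ 1 (ℕ.+-monoˡ-≤ 2 (ℕ.*-monoˡ-≤ 5 le))))

  divCellTime-mono : ∀ {m n} → m ≤ n → divCellTime m ≤ divCellTime n
  divCellTime-mono le = ℕ.+-monoʳ-≤ 2 (ℕ.+-monoˡ-≤ 6 (subTime-mono le))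

  replyTime-mono : ∀ n {k l} → k ≤ l → replyTime n k ≤ replyTime n l
  replyTime-mono n {k} {l} le =
    ℕ.+-mono-≤ (lin 5 2) (ℕ.+-mono-≤ (lin 3 2) (ℕ.+-mono-≤ (lin 3 2) (ℕ.+-monoʳ-≤ 2 (ℕ.+-monoʳ-≤ (n * 7 + 2)
    (ℕ.+-monoʳ-≤ (n * 5 + 2) (ℕ.+-mono-≤ (ℕ.+-monoˡ-≤ 2 (ℕ.*-mono-≤ feed≤ (ℕ.+-monoʳ-≤ 2 (divCellTime-mono (ℕ.+-monoʳ-≤ n feed≤)))))
    (ℕ.+-monoʳ-≤ 2 (ℕ.+-mono-≤ (ℕ.+-monoˡ-≤ 2 (ℕ.*-monoˡ-≤ 3 (ℕ.+-monoʳ-≤ n feed≤)))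
    (ℕ.+-monoˡ-≤ 3 (ℕ.+-monoˡ-≤ 2 (ℕ.*-monoˡ-≤ 5 (s≤s feed≤))))))))))))
    where
    lin : ∀ a b → k * a + b ≤ l * a + b
    lin a b = ℕ.+-monoˡ-≤ b (ℕ.*-monoˡ-≤ a le)
    feed≤ : feedSize n k ≤ feedSize n l
    feed≤ = ℕ.+-monoʳ-≤ n (s≤s le)

  -- Sign, point and final 1 account for the 3; the integer part has at most as many digits as `x`,
  -- and the query of length `m` produces `m` fractional digits. As a query is no longer than its
  -- tape, an answer adds at most `3 + n` to the height bound.
  length-oracle : ∀ neg x ys (0<y : 0 < val ys) m {n} → length x ≤ n →
    length (encode𝔻 (digitOracle neg x ys 0<y m)) ≤ (3 + n) + m
  length-oracle neg x ys 0<y m {n} x≤n = begin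
    length (encode𝔻 (digitOracle neg x ys 0<y m))  ≡⟨ cong length encoding ⟩
    length (signSymbols neg ++ bitSymbols (strip I) ++ point ∷ bitSymbols F ++ [ bit true ])
      ≡⟨ trans (List.length-++ (signSymbols neg)) (cong (λ l → length (signSymbols neg) + l) (trans (List.length-++ (bitSymbols (strip I)))
           (cong₂ (λ p q → p + suc q) (List.length-map bit (strip I)) (trans (List.length-++ (bitSymbols F))
             (cong (_+ 1) (trans (List.length-map bit F) (trans length-F (List.length-replicate m)))))))) ⟩
    length (signSymbols neg) + (length (strip I) + suc (m + 1))
      ≤⟨ ℕ.+-mono-≤ (length-sign neg) (ℕ.+-monoˡ-≤ (suc (m + 1)) (ℕ.≤-trans (length-strip I)
           (ℕ.≤-trans (ℕ.≤-reflexive (trans length-I (List.length-reverse x))) x≤n))) ⟩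
    1 + (n + suc (m + 1)) ≡⟨ lemma n m ⟩
    (3 + n) + m ∎
    where
    open ℕ.≤-Reasoning
    open Division-encoding neg x ys m 0<y
    lemma : ∀ n m → 1 + (n + (1 + (m + 1))) ≡ (3 + n) + m
    lemma = solve-∀

  module _ (neg : Bool) (x ys : List Bool) (0<y : 0 < val ys) (n : ℕ) (x≤n : length x ≤ n) (ys≤n : length ys ≤ n) where

    private
      ψ : Fin 1 → ℕ → 𝔻
      ψ _ = digitOracle neg x ys 0<y

      store : Vec Sides tapes → Store
      store = simStore neg [] [] x ys 0<y

    run-reply : ∀ i t k → Bounded k t → Σ[ t′ ∈ Vec Sides tapes ]
      (Run φ (reply neg i) (store t) (replyTime n k) tt (store t′) ×
       Vec.map tapeN t′ ≡ OracleTM.ask N ψ i (Vec.map tapeN t) × Bounded ((3 + n) + k) t′)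
    run-reply 0F (p₀ ∷ p₁ ∷ (l₂ , r₂) ∷ tw) k t≤k =
        p₀ ∷ p₁ ∷ ([] , List.map symbol ans) ∷ tw
      , run-replyProgram neg [] [] x ys 0<y n k p₀ p₁ tw x≤n ys≤n l₂ r₂ (proj₁ (t≤k 2F)) (proj₂ (t≤k 2F))
      , cong (λ T → tapeN p₀ ∷ tapeN p₁ ∷ T ∷ Vec.map tapeN tw)
          (trans (tapeN-load ans) (cong (λ w → load (encode𝔻 (ψ 0F (leadingOnes w)))) (sym (contents-tapeN l₂ r₂))))
      , bounded
      where
      ans = encode𝔻 (ψ 0F (leadingOnes (symbols r₂)))
      grow : ∀ {p : Sides} → length (proj₁ p) ≤ k × length (proj₂ p) ≤ k → length (proj₁ p) ≤ (3 + n) + k × length (proj₂ p) ≤ (3 + n) + k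
      grow (l≤ , r≤) = ℕ.m≤n⇒m≤o+n (3 + n) l≤ , ℕ.m≤n⇒m≤o+n (3 + n) r≤
      bounded : Bounded ((3 + n) + k) (p₀ ∷ p₁ ∷ ([] , List.map symbol ans) ∷ tw)
      bounded 0F = grow {p₀} (t≤k 0F)
      bounded 1F = grow {p₁} (t≤k 1F)
      bounded 2F = z≤n , subst (_≤ (3 + n) + k) (sym (List.length-map symbol ans))
        (ℕ.≤-trans (length-oracle neg x ys 0<y (leadingOnes (symbols r₂)) x≤n)
          (ℕ.+-monoʳ-≤ (3 + n) (ℕ.≤-trans (leadingOnes-≤ r₂) (proj₂ (t≤k 2F)))))
      bounded (suc (suc (suc j))) = grow {lookup tw j} (t≤k (suc (suc (suc j))))

    startBlock : Vec Sides tapes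
    startBlock = ([] , List.map symbol (unary (length ys))) ∷ Vec.replicate _ ([] , [])

    run-core : ∀ T z → OracleTM.result N ψ (unary (length ys)) T ≡ just (encode𝔻 z) → Σ[ t ∈ Vec Sides tapes ]
      Run φ (pop Y (withDivisor neg)) (store startBlock) (coreTime n T) tt
        (raw [] (List.map symbol (encodeℤ (productℤ (val ys) z))) (bitCells x) (bitCells ys) [] [] [] [] [] [] t)
    run-core T z eq =
      let ts , run≡ , out≡ = halted {M = N} (OracleTM.run N ψ T (start , OracleTM.initial N (unary (length ys)))) eq
          t₁ , run-sim , tapes≡ , t₁≤ = run-simulate N id id (λ _ → refl) φ
            (block [] [] (bitCells x) (bitCells ys) [] [] [] [] [] []) ψ (reply neg) (3 + n) (replyTime n)
            (s≤s (s≤s z≤n)) run-reply T start n startBlock bounded₀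
            (trans (cong (λ ts → OracleTM.run N ψ T (start , ts)) tapes₀) run≡)
          t₂ , run-fin = finish t₁ t₁≤ (trans (cong (OracleTM.output N) tapes≡) out≡)
      in t₂ , peek ys 0<y (weaken (simulationTime-bound N id id (λ _ → refl) φ
            (block [] [] (bitCells x) (bitCells ys) [] [] [] [] [] []) ψ (reply neg) (3 + n) (replyTime n)
            (s≤s (s≤s z≤n)) run-reply (replyTime-mono n) T n) run-sim ⨾ run-fin)
      where
      tapes₀ : Vec.map tapeN startBlock ≡ OracleTM.initial N (unary (length ys))
      tapes₀ = cong₂ _∷_ (tapeN-load (unary (length ys))) (Vec.map-replicate tapeN ([] , []) _)
      bounded₀ : Bounded n startBlock
      bounded₀ zero    = z≤n , subst (_≤ n) (sym (trans (List.length-map symbol (unary (length ys))) (List.length-replicate (length ys)))) ys≤n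
      bounded₀ (suc j) = subst (λ p → length (proj₁ p) ≤ n × length (proj₂ p) ≤ n) (sym (Vec.lookup-replicate j _)) (z≤n , z≤n)
      finish : ∀ t → Bounded (blocksBound n T) t → OracleTM.output N (Vec.map tapeN t) ≡ encode𝔻 z → Σ[ t′ ∈ Vec Sides tapes ]
        Run φ post (store t) (postTime n (blocksBound n T)) tt
          (raw [] (List.map symbol (encodeℤ (productℤ (val ys) z))) (bitCells x) (bitCells ys) [] [] [] [] [] [] t′)
      finish (p₀ ∷ (l₁ , r₁) ∷ tw) t≤ out≡ =
        let rest , run = run-post [] (bitCells x) ys n (blocksBound n T) p₀ l₁ tw ys≤n z r₁ (proj₂ (t≤ 1F))
              (trans (sym (contents-tapeN l₁ r₁)) out≡)
        in _ , run
      -- A positive divisor has a digit on top of its stack, so the test for y = 0 pops and restores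
      -- it.
      peek : ∀ ys → 0 < val ys → ∀ {S′ t} →
        Run φ (simulate N id id (λ _ → refl) leftN rightN (reply neg) start >> post)
          (raw [] [] (bitCells x) (bitCells ys) [] [] [] [] [] [] startBlock) t tt S′ →
        Run φ (pop Y (withDivisor neg)) (raw [] [] (bitCells x) (bitCells ys) [] [] [] [] [] [] startBlock) (1 + (2 + t)) tt S′
      peek (d ∷ ys) _ run = pop (push run)

  unaryNext : List Bool × List Sym → Bool → List Bool × List Sym
  unaryNext (s , w) d = d ∷ s , bit true ∷ w

  foldl-unary : ∀ ds s w → List.foldl unaryNext (s , w) ds ≡ (ds ʳ++ s , List.foldl (λ w _ → bit true ∷ w) w ds)
  foldl-unary []       s w = refl
  foldl-unary (d ∷ ds) s w = foldl-unary ds _ _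

  emptyBlock : Vec Sides tapes
  emptyBlock = Vec.replicate _ ([] , [])

  reverse-reverse : ∀ (ds : List Bool) → reverse ds ʳ++ [] ≡ ds
  reverse-reverse = List.reverse-involutive

  encodeℤ-cells : ∀ i → List.map (symbol {Aux}) (encodeℤ i) ≡
    List.map symbol (signSymbols (isNegative i)) ++ bitCells (reverse (bits ℤ.∣ i ∣))
  encodeℤ-cells i = trans (List.map-++ symbol (sign i) _)
    (cong₂ _++_ (cong (List.map symbol) (sign-isNegative i)) (sym (List.map-∘ (reverse (bits ℤ.∣ i ∣)))))

  run-parse : ∀ x y {n t S} → length (bits ℤ.∣ x ∣) ≤ n →
    Run φ (afterSign (isNegative x) (isNegative y))
      (raw (bitCells (reverse (bits ℤ.∣ y ∣))) [] (bitCells (bits ℤ.∣ x ∣)) [] [] [] [] [] [] [] emptyBlock) t tt S →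
    Run φ program (initialStore (encodeℤ x ++ sep ∷ encodeℤ y)) (programTime n t) tt S
  run-parse x y {n} {t} {S} x≤n run =
    run-starts start≡
    (run-popSign φ {ctx = λ i → raw i [] [] [] [] [] [] [] [] [] emptyBlock} refl
            (isNegative x) (bitCells dx ++ symbol sep ∷ (List.map symbol (signSymbols (isNegative y)) ++ bitCells dy)) (isMinus-bits dx _ refl) ⨾
    run-ends (cong (λ s → raw (List.map symbol (signSymbols (isNegative y)) ++ bitCells dy) [] (bitCells s) [] [] [] [] [] [] [] emptyBlock)
                      (reverse-reverse (bits ℤ.∣ x ∣)))
            (run-scan φ {e = bitCell} {ctx = λ cs s → raw cs [] (bitCells s) [] [] [] [] [] [] [] emptyBlock}
            refl (λ s d → d ∷ s) (λ _ _ → ⊤) 3 (λ _ → refl) (λ _ _ _ → push ret , tt)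
            dx (symbol sep ∷ (List.map symbol (signSymbols (isNegative y)) ++ bitCells dy)) refl
            (subst (_≤ n) (sym (List.length-reverse (bits ℤ.∣ x ∣))) x≤n) tt) ⨾
    run-starts (cong (λ cs → raw (List.map symbol (signSymbols (isNegative y)) ++ cs) [] (bitCells (bits ℤ.∣ x ∣)) [] [] [] [] [] [] [] emptyBlock)
                        (sym (List.++-identityʳ (bitCells dy))))
            (run-popSign φ {ctx = λ i → raw i [] (bitCells (bits ℤ.∣ x ∣)) [] [] [] [] [] [] [] emptyBlock} refl
            (isNegative y) (bitCells dy ++ []) (isMinus-bits dy [] refl)) ⨾
      run-starts (cong (λ cs → raw cs [] (bitCells (bits ℤ.∣ x ∣)) [] [] [] [] [] [] [] emptyBlock) (List.++-identityʳ (bitCells dy))) run)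
    where
    dx dy : List Bool
    dx = reverse (bits ℤ.∣ x ∣)
    dy = reverse (bits ℤ.∣ y ∣)
    start≡ : initialStore (encodeℤ x ++ sep ∷ encodeℤ y) ≡
      raw (List.map symbol (signSymbols (isNegative x)) ++ (bitCells dx ++ symbol sep ∷ (List.map symbol (signSymbols (isNegative y)) ++ bitCells dy)))
        [] [] [] [] [] [] [] [] [] emptyBlock
    start≡ = cong₂ (λ i v → i ∷ [] ∷ [] ∷ [] ∷ [] ∷ [] ∷ [] ∷ [] ∷ [] ∷ [] ∷ v)
      (trans (List.map-++ symbol (encodeℤ x) _) (trans (cong₂ (λ u v → u ++ symbol sep ∷ v) (encodeℤ-cells x) (encodeℤ-cells y))
        (List.++-assoc (List.map symbol (signSymbols (isNegative x))) (bitCells dx) _)))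
      (sym (flat-empty tapes))

  run-divisor : ∀ neg c ys {n t S} → length ys ≤ n →
    Run φ (pop Y (withDivisor neg))
      (raw [] [] c (bitCells ys) [] [] [] [] [] [] (([] , List.map symbol (unary (length ys))) ∷ Vec.replicate _ ([] , []))) t tt S →
    Run φ (afterSign neg false) (raw (bitCells (reverse ys)) [] c [] [] [] [] [] [] [] emptyBlock) ((n * 7 + 2) + t) tt S
  run-divisor neg c ys {n} ys≤n run = run-ends (cong (λ s → raw [] [] c (bitCells (proj₁ s)) [] [] [] [] [] [] (([] , List.map symbol (proj₂ s)) ∷ Vec.replicate _ ([] , []))) folded)
      (run-scan-all φ {σ = List Bool × List Sym} {e = bitCell}
        {ctx = λ cs s → raw cs [] c (bitCells (proj₁ s)) [] [] [] [] [] [] (([] , List.map symbol (proj₂ s)) ∷ Vec.replicate _ ([] , []))}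
        refl unaryNext (λ _ _ → ⊤) 5 (λ _ → refl) (λ _ _ _ → push (push ret) , tt)
        (reverse ys) (subst (_≤ n) (sym (List.length-reverse ys)) ys≤n) tt) ⨾ run
    where
    folded : List.foldl unaryNext ([] , []) (reverse ys) ≡ (ys , unary (length ys))
    folded = trans (foldl-unary (reverse ys) [] []) (cong₂ _,_ (reverse-reverse ys)
      (trans (foldl-push (bit true) (reverse ys) []) (trans (List.++-identityʳ _) (cong unary (List.length-reverse ys)))))

  module _ (x : ℤ) (n : ℕ) (x≤n : length (bits ℤ.∣ x ∣) ≤ n) where

    private
      input : ℤ → List Sym
      input y = encodeℤ x ++ sep ∷ encodeℤ y

      neg = isNegative x
      xs = bits ℤ.∣ x ∣

    outputs-negative : ∀ y → Outputs φ program (input -[1+ y ]) (programTime n 1) []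
    outputs-negative y = run-outputs (run-parse x -[1+ y ] x≤n ret) refl

    outputs-zero : Outputs φ program (input (+ 0)) (programTime n ((n * 7 + 2) + 2)) []
    outputs-zero = run-outputs (run-parse x (+ 0) x≤n (run-divisor neg (bitCells xs) [] {n} z≤n (pop ret))) refl

    module _ (y : ℕ) (0<y : 0 < val (bits y)) (y≤n : length (bits y) ≤ n) where

      outputs-positive : ∀ T z →
        OracleTM.result N (λ _ → digitOracle neg xs (bits y) 0<y) (unary (length (bits y))) T ≡ just (encode𝔻 z) →
        Outputs φ program (input (+ y)) (programTime n ((n * 7 + 2) + coreTime n T))
          (encodeℤ (productℤ (val (bits y)) z))
      outputs-positive T z eq =
        let t , run = run-core neg xs (bits y) 0<y n x≤n y≤n T z eq
        in run-outputs (run-parse x (+ y) x≤n (run-divisor neg (bitCells xs) (bits y) y≤n run)) (symbols-map _)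

-- The machine for f

firstDigit : List Bool → Bool
firstDigit ds = maybe′ id false (top ds)

-- Continues an expansion that is too short with zeros, so the length is always `m`.
padTake : ℕ → List Bool → List Bool
padTake zero    ds = []
padTake (suc m) ds = firstDigit ds ∷ padTake m (below ds)

length-padTake : ∀ m ds → length (padTake m ds) ≡ m
length-padTake zero    ds = refl
length-padTake (suc m) ds = cong suc (length-padTake m (below ds))

popDigit : List Bool × List Bool → Bool → List Bool × List Bool
popDigit (ds , es) _ = below ds , firstDigit ds ∷ es

foldl-padTake : ∀ xs ds es → Σ[ rest ∈ List Bool ]
  List.foldl popDigit (ds , es) xs ≡ (rest , padTake (length xs) ds ʳ++ es)
foldl-padTake []       ds es = ds , refl
foldl-padTake (x ∷ xs) ds es = foldl-padTake xs (below ds) (firstDigit ds ∷ es)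

Canonical : List Bool → Set
Canonical ds = strip ds ≡ ds

canonical-init : ∀ ds d → Canonical (ds ++ [ d ]) → Canonical ds
canonical-init []           d eq = refl
canonical-init (true ∷ ds)  d eq = refl
-- Stripping a leading zero would shorten the list, which a canonical list does not allow.
canonical-init (false ∷ ds) d eq with () ← ℕ.<⇒≱ (ℕ.n<1+n _)
  (subst (λ es → length es ≤ length (ds ++ [ d ])) eq (length-strip (ds ++ [ d ])))

-- Moving the binary point left: ds is the integer part, last digit first.
record Shifted (n : ℕ) (ds es : List Bool) : Set where
  field
    int frac  : List Bool
    same      : msb 0 (reverse int ++ frac) ≡ msb 0 (reverse ds ++ es)
    length≡   : length frac ≡ n + length es
    canonical : Canonical (reverse ds) → Canonical (reverse int)
    shorter   : length int ≤ length ds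

-- Each mark hands the last integer digit over to the fractional part. When the integer part is used
-- up zeros are inserted instead, which keep the value of the whole string and still count as
-- fractional digits.
shiftPoint : ∀ xs ds es → Σ[ s ∈ Shifted (length xs) ds es ]
  List.foldl popDigit (ds , es) xs ≡ (Shifted.int s , Shifted.frac s)
shiftPoint []       ds es = record { int = ds ; frac = es ; same = refl ; length≡ = refl ; canonical = id ; shorter = ℕ.≤-refl } , refl
shiftPoint (x ∷ xs) []       es with shiftPoint xs [] (false ∷ es)
... | s , eq = record { Shifted s ; length≡ = trans (Shifted.length≡ s) (ℕ.+-suc (length xs) (length es)) } , eq
shiftPoint (x ∷ xs) (d ∷ ds) es with shiftPoint xs ds (d ∷ es)
... | s , eq = record
  { int       = Shifted.int s
  ; frac      = Shifted.frac s
  ; same      = trans (Shifted.same s) (cong (msb 0) (trans (sym (List.++-assoc (reverse ds) [ d ] es))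
                  (cong (_++ es) (sym (List.unfold-reverse d ds)))))
  ; length≡   = trans (Shifted.length≡ s) (ℕ.+-suc (length xs) (length es))
  ; canonical = λ c → Shifted.canonical s (canonical-init (reverse ds) d (subst Canonical (List.unfold-reverse d ds) c))
  ; shorter   = ℕ.m≤n⇒m≤1+n (Shifted.shorter s)
  } , eq

-- The final 1 of an approximant stops the removal of leading zeros before the point is reached.
strip-last : ∀ ds → Σ[ es ∈ List Bool ] strip (ds ++ [ true ]) ≡ true ∷ es
strip-last []           = [] , refl
strip-last (true ∷ ds)  = ds ++ [ true ] , refl
strip-last (false ∷ ds) = strip-last ds


inlCell : ∀ {A B : Set} → Cell A → Cell (A ⊎ B)
inlCell blank      = blank
inlCell (symbol s) = symbol s
inlCell (aux a)    = aux (inj₁ a)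

inrCell : ∀ {A B : Set} → Cell B → Cell (A ⊎ B)
inrCell blank      = blank
inrCell (symbol s) = symbol s
inrCell (aux b)    = aux (inj₂ b)

-- Cells of the other machine are never met; blank is a junk value.
outlCell : ∀ {A B : Set} → Cell (A ⊎ B) → Cell A
outlCell blank          = blank
outlCell (symbol s)     = symbol s
outlCell (aux (inj₁ a)) = aux a
outlCell (aux (inj₂ _)) = blank

outrCell : ∀ {A B : Set} → Cell (A ⊎ B) → Cell B
outrCell blank          = blank
outrCell (symbol s)     = symbol s
outrCell (aux (inj₁ _)) = blank
outrCell (aux (inj₂ b)) = aux b

outl-inl : ∀ {A B : Set} (c : Cell A) → outlCell {A} {B} (inlCell c) ≡ c
outl-inl blank      = refl
outl-inl (symbol s) = refl
outl-inl (aux a)    = refl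

outr-inr : ∀ {A B : Set} (c : Cell B) → outrCell {A} {B} (inrCell c) ≡ c
outr-inr blank      = refl
outr-inr (symbol s) = refl
outr-inr (aux b)    = refl

module ComputingMachine (K : OracleTM 0) (G : OracleTM 2) where
  module K = OracleTM K
  module G = OracleTM G

  Aux : Set
  Aux = K.Aux ⊎ G.Aux

  finite-Aux : Finite Aux
  finite-Aux = finite-⊎ K.finite-Aux G.finite-Aux

  workTapes : ℕ
  workTapes = 7 + (12 + (double K.work + double G.work))

  open StackMachine 1 workTapes Aux finite-Aux
    using (Prog; ret; push; pop; call; bind; _>>_; stacks)
  open Simulation 1 workTapes Aux finite-Aux
  open Loops 1 workTapes Aux finite-Aux

  -- `OR` is the oracle tape; `CNT` counts up to `m`, and `C₂`, `C₃` hold `m` and `m + 1` in unary;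
  -- `A` and `B` keep the encodings of a and y, and `T`, `U` are scratch. Stacks 10 to 13 are the
  -- input and output tapes of `K`, 14 to 21 the first four tapes of `G`, and from 22 on come the
  -- work tapes of both.
  IN OUT OR CNT C₂ C₃ A B T U RK₀ RK₁ RG₁ LG₂ RG₂ LG₃ RG₃ : Fin stacks
  IN  = 0F
  OUT = 1F
  OR  = 2F
  CNT = 3F
  C₂  = 4F
  C₃  = 5F
  A   = 6F
  B   = 7F
  T   = 8F
  U   = 9F
  RK₀ = suc (suc 9F)
  RK₁ = suc (suc (suc (suc 9F)))
  RG₁ = suc (suc (suc (suc (suc (suc (suc (suc 9F)))))))
  LG₂ = suc (suc (suc (suc (suc (suc (suc (suc (suc 9F))))))))
  RG₂ = suc (suc (suc (suc (suc (suc (suc (suc (suc (suc 9F)))))))))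
  LG₃ = suc (suc (suc (suc (suc (suc (suc (suc (suc (suc (suc 9F))))))))))
  RG₃ = suc (suc (suc (suc (suc (suc (suc (suc (suc (suc (suc (suc 9F)))))))))))

  leftK rightK : Fin K.tapes → Fin stacks
  leftK  0F            = suc 9F
  leftK  1F            = suc (suc (suc 9F))
  leftK  (suc (suc j)) = 22 ↑ʳ (leftSide j ↑ˡ double G.work)
  rightK 0F            = RK₀
  rightK 1F            = RK₁
  rightK (suc (suc j)) = 22 ↑ʳ (rightSide j ↑ˡ double G.work)

  leftG rightG : Fin G.tapes → Fin stacks
  leftG  0F                        = suc (suc (suc (suc (suc 9F))))
  leftG  1F                        = suc (suc (suc (suc (suc (suc (suc 9F))))))
  leftG  2F                        = LG₂
  leftG  3F                        = LG₃
  leftG  (suc (suc (suc (suc j)))) = 22 ↑ʳ (double K.work ↑ʳ leftSide j)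
  rightG 0F                        = suc (suc (suc (suc (suc (suc 9F)))))
  rightG 1F                        = RG₁
  rightG 2F                        = RG₂
  rightG 3F                        = RG₃
  rightG (suc (suc (suc (suc j)))) = 22 ↑ʳ (double K.work ↑ʳ rightSide j)

  one zero′ : Cell Aux
  one   = symbol (bit true)
  zero′ = symbol (bit false)

  fracCell : Fin stacks → Maybe (Cell Aux) → Prog ⊤
  fracCell i (just c) = push i c (ret tt)
  fracCell i nothing  = push i zero′ (ret tt)

  -- The oracles of `G` are constant, since a and y are integers and hence exact, so the query is
  -- discarded unread. The copy goes through `T` and writes the source back for later queries.
  refill : Fin stacks → Fin stacks → Fin stacks → Prog ⊤
  refill L R source =
    drain L >> (drain R >> (transfer source T >> scan T never (λ c → push source c (push R c (ret tt)))))

  replyG : Fin 2 → Prog ⊤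
  replyG 0F = refill LG₂ RG₂ A
  replyG 1F = refill LG₃ RG₃ B

  replyK : Fin 0 → Prog ⊤
  replyK ()

  simulateK simulateG : Prog ⊤
  simulateK = simulate K outlCell inlCell outl-inl leftK rightK replyK K.start
  simulateG = simulate G outrCell inrCell outr-inr leftG rightG replyG G.start

  -- Dividing by y = 2^(m+1) is moving `m + 1` digits across the point. The integer digits lie on
  -- `T` with the last one on top, ready to be put in front of the fractional digits on `OUT`, one
  -- per mark of `C₃`.
  deliver : Prog ⊤
  deliver = bind finite-Bool (popSign RG₁) λ neg →
    scan RG₁ isPoint (λ c → push T c (ret tt)) >> (
    scan RG₁ notBit (λ c → push U c (ret tt)) >> (
    transfer U OUT >> (
    scan C₃ never (λ _ → pop T (fracCell OUT)) >> push OUT (symbol point) (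
    transfer T OUT >> pushSign OUT neg))))

  -- Only `m` fractional digits of the answer are taken, since their number is not bounded by `k`
  -- and `n`; the others stay on `OR`. The numerator is the string read so far with a final 1, and
  -- the point on `A` comes last because the constant is an integer.
  approximate : Prog ⊤
  approximate = bind finite-Bool (popSign OR) λ neg →
    scan OR isPoint (λ c → push T c (ret tt)) >> (
    scan C₂ never (λ _ → pop OR (fracCell T)) >> push T one (push A (symbol point) (
    transfer T A >> (
    bind finite-Bool (stripZeros A) λ _ → pushSign A neg))))

  -- The first answer left an unbounded number of fractional digits on `OR`. They cannot be removed
  -- in time and might begin with ones, so a separator is put between them and the new query of `m`
  -- ones. `B` receives the digit 1 followed by `m + 1` zeros, that is y.
  precision : Prog ⊤
  precision =
    scan RK₁ notBit (λ _ → push CNT one (ret tt)) >> (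
    scan IN never (λ _ → push CNT one (ret tt)) >>
    push CNT one (push CNT one (push CNT one (push OR (symbol sep) (push B (symbol point) (
    scan CNT never (λ _ → push OR one (push C₂ one (push C₃ one (push B zero′ (ret tt))))) >>
    push C₃ one (push B zero′ (push B one (ret tt)))))))))

  -- The index of the Lipschitz constant, in unary: the number of integer digits of the first answer
  -- plus 2. By `2^j+3≤` the increase by 2 makes room for 3 beyond the modulus of that answer.
  magnitude : Prog ⊤
  magnitude = bind finite-Bool (popSign OR) λ _ →
    scan OR isPoint (λ _ → push RK₀ one (ret tt)) >> push RK₀ one (push RK₀ one (ret tt))

  program : Prog ⊤
  -- The oracle tape is empty at the start, so the first query has precision 0.
  program = call 0F (magnitude >> (simulateK >> (precision >> call 0F (approximate >> (simulateG >> deliver)))))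

  magnitudeTime : ℕ → ℕ
  magnitudeTime N = 4 + ((N * 5 + 2) + 5)

  precisionTime : ℕ → ℕ
  precisionTime N = (N * 5 + 2) + ((N * 5 + 2) + (2 + (2 + (2 + (2 + (2 + ((N * 11 + 2) + 7)))))))

  guard : ℕ → ℕ → ℕ
  guard n ℓ = 3 + (n + ℓ)

  -- The integer digits, the `m` fractional digits and the final 1 of an approximant.
  digitsSize : ℕ → ℕ
  digitsSize N = N + suc N

  approximateTime : ℕ → ℕ
  approximateTime N =
    4 + ((N * 5 + 2) + ((N * 6 + 2) + (2 + (2 + ((digitsSize N * 5 + 2) + ((digitsSize N * 2 + 4) + 3))))))

  shiftExponent : ℕ → 𝔻 → 𝔻
  shiftExponent m (a /2^ b) = a /2^ (m + b)

  deliverTime : ℕ → ℕ → ℕ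
  deliverTime N k =
    4 + ((k * 5 + 2) + ((k * 5 + 2) + ((k * 5 + 2) + ((suc N * 6 + 2) + (2 + ((k * 5 + 2) + 3))))))

  refillTime : ℕ → ℕ → ℕ
  refillTime s k = (k * 3 + 2) + ((k * 3 + 2) + ((s * 5 + 2) + (s * 7 + 2)))

  simKTime : ℕ → ℕ
  simKTime T = suc T * (K.tapes * 3 + (K.tapes * 6 + 1))

  simGTime : ℕ → ℕ → ℕ
  simGTime s T = suc T * (G.tapes * 3 + (G.tapes * 6 + (refillTime s (T * s + 0) + 1)))

  constants : 𝔻 → 𝔻 → Fin 2 → ℕ → 𝔻
  constants a b 0F _ = a
  constants a b 1F _ = b

  totalTime : ℕ → ℕ → ℕ → ℕ
  totalTime N TK TG = 1 + (magnitudeTime N + (simKTime TK + (precisionTime N + (1 + (approximateTime N +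
    (simGTime (digitsSize N + 3) TG + deliverTime N (TG * (digitsSize N + 3) + 0)))))))

-- Runs of the machine for f

encode-cells : ∀ {A} d → List.map (symbol {A}) (encode𝔻 d) ≡
  List.map symbol (signSymbols (isNegative (𝔻.numerator d))) ++ (bitCells (intDigits d) ++ symbol point ∷ bitCells (fracDigits d))
encode-cells d = trans (cong (List.map symbol) (encode-form d))
  (trans (List.map-++ symbol (signSymbols (isNegative (𝔻.numerator d))) _)
    (cong (List.map symbol (signSymbols (isNegative (𝔻.numerator d))) ++_)
      (trans (List.map-++ symbol (bitSymbols (intDigits d)) _)
        (cong₂ (λ u v → u ++ symbol point ∷ v) (sym (List.map-∘ (intDigits d))) (sym (List.map-∘ (fracDigits d)))))))

foldl-count : ∀ {B : Set} (xs : List B) j → List.foldl (λ j _ → suc j) j xs ≡ length xs + j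
foldl-count []       j = refl
foldl-count (x ∷ xs) j = trans (foldl-count xs (suc j)) (ℕ.+-suc (length xs) j)

-- The integer whose digits are those of d up to the m-th fractional one, and
-- a final 1, which keeps it nonzero.
approximant : ℕ → 𝔻 → ℤ
approximant m d =
  signed (isNegative (𝔻.numerator d)) (msb 0 (intDigits d ++ (padTake m (fracDigits d) ++ [ true ])))

module ComputingCorrectness (K : OracleTM 0) (G : OracleTM 2) (φ : Fin 1 → ℕ → 𝔻) where
  open ComputingMachine K G
  open StackMachine 1 workTapes Aux finite-Aux
    using (Prog; ret; push; pop; call; _>>_; _⨾_; Run; Store; weaken; run-ends; run-starts; run-push; initialStore; Outputs; run-outputs)
  open Simulation 1 workTapes Aux finite-Aux
  open Loops 1 workTapes Aux finite-Aux

  -- The tapes accessed by name are matched out of the blocks, and the work tapes of both machines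
  -- are appended. Once the blocks are split in this way, the lens laws for named stacks hold by
  -- `refl`.
  raw : (i o q n c d a b t u : List (Cell Aux)) → Vec Sides K.tapes → Vec Sides G.tapes → Store
  raw i o q n c d a b t u ((k₀ , k₁) ∷ (k₂ , k₃) ∷ kw) ((g₀ , g₁) ∷ (g₂ , g₃) ∷ (g₄ , g₅) ∷ (g₆ , g₇) ∷ gw) =
    i ∷ o ∷ q ∷ n ∷ c ∷ d ∷ a ∷ b ∷ t ∷ u ∷ k₀ ∷ k₁ ∷ k₂ ∷ k₃ ∷ g₀ ∷ g₁ ∷ g₂ ∷ g₃ ∷ g₄ ∷ g₅ ∷ g₆ ∷ g₇ ∷ (flat kw Vec.++ flat gw)

  blockK : ∀ i o q n c d a b t u gb → Block leftK rightK (λ kb → raw i o q n c d a b t u kb gb)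
  blockK i o q n c d a b t u gb@((g₀ , g₁) ∷ (g₂ , g₃) ∷ (g₄ , g₅) ∷ (g₆ , g₇) ∷ gw) =
    record { getL = getL ; getR = getR ; putL = putL ; putR = putR }
    where
    getL : ∀ kb j → lookup (raw i o q n c d a b t u kb gb) (leftK j) ≡ proj₁ (lookup kb j)
    getL (_ ∷ _ ∷ kw) 0F            = refl
    getL (_ ∷ _ ∷ kw) 1F            = refl
    getL (_ ∷ _ ∷ kw) (suc (suc j)) = trans (Vec.lookup-++ˡ (flat kw) (flat gw) (leftSide j)) (lookup-leftSide kw j)
    getR : ∀ kb j → lookup (raw i o q n c d a b t u kb gb) (rightK j) ≡ proj₂ (lookup kb j)
    getR (_ ∷ _ ∷ kw) 0F            = refl
    getR (_ ∷ _ ∷ kw) 1F            = refl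
    getR (_ ∷ _ ∷ kw) (suc (suc j)) = trans (Vec.lookup-++ˡ (flat kw) (flat gw) (rightSide j)) (lookup-rightSide kw j)
    tail≡ : ∀ {k₀ k₁ v w} → v ≡ w →
      i ∷ o ∷ q ∷ n ∷ c ∷ d ∷ a ∷ b ∷ t ∷ u ∷ proj₁ k₀ ∷ proj₂ k₀ ∷ proj₁ k₁ ∷ proj₂ k₁ ∷ g₀ ∷ g₁ ∷ g₂ ∷ g₃ ∷ g₄ ∷ g₅ ∷ g₆ ∷ g₇ ∷ v
      ≡ i ∷ o ∷ q ∷ n ∷ c ∷ d ∷ a ∷ b ∷ t ∷ u ∷ proj₁ k₀ ∷ proj₂ k₀ ∷ proj₁ k₁ ∷ proj₂ k₁ ∷ g₀ ∷ g₁ ∷ g₂ ∷ g₃ ∷ g₄ ∷ g₅ ∷ g₆ ∷ g₇ ∷ w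
    tail≡ refl = refl
    putL : ∀ kb j l → raw i o q n c d a b t u kb gb [ leftK j ]≔ l ≡ raw i o q n c d a b t u (kb [ j ]≔ (l , proj₂ (lookup kb j))) gb
    putL (_ ∷ _ ∷ kw)   0F            l = refl
    putL (_ ∷ _ ∷ kw)   1F            l = refl
    putL (k₀ ∷ k₁ ∷ kw) (suc (suc j)) l = tail≡ {k₀} {k₁}
      (trans (Vec.[]≔-++-↑ˡ (flat kw) (flat gw) (leftSide j)) (cong (Vec._++ flat gw) (update-leftSide kw j l)))
    putR : ∀ kb j r → raw i o q n c d a b t u kb gb [ rightK j ]≔ r ≡ raw i o q n c d a b t u (kb [ j ]≔ (proj₁ (lookup kb j) , r)) gb
    putR (_ ∷ _ ∷ kw)   0F            r = refl
    putR (_ ∷ _ ∷ kw)   1F            r = refl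
    putR (k₀ ∷ k₁ ∷ kw) (suc (suc j)) r = tail≡ {k₀} {k₁}
      (trans (Vec.[]≔-++-↑ˡ (flat kw) (flat gw) (rightSide j)) (cong (Vec._++ flat gw) (update-rightSide kw j r)))

  update-++ʳ : ∀ {k l} (v : Vec (List (Cell Aux)) k) (w : Vec (List (Cell Aux)) l) j s →
               (v Vec.++ w) [ k ↑ʳ j ]≔ s ≡ v Vec.++ (w [ j ]≔ s)
  update-++ʳ []      w j s = refl
  update-++ʳ (x ∷ v) w j s = cong (x ∷_) (update-++ʳ v w j s)

  blockG : ∀ i o q n c d a b t u kb → Block leftG rightG (raw i o q n c d a b t u kb)
  blockG i o q n c d a b t u kb@((k₀ , k₁) ∷ (k₂ , k₃) ∷ kw) =
    record { getL = getL ; getR = getR ; putL = putL ; putR = putR }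
    where
    getL : ∀ gb j → lookup (raw i o q n c d a b t u kb gb) (leftG j) ≡ proj₁ (lookup gb j)
    getL (_ ∷ _ ∷ _ ∷ _ ∷ gw) 0F                        = refl
    getL (_ ∷ _ ∷ _ ∷ _ ∷ gw) 1F                        = refl
    getL (_ ∷ _ ∷ _ ∷ _ ∷ gw) 2F                        = refl
    getL (_ ∷ _ ∷ _ ∷ _ ∷ gw) 3F                        = refl
    getL (_ ∷ _ ∷ _ ∷ _ ∷ gw) (suc (suc (suc (suc j)))) =
      trans (Vec.lookup-++ʳ (flat kw) (flat gw) (leftSide j)) (lookup-leftSide gw j)
    getR : ∀ gb j → lookup (raw i o q n c d a b t u kb gb) (rightG j) ≡ proj₂ (lookup gb j)
    getR (_ ∷ _ ∷ _ ∷ _ ∷ gw) 0F                        = refl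
    getR (_ ∷ _ ∷ _ ∷ _ ∷ gw) 1F                        = refl
    getR (_ ∷ _ ∷ _ ∷ _ ∷ gw) 2F                        = refl
    getR (_ ∷ _ ∷ _ ∷ _ ∷ gw) 3F                        = refl
    getR (_ ∷ _ ∷ _ ∷ _ ∷ gw) (suc (suc (suc (suc j)))) =
      trans (Vec.lookup-++ʳ (flat kw) (flat gw) (rightSide j)) (lookup-rightSide gw j)
    tail≡ : ∀ {p₀ p₁ p₂ p₃ v w} → v ≡ w →
      i ∷ o ∷ q ∷ n ∷ c ∷ d ∷ a ∷ b ∷ t ∷ u ∷ k₀ ∷ k₁ ∷ k₂ ∷ k₃ ∷ proj₁ p₀ ∷ proj₂ p₀ ∷ proj₁ p₁ ∷ proj₂ p₁ ∷ proj₁ p₂ ∷ proj₂ p₂ ∷ proj₁ p₃ ∷ proj₂ p₃ ∷ v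
      ≡ i ∷ o ∷ q ∷ n ∷ c ∷ d ∷ a ∷ b ∷ t ∷ u ∷ k₀ ∷ k₁ ∷ k₂ ∷ k₃ ∷ proj₁ p₀ ∷ proj₂ p₀ ∷ proj₁ p₁ ∷ proj₂ p₁ ∷ proj₁ p₂ ∷ proj₂ p₂ ∷ proj₁ p₃ ∷ proj₂ p₃ ∷ w
    tail≡ refl = refl
    putL : ∀ gb j l → raw i o q n c d a b t u kb gb [ leftG j ]≔ l ≡ raw i o q n c d a b t u kb (gb [ j ]≔ (l , proj₂ (lookup gb j)))
    putL (_ ∷ _ ∷ _ ∷ _ ∷ gw) 0F                            l = refl
    putL (_ ∷ _ ∷ _ ∷ _ ∷ gw) 1F                            l = refl
    putL (_ ∷ _ ∷ _ ∷ _ ∷ gw) 2F                            l = refl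
    putL (_ ∷ _ ∷ _ ∷ _ ∷ gw) 3F                            l = refl
    putL (p₀ ∷ p₁ ∷ p₂ ∷ p₃ ∷ gw) (suc (suc (suc (suc j)))) l = tail≡ {p₀} {p₁} {p₂} {p₃}
      (trans (update-++ʳ (flat kw) (flat gw) (leftSide j) l) (cong (flat kw Vec.++_) (update-leftSide gw j l)))
    putR : ∀ gb j r → raw i o q n c d a b t u kb gb [ rightG j ]≔ r ≡ raw i o q n c d a b t u kb (gb [ j ]≔ (proj₁ (lookup gb j) , r))
    putR (_ ∷ _ ∷ _ ∷ _ ∷ gw) 0F                            r = refl
    putR (_ ∷ _ ∷ _ ∷ _ ∷ gw) 1F                            r = refl
    putR (_ ∷ _ ∷ _ ∷ _ ∷ gw) 2F                            r = refl
    putR (_ ∷ _ ∷ _ ∷ _ ∷ gw) 3F                            r = refl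
    putR (p₀ ∷ p₁ ∷ p₂ ∷ p₃ ∷ gw) (suc (suc (suc (suc j)))) r = tail≡ {p₀} {p₁} {p₂} {p₃}
      (trans (update-++ʳ (flat kw) (flat gw) (rightSide j) r) (cong (flat kw Vec.++_) (update-rightSide gw j r)))

  gEmpty : Vec Sides G.tapes
  gEmpty = Vec.replicate _ ([] , [])

  run-magnitude : ∀ i d {N} kt → length (intDigits d) ≤ N →
    Run φ magnitude (raw i [] (List.map symbol (encode𝔻 d)) [] [] [] [] [] [] [] (([] , []) ∷ kt) gEmpty) (magnitudeTime N) tt
      (raw i [] (bitCells (fracDigits d)) [] [] [] [] [] [] [] (([] , replicate (2 + length (intDigits d)) one) ∷ kt) gEmpty)
  run-magnitude i d (k₁ ∷ kw) I≤N =
    run-starts (cong (λ q → raw i [] q [] [] [] [] [] [] [] (([] , []) ∷ k₁ ∷ kw) gEmpty) (encode-cells d))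
    (run-popSign φ {ctx = λ q → raw i [] q [] [] [] [] [] [] [] (([] , []) ∷ k₁ ∷ kw) gEmpty}
            refl (isNegative (𝔻.numerator d)) (bitCells I ++ symbol point ∷ bitCells (fracDigits d)) (isMinus-bits I _ refl) ⨾
    run-ends (cong (λ j → raw i [] (bitCells (fracDigits d)) [] [] [] [] [] [] [] (([] , replicate j one) ∷ k₁ ∷ kw) gEmpty)
                      (trans (foldl-count I 0) (ℕ.+-identityʳ _)))
            (run-scan φ {e = symbol ∘ bit} {ctx = λ cs j → raw i [] cs [] [] [] [] [] [] [] (([] , replicate j one) ∷ k₁ ∷ kw) gEmpty}
              refl (λ j _ → suc j) (λ _ _ → ⊤) 3 (λ _ → refl) (λ _ _ _ → push ret , tt)
              I (symbol point ∷ bitCells (fracDigits d)) refl I≤N tt) ⨾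
      push (push ret))
    where I = intDigits d

  run-precision : ∀ n q k₀ l₁ r₁ kw kd {N} → symbols r₁ ≡ bitSymbols kd → guard n (length kd) ≤ N →
    Σ[ r₁′ ∈ List (Cell Aux) ] let m = guard n (length kd) in
    Run φ precision (raw (List.map symbol (unary n)) [] q [] [] [] [] [] [] [] (k₀ ∷ (l₁ , r₁) ∷ kw) gEmpty) (precisionTime N) tt
      (raw [] [] (replicate m one ++ symbol sep ∷ q) [] (replicate m one) (replicate (suc m) one) []
        (one ∷ replicate (suc m) zero′ ++ [ symbol point ]) [] [] (k₀ ∷ (l₁ , r₁′) ∷ kw) gEmpty)
  run-precision n q k₀ l₁ r₁ kw kd {N} out≡ m≤N = below rest ,
    run-starts (cong (λ cs → raw (List.map symbol (unary n)) [] q [] [] [] [] [] [] [] (k₀ ∷ (l₁ , cs) ∷ kw) gEmpty) r₁≡)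
    (run-ends (cong (λ j → raw (List.map symbol (unary n)) [] q (replicate j one) [] [] [] [] [] [] (k₀ ∷ (l₁ , below rest) ∷ kw) gEmpty)
                      (trans (foldl-count kd 0) (ℕ.+-identityʳ _)))
            (run-scan φ {e = symbol ∘ bit} {ctx = λ cs j → raw (List.map symbol (unary n)) [] q (replicate j one) [] [] [] [] [] [] (k₀ ∷ (l₁ , cs) ∷ kw) gEmpty}
              refl (λ j _ → suc j) (λ _ _ → ⊤) 3 (λ _ → refl) (λ _ _ _ → push ret , tt)
              kd rest (no-symbols-stop rest no-rest) kd≤N tt) ⨾
    run-ends (cong (λ j → raw [] [] q (replicate j one) [] [] [] [] [] [] (k₀ ∷ (l₁ , below rest) ∷ kw) gEmpty)
                      (trans (foldl-count (unary n) (length kd)) (cong (_+ length kd) (List.length-replicate n))))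
            (run-scan-all φ {e = symbol} {ctx = λ cs j → raw cs [] q (replicate j one) [] [] [] [] [] [] (k₀ ∷ (l₁ , below rest) ∷ kw) gEmpty}
              refl (λ j _ → suc j) (λ _ _ → ⊤) 3 (λ _ → refl) (λ _ _ _ → push ret , tt)
              (unary n) (subst (_≤ N) (sym (List.length-replicate n)) n≤N) tt) ⨾
      push (push (push (push (push
    (run-starts (cong (λ cs → raw [] [] (symbol sep ∷ q) cs [] [] [] [ symbol point ] [] [] (k₀ ∷ (l₁ , below rest) ∷ kw) gEmpty)
                        (sym (List.map-replicate (λ _ → one) m tt)))
            (run-ends (cong (λ j → raw [] [] (replicate j one ++ symbol sep ∷ q) [] (replicate j one) (replicate j one) []
                          (replicate j zero′ ++ [ symbol point ]) [] [] (k₀ ∷ (l₁ , below rest) ∷ kw) gEmpty)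
                        (trans (foldl-count (replicate m tt) 0) (trans (ℕ.+-identityʳ _) (List.length-replicate m))))
            (run-scan-all φ {e = λ (_ : ⊤) → one}
              {ctx = λ cs j → raw [] [] (replicate j one ++ symbol sep ∷ q) cs (replicate j one) (replicate j one) []
                          (replicate j zero′ ++ [ symbol point ]) [] [] (k₀ ∷ (l₁ , below rest) ∷ kw) gEmpty}
              refl (λ j _ → suc j) (λ _ _ → ⊤) 9 (λ _ → refl)
              (λ _ _ _ → push (push (push (push ret))) , tt) (replicate m tt) (subst (_≤ N) (sym (List.length-replicate m)) m≤N) tt)) ⨾
      push (push (push ret))))))))
    where
    open SplitSymbols (splitSymbols r₁)
    m = guard n (length kd)
    r₁≡ : r₁ ≡ bitCells kd ++ rest
    r₁≡ = trans split (cong (_++ rest) (trans (cong (List.map symbol) out≡) (sym (List.map-∘ kd))))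
    n≤N : n ≤ N
    n≤N = ℕ.≤-trans (ℕ.≤-trans (ℕ.m≤m+n n (length kd)) (ℕ.m≤n+m _ 3)) m≤N
    kd≤N : length kd ≤ N
    kd≤N = ℕ.≤-trans (ℕ.≤-trans (ℕ.m≤n+m (length kd) n) (ℕ.m≤n+m _ 3)) m≤N

  run-approximate : ∀ d₂ b kb m d {N} → length (intDigits d) ≤ N → m ≤ N →
    Σ[ q ∈ List (Cell Aux) ]
    (Run φ approximate (raw [] [] (List.map symbol (encode𝔻 d)) [] (replicate m one) d₂ [] b [] [] kb gEmpty) (approximateTime N) tt
      (raw [] [] q [] [] d₂ (List.map symbol (encode𝔻 (approximant m d /2^ 0))) b [] [] kb gEmpty)
    × length (encode𝔻 (approximant m d /2^ 0)) ≤ digitsSize N + 3)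
  run-approximate d₂ b kb@(k₀ ∷ k₁ ∷ kw) m d {N} I≤N m≤N = bitCells (proj₁ taken) , run , answer≤
    where
    neg = isNegative (𝔻.numerator d)
    I = intDigits d
    F = fracDigits d
    F′ = padTake m F
    D = I ++ (F′ ++ [ true ])
    taken = foldl-padTake (replicate m true) F (I ʳ++ [])
    Q : List (Cell Aux)
    Q = bitCells (proj₁ taken)
    taken≡ : List.foldl popDigit (F , I ʳ++ []) (replicate m true) ≡ (proj₁ taken , F′ ʳ++ (I ʳ++ []))
    taken≡ = trans (proj₂ taken) (cong (λ l → proj₁ taken , padTake l F ʳ++ (I ʳ++ [])) (List.length-replicate m))
    pop-OR : ∀ f t c → Run φ (pop OR (fracCell T)) (raw [] [] (bitCells f) [] c d₂ [] b (bitCells t) [] kb gEmpty) 4 tt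
               (raw [] [] (bitCells (below f)) [] c d₂ [] b (bitCells (firstDigit f ∷ t)) [] kb gEmpty)
    pop-OR []      t c = pop (push ret)
    pop-OR (_ ∷ f) t c = pop (push ret)
    length-D : length D ≡ length I + suc m
    length-D = trans (List.length-++ I) (cong (λ l → length I + l)
      (trans (List.length-++ F′) (trans (ℕ.+-comm (length F′) 1) (cong suc (length-padTake m F)))))
    D≤ : length D ≤ digitsSize N
    D≤ = subst (_≤ digitsSize N) (sym length-D) (ℕ.+-mono-≤ I≤N (s≤s m≤N))
    bits≡ : (true ∷ (F′ ʳ++ (I ʳ++ []))) ʳ++ [] ≡ D
    bits≡ = trans (List.ʳ++-ʳ++ F′) (ʳ++-undo I (F′ ++ [ true ]))
    digits≤ : length (bitCells {Aux} (true ∷ (F′ ʳ++ (I ʳ++ [])))) ≤ digitsSize N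
    digits≤ = subst (_≤ digitsSize N)
      (trans (cong length (sym bits≡)) (trans (List.length-ʳ++ (true ∷ (F′ ʳ++ (I ʳ++ []))))
        (trans (ℕ.+-identityʳ _) (sym (List.length-map (symbol ∘ bit) (true ∷ (F′ ʳ++ (I ʳ++ [])))))))) D≤
    reversed : bitCells (true ∷ (F′ ʳ++ (I ʳ++ []))) ʳ++ [ symbol point ] ≡ bitCells D ++ [ symbol point ]
    reversed = trans (List.ʳ++-defn (bitCells (true ∷ (F′ ʳ++ (I ʳ++ [])))))
      (cong (_++ [ symbol point ]) (trans (sym (List.map-ʳ++ (symbol ∘ bit) (true ∷ (F′ ʳ++ (I ʳ++ []))))) (cong bitCells bits≡)))
    stripped : Σ[ es ∈ List Bool ] strip D ≡ true ∷ es
    stripped = subst (λ ds → Σ[ es ∈ List Bool ] strip ds ≡ true ∷ es) (List.++-assoc I F′ [ true ]) (strip-last (I ++ F′))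
    D++[] : D ++ [] ≡ D
    D++[] = List.++-identityʳ D
    signable : Signable neg (msb 0 (D ++ []))
    signable _ rewrite D++[] | sym (List.++-assoc I F′ [ true ]) | msb-++ 0 (I ++ F′) [ true ] = s≤s z≤n
    encoded : List.map symbol (signSymbols neg) ++ (bitCells (strip D) ++ [ symbol point ]) ≡
              List.map symbol (encode𝔻 (approximant m d /2^ 0))
    encoded = begin
      σ (signSymbols neg) ++ (bitCells (strip D) ++ [ symbol point ])
        ≡⟨ cong (λ v → σ (signSymbols neg) ++ (v ++ [ symbol point ])) (List.map-∘ (strip D)) ⟩
      σ (signSymbols neg) ++ (σ (bitSymbols (strip D)) ++ σ [ point ])
        ≡⟨ cong (σ (signSymbols neg) ++_) (List.map-++ symbol (bitSymbols (strip D)) _) ⟨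
      σ (signSymbols neg) ++ σ (bitSymbols (strip D) ++ [ point ])
        ≡⟨ List.map-++ symbol (signSymbols neg) _ ⟨
      σ (signSymbols neg ++ bitSymbols (strip D) ++ [ point ])
        ≡⟨ cong σ (encode-digits neg D [] signable) ⟨
      σ (encode𝔻 (signed neg (msb 0 (D ++ [])) /2^ 0))
        ≡⟨ cong (λ ds → σ (encode𝔻 (signed neg (msb 0 ds) /2^ 0))) D++[] ⟩
      σ (encode𝔻 (approximant m d /2^ 0)) ∎
      where
      open ≡-Reasoning
      σ = List.map (symbol {Aux})
    answer≤ : length (encode𝔻 (approximant m d /2^ 0)) ≤ digitsSize N + 3
    answer≤ = begin
      length (encode𝔻 (approximant m d /2^ 0))  ≡⟨ List.length-map (symbol {Aux}) (encode𝔻 (approximant m d /2^ 0)) ⟨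
      length (List.map (symbol {Aux}) (encode𝔻 (approximant m d /2^ 0)))  ≡⟨ cong length encoded ⟨
      length (S ++ (bitCells (strip D) ++ [ symbol point ]))
        ≡⟨ trans (List.length-++ S) (cong₂ _+_ (List.length-map symbol (signSymbols neg)) (trans (List.length-++ (bitCells (strip D)))
             (cong (_+ 1) (List.length-map _ (strip D))))) ⟩
      length (signSymbols neg) + (length (strip D) + 1)
        ≤⟨ ℕ.+-mono-≤ (length-sign neg) (ℕ.+-monoˡ-≤ 1 (ℕ.≤-trans (length-strip D) D≤)) ⟩
      1 + (digitsSize N + 1)  ≡⟨ ℕ.+-suc (digitsSize N) 1 ⟨
      digitsSize N + 2        ≤⟨ ℕ.+-monoʳ-≤ (digitsSize N) (ℕ.n≤1+n 2) ⟩
      digitsSize N + 3        ∎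
      where
      open ℕ.≤-Reasoning
      S = List.map (symbol {Aux}) (signSymbols neg)
    run : Run φ approximate (raw [] [] (List.map symbol (encode𝔻 d)) [] (replicate m one) d₂ [] b [] [] kb gEmpty) (approximateTime N) tt
            (raw [] [] Q [] [] d₂ (List.map symbol (encode𝔻 (approximant m d /2^ 0))) b [] [] kb gEmpty)
    run = run-starts (cong₂ (λ q c → raw [] [] q [] c d₂ [] b [] [] kb gEmpty) (encode-cells d) (sym (List.map-replicate (symbol ∘ bit) m true)))
      (run-popSign φ {ctx = λ q → raw [] [] q [] (bitCells (replicate m true)) d₂ [] b [] [] kb gEmpty}
              refl neg (bitCells I ++ symbol point ∷ bitCells F) (isMinus-bits I _ refl) ⨾
      run-scan φ {e = symbol ∘ bit} {ctx = λ q t → raw [] [] q [] (bitCells (replicate m true)) d₂ [] b (bitCells t) [] kb gEmpty}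
                refl (λ t x → x ∷ t) (λ _ _ → ⊤) 3 (λ _ → refl) (λ _ _ _ → push ret , tt)
                I (symbol point ∷ bitCells F) refl I≤N tt ⨾
      run-ends (cong (λ s → raw [] [] (bitCells (proj₁ s)) [] [] d₂ [] b (bitCells (proj₂ s)) [] kb gEmpty) taken≡)
              (run-scan-all φ {σ = List Bool × List Bool} {e = symbol ∘ bit}
                {ctx = λ c s → raw [] [] (bitCells (proj₁ s)) [] c d₂ [] b (bitCells (proj₂ s)) [] kb gEmpty}
                refl popDigit (λ _ _ → ⊤) 4 (λ _ → refl)
                (λ {_} {s} x c _ → pop-OR (proj₁ s) (proj₂ s) c , tt) (replicate m true)
                (subst (_≤ N) (sym (List.length-replicate m)) m≤N) tt) ⨾
        push (push
      (run-ends (cong (λ a → raw [] [] Q [] [] d₂ a b [] [] kb gEmpty) reversed)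
              (run-transfer φ {ctx = λ t a → raw [] [] Q [] [] d₂ a b t [] kb gEmpty}
                refl refl
                (bitCells (true ∷ (F′ ʳ++ (I ʳ++ [])))) digits≤) ⨾
      run-stripZeros φ {ctx = λ a → raw [] [] Q [] [] d₂ a b [] [] kb gEmpty}
              refl D [ symbol point ] (proj₂ stripped) D≤ ⨾
        run-ends (cong (λ a → raw [] [] Q [] [] d₂ a b [] [] kb gEmpty) encoded)
          (run-pushSign φ {ctx = λ a → raw [] [] Q [] [] d₂ a b [] [] kb gEmpty} refl neg _))))

  powerCells : ∀ m → one ∷ replicate m zero′ ++ [ symbol point ] ≡ List.map symbol (encode𝔻 (+ (2 ^ m) /2^ 0))
  powerCells m = sym (begin
    List.map symbol (encode𝔻 (+ (2 ^ m) /2^ 0))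
      ≡⟨ cong (λ n → List.map symbol (encode𝔻 (+ n /2^ 0))) value ⟨
    List.map symbol (encode𝔻 (+ (msb 0 (D ++ [])) /2^ 0))
      ≡⟨ cong (List.map symbol) (encode-digits false D [] (λ ())) ⟩
    List.map symbol (bitSymbols D ++ [ point ])
      ≡⟨ List.map-++ symbol (bitSymbols D) _ ⟩
    List.map symbol (bitSymbols D) ++ [ symbol point ]
      ≡⟨ cong (λ v → one ∷ v ++ [ symbol point ]) (trans (cong (List.map symbol) (List.map-replicate bit m false)) (List.map-replicate symbol m (bit false))) ⟩
    one ∷ replicate m zero′ ++ [ symbol point ] ∎)
    where
    open ≡-Reasoning
    D = true ∷ replicate m false
    value : msb 0 (D ++ []) ≡ 2 ^ m
    value = trans (cong (msb 1) (List.++-identityʳ (replicate m false))) (trans (msb-zeros 1 m) (ℕ.*-identityˡ _))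

  run-deliver : ∀ q a b kb m z g₀ l₁ r₁ gw {N k} → m ≤ N → length r₁ ≤ k → symbols r₁ ≡ encode𝔻 z →
    Σ[ r₁′ ∈ List (Cell Aux) ]
    Run φ deliver (raw [] [] q [] [] (replicate (suc m) one) a b [] [] kb (g₀ ∷ (l₁ , r₁) ∷ gw)) (deliverTime N k) tt
      (raw [] (List.map symbol (encode𝔻 (shiftExponent (suc m) z))) q [] [] [] a b [] [] kb (g₀ ∷ (l₁ , r₁′) ∷ gw))
  run-deliver q a b kb@(k₀ ∷ k₁ ∷ kw) m z@(num /2^ ex) g₀ l₁ r₁ gt@(g₂ ∷ g₃ ∷ gw) {N} {k} m≤N r₁≤k out≡ with encodedCells z r₁ out≡
  ... | record { rest = rest ; no-rest = no-rest ; split = refl ; int≤ = int≤ ; frac≤ = frac≤ } = below rest ,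
    run-starts (cong (λ d → raw [] [] q [] [] d a b [] [] kb (g₀ ∷ (l₁ , r₁) ∷ gt)) (sym (List.map-replicate (symbol ∘ bit) (suc m) true)))
    (run-popSign φ {ctx = λ r → raw [] [] q [] [] Marks a b [] [] kb (g₀ ∷ (l₁ , r) ∷ gt)}
            refl neg _ (isMinus-bits I _ refl) ⨾
    run-scan φ {e = symbol ∘ bit} {ctx = λ r t → raw [] [] q [] [] Marks a b (bitCells t) [] kb (g₀ ∷ (l₁ , r) ∷ gt)}
            refl (λ t x → x ∷ t) (λ _ _ → ⊤) 3 (λ _ → refl) (λ _ _ _ → push ret , tt)
            I (symbol point ∷ (bitCells F ++ rest)) refl I≤k tt ⨾
    run-scan φ {e = symbol ∘ bit} {ctx = λ r u → raw [] [] q [] [] Marks a b (bitCells T₀) (bitCells u) kb (g₀ ∷ (l₁ , r) ∷ gt)}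
            refl (λ t x → x ∷ t) (λ _ _ → ⊤) 3 (λ _ → refl) (λ _ _ _ → push ret , tt)
            F rest (no-symbols-stop rest no-rest) F≤k tt ⨾
    run-ends (cong (λ o → raw [] (bitCells o) q [] [] Marks a b (bitCells T₀) [] kb gb′) (trans (ʳ++-undo F []) (List.++-identityʳ F)))
            (run-transfer-bits φ {ctx = λ u o → raw [] o q [] [] Marks a b (bitCells T₀) u kb gb′}
              refl refl (F ʳ++ []) (length-rev F F≤k)) ⨾
    run-ends (cong (λ s → raw [] (bitCells (proj₂ s)) q [] [] [] a b (bitCells (proj₁ s)) [] kb gb′) (proj₂ shifted))
            (run-scan-all φ {σ = List Bool × List Bool} {e = symbol ∘ bit}
              {ctx = λ c s → raw [] (bitCells (proj₂ s)) q [] [] c a b (bitCells (proj₁ s)) [] kb gb′}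
              refl popDigit (λ _ _ → ⊤) 4 (λ _ → refl)
              (λ {_} {s} x c _ → pop-T (proj₁ s) (proj₂ s) c , tt) (replicate (suc m) true)
              (subst (_≤ suc N) (sym (List.length-replicate (suc m))) (s≤s m≤N)) tt) ⨾
      push
    (run-ends (cong (λ o → raw [] o q [] [] [] a b [] [] kb gb′) outcells)
            (run-transfer φ {ctx = λ t o → raw [] o q [] [] [] a b t [] kb gb′}
              refl refl
              (bitCells int) (subst (_≤ k) (sym (List.length-map _ int)) (ℕ.≤-trans shorter (length-rev I I≤k)))) ⨾
      run-ends (cong (λ o → raw [] o q [] [] [] a b [] [] kb gb′) encoded)
        (run-pushSign φ {ctx = λ o → raw [] o q [] [] [] a b [] [] kb gb′} refl neg _)))
    where
    neg = isNegative num
    I = intDigits z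
    F = fracDigits z
    Marks : List (Cell Aux)
    Marks = bitCells (replicate (suc m) true)
    T₀ = I ʳ++ []
    gb′ = g₀ ∷ (l₁ , below rest) ∷ gt
    shifted = shiftPoint (replicate (suc m) true) T₀ F
    open Shifted (proj₁ shifted)
    I≤k : length I ≤ k
    I≤k = ℕ.≤-trans int≤ r₁≤k
    F≤k : length F ≤ k
    F≤k = ℕ.≤-trans frac≤ r₁≤k
    pop-T : ∀ t o c → Run φ (pop T (fracCell OUT)) (raw [] (bitCells o) q [] [] c a b (bitCells t) [] kb gb′) 4 tt
              (raw [] (bitCells (firstDigit t ∷ o)) q [] [] c a b (bitCells (below t)) [] kb gb′)
    pop-T []      o c = pop (push ret)
    pop-T (_ ∷ t) o c = pop (push ret)
    outcells : bitCells int ʳ++ (symbol point ∷ bitCells frac) ≡ bitCells (reverse int) ++ symbol point ∷ bitCells frac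
    outcells = trans (List.ʳ++-defn (bitCells int)) (cong (_++ symbol point ∷ bitCells frac) (sym (List.reverse-map (symbol ∘ bit) int)))
    value : msb 0 (reverse int ++ frac) ≡ ℤ.∣ num ∣
    value = trans same (trans (cong (λ ds → msb 0 (ds ++ F)) (List.reverse-involutive I)) (msb-digits z))
    -- The output of `G` is an encoding, so its integer part has no leading zero, and neither has
    -- what remains of it after the shift. Therefore nothing needs to be stripped.
    canon : strip (reverse int) ≡ reverse int
    canon = canonical (subst Canonical (sym (List.reverse-involutive I)) (strip-reverse-bits (ℤ.∣ num ∣ ÷2^ ex)))
    exponent≡ : length frac ≡ suc m + ex
    exponent≡ = trans length≡ (cong₂ _+_ (List.length-replicate (suc m)) (length-lowDigits ex ℤ.∣ num ∣))
    signable : ∀ num → Signable (isNegative num) ℤ.∣ num ∣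
    signable (+ _) ()
    signable -[1+ _ ] _ = s≤s z≤n
    encoded : List.map symbol (signSymbols neg) ++ (bitCells (reverse int) ++ symbol point ∷ bitCells frac) ≡
              List.map symbol (encode𝔻 (num /2^ (suc m + ex)))
    encoded = begin
      σ (signSymbols neg) ++ (bitCells (reverse int) ++ symbol point ∷ bitCells frac)
        ≡⟨ cong (σ (signSymbols neg) ++_) (cong₂ (λ u v → u ++ symbol point ∷ v) (List.map-∘ (reverse int)) (List.map-∘ frac)) ⟩
      σ (signSymbols neg) ++ (σ (bitSymbols (reverse int)) ++ σ (point ∷ bitSymbols frac))
        ≡⟨ trans (List.map-++ symbol (signSymbols neg) _) (cong (σ (signSymbols neg) ++_) (List.map-++ symbol (bitSymbols (reverse int)) _)) ⟨
      σ (signSymbols neg ++ bitSymbols (reverse int) ++ point ∷ bitSymbols frac)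
        ≡⟨ cong (λ ds → σ (signSymbols neg ++ bitSymbols ds ++ point ∷ bitSymbols frac)) canon ⟨
      σ (signSymbols neg ++ bitSymbols (strip (reverse int)) ++ point ∷ bitSymbols frac)
        ≡⟨ cong σ (encode-digits neg (reverse int) frac (subst (Signable neg) (sym value) (signable num))) ⟨
      σ (encode𝔻 (signed neg (msb 0 (reverse int ++ frac)) /2^ length frac))
        ≡⟨ cong₂ (λ n e → σ (encode𝔻 (signed neg n /2^ e))) value exponent≡ ⟩
      σ (encode𝔻 (signed neg ℤ.∣ num ∣ /2^ (suc m + ex)))
        ≡⟨ cong (λ a → σ (encode𝔻 (a /2^ (suc m + ex)))) (signed-isNegative num) ⟩
      σ (encode𝔻 (num /2^ (suc m + ex))) ∎
      where
      open ≡-Reasoning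
      σ = List.map (symbol {Aux})

  copyBoth : List (Cell Aux) × List (Cell Aux) → Cell Aux → List (Cell Aux) × List (Cell Aux)
  copyBoth (s , r) c = c ∷ s , c ∷ r

  foldl-copyBoth : ∀ cs s r → List.foldl copyBoth (s , r) cs ≡ (cs ʳ++ s , cs ʳ++ r)
  foldl-copyBoth []       s r = refl
  foldl-copyBoth (c ∷ cs) s r = foldl-copyBoth cs _ _

  run-refill : ∀ {L R source} {ctx : (l r s t : List (Cell Aux)) → Store} →
    (λ l r s t → ctx [] r s t [ L ]≔ l) ≡ ctx → (λ l r s t → ctx l [] s t [ R ]≔ r) ≡ ctx →
    (λ l r s t → ctx l r [] t [ source ]≔ s) ≡ ctx → (λ l r s t → ctx l r s [] [ T ]≔ t) ≡ ctx →
    ∀ l r w {n k} → length l ≤ k → length r ≤ k → length w ≤ n →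
    Run φ (refill L R source) (ctx l r w []) (refillTime n k) tt (ctx [] w w [])
  run-refill {L} {R} {source} {ctx} at-L at-R at-s at-T l r w {n} l≤ r≤ w≤ =
    run-drain φ {ctx = λ l → ctx l r w []} (cong (λ f l → f l r w []) at-L) l l≤ ⨾
    run-drain φ {ctx = λ r → ctx [] r w []} (cong (λ f r → f [] r w []) at-R) r r≤ ⨾
    run-transfer φ {ctx = λ s t → ctx [] [] s t} (cong (λ f → f [] []) at-s) (cong (λ f → f [] []) at-T) w w≤ ⨾
      run-starts (cong (ctx [] [] []) (sym (List.map-id (w ʳ++ []))))
        (run-ends (cong (λ s → ctx [] (proj₂ s) (proj₁ s) []) copied)
          (run-scan-all φ {σ = List (Cell Aux) × List (Cell Aux)} {e = id} {ctx = λ t s → ctx [] (proj₂ s) (proj₁ s) t}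
            (cong (λ f t s → f [] (proj₂ s) (proj₁ s) t) at-T) copyBoth (λ _ _ → ⊤) 5 (λ _ → refl)
            (λ {_} {s} c t _ → copy c t (proj₁ s) (proj₂ s) , tt)
            (w ʳ++ []) (length-rev w w≤) tt))
    where
    at-s′ : ∀ r t → Lens source (λ s → ctx [] r s t)
    at-s′ r t = cong (λ f s → f [] r s t) at-s
    at-R′ : ∀ s t → Lens R (λ r → ctx [] r s t)
    at-R′ s t = cong (λ f r → f [] r s t) at-R
    copy : ∀ c t s r → Run φ (push source c (push R c (ret tt))) (ctx [] r s t) 5 tt (ctx [] (c ∷ r) (c ∷ s) t)
    copy c t s r = run-push (get (at-s′ r t) s) (put (at-s′ r t) s (c ∷ s))
      (run-push (get (at-R′ (c ∷ s) t) r) (put (at-R′ (c ∷ s) t) r (c ∷ r)) ret)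
    undo : (w ʳ++ []) ʳ++ [] ≡ w
    undo = trans (ʳ++-undo w []) (List.++-identityʳ w)
    copied : List.foldl copyBoth ([] , []) (w ʳ++ []) ≡ (w , w)
    copied = trans (foldl-copyBoth (w ʳ++ []) [] []) (cong₂ _,_ undo undo)

  tapeK : Sides → Tape K.Aux
  tapeK = tapeOf K outlCell inlCell outl-inl

  tapeG : Sides → Tape G.Aux
  tapeG = tapeOf G outrCell inrCell outr-inr

  tapeK-load : ∀ w → tapeK ([] , List.map symbol w) ≡ load w
  tapeK-load []      = refl
  tapeK-load (s ∷ w) = cong (tape [] (symbol s)) (sym (List.map-∘ w))

  tapeG-load : ∀ w → tapeG ([] , List.map symbol w) ≡ load w
  tapeG-load []      = refl
  tapeG-load (s ∷ w) = cong (tape [] (symbol s)) (sym (List.map-∘ w))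

  symbols-outl : ∀ cs → symbols (List.map (outlCell {K.Aux} {G.Aux}) cs) ≡ symbols cs
  symbols-outl []                  = refl
  symbols-outl (blank ∷ cs)        = refl
  symbols-outl (symbol s ∷ cs)     = cong (s ∷_) (symbols-outl cs)
  symbols-outl (aux (inj₁ _) ∷ cs) = refl
  symbols-outl (aux (inj₂ _) ∷ cs) = refl

  symbols-outr : ∀ cs → symbols (List.map (outrCell {K.Aux} {G.Aux}) cs) ≡ symbols cs
  symbols-outr []                  = refl
  symbols-outr (blank ∷ cs)        = refl
  symbols-outr (symbol s ∷ cs)     = cong (s ∷_) (symbols-outr cs)
  symbols-outr (aux (inj₁ _) ∷ cs) = refl
  symbols-outr (aux (inj₂ _) ∷ cs) = refl

  contents-tapeK : ∀ l r → contents (tapeK (l , r)) ≡ symbols r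
  contents-tapeK l []      = refl
  contents-tapeK l (c ∷ r) = symbols-outl (c ∷ r)

  contents-tapeG : ∀ l r → contents (tapeG (l , r)) ≡ symbols r
  contents-tapeG l []      = refl
  contents-tapeG l (c ∷ r) = symbols-outr (c ∷ r)

  length-symbols : ∀ (cs : List (Cell Aux)) → length (symbols cs) ≤ length cs
  length-symbols []              = z≤n
  length-symbols (blank ∷ cs)    = z≤n
  length-symbols (aux _ ∷ cs)    = z≤n
  length-symbols (symbol s ∷ cs) = s≤s (length-symbols cs)

  -- The bound on the length of the output is what later bounds the number of digits of the
  -- Lipschitz constant, and with it the precision `m`.
  run-simulateK : ∀ i q ψ l T {N w} → l ≤ N → OracleTM.result K ψ (unary l) T ≡ just w →
    Σ[ k₀ ∈ Sides ] Σ[ l₁ ∈ List (Cell Aux) ] Σ[ r₁ ∈ List (Cell Aux) ] Σ[ kw ∈ Vec Sides K.work ] (symbols r₁ ≡ w × length w ≤ T * 2 + N ×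
    Run φ simulateK (raw i [] q [] [] [] [] [] [] [] (([] , replicate l one) ∷ Vec.replicate _ ([] , [])) gEmpty) (simKTime T) tt
      (raw i [] q [] [] [] [] [] [] [] (k₀ ∷ (l₁ , r₁) ∷ kw) gEmpty))
  run-simulateK i q ψ l T {N} l≤N eq =
    let ts , run≡ , out≡ = halted {M = K} (OracleTM.run K ψ T (K.start , OracleTM.initial K (unary l))) eq
        kb , run , tapes≡ , kb≤ = run-simulate K outlCell inlCell outl-inl φ (blockK i [] q [] [] [] [] [] [] [] gEmpty)
          ψ replyK 2 (λ _ → 0) ℕ.≤-refl (λ ()) T K.start N start bounded₀
          (trans (cong (λ ts → OracleTM.run K ψ T (K.start , ts)) tapes₀) run≡)
    in finish kb kb≤ (trans (cong (OracleTM.output K) tapes≡) out≡)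
         (weaken (simulationTime-bound K outlCell inlCell outl-inl φ (blockK i [] q [] [] [] [] [] [] [] gEmpty)
           ψ replyK 2 (λ _ → 0) ℕ.≤-refl (λ ()) (λ _ → z≤n) T N) run)
    where
    start : Vec Sides K.tapes
    start = ([] , replicate l one) ∷ Vec.replicate _ ([] , [])
    tapes₀ : Vec.map tapeK start ≡ OracleTM.initial K (unary l)
    tapes₀ = cong₂ _∷_ (trans (cong (λ r → tapeK ([] , r)) (sym (List.map-replicate symbol l (bit true)))) (tapeK-load (unary l)))
      (Vec.map-replicate tapeK ([] , []) _)
    bounded₀ : Bounded N start
    bounded₀ zero    = z≤n , subst (_≤ N) (sym (List.length-replicate l)) l≤N
    bounded₀ (suc j) = subst (λ p → length (proj₁ p) ≤ N × length (proj₂ p) ≤ N) (sym (Vec.lookup-replicate j _)) (z≤n , z≤n)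
    finish : ∀ kb {w t} → Bounded (T * 2 + N) kb → OracleTM.output K (Vec.map tapeK kb) ≡ w →
      Run φ simulateK (raw i [] q [] [] [] [] [] [] [] start gEmpty) t tt (raw i [] q [] [] [] [] [] [] [] kb gEmpty) →
      Σ[ k₀ ∈ Sides ] Σ[ l₁ ∈ List (Cell Aux) ] Σ[ r₁ ∈ List (Cell Aux) ] Σ[ kw ∈ Vec Sides K.work ] (symbols r₁ ≡ w × length w ≤ T * 2 + N ×
      Run φ simulateK (raw i [] q [] [] [] [] [] [] [] start gEmpty) t tt (raw i [] q [] [] [] [] [] [] [] (k₀ ∷ (l₁ , r₁) ∷ kw) gEmpty))
    finish (k₀ ∷ (l₁ , r₁) ∷ kw) kb≤ out≡ run = k₀ , l₁ , r₁ , kw , w≡ ,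
      subst (λ w → length w ≤ T * 2 + N) w≡ (ℕ.≤-trans (length-symbols r₁) (proj₂ (kb≤ 1F))) , run
      where w≡ = trans (sym (contents-tapeK l₁ r₁)) out≡

  refillTime-mono : ∀ s {k l} → k ≤ l → refillTime s k ≤ refillTime s l
  refillTime-mono s le = ℕ.+-mono-≤ (ℕ.+-monoˡ-≤ 2 (ℕ.*-monoˡ-≤ 3 le))
    (ℕ.+-monoˡ-≤ ((s * 5 + 2) + (s * 7 + 2)) (ℕ.+-monoˡ-≤ 2 (ℕ.*-monoˡ-≤ 3 le)))

  module _ (q d : List (Cell Aux)) (kb : Vec Sides K.tapes) (a b : 𝔻) (s : ℕ) (2≤s : 2 ≤ s)
           (a≤s : length (encode𝔻 a) ≤ s) (b≤s : length (encode𝔻 b) ≤ s) where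

    private
      store : Vec Sides G.tapes → Store
      store = raw [] [] q [] [] d (List.map symbol (encode𝔻 a)) (List.map symbol (encode𝔻 b)) [] [] kb

    run-replyG : ∀ i t k → Bounded k t → Σ[ t′ ∈ Vec Sides G.tapes ]
      (Run φ (replyG i) (store t) (refillTime s k) tt (store t′) ×
       Vec.map tapeG t′ ≡ OracleTM.ask G (constants a b) i (Vec.map tapeG t) × Bounded (s + k) t′)
    run-replyG i t k t≤k = go i kb t t≤k
      where
      ea eb : List (Cell Aux)
      ea = List.map symbol (encode𝔻 a)
      eb = List.map symbol (encode𝔻 b)
      cells≤ : ∀ {x} → length (encode𝔻 x) ≤ s → length (List.map (symbol {Aux}) (encode𝔻 x)) ≤ s
      cells≤ {x} = subst (_≤ s) (sym (List.length-map symbol (encode𝔻 x)))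
      grow : ∀ {p : Sides} → length (proj₁ p) ≤ k × length (proj₂ p) ≤ k → length (proj₁ p) ≤ s + k × length (proj₂ p) ≤ s + k
      grow (l≤ , r≤) = ℕ.m≤n⇒m≤o+n s l≤ , ℕ.m≤n⇒m≤o+n s r≤
      go : ∀ i kb t → Bounded k t → Σ[ t′ ∈ Vec Sides G.tapes ]
        (Run φ (replyG i) (raw [] [] q [] [] d ea eb [] [] kb t) (refillTime s k) tt (raw [] [] q [] [] d ea eb [] [] kb t′) ×
         Vec.map tapeG t′ ≡ OracleTM.ask G (constants a b) i (Vec.map tapeG t) × Bounded (s + k) t′)
      go 0F (k₀ ∷ k₁ ∷ kw) (g₀ ∷ g₁ ∷ (l , r) ∷ g₃ ∷ gw) t≤k =
          g₀ ∷ g₁ ∷ ([] , ea) ∷ g₃ ∷ gw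
        , run-refill {ctx = λ l r s t → raw [] [] q [] [] d s eb t [] (k₀ ∷ k₁ ∷ kw) (g₀ ∷ g₁ ∷ (l , r) ∷ g₃ ∷ gw)}
            refl refl
            refl refl
            l r ea (proj₁ (t≤k 2F)) (proj₂ (t≤k 2F)) (cells≤ {a} a≤s)
        , cong (λ T → tapeG g₀ ∷ tapeG g₁ ∷ T ∷ tapeG g₃ ∷ Vec.map tapeG gw) (tapeG-load (encode𝔻 a))
        , λ { 0F → grow {g₀} (t≤k 0F) ; 1F → grow {g₁} (t≤k 1F) ; 2F → z≤n , ℕ.≤-trans (cells≤ {a} a≤s) (ℕ.m≤m+n s k)
            ; 3F → grow {g₃} (t≤k 3F) ; (suc (suc (suc (suc j)))) → grow {lookup gw j} (t≤k (suc (suc (suc (suc j))))) }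
      go 1F (k₀ ∷ k₁ ∷ kw) (g₀ ∷ g₁ ∷ g₂ ∷ (l , r) ∷ gw) t≤k =
          g₀ ∷ g₁ ∷ g₂ ∷ ([] , eb) ∷ gw
        , run-refill {ctx = λ l r s t → raw [] [] q [] [] d ea s t [] (k₀ ∷ k₁ ∷ kw) (g₀ ∷ g₁ ∷ g₂ ∷ (l , r) ∷ gw)}
            refl refl
            refl refl
            l r eb (proj₁ (t≤k 3F)) (proj₂ (t≤k 3F)) (cells≤ {b} b≤s)
        , cong (λ T → tapeG g₀ ∷ tapeG g₁ ∷ tapeG g₂ ∷ T ∷ Vec.map tapeG gw) (tapeG-load (encode𝔻 b))
        , λ { 0F → grow {g₀} (t≤k 0F) ; 1F → grow {g₁} (t≤k 1F) ; 2F → grow {g₂} (t≤k 2F)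
            ; 3F → z≤n , ℕ.≤-trans (cells≤ {b} b≤s) (ℕ.m≤m+n s k)
            ; (suc (suc (suc (suc j)))) → grow {lookup gw j} (t≤k (suc (suc (suc (suc j))))) }

    run-simulateG : ∀ T {w} → OracleTM.result G (constants a b) [] T ≡ just w →
      Σ[ g₀ ∈ Sides ] Σ[ l₁ ∈ List (Cell Aux) ] Σ[ r₁ ∈ List (Cell Aux) ] Σ[ gw ∈ Vec Sides (2 + G.work) ] (symbols r₁ ≡ w ×
      length r₁ ≤ T * s + 0 × Run φ simulateG (store gEmpty) (simGTime s T) tt (store (g₀ ∷ (l₁ , r₁) ∷ gw)))
    run-simulateG T eq =
      let ts , run≡ , out≡ = halted {M = G} (OracleTM.run G (constants a b) T (G.start , OracleTM.initial G [])) eq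
          gb , run , tapes≡ , gb≤ = run-simulate G outrCell inrCell outr-inr φ block (constants a b) replyG s (refillTime s) 2≤s run-replyG
            T G.start 0 gEmpty bounded₀
            (trans (cong (λ ts → OracleTM.run G (constants a b) T (G.start , ts)) tapes₀) run≡)
      in finish gb gb≤ (trans (cong (OracleTM.output G) tapes≡) out≡)
           (weaken (simulationTime-bound G outrCell inrCell outr-inr φ block (constants a b) replyG s (refillTime s) 2≤s run-replyG
             (refillTime-mono s) T 0) run)
      where
      block = blockG [] [] q [] [] d (List.map symbol (encode𝔻 a)) (List.map symbol (encode𝔻 b)) [] [] kb
      tapes₀ : Vec.map tapeG gEmpty ≡ OracleTM.initial G []
      tapes₀ = Vec.map-replicate tapeG ([] , []) _
      bounded₀ : Bounded 0 gEmpty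
      bounded₀ j = subst (λ p → length (proj₁ p) ≤ 0 × length (proj₂ p) ≤ 0) (sym (Vec.lookup-replicate j _)) (z≤n , z≤n)
      finish : ∀ gb {w t} → Bounded (T * s + 0) gb → OracleTM.output G (Vec.map tapeG gb) ≡ w →
        Run φ simulateG (store gEmpty) t tt (store gb) →
        Σ[ g₀ ∈ Sides ] Σ[ l₁ ∈ List (Cell Aux) ] Σ[ r₁ ∈ List (Cell Aux) ] Σ[ gw ∈ Vec Sides (2 + G.work) ] (symbols r₁ ≡ w ×
        length r₁ ≤ T * s + 0 × Run φ simulateG (store gEmpty) t tt (store (g₀ ∷ (l₁ , r₁) ∷ gw)))
      finish (g₀ ∷ (l₁ , r₁) ∷ gw) gb≤ out≡ run =
        g₀ , l₁ , r₁ , gw , trans (sym (contents-tapeG l₁ r₁)) out≡ , proj₂ (gb≤ 1F) , run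

  replicate-++ : ∀ k l → Vec.replicate k [] Vec.++ Vec.replicate l [] ≡ Vec.replicate {A = List (Cell Aux)} (k + l) []
  replicate-++ zero    l = refl
  replicate-++ (suc k) l = cong ([] ∷_) (replicate-++ k l)

  length-power : ∀ m {N} → m ≤ N → length (encode𝔻 (+ (2 ^ suc m) /2^ 0)) ≤ digitsSize N + 3
  length-power m {N} m≤N = begin
    length (encode𝔻 (+ (2 ^ suc m) /2^ 0))                                 ≡⟨ List.length-map (symbol {Aux}) (encode𝔻 (+ (2 ^ suc m) /2^ 0)) ⟨
    length (List.map (symbol {Aux}) (encode𝔻 (+ (2 ^ suc m) /2^ 0)))       ≡⟨ cong length (powerCells (suc m)) ⟨
    suc (length (replicate (suc m) zero′ ++ [ symbol point ]))
      ≡⟨ cong suc (trans (List.length-++ (replicate (suc m) zero′)) (cong (_+ 1) (List.length-replicate (suc m)))) ⟩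
    suc (suc m + 1)                                    ≤⟨ s≤s (ℕ.+-monoˡ-≤ 1 (s≤s m≤N)) ⟩
    suc (suc N + 1)                                    ≤⟨ s≤s (ℕ.+-monoˡ-≤ 1 (ℕ.m≤n+m (suc N) N)) ⟩
    suc (digitsSize N + 1)                             ≡⟨ ℕ.+-suc (digitsSize N) 1 ⟨
    digitsSize N + 2                                   ≤⟨ ℕ.+-monoʳ-≤ (digitsSize N) (ℕ.n≤1+n 2) ⟩
    digitsSize N + 3                                   ∎
    where open ℕ.≤-Reasoning

  module _ (n : ℕ) (ψ : Fin 0 → ℕ → 𝔻) (k : ℕ) where

    private
      d₀ = φ 0F 0
      m = guard n (length (reverse (bits k)))
      d₁ = φ 0F m
      a b : 𝔻
      a = approximant m d₁ /2^ 0
      b = + (2 ^ suc m) /2^ 0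

    outputs-program : ∀ TK TG N z → 2 + length (intDigits d₀) ≤ N → m ≤ N → length (intDigits d₁) ≤ N →
      OracleTM.result K ψ (unary (2 + length (intDigits d₀))) TK ≡ just (binary k) →
      OracleTM.result G (constants a b) [] TG ≡ just (encode𝔻 z) →
      Outputs φ program (unary n) (totalTime N TK TG) (encode𝔻 (shiftExponent (suc m) z))
    outputs-program TK TG N z L≤N m≤N I≤N resK resG =
      afterK (run-simulateK (List.map symbol (unary n)) or ψ (2 + length (intDigits d₀)) TK L≤N resK)
      where
      or : List (Cell Aux)
      or = bitCells (fracDigits d₀)
      s = digitsSize N + 3
      ea eb c₃ : List (Cell Aux)
      ea = List.map symbol (encode𝔻 a)
      eb = List.map symbol (encode𝔻 b)
      c₃ = replicate (suc m) one
      b≤ : length (encode𝔻 b) ≤ digitsSize N + 3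
      b≤ = length-power m m≤N
      start≡ : initialStore (unary n) ≡ raw (List.map symbol (unary n)) [] [] [] [] [] [] [] [] [] (Vec.replicate _ ([] , [])) gEmpty
      start≡ = cong (λ v → List.map symbol (unary n) ∷ [] ∷ [] ∷ [] ∷ [] ∷ [] ∷ [] ∷ [] ∷ [] ∷ [] ∷ [] ∷ [] ∷ [] ∷ [] ∷
          [] ∷ [] ∷ [] ∷ [] ∷ [] ∷ [] ∷ [] ∷ [] ∷ v)
        (sym (trans (cong₂ Vec._++_ (flat-empty K.work) (flat-empty G.work)) (replicate-++ (double K.work) (double G.work))))
      Final : Store → Set
      Final S = lookup S OUT ≡ List.map symbol (encode𝔻 (shiftExponent (suc m) z))
      lookup-OUT : ∀ o q n c d a b t u kb gb → lookup (raw [] o q n c d a b t u kb gb) OUT ≡ o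
      lookup-OUT o q n c d a b t u (_ ∷ _ ∷ _) (_ ∷ _ ∷ _ ∷ _ ∷ _) = refl
      t₁ t₂ : ℕ
      t₁ = simGTime s TG + deliverTime N (TG * s + 0)
      t₂ = approximateTime N + t₁
      K₀ : Store
      K₀ = raw (List.map symbol (unary n)) [] or [] [] [] [] [] [] [] (([] , replicate (2 + length (intDigits d₀)) one) ∷ Vec.replicate _ ([] , [])) gEmpty
      A₀ : Vec Sides K.tapes → Store
      A₀ kb = raw [] [] (List.map symbol (encode𝔻 d₁)) [] (replicate m one) c₃ [] eb [] [] kb gEmpty
      G₀ : List (Cell Aux) → Vec Sides K.tapes → Vec Sides G.tapes → Store
      G₀ q = raw [] [] q [] [] c₃ ea eb [] []
      D₀ : List (Cell Aux) → Vec Sides K.tapes → Vec Sides G.tapes → Store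
      D₀ q = raw [] (List.map symbol (encode𝔻 (shiftExponent (suc m) z))) q [] [] [] ea eb [] []
      finish : ∀ k₀ l₁ r₁ kw r₁′ → Run φ simulateK K₀ (simKTime TK) tt (raw (List.map symbol (unary n)) [] or [] [] [] [] [] [] [] (k₀ ∷ (l₁ , r₁) ∷ kw) gEmpty) →
        Run φ precision (raw (List.map symbol (unary n)) [] or [] [] [] [] [] [] [] (k₀ ∷ (l₁ , r₁) ∷ kw) gEmpty) (precisionTime N) tt
          (raw [] [] (replicate m one ++ symbol sep ∷ or) [] (replicate m one) c₃ [] (one ∷ replicate (suc m) zero′ ++ [ symbol point ]) [] [] (k₀ ∷ (l₁ , r₁′) ∷ kw) gEmpty) →
        ∀ S′ → Run φ (approximate >> (simulateG >> deliver)) (A₀ (k₀ ∷ (l₁ , r₁′) ∷ kw)) t₂ tt S′ → Final S′ →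
        Outputs φ program (unary n) (totalTime N TK TG) (encode𝔻 (shiftExponent (suc m) z))
      finish k₀ l₁ r₁ kw r₁′ runK runP S′ run final≡ = run-outputs
        (run-starts start≡
        (call (run-magnitude (List.map symbol (unary n)) d₀ (Vec.replicate _ ([] , [])) (ℕ.≤-trans (ℕ.m≤n+m _ 2) L≤N) ⨾
        runK ⨾
        run-ends (cong (λ b → raw [] [] (replicate m one ++ symbol sep ∷ or) [] (replicate m one) c₃ [] b [] [] (k₀ ∷ (l₁ , r₁′) ∷ kw) gEmpty)
                          (powerCells (suc m))) runP ⨾
        -- The separator ends the count of leading ones, so the query asks for precision `m`
        -- exactly.
        call (run-starts (cong (λ j → raw [] [] (List.map symbol (encode𝔻 (φ 0F j))) [] (replicate m one) c₃ [] eb [] [] (k₀ ∷ (l₁ , r₁′) ∷ kw) gEmpty)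
                            (leadingOnes-ones {Aux} m (symbol sep ∷ or) refl)) run))))
        (trans (cong symbols final≡) (symbols-map _))
      afterK : (Σ[ k₀ ∈ Sides ] Σ[ l₁ ∈ List (Cell Aux) ] Σ[ r₁ ∈ List (Cell Aux) ] Σ[ kw ∈ Vec Sides K.work ] (symbols r₁ ≡ binary k × length (binary k) ≤ TK * 2 + N ×
        Run φ simulateK K₀ (simKTime TK) tt (raw (List.map symbol (unary n)) [] or [] [] [] [] [] [] [] (k₀ ∷ (l₁ , r₁) ∷ kw) gEmpty))) →
        Outputs φ program (unary n) (totalTime N TK TG) (encode𝔻 (shiftExponent (suc m) z))
      afterK (k₀ , l₁ , r₁ , kw , out≡ , _ , runK) = afterP (run-precision n or k₀ l₁ r₁ kw (reverse (bits k)) {N} out≡ m≤N)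
        where
        afterP : (Σ[ r₁′ ∈ List (Cell Aux) ]
          Run φ precision (raw (List.map symbol (unary n)) [] or [] [] [] [] [] [] [] (k₀ ∷ (l₁ , r₁) ∷ kw) gEmpty) (precisionTime N) tt
            (raw [] [] (replicate m one ++ symbol sep ∷ or) [] (replicate m one) c₃ [] (one ∷ replicate (suc m) zero′ ++ [ symbol point ]) [] [] (k₀ ∷ (l₁ , r₁′) ∷ kw) gEmpty)) →
          Outputs φ program (unary n) (totalTime N TK TG) (encode𝔻 (shiftExponent (suc m) z))
        afterP (r₁′ , runP) = afterA (run-approximate c₃ eb (k₀ ∷ (l₁ , r₁′) ∷ kw) m d₁ {N} I≤N m≤N)
          where
          kb = k₀ ∷ (l₁ , r₁′) ∷ kw
          afterA : (Σ[ q ∈ List (Cell Aux) ] (Run φ approximate (A₀ kb) (approximateTime N) tt (G₀ q kb gEmpty) × length (encode𝔻 a) ≤ s)) →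
            Outputs φ program (unary n) (totalTime N TK TG) (encode𝔻 (shiftExponent (suc m) z))
          afterA (q , runA , a≤) = afterG (run-simulateG q c₃ kb a b s (ℕ.≤-trans (s≤s (s≤s z≤n)) (ℕ.m≤n+m 3 (digitsSize N))) a≤ b≤ TG resG)
            where
            afterG : (Σ[ g₀ ∈ Sides ] Σ[ gl ∈ List (Cell Aux) ] Σ[ gr ∈ List (Cell Aux) ] Σ[ gw ∈ Vec Sides (2 + G.work) ]
              (symbols gr ≡ encode𝔻 z × length gr ≤ TG * s + 0 ×
               Run φ simulateG (G₀ q kb gEmpty) (simGTime s TG) tt (G₀ q kb (g₀ ∷ (gl , gr) ∷ gw)))) →
              Outputs φ program (unary n) (totalTime N TK TG) (encode𝔻 (shiftExponent (suc m) z))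
            afterG (g₀ , gl , gr , gw , outG , gr≤ , runG) = afterD (run-deliver q ea eb kb m z g₀ gl gr gw {N} m≤N gr≤ outG)
              where
              afterD : (Σ[ gr′ ∈ List (Cell Aux) ] Run φ deliver (G₀ q kb (g₀ ∷ (gl , gr) ∷ gw)) (deliverTime N (TG * s + 0)) tt (D₀ q kb (g₀ ∷ (gl , gr′) ∷ gw))) →
                Outputs φ program (unary n) (totalTime N TK TG) (encode𝔻 (shiftExponent (suc m) z))
              afterD (gr′ , runD) = finish k₀ l₁ r₁ kw r₁′ runK runP (D₀ q kb (g₀ ∷ (gl , gr′) ∷ gw))
                (runA ⨾ runG ⨾ runD) (lookup-OUT _ q [] [] [] ea eb [] [] kb (g₀ ∷ (gl , gr′) ∷ gw))

  -- A machine cannot write more than it has time for, so a polytime sequence has polynomially many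
  -- digits.
  length-resultK : ∀ ψ l T {w} → OracleTM.result K ψ (unary l) T ≡ just w → length w ≤ T * 2 + l
  length-resultK ψ l T eq = let _ , _ , _ , _ , _ , w≤ , _ = run-simulateK [] [] ψ l T ℕ.≤-refl eq in w≤

-- Approximation of reals

ℚ-ring : AlmostCommutativeRing _ _
ℚ-ring = fromCommutativeRing ℚ.+-*-commutativeRing λ p → dec⇒maybe (0ℚ ℚ.≟ p)

frac : ℤ → (d : ℕ) → .{{NonZero d}} → ℚ
frac a d = a ℚ./ d

toℚᵘ-frac : ∀ a d-1 → ℚ.toℚᵘ (frac a (suc d-1)) ℚᵘ.≃ mkℚᵘ a d-1
toℚᵘ-frac a d-1 = ℚ.toℚᵘ-fromℚᵘ (mkℚᵘ a d-1)

frac-≤ : ∀ a d c f .{{_ : NonZero d}} .{{_ : NonZero f}} → a ℤ.* + f ℤ.≤ c ℤ.* + d → frac a d ℚ.≤ frac c f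
frac-≤ a (suc d) c (suc f) le = ℚ.toℚᵘ-cancel-≤
  (ℚᵘ.≤-respˡ-≃ (ℚᵘ.≃-sym (toℚᵘ-frac a d)) (ℚᵘ.≤-respʳ-≃ (ℚᵘ.≃-sym (toℚᵘ-frac c f)) (*≤* le)))

frac-≤⁻¹ : ∀ a d c f .{{_ : NonZero d}} .{{_ : NonZero f}} → frac a d ℚ.≤ frac c f → a ℤ.* + f ℤ.≤ c ℤ.* + d
frac-≤⁻¹ a (suc d) c (suc f) le
  with *≤* le′ ← ℚᵘ.≤-respˡ-≃ (toℚᵘ-frac a d) (ℚᵘ.≤-respʳ-≃ (toℚᵘ-frac c f) (ℚ.toℚᵘ-mono-≤ le)) = le′

frac-+-≤ : ∀ a d b e c f .{{_ : NonZero d}} .{{_ : NonZero e}} .{{_ : NonZero f}} →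
  (a ℤ.* + e ℤ.+ b ℤ.* + d) ℤ.* + f ℤ.≤ c ℤ.* (+ d ℤ.* + e) → frac a d ℚ.+ frac b e ℚ.≤ frac c f
frac-+-≤ a (suc d) b (suc e) c (suc f) le = ℚ.toℚᵘ-cancel-≤
  (ℚᵘ.≤-respˡ-≃ (ℚᵘ.≃-sym (ℚᵘ.≃-trans (ℚ.toℚᵘ-homo-+ (frac a (suc d)) (frac b (suc e))) (ℚᵘ.+-cong (toℚᵘ-frac a d) (toℚᵘ-frac b e))))
    (ℚᵘ.≤-respʳ-≃ (ℚᵘ.≃-sym (toℚᵘ-frac c f)) (*≤* le)))

-- Reduces an estimate between fractions to one between natural numbers. The denominators are
-- cleared in the unnormalised rationals, where they are still visible.
frac-near : ∀ a d b e c f .{{_ : NonZero d}} .{{_ : NonZero e}} .{{_ : NonZero f}} →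
  ℤ.∣ a ℤ.* + e ℤ.- b ℤ.* + d ∣ * f ≤ c * (d * e) → ℚ.∣ frac a d ℚ.- frac b e ∣ ℚ.≤ frac (+ c) f
frac-near a (suc d) b (suc e) c (suc f) le = ℚ.toℚᵘ-cancel-≤
  (ℚᵘ.≤-respˡ-≃ (ℚᵘ.≃-sym left≃) (ℚᵘ.≤-respʳ-≃ (ℚᵘ.≃-sym (toℚᵘ-frac (+ c) f)) (*≤* le′)))
  where
  left≃ : ℚ.toℚᵘ ℚ.∣ frac a (suc d) ℚ.- frac b (suc e) ∣ ℚᵘ.≃ ℚᵘ.∣ mkℚᵘ a d ℚᵘ.- mkℚᵘ b e ∣
  left≃ = ℚᵘ.≃-trans (ℚ.toℚᵘ-homo-∣-∣ (frac a (suc d) ℚ.- frac b (suc e))) (ℚᵘ.∣-∣-cong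
    (ℚᵘ.≃-trans (ℚ.toℚᵘ-homo-+ (frac a (suc d)) (ℚ.- frac b (suc e)))
      (ℚᵘ.+-cong (toℚᵘ-frac a d) (ℚᵘ.≃-trans (ℚ.toℚᵘ-homo‿- (frac b (suc e))) (ℚᵘ.-‿cong (toℚᵘ-frac b e))))))
  num≡ : a ℤ.* + suc e ℤ.+ (ℤ.- b) ℤ.* + suc d ≡ a ℤ.* + suc e ℤ.- b ℤ.* + suc d
  num≡ = cong (λ i → a ℤ.* + suc e ℤ.+ i) (sym (ℤ.neg-distribˡ-* b (+ suc d)))
  le′ : + ℤ.∣ a ℤ.* + suc e ℤ.+ (ℤ.- b) ℤ.* + suc d ∣ ℤ.* + suc f ℤ.≤ + c ℤ.* + (suc d * suc e)
  le′ rewrite num≡ = subst₂ (sym (ℤ.pos-* ℤ.∣ a ℤ.* + suc e ℤ.- b ℤ.* + suc d ∣ (suc f))) (sym (ℤ.pos-* c (suc d * suc e))) (+≤+ le)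
    where
    subst₂ : ∀ {a b c d : ℤ} → a ≡ b → c ≡ d → b ℤ.≤ d → a ℤ.≤ c
    subst₂ refl refl le = le

frac-* : ∀ k a d .{{_ : NonZero d}} → frac k 1 ℚ.* frac a d ≡ frac (k ℤ.* a) d
frac-* k a (suc d) = ℚ.toℚᵘ-injective (ℚᵘ.≃-trans
  (ℚᵘ.≃-trans (ℚ.toℚᵘ-homo-* (frac k 1) (frac a (suc d))) (ℚᵘ.*-cong (toℚᵘ-frac k 0) (toℚᵘ-frac a d)))
  (ℚᵘ.≃-trans (*≡* (cong (λ n → (k ℤ.* a) ℤ.* + suc n) (sym (ℕ.+-identityʳ d)))) (ℚᵘ.≃-sym (toℚᵘ-frac (k ℤ.* a) d))))

frac-nonNeg : ∀ n d .{{_ : NonZero d}} → 0ℚ ℚ.≤ frac (+ n) d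
frac-nonNeg n d = frac-≤ (+ 0) 1 (+ n) d (subst (+ 0 ℤ.≤_) (sym (ℤ.*-identityʳ (+ n))) (+≤+ z≤n))

∣m⊖n∣≤ : ∀ m n {c} → m ≤ n + c → n ≤ m + c → ℤ.∣ m ℤ.⊖ n ∣ ≤ c
∣m⊖n∣≤ m n m≤ n≤ with ℕ.≤-total m n
... | inj₁ m≤n = subst (_≤ _) (sym (ℤ.∣⊖∣-≤ m≤n)) (ℕ.m≤n+o⇒m∸n≤o n m n≤)
... | inj₂ n≤m = subst (_≤ _) (sym (trans (ℤ.∣m⊖n∣≡∣n⊖m∣ m n) (ℤ.∣⊖∣-≤ n≤m))) (ℕ.m≤n+o⇒m∸n≤o m n m≤)

signed-true : ∀ n → signed true n ≡ ℤ.- (+ n)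
signed-true zero    = refl
signed-true (suc n) = refl

-- Both numbers carry the same sign, so comparing the absolute values in both directions suffices.
signed-diff : ∀ neg a b c d {e} → a * b ≤ c * d + e → c * d ≤ a * b + e →
  ℤ.∣ signed neg a ℤ.* + b ℤ.- signed neg c ℤ.* + d ∣ ≤ e
signed-diff false a b c d p q = subst (_≤ _)
  (cong ℤ.∣_∣ (trans (sym (ℤ.m-n≡m⊖n (a * b) (c * d))) (cong₂ (λ m n → m ℤ.- n) (ℤ.pos-* a b) (ℤ.pos-* c d))))
  (∣m⊖n∣≤ (a * b) (c * d) p q)
signed-diff true  a b c d p q = subst (_≤ _)
  (trans (sym (ℤ.∣-i∣≡∣i∣ (+ a ℤ.* + b ℤ.- + c ℤ.* + d)))
    (cong ℤ.∣_∣ (trans (flip (+ a) (+ b) (+ c) (+ d))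
      (cong₂ (λ i j → i ℤ.* + b ℤ.- j ℤ.* + d) (sym (signed-true a)) (sym (signed-true c))))))
  (signed-diff false a b c d p q)
  where
  flip : ∀ a b c d → ℤ.- (a ℤ.* b ℤ.- c ℤ.* d) ≡ (ℤ.- a) ℤ.* b ℤ.- (ℤ.- c) ℤ.* d
  flip = ℤ-Solver.solve-∀

-- The number obtained from A / d by keeping the first m fractional digits, here
-- the integer q, and putting the digit 1 behind them.
half-digit : ∀ neg A d q m .{{_ : NonZero d}} → q * d ≤ A * 2 ^ m → A * 2 ^ m ≤ suc q * d →
  ℚ.∣ frac (signed neg A) d ℚ.- toℚ (signed neg (suc (2 * q)) /2^ suc m) ∣ ℚ.≤ toℚ (+ 1 /2^ m)
half-digit neg A d q m p r = frac-near (signed neg A) d (signed neg (suc (2 * q))) (2 ^ suc m) 1 (2 ^ m)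
  {{_}} {{ℕ.m^n≢0 2 (suc m)}} {{ℕ.m^n≢0 2 m}}
  (ℕ.≤-trans (ℕ.*-monoˡ-≤ (2 ^ m) (signed-diff neg A (2 ^ suc m) (suc (2 * q)) d upper lower))
    (ℕ.≤-reflexive (l₅ d (2 ^ m))))
  where
  open ℕ.≤-Reasoning
  l₁ : ∀ A M → A * (2 * M) ≡ 2 * (A * M)
  l₁ = solve-∀
  l₂ : ∀ q d → 2 * ((1 + q) * d) ≡ (1 + 2 * q) * d + d
  l₂ = solve-∀
  l₃ : ∀ d → d + d ≡ 2 * d
  l₃ = solve-∀
  l₄ : ∀ q d → (1 + 2 * q) * d ≡ 2 * (q * d) + d
  l₄ = solve-∀
  l₅ : ∀ d M → 2 * d * M ≡ 1 * (d * (2 * M))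
  l₅ = solve-∀
  d≤2d : d ≤ 2 * d
  d≤2d = ℕ.m≤m+n d (d + 0)
  upper : A * 2 ^ suc m ≤ suc (2 * q) * d + 2 * d
  upper = begin
    A * 2 ^ suc m          ≡⟨ l₁ A (2 ^ m) ⟩
    2 * (A * 2 ^ m)        ≤⟨ ℕ.*-monoʳ-≤ 2 r ⟩
    2 * (suc q * d)        ≡⟨ l₂ q d ⟩
    suc (2 * q) * d + d    ≤⟨ ℕ.+-monoʳ-≤ (suc (2 * q) * d) d≤2d ⟩
    suc (2 * q) * d + 2 * d ∎
  lower : suc (2 * q) * d ≤ A * 2 ^ suc m + 2 * d
  lower = begin
    suc (2 * q) * d        ≡⟨ l₄ q d ⟩
    2 * (q * d) + d        ≤⟨ ℕ.+-mono-≤ (ℕ.*-monoʳ-≤ 2 p) d≤2d ⟩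
    2 * (A * 2 ^ m) + 2 * d ≡⟨ cong (_+ 2 * d) (l₁ A (2 ^ m)) ⟨
    A * 2 ^ suc m + 2 * d  ∎

record Near (x y : ℝ) (c : ℚ) : Set where
  constructor near
  field
    distance≤ : ℝ.∣ x ℝ.- y ∣ ℝ.≤ fromℚ c
open Near public

private
  half : ℚ → ℚ
  half ε = ½ ℚ.* ε

  half-pos : ∀ ε → .{{Positive ε}} → Positive (half ε)
  half-pos ε = ℚ.pos*pos⇒pos ½ ε

  half+half : ∀ ε → half ε ℚ.+ half ε ≡ ε
  half+half ε = trans (sym (ℚ.*-distribʳ-+ ε ½ ½)) (ℚ.*-identityˡ ε)

  ∣p-q∣-sym : ∀ p q → ℚ.∣ p ℚ.- q ∣ ≡ ℚ.∣ q ℚ.- p ∣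
  ∣p-q∣-sym p q = trans (cong ℚ.∣_∣ (lemma p q)) (ℚ.∣-p∣≡∣p∣ (q ℚ.- p))
    where
    lemma : ∀ p q → p ℚ.- q ≡ ℚ.- (q ℚ.- p)
    lemma = Ring.solve-∀ ℚ-ring

  ∣p-r∣≤ : ∀ p q r → ℚ.∣ p ℚ.- r ∣ ℚ.≤ ℚ.∣ p ℚ.- q ∣ ℚ.+ ℚ.∣ q ℚ.- r ∣
  ∣p-r∣≤ p q r = subst (λ s → ℚ.∣ s ∣ ℚ.≤ ℚ.∣ p ℚ.- q ∣ ℚ.+ ℚ.∣ q ℚ.- r ∣) (lemma p q r)
    (ℚ.∣p+q∣≤∣p∣+∣q∣ (p ℚ.- q) (q ℚ.- r))
    where
    lemma : ∀ p q r → (p ℚ.- q) ℚ.+ (q ℚ.- r) ≡ p ℚ.- r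
    lemma = Ring.solve-∀ ℚ-ring

  regroup : ∀ c e d ε → (c ℚ.+ e) ℚ.+ (d ℚ.+ ε) ≡ (c ℚ.+ d) ℚ.+ (e ℚ.+ ε)
  regroup = Ring.solve-∀ ℚ-ring

near-trans : ∀ {x y z c d} → Near x y c → Near y z d → Near x z (c ℚ.+ d)
near-trans {x} {y} {z} {c} {d} (near xy) (near yz) = near λ ε →
  let M , h = xy (half ε) {{half-pos ε}}
      N , k = yz (half ε) {{half-pos ε}}
  in M + N , λ n le → ℚ.≤-trans (∣p-r∣≤ (seq x n) (seq y n) (seq z n))
       (ℚ.≤-trans (ℚ.+-mono-≤ (h n (ℕ.≤-trans (ℕ.m≤m+n M N) le)) (k n (ℕ.≤-trans (ℕ.m≤n+m N M) le)))
         (ℚ.≤-reflexive (trans (regroup c (half ε) d (half ε)) (cong ((c ℚ.+ d) ℚ.+_) (half+half ε)))))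

near-sym : ∀ {x y c} → Near x y c → Near y x c
near-sym {x} {y} {c} (near xy) = near λ ε → let N , h = xy ε in
  N , λ n le → subst (ℚ._≤ c ℚ.+ ε) (∣p-q∣-sym (seq x n) (seq y n)) (h n le)

near-weaken : ∀ {x y c d} → c ℚ.≤ d → Near x y c → Near x y d
near-weaken c≤d (near xy) = near λ ε → let N , h = xy ε in N , λ n le → ℚ.≤-trans (h n le) (ℚ.+-monoˡ-≤ ε c≤d)

near-ℚ : ∀ {p q c} → ℚ.∣ p ℚ.- q ∣ ℚ.≤ c → Near (fromℚ p) (fromℚ q) c
near-ℚ {c = c} le = near λ ε → 0 , λ _ _ → ℚ.≤-trans le
  (subst (ℚ._≤ c ℚ.+ ε) (ℚ.+-identityʳ c) (ℚ.+-monoʳ-≤ c (ℚ.<⇒≤ (ℚ.positive⁻¹ ε))))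

near-refl : ∀ p → Near (fromℚ p) (fromℚ p) 0ℚ
near-refl p = near-ℚ (ℚ.≤-reflexive (cong ℚ.∣_∣ (ℚ.+-inverseʳ p)))

near-resp : ∀ {x x′ y y′ c} → (∀ n → seq x n ≡ seq x′ n) → (∀ n → seq y n ≡ seq y′ n) → Near x y c → Near x′ y′ c
near-resp {c = c} ex ey (near xy) = near λ ε → let N , h = xy ε in
  N , λ n le → subst (ℚ._≤ c ℚ.+ ε) (cong₂ (λ p q → ℚ.∣ p ℚ.- q ∣) (ex n) (ey n)) (h n le)

≈⇒near : ∀ {x y} → x ≈ y → Near x y 0ℚ
≈⇒near {x} {y} x≈y = near λ ε → let N , h = x≈y ε in
  N , λ n le → ℚ.≤-trans (h n le) (ℚ.≤-reflexive (sym (ℚ.+-identityˡ ε)))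

-- The order of the reals is defined with a slack ε; between rational constants density removes it.
≤+ε⇒≤ : ∀ {p q} → (∀ ε → .{{Positive ε}} → p ℚ.≤ q ℚ.+ ε) → p ℚ.≤ q
≤+ε⇒≤ {p} {q} h = ℚ.≮⇒≥ λ q<p → let m , q<m , m<p = ℚ.<-dense q<p in
  ℚ.<-irrefl refl (ℚ.<-≤-trans m<p (subst (p ℚ.≤_) (lemma q m)
    (h (m ℚ.- q) {{ℚ.positive (subst (ℚ._< m ℚ.- q) (ℚ.+-inverseʳ q) (ℚ.+-monoˡ-< (ℚ.- q) q<m))}})))
  where
  lemma : ∀ q m → q ℚ.+ (m ℚ.- q) ≡ m
  lemma = Ring.solve-∀ ℚ-ring

private
  shrink : ∀ y ε → 0ℚ ℚ.≤ y → .{{Positive ε}} → Σ[ δ ∈ ℚ ] (Positive δ × y ℚ.* δ ℚ.≤ ε)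
  shrink y ε 0≤y = δ , δ>0 , ℚ.≤-trans (ℚ.*-monoʳ-≤-nonNeg δ {{ℚ.pos⇒nonNeg δ {{δ>0}}}} y≤C) (ℚ.≤-reflexive Cδ≡ε)
    where
    C : ℚ
    -- `y` itself may be 0 and could not be inverted.
    C = ℚ.1ℚ ℚ.+ y
    C>0 : Positive C
    C>0 = ℚ.pos+nonNeg⇒pos ℚ.1ℚ y {{ℚ.nonNegative 0≤y}}
    C⁻¹ : ℚ
    C⁻¹ = (ℚ.1/ C) {{ℚ.pos⇒nonZero C {{C>0}}}}
    δ : ℚ
    δ = ε ℚ.* C⁻¹
    δ>0 : Positive δ
    δ>0 = ℚ.pos*pos⇒pos ε C⁻¹ {{ℚ.1/pos⇒pos C {{C>0}}}}
    swap : ∀ C ε D → C ℚ.* (ε ℚ.* D) ≡ ε ℚ.* (C ℚ.* D)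
    swap = Ring.solve-∀ ℚ-ring
    Cδ≡ε : C ℚ.* δ ≡ ε
    Cδ≡ε = trans (swap C ε C⁻¹) (trans (cong (ε ℚ.*_) (ℚ.*-inverseʳ C {{ℚ.pos⇒nonZero C {{C>0}}}})) (ℚ.*-identityʳ ε))
    y≤C : y ℚ.≤ C
    y≤C = subst (ℚ._≤ C) (ℚ.+-identityˡ y) (ℚ.+-monoˡ-≤ y (from-yes (0ℚ ℚ.≤? ℚ.1ℚ)))

near-lipschitz : ∀ {A B x y K c} → 0ℚ ℚ.≤ K → ℝ.∣ A ℝ.- B ∣ ℝ.≤ fromℚ K ℝ.* ℝ.∣ x ℝ.- y ∣ → Near x y c → Near A B (K ℚ.* c)
near-lipschitz {A} {B} {x} {y} {K} {c} 0≤K lip (near xy) = near λ ε →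
  let δ , δ>0 , Kδ≤ = shrink K (half ε) 0≤K {{half-pos ε}}
      M , h = lip (half ε) {{half-pos ε}}
      N , k = xy δ {{δ>0}}
  in M + N , λ n le → chain ε (ℚ.∣ seq A n ℚ.- seq B n ∣) (ℚ.∣ seq x n ℚ.- seq y n ∣) δ
       (h n (ℕ.≤-trans (ℕ.m≤m+n M N) le)) (k n (ℕ.≤-trans (ℕ.m≤n+m N M) le)) Kδ≤
  where
  open ℚ.≤-Reasoning
  chain : ∀ ε a d δ → a ℚ.≤ K ℚ.* d ℚ.+ half ε → d ℚ.≤ c ℚ.+ δ → K ℚ.* δ ℚ.≤ half ε → a ℚ.≤ K ℚ.* c ℚ.+ ε
  chain ε a d δ a≤ d≤ Kδ≤ = begin
    a                                      ≤⟨ a≤ ⟩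
    K ℚ.* d ℚ.+ half ε                     ≤⟨ ℚ.+-monoˡ-≤ (half ε) (ℚ.*-monoˡ-≤-nonNeg K {{ℚ.nonNegative 0≤K}} d≤) ⟩
    K ℚ.* (c ℚ.+ δ) ℚ.+ half ε             ≡⟨ cong (ℚ._+ half ε) (ℚ.*-distribˡ-+ K c δ) ⟩
    (K ℚ.* c ℚ.+ K ℚ.* δ) ℚ.+ half ε       ≤⟨ ℚ.+-monoˡ-≤ (half ε) (ℚ.+-monoʳ-≤ (K ℚ.* c) Kδ≤) ⟩
    (K ℚ.* c ℚ.+ half ε) ℚ.+ half ε        ≡⟨ ℚ.+-assoc (K ℚ.* c) (half ε) (half ε) ⟩
    K ℚ.* c ℚ.+ (half ε ℚ.+ half ε)        ≡⟨ cong (K ℚ.* c ℚ.+_) (half+half ε) ⟩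
    K ℚ.* c ℚ.+ ε                          ∎

-- Multiplication by `k` is a function with Lipschitz constant `k`.
near-scale : ∀ {x y k c} → 0ℚ ℚ.≤ k → Near x y c → Near (fromℚ k ℝ.* x) (fromℚ k ℝ.* y) (k ℚ.* c)
near-scale {x} {y} {k} {c} 0≤k = near-lipschitz {fromℚ k ℝ.* x} {fromℚ k ℝ.* y} {x} {y} {k} {c} 0≤k bound
  where
  lemma : ∀ k x y → k ℚ.* x ℚ.- k ℚ.* y ≡ k ℚ.* (x ℚ.- y)
  lemma = Ring.solve-∀ ℚ-ring
  scaled : ∀ p q → ℚ.∣ k ℚ.* p ℚ.- k ℚ.* q ∣ ≡ k ℚ.* ℚ.∣ p ℚ.- q ∣
  scaled p q = trans (cong ℚ.∣_∣ (lemma k p q)) (trans (ℚ.∣p*q∣≡∣p∣*∣q∣ k (p ℚ.- q))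
    (cong (ℚ._* ℚ.∣ p ℚ.- q ∣) (ℚ.0≤p⇒∣p∣≡p 0≤k)))
  widen : ∀ p ε → .{{Positive ε}} → p ℚ.≤ p ℚ.+ ε
  widen p ε = subst (ℚ._≤ p ℚ.+ ε) (ℚ.+-identityʳ p) (ℚ.+-monoʳ-≤ p (ℚ.<⇒≤ (ℚ.positive⁻¹ ε)))
  bound : ℝ.∣ (fromℚ k ℝ.* x) ℝ.- (fromℚ k ℝ.* y) ∣ ℝ.≤ fromℚ k ℝ.* ℝ.∣ x ℝ.- y ∣
  bound ε = 0 , λ n _ → ℚ.≤-trans (ℚ.≤-reflexive (scaled (seq x n) (seq y n))) (widen (k ℚ.* ℚ.∣ seq x n ℚ.- seq y n ∣) ε)

private
  p≤∣p∣ : ∀ p → p ℚ.≤ ℚ.∣ p ∣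
  p≤∣p∣ p with ℚ.≤-total 0ℚ p
  ... | inj₁ 0≤p = ℚ.≤-reflexive (sym (ℚ.0≤p⇒∣p∣≡p 0≤p))
  ... | inj₂ p≤0 = ℚ.≤-trans p≤0 (ℚ.0≤∣p∣ p)

  -p≤∣p∣ : ∀ p → ℚ.- p ℚ.≤ ℚ.∣ p ∣
  -p≤∣p∣ p = ℚ.≤-trans (p≤∣p∣ (ℚ.- p)) (ℚ.≤-reflexive (ℚ.∣-p∣≡∣p∣ p))

  ∣p∣≤ : ∀ {p c} → ℚ.- c ℚ.≤ p → p ℚ.≤ c → ℚ.∣ p ∣ ℚ.≤ c
  ∣p∣≤ {p} {c} -c≤p p≤c with ℚ.∣p∣≡p∨∣p∣≡-p p
  ... | inj₁ eq = ℚ.≤-trans (ℚ.≤-reflexive eq) p≤c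
  ... | inj₂ eq = ℚ.≤-trans (ℚ.≤-reflexive eq) (ℚ.≤-trans (ℚ.neg-antimono-≤ -c≤p) (ℚ.≤-reflexive (neg-neg c)))
    where
    neg-neg : ∀ c → ℚ.- (ℚ.- c) ≡ c
    neg-neg = Ring.solve-∀ ℚ-ring

  ∣p∣≤∣p-q∣+∣q∣ : ∀ p q → ℚ.∣ p ∣ ℚ.≤ ℚ.∣ p ℚ.- q ∣ ℚ.+ ℚ.∣ q ∣
  ∣p∣≤∣p-q∣+∣q∣ p q = subst (λ s → ℚ.∣ s ∣ ℚ.≤ ℚ.∣ p ℚ.- q ∣ ℚ.+ ℚ.∣ q ∣) (lemma p q) (ℚ.∣p+q∣≤∣p∣+∣q∣ (p ℚ.- q) q)
    where
    lemma : ∀ p q → (p ℚ.- q) ℚ.+ q ≡ p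
    lemma = Ring.solve-∀ ℚ-ring

power : ℕ → ℚ
power i = frac (+ (2 ^ i)) 1

near⇒C : ∀ {x p c} i → Near x (fromℚ p) c → ℚ.∣ p ∣ ℚ.+ c ℚ.≤ power i → C[ i ] x
near⇒C {x} {p} {c} i (near xp) le = lower , upper
  where
  open ℚ.≤-Reasoning
  swap : ∀ c ε p → c ℚ.+ ε ℚ.+ p ≡ p ℚ.+ c ℚ.+ ε
  swap = Ring.solve-∀ ℚ-ring
  bound : ∀ ε n → ℚ.∣ seq x n ℚ.- p ∣ ℚ.≤ c ℚ.+ ε → ℚ.∣ seq x n ∣ ℚ.≤ power i ℚ.+ ε
  bound ε n h = begin
    ℚ.∣ seq x n ∣                          ≤⟨ ∣p∣≤∣p-q∣+∣q∣ (seq x n) p ⟩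
    ℚ.∣ seq x n ℚ.- p ∣ ℚ.+ ℚ.∣ p ∣        ≤⟨ ℚ.+-monoˡ-≤ ℚ.∣ p ∣ h ⟩
    c ℚ.+ ε ℚ.+ ℚ.∣ p ∣                    ≡⟨ swap c ε ℚ.∣ p ∣ ⟩
    ℚ.∣ p ∣ ℚ.+ c ℚ.+ ε                    ≤⟨ ℚ.+-monoˡ-≤ ε le ⟩
    power i ℚ.+ ε                          ∎
  upper : x ℝ.≤ fromℕ (2 ^ i)
  upper ε with xp ε
  ... | N , h = N , λ n N≤n → ℚ.≤-trans (p≤∣p∣ (seq x n)) (bound ε n (h n N≤n))
  split : ∀ B ε → ℚ.- B ≡ (ℚ.- (B ℚ.+ ε)) ℚ.+ ε
  split = Ring.solve-∀ ℚ-ring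
  neg-neg : ∀ x → ℚ.- (ℚ.- x) ≡ x
  neg-neg = Ring.solve-∀ ℚ-ring
  lower : (ℝ.- fromℕ (2 ^ i)) ℝ.≤ x
  lower ε with xp ε
  ... | N , h = N , λ n N≤n → begin
    ℚ.- power i                     ≡⟨ split (power i) ε ⟩
    (ℚ.- (power i ℚ.+ ε)) ℚ.+ ε     ≤⟨ ℚ.+-monoˡ-≤ ε (ℚ.neg-antimono-≤ (ℚ.≤-trans (-p≤∣p∣ (seq x n)) (bound ε n (h n N≤n)))) ⟩
    (ℚ.- (ℚ.- seq x n)) ℚ.+ ε       ≡⟨ cong (ℚ._+ ε) (neg-neg (seq x n)) ⟩
    seq x n ℚ.+ ε                   ∎

C⇒near : ∀ {x p c} i → C[ i ] x → Near x (fromℚ p) c → ℚ.∣ p ∣ ℚ.≤ power i ℚ.+ c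
C⇒near {x} {p} {c} i (lower , upper) (near xp) = ≤+ε⇒≤ bound
  where
  open ℚ.≤-Reasoning
  bound : ∀ ε → .{{Positive ε}} → ℚ.∣ p ∣ ℚ.≤ (power i ℚ.+ c) ℚ.+ ε
  bound ε with lower (half ε) {{half-pos ε}} | upper (half ε) {{half-pos ε}} | xp (half ε) {{half-pos ε}}
  ... | L , l | U , u | N , h = begin
    ℚ.∣ p ∣                                     ≤⟨ ∣p∣≤∣p-q∣+∣q∣ p (seq x n) ⟩
    ℚ.∣ p ℚ.- seq x n ∣ ℚ.+ ℚ.∣ seq x n ∣       ≤⟨ ℚ.+-mono-≤ (ℚ.≤-trans (ℚ.≤-reflexive (∣p-q∣-sym p (seq x n))) (h n N≤n)) (∣p∣≤ lo (u n U≤n)) ⟩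
    (c ℚ.+ half ε) ℚ.+ (power i ℚ.+ half ε)     ≡⟨ trans (regroup c (half ε) (power i) (half ε)) (cong₂ ℚ._+_ (ℚ.+-comm c (power i)) (half+half ε)) ⟩
    (power i ℚ.+ c) ℚ.+ ε                       ∎
    where
    n = L + (U + N)
    U≤n = ℕ.≤-trans (ℕ.m≤m+n U N) (ℕ.m≤n+m (U + N) L)
    N≤n = ℕ.≤-trans (ℕ.m≤n+m N U) (ℕ.m≤n+m (U + N) L)
    lemma : ∀ B ε → ℚ.- (B ℚ.+ ε) ≡ (ℚ.- B) ℚ.- ε
    lemma = Ring.solve-∀ ℚ-ring
    lemma′ : ∀ x ε → (x ℚ.+ ε) ℚ.- ε ≡ x
    lemma′ = Ring.solve-∀ ℚ-ring
    lo : ℚ.- (power i ℚ.+ half ε) ℚ.≤ seq x n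
    lo = begin
      ℚ.- (power i ℚ.+ half ε)          ≡⟨ lemma (power i) (half ε) ⟩
      (ℚ.- power i) ℚ.- half ε          ≤⟨ ℚ.+-monoˡ-≤ (ℚ.- half ε) (l n (ℕ.m≤m+n L _)) ⟩
      (seq x n ℚ.+ half ε) ℚ.- half ε   ≡⟨ lemma′ (seq x n) (half ε) ⟩
      seq x n                           ∎

abs⇒C : ∀ {p} i → ℚ.∣ p ∣ ℚ.≤ power i → C[ i ] (fromℚ p)
abs⇒C {p} i le = near⇒C {fromℚ p} {p} {0ℚ} i (near-refl p) (ℚ.≤-trans (ℚ.≤-reflexive (ℚ.+-identityʳ ℚ.∣ p ∣)) le)

-- `RunsInTime` speaks of the least index of a box containing the arguments. Deciding membership for
-- rationals is what makes this index available for the simulated runs.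
C?-ℚ : ∀ i p → Dec (C[ i ] (fromℚ p))
C?-ℚ i p with ℚ.∣ p ∣ ℚ.≤? power i
... | yes le = yes (abs⇒C i le)
... | no ¬le = no λ inC → ¬le (ℚ.≤-trans (C⇒near {fromℚ p} {p} {0ℚ} i inC (near-refl p))
                 (ℚ.≤-reflexive (ℚ.+-identityʳ (power i))))

least : ∀ {P : ℕ → Set} → (∀ j → Dec (P j)) → ∀ n → P n → Σ[ k ∈ ℕ ] (k ≤ n × IsLeast P k)
least P? zero    p = 0 , z≤n , p , λ _ _ → z≤n
least {P} P? (suc n) p with P? 0
... | yes p₀ = 0 , z≤n , p₀ , λ _ _ → z≤n
... | no ¬p₀ with least {P ∘ suc} (P? ∘ suc) n p
... | k , k≤n , pk , min = suc k , s≤s k≤n , pk , λ { zero p₀ → ⊥-elim (¬p₀ p₀) ; (suc j) pj → s≤s (min j pj) }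

-- Polynomial bounds

-- Only an upper bound is asked for. The combinators below follow arithmetic expressions, so that a
-- certificate is a transcript of the time bound it is for.
Poly : ∀ {v} → (Vec ℕ v → ℕ) → Set
Poly {v} f = Σ[ p ∈ Polynomial v ] (∀ ρ → f ρ ≤ eval p ρ)

poly-con : ∀ {v} c → Poly {v} (λ _ → c)
poly-con c = con c , λ _ → ℕ.≤-refl

poly-var : ∀ {v} i → Poly {v} (λ ρ → lookup ρ i)
poly-var i = var i , λ _ → ℕ.≤-refl

infixl 6 _⊞_
infixl 7 _⊠_

_⊞_ : ∀ {v} {f g : Vec ℕ v → ℕ} → Poly f → Poly g → Poly (λ ρ → f ρ + g ρ)
(p , f≤p) ⊞ (q , g≤q) = p ⊕ q , λ ρ → ℕ.+-mono-≤ (f≤p ρ) (g≤q ρ)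

_⊠_ : ∀ {v} {f g : Vec ℕ v → ℕ} → Poly f → Poly g → Poly (λ ρ → f ρ * g ρ)
(p , f≤p) ⊠ (q , g≤q) = p ⊗ q , λ ρ → ℕ.*-mono-≤ (f≤p ρ) (g≤q ρ)

infixl 7 _⊠ₙ_
infixl 6 _⊞ₙ_ _ₙ⊞_

_⊠ₙ_ : ∀ {v} {f : Vec ℕ v → ℕ} → Poly f → ∀ c → Poly (λ ρ → f ρ * c)
p ⊠ₙ c = p ⊠ poly-con c

_⊞ₙ_ : ∀ {v} {f : Vec ℕ v → ℕ} → Poly f → ∀ c → Poly (λ ρ → f ρ + c)
p ⊞ₙ c = p ⊞ poly-con c

_ₙ⊞_ : ∀ {v} {f : Vec ℕ v → ℕ} → ∀ c → Poly f → Poly (λ ρ → c + f ρ)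
c ₙ⊞ p = poly-con c ⊞ p

-- Coefficients are natural numbers, so every polynomial is monotone; this allows bounds to be
-- substituted for arguments.
eval-mono : ∀ {v} (p : Polynomial v) {ρ ρ′} → (∀ i → lookup ρ i ≤ lookup ρ′ i) → eval p ρ ≤ eval p ρ′
eval-mono (con c) le = ℕ.≤-refl
eval-mono (var i) le = le i
eval-mono (p ⊕ q) le = ℕ.+-mono-≤ (eval-mono p le) (eval-mono q le)
eval-mono (p ⊗ q) le = ℕ.*-mono-≤ (eval-mono p le) (eval-mono q le)

substitute : ∀ {v w} → Polynomial v → Vec (Polynomial w) v → Polynomial w
substitute (con c) qs = con c
substitute (var i) qs = lookup qs i
substitute (p ⊕ q) qs = substitute p qs ⊕ substitute q qs
substitute (p ⊗ q) qs = substitute p qs ⊗ substitute q qs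

eval-substitute : ∀ {v w} (p : Polynomial v) (qs : Vec (Polynomial w) v) ρ →
                  eval (substitute p qs) ρ ≡ eval p (Vec.map (λ q → eval q ρ) qs)
eval-substitute (con c) qs ρ = refl
eval-substitute (var i) qs ρ = sym (Vec.lookup-map i (λ q → eval q ρ) qs)
eval-substitute (p ⊕ q) qs ρ = cong₂ _+_ (eval-substitute p qs ρ) (eval-substitute q qs ρ)
eval-substitute (p ⊗ q) qs ρ = cong₂ _*_ (eval-substitute p qs ρ) (eval-substitute q qs ρ)

eval-mono₁ : ∀ (p : Polynomial 1) {a a′} → a ≤ a′ → eval p (a ∷ []) ≤ eval p (a′ ∷ [])
eval-mono₁ p le = eval-mono p λ { 0F → le }

eval-mono₂ : ∀ (p : Polynomial 2) {a a′ b b′} → a ≤ a′ → b ≤ b′ → eval p (a ∷ b ∷ []) ≤ eval p (a′ ∷ b′ ∷ [])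
eval-mono₂ p le le′ = eval-mono p λ { 0F → le ; 1F → le′ }

poly-eval₁ : ∀ {v} {f : Vec ℕ v → ℕ} (p : Polynomial 1) → Poly f → Poly (λ ρ → eval p (f ρ ∷ []))
poly-eval₁ p (q , f≤q) = substitute p (q ∷ []) , λ ρ →
  ℕ.≤-trans (eval-mono₁ p (f≤q ρ)) (ℕ.≤-reflexive (sym (eval-substitute p (q ∷ []) ρ)))

poly-eval₂ : ∀ {v} {f g : Vec ℕ v → ℕ} (p : Polynomial 2) → Poly f → Poly g → Poly (λ ρ → eval p (f ρ ∷ g ρ ∷ []))
poly-eval₂ p (q , f≤q) (r , g≤r) = substitute p (q ∷ r ∷ []) , λ ρ →
  ℕ.≤-trans (eval-mono₂ p (f≤q ρ) (g≤r ρ)) (ℕ.≤-reflexive (sym (eval-substitute p (q ∷ r ∷ []) ρ)))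

-- A Turing machine runs with an absurd function as its oracles, and functions out of `Fin 0` need
-- not be definitionally equal. The statement for all oracles covers that particular one;
-- `oracle-result` exposes it in the converse direction.
turingMachine-result : ∀ (M : TuringMachine) w t v → (∀ φ → OracleTM.result M φ w t ≡ just v) →
                       TuringMachine.result M w t ≡ just v
turingMachine-result M w t v h = h _

oracle-result : ∀ (M : TuringMachine) w t v → TuringMachine.result M w t ≡ just v →
                Σ[ ψ ∈ (Fin 0 → ℕ → 𝔻) ] OracleTM.result M ψ w t ≡ just v
oracle-result M w t v eq = _ , eq

-- `Computes` gives a correct output at an unspecified time, and `RunsInTime` gives only halting
-- within the polynomial. By determinism the output at the polynomial time is the correct one.
halting-result : ∀ {o} (M : OracleTM o) φ {w t t′ v} → OracleTM.result M φ w t ≡ just v →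
                 Is-just (OracleTM.result M φ w t′) → OracleTM.result M φ w t′ ≡ just v
halting-result M φ {w} {t} {t′} eq halts with OracleTM.result M φ w t′ in eq′ | halts
... | just v′ | _ = cong just (sym (result-unique M φ {t} {t′} {w} eq eq′))

abs-frac : ∀ a d c .{{_ : NonZero d}} → ℤ.∣ a ∣ ≤ c * d → ℚ.∣ frac a d ∣ ℚ.≤ frac (+ c) 1
abs-frac a d c le = subst (λ p → ℚ.∣ p ∣ ℚ.≤ frac (+ c) 1) (ℚ.+-identityʳ (frac a d))
  (frac-near a d (+ 0) 1 c 1 (subst₂ (λ i e → ℤ.∣ i ∣ * 1 ≤ c * e)
    (trans (cong₂ ℤ._-_ (ℤ.*-identityʳ a) (ℤ.*-zeroˡ (+ d))) (ℤ.+-identityʳ a)) (ℕ.*-identityʳ d)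
    (subst (_≤ c * d) (sym (ℕ.*-identityʳ ℤ.∣ a ∣)) le)))
  where
  subst₂ : ∀ {A B : Set} (P : A → B → Set) {a a′ b b′} → a′ ≡ a → b′ ≡ b → P a b → P a′ b′
  subst₂ P refl refl p = p

-- From polytime computability to definability

polytimeℤ : ∀ w A finA (program : StackMachine.Prog 0 w A finA ⊤) (h : ℤ → ℤ → ℤ) (p : Polynomial 2) →
  (∀ φ x y → StackMachine.Outputs 0 w A finA φ program (encodeℤ x ++ sep ∷ encodeℤ y)
                (eval p (length (encodeℤ x) ∷ length (encodeℤ y) ∷ [])) (encodeℤ (h x y))) →
  PolytimeComputableℤ h
polytimeℤ w A finA program h p out = machine program , p , λ x y →
  turingMachine-result (machine program) (encodeℤ x ++ sep ∷ encodeℤ y)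
    (eval p (length (encodeℤ x) ∷ length (encodeℤ y) ∷ [])) (encodeℤ (h x y)) λ φ → Outputs.result≡ (out φ x y)
  where open StackMachine 0 w A finA using (machine; module Outputs)

module Definable (f : RealFunction 1) (N : OracleTM 1) (computes : Computes N f) (p : Polynomial 2) (runs : RunsInTime N p) where

  private
    module D = DefinabilityMachine N
    module C = DefinabilityCorrectness N

    val-bits>0 : ∀ y → 0 < val (bits (suc y))
    val-bits>0 y = subst (0 <_) (sym (val-bits (suc y))) (s≤s z≤n)

    approximations : ℤ → ℕ → ℕ → 𝔻
    approximations x y = digitOracle (isNegative x) (bits ℤ.∣ x ∣) (bits (suc y)) (val-bits>0 y)

    argument : ℤ → ℕ → F.Vector ℝ 1
    argument x y = fromℚ (x ℚ./ suc y) F.∷ F.[]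

    approximates : ∀ x y i → CF (argument x y i) (approximations x y)
    approximates x y 0F m = distance≤ (near-ℚ {x ℚ./ suc y} {toℚ (approximations x y m)} (subst (λ q → ℚ.∣ q ℚ.- toℚ (approximations x y m) ∣ ℚ.≤ toℚ (+ 1 /2^ m)) frac≡
        (half-digit (isNegative x) X Y (X * 2 ^ m / Y) m (ℕ.m/n*n≤m (X * 2 ^ m) Y) upper)))
      where
      X = val (bits ℤ.∣ x ∣)
      Y = val (bits (suc y))
      instance
        Y≢0 : NonZero Y
        Y≢0 = ℕ.>-nonZero (val-bits>0 y)
      frac≡ : frac (signed (isNegative x) X) Y ≡ x ℚ./ suc y
      frac≡ = ℚ./-cong (trans (cong (signed (isNegative x)) (val-bits ℤ.∣ x ∣)) (signed-isNegative x)) (val-bits (suc y))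
      upper : X * 2 ^ m ≤ suc (X * 2 ^ m / Y) * Y
      upper = ℕ.≤-trans (ℕ.≤-reflexive (ℕ.m≡m%n+[m/n]*n (X * 2 ^ m) Y))
        (ℕ.+-monoˡ-≤ (X * 2 ^ m / Y * Y) (ℕ.<⇒≤ (ℕ.m%n<n (X * 2 ^ m) Y)))

    precision : ℕ → ℕ
    precision y = length (bits (suc y))

    value : ∀ x y → Σ[ t ∈ ℕ ] Σ[ z ∈ 𝔻 ] (OracleTM.result N (λ _ → approximations x y) (unary (precision y)) t ≡ just (encode𝔻 z)
              × Near (toℝ z) (apply₁ f (fromℚ (x ℚ./ suc y))) (toℚ (+ 1 /2^ precision y)))
    value x y = let t , z , eq , le = computes (argument x y) (λ _ → approximations x y) (approximates x y) (precision y)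
                in t , z , eq , near le

    z : ℤ → ℕ → 𝔻
    z x y = proj₁ (proj₂ (value x y))

  -- A function of x and y alone, because `z` comes from the fixed oracle `approximations x y`. The
  -- values 0 for y ≤ 0 agree with the empty output of the program.
  rounded : ℤ → ℤ → ℤ
  rounded x (+ zero)  = + 0
  rounded x (+ suc y) = D.productℤ (val (bits (suc y))) (z x y)
  rounded x -[1+ y ]  = + 0

  private
    n<2^bits : ∀ n → n < 2 ^ length (bits n)
    n<2^bits n = subst (_< 2 ^ length (bits n)) (val-bits n) (val-< (bits n))

    quotient-C : ∀ x y i → C[ length (bits ℤ.∣ x ∣) ] (argument x y i)
    quotient-C x y 0F = abs⇒C (length (bits ℤ.∣ x ∣)) (abs-frac x (suc y) (2 ^ length (bits ℤ.∣ x ∣))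
      (ℕ.≤-trans (ℕ.<⇒≤ (n<2^bits ℤ.∣ x ∣)) (ℕ.m≤m*n (2 ^ length (bits ℤ.∣ x ∣)) (suc y))))

    -- As |x / y| ≤ |x|, the least `k` is at most the number of digits of |x|, so the running time
    -- of `N` is bounded in terms of the length of the input.
    result-z : ∀ x y n → length (bits ℤ.∣ x ∣) ≤ n → precision y ≤ n →
      OracleTM.result N (λ _ → approximations x y) (unary (precision y)) (eval p (n ∷ n ∷ [])) ≡ just (encode𝔻 (z x y))
    result-z x y n x≤n y≤n with least {λ j → ∀ i → C[ j ] (argument x y i)} decide (length (bits ℤ.∣ x ∣)) (quotient-C x y)
      where
      decide : ∀ j → Dec (∀ i → C[ j ] (argument x y i))
      decide j with C?-ℚ j (x ℚ./ suc y)
      ... | yes c = yes λ { 0F → c }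
      ... | no ¬c = no λ c → ¬c (c 0F)
    ... | k , k≤ , isLeast = result-mono N (λ _ → approximations x y) {eval p (k ∷ precision y ∷ [])} {eval p (n ∷ n ∷ [])} {unary (precision y)} {encode𝔻 (z x y)}
      (eval-mono₂ p (ℕ.≤-trans k≤ x≤n) y≤n)
      (halting-result N (λ _ → approximations x y) {unary (precision y)} {proj₁ (value x y)} {eval p (k ∷ precision y ∷ [])}
        (proj₁ (proj₂ (proj₂ (value x y)))) (runs (argument x y) (λ _ → approximations x y) (approximates x y) (precision y) k isLeast))

    size time : Vec ℕ 2 → ℕ
    size ρ = lookup ρ 0F + lookup ρ 1F

    -- The sum of the times of the three cases y < 0, y = 0 and y > 0 bounds each of them.
    time ρ = D.programTime n ((1 + ((n * 7 + 2) + 2)) + ((n * 7 + 2) + D.coreTime n (eval p (n ∷ n ∷ []))))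
      where n = size ρ

    poly-arith : ∀ {f : Vec ℕ 2 → ℕ} → Poly f → Poly (λ ρ → D.arithTime (f ρ))
    poly-arith n = (n ⊠ₙ 9 ⊞ₙ 3) ⊞ ((n ⊠ₙ 5 ⊞ₙ 2) ⊞ₙ 1)

    poly-divCell : ∀ {f : Vec ℕ 2 → ℕ} → Poly f → Poly (λ ρ → D.divCellTime (f ρ))
    poly-divCell n = 2 ₙ⊞ ((poly-arith n ⊞ ((n ⊠ₙ 3 ⊞ₙ 2) ⊞ ((n ⊠ₙ 5 ⊞ₙ 2) ⊞ₙ 1))) ⊞ₙ 6)

    poly-reply : ∀ {f g : Vec ℕ 2 → ℕ} → Poly f → Poly g → Poly (λ ρ → D.replyTime (f ρ) (g ρ))
    poly-reply n k =
      (k ⊠ₙ 5 ⊞ₙ 2) ⊞ ((k ⊠ₙ 3 ⊞ₙ 2) ⊞ ((k ⊠ₙ 3 ⊞ₙ 2) ⊞ (2 ₙ⊞ ((n ⊠ₙ 7 ⊞ₙ 2) ⊞ ((n ⊠ₙ 5 ⊞ₙ 2) ⊞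
      ((feed ⊠ (2 ₙ⊞ poly-divCell (n ⊞ feed)) ⊞ₙ 2) ⊞ (2 ₙ⊞ (((n ⊞ feed) ⊠ₙ 3 ⊞ₙ 2) ⊞
      (((1 ₙ⊞ feed) ⊠ₙ 5 ⊞ₙ 2) ⊞ₙ 3)))))))))
      where feed = n ⊞ (1 ₙ⊞ k)

    poly-mulCell : ∀ {f : Vec ℕ 2 → ℕ} → Poly f → Poly (λ ρ → D.mulCellTime (f ρ))
    poly-mulCell n = 2 ₙ⊞ ((poly-arith n ⊞ ((n ⊠ₙ 3 ⊞ₙ 2) ⊞ (2 ₙ⊞ ((1 ₙ⊞ n) ⊠ₙ 5 ⊞ₙ 2)))) ⊞ₙ 1)

    poly-post : ∀ {f g : Vec ℕ 2 → ℕ} → Poly f → Poly g → Poly (λ ρ → D.postTime (f ρ) (g ρ))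
    poly-post n k =
      4 ₙ⊞ ((k ⊠ (2 ₙ⊞ poly-mulCell s) ⊞ₙ 2) ⊞ ((k ⊠ (2 ₙ⊞ (poly-mulCell s ⊞ₙ 3)) ⊞ₙ 2) ⊞
      ((k ⊠ₙ 4 ⊞ₙ 2) ⊞ ((s ⊠ₙ 5 ⊞ₙ 2) ⊞ ((s ⊠ₙ 2 ⊞ₙ 4) ⊞ₙ 3)))))
      where s = n ⊞ (k ⊞ k) ⊠ₙ 2

    poly-time : Poly time
    poly-time = 4 ₙ⊞ ((n ⊠ₙ 5 ⊞ₙ 2) ⊞ (4 ₙ⊞ ((1 ₙ⊞ ((n ⊠ₙ 7 ⊞ₙ 2) ⊞ₙ 2)) ⊞ ((n ⊠ₙ 7 ⊞ₙ 2) ⊞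
      (1 ₙ⊞ (2 ₙ⊞ (((1 ₙ⊞ T) ⊠ (poly-con (tapes * 3) ⊞ (poly-con (tapes * 6) ⊞ (poly-reply n k ⊞ₙ 1)))) ⊞ poly-post n k)))))))
      where
      tapes = OracleTM.tapes N
      n = poly-var 0F ⊞ poly-var 1F
      T = poly-eval₂ p n n
      k = T ⊠ (3 ₙ⊞ n) ⊞ n

    length-encodeℤ : ∀ i → length (bits ℤ.∣ i ∣) ≤ length (encodeℤ i)
    length-encodeℤ i = begin
      length (bits ℤ.∣ i ∣)                         ≡⟨ trans (List.length-map bit (reverse (bits ℤ.∣ i ∣))) (List.length-reverse (bits ℤ.∣ i ∣)) ⟨
      length (binary ℤ.∣ i ∣)                       ≤⟨ ℕ.m≤n+m _ (length (sign i)) ⟩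
      length (sign i) + length (binary ℤ.∣ i ∣)     ≡⟨ List.length-++ (sign i) ⟨
      length (encodeℤ i)                            ∎
      where open ℕ.≤-Reasoning

    outputs-rounded : ∀ φ x y → StackMachine.Outputs 0 D.workTapes (OracleTM.Aux N) (OracleTM.finite-Aux N) φ D.program
      (encodeℤ x ++ sep ∷ encodeℤ y) (time (length (encodeℤ x) ∷ length (encodeℤ y) ∷ [])) (encodeℤ (rounded x y))
    outputs-rounded φ x y = go y (ℕ.≤-trans (length-encodeℤ y) (ℕ.m≤n+m _ (length (encodeℤ x))))
      where
      open StackMachine 0 D.workTapes (OracleTM.Aux N) (OracleTM.finite-Aux N) using (Outputs; outputs-mono)
      n = length (encodeℤ x) + length (encodeℤ y)
      T = eval p (n ∷ n ∷ [])
      t₁ t₂ t₃ : ℕ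
      t₁ = 1
      t₂ = (n * 7 + 2) + 2
      t₃ = (n * 7 + 2) + D.coreTime n T
      x≤n : length (bits ℤ.∣ x ∣) ≤ n
      x≤n = ℕ.≤-trans (length-encodeℤ x) (ℕ.m≤m+n _ (length (encodeℤ y)))
      programTime-mono : ∀ {t t′} → t ≤ t′ → D.programTime n t ≤ D.programTime n t′
      programTime-mono le = ℕ.+-monoʳ-≤ 4 (ℕ.+-monoʳ-≤ (n * 5 + 2) (ℕ.+-monoʳ-≤ 4 le))
      go : ∀ y → length (bits ℤ.∣ y ∣) ≤ n →
        Outputs φ D.program (encodeℤ x ++ sep ∷ encodeℤ y) (D.programTime n ((t₁ + t₂) + t₃)) (encodeℤ (rounded x y))
      go (+ zero)  y≤n = outputs-mono (programTime-mono (ℕ.≤-trans (ℕ.m≤n+m t₂ t₁) (ℕ.m≤m+n (t₁ + t₂) t₃))) (C.outputs-zero φ x n x≤n)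
      go -[1+ y ]  y≤n = outputs-mono (programTime-mono (ℕ.≤-trans (ℕ.m≤m+n t₁ t₂) (ℕ.m≤m+n (t₁ + t₂) t₃))) (C.outputs-negative φ x n x≤n y)
      go (+ suc y) y≤n = outputs-mono (programTime-mono (ℕ.m≤n+m t₃ (t₁ + t₂)))
        (C.outputs-positive φ x n x≤n (suc y) (val-bits>0 y) y≤n T (z x y) (result-z x y n x≤n y≤n))

  rounded-polytime : PolytimeComputableℤ rounded
  rounded-polytime = polytimeℤ D.workTapes (OracleTM.Aux N) (OracleTM.finite-Aux N) D.program rounded (proj₁ poly-time)
    λ φ x y → StackMachine.outputs-mono 0 D.workTapes (OracleTM.Aux N) (OracleTM.finite-Aux N)
      (proj₂ poly-time (length (encodeℤ x) ∷ length (encodeℤ y) ∷ [])) (outputs-rounded φ x y)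

  private
    product-signed : ∀ y neg A → + y ℤ.* signed neg A ≡ signed neg (y * A)
    product-signed y false A = sym (ℤ.pos-* y A)
    product-signed y true  A = trans (cong (+ y ℤ.*_) (signed-true A))
      (trans (sym (ℤ.neg-distribʳ-* (+ y) (+ A))) (trans (cong ℤ.-_ (sym (ℤ.pos-* y A))) (sym (signed-true (y * A)))))

    -- Truncating a quotient by `2 ^ b` changes the numerator by less than `2 ^ b`.
    near-product : ∀ y d → Near (fromℤ (D.productℤ y d)) (fromℚ (frac (+ y) 1 ℚ.* toℚ d)) (frac (+ 1) 1)
    near-product y (a /2^ b) = near-ℚ (subst (λ q → ℚ.∣ frac (signed neg Q) 1 ℚ.- q ∣ ℚ.≤ frac (+ 1) 1) (sym product≡)
      (frac-near (signed neg Q) 1 (signed neg (y * A)) (2 ^ b) 1 1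
        (subst₂ (signed-diff neg Q (2 ^ b) (y * A) 1 {2 ^ b} upper lower))))
      where
      instance
        2^b≢0 : NonZero (2 ^ b)
        2^b≢0 = ℕ.m^n≢0 2 b
      neg = isNegative a
      A = ℤ.∣ a ∣
      Q = y * A ÷2^ b
      product≡ : frac (+ y) 1 ℚ.* frac a (2 ^ b) ≡ frac (signed neg (y * A)) (2 ^ b)
      product≡ = trans (frac-* (+ y) a (2 ^ b))
        (ℚ./-cong (trans (cong (+ y ℤ.*_) (sym (signed-isNegative a))) (product-signed y neg A)) refl)
      division : y * A ≡ y * A % 2 ^ b + Q * 2 ^ b
      division = ℕ.m≡m%n+[m/n]*n (y * A) (2 ^ b)
      upper : Q * 2 ^ b ≤ y * A * 1 + 2 ^ b
      upper = ℕ.≤-trans (ℕ.≤-trans (ℕ.m/n*n≤m (y * A) (2 ^ b)) (ℕ.≤-reflexive (sym (ℕ.*-identityʳ (y * A))))) (ℕ.m≤m+n _ _)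
      lower : y * A * 1 ≤ Q * 2 ^ b + 2 ^ b
      lower = ℕ.≤-trans (ℕ.≤-reflexive (trans (ℕ.*-identityʳ (y * A)) (trans division (ℕ.+-comm (y * A % 2 ^ b) (Q * 2 ^ b)))))
        (ℕ.+-monoʳ-≤ (Q * 2 ^ b) (ℕ.<⇒≤ (ℕ.m%n<n (y * A) (2 ^ b))))
      subst₂ : ∀ {m} → m ≤ 2 ^ b → m * 1 ≤ 1 * (1 * 2 ^ b)
      subst₂ le = ℕ.≤-trans (ℕ.≤-reflexive (ℕ.*-identityʳ _)) (ℕ.≤-trans le (ℕ.≤-reflexive (sym (trans (ℕ.*-identityˡ _) (ℕ.*-identityˡ _)))))

  -- One unit is due to the truncation. The other bounds y times the error of z, since y is less
  -- than 2 to the precision, its number of digits.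
  rounded-near : ∀ x y → Near (fromℤ (rounded x (+ suc y))) (fromℕ (suc y) ℝ.* apply₁ f (fromℚ (x ℚ./ suc y))) (frac (+ 2) 1)
  rounded-near x y = near-weaken bound (near-trans
      (subst (λ v → Near (fromℤ (D.productℤ v (z x y))) (fromℚ (frac (+ suc y) 1 ℚ.* toℚ (z x y))) (frac (+ 1) 1))
        (sym (val-bits (suc y))) (near-product (suc y) (z x y)))
      (near-resp (λ _ → refl) (λ _ → refl) (near-scale (frac-nonNeg (suc y) 1) (proj₂ (proj₂ (proj₂ (value x y)))))))
    where
    instance
      2^n≢0 : NonZero (2 ^ precision y)
      2^n≢0 = ℕ.m^n≢0 2 (precision y)
    bound : frac (+ 1) 1 ℚ.+ frac (+ suc y) 1 ℚ.* frac (+ 1) (2 ^ precision y) ℚ.≤ frac (+ 2) 1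
    bound = ℚ.+-monoʳ-≤ (frac (+ 1) 1) {_} {frac (+ 1) 1} (ℚ.≤-trans (ℚ.≤-reflexive (frac-* (+ suc y) (+ 1) (2 ^ precision y)))
      (frac-≤ (+ suc y ℤ.* + 1) (2 ^ precision y) (+ 1) 1
        (subst₂ (ℤ.*-identityʳ (+ suc y ℤ.* + 1)) (ℤ.*-identityʳ (+ suc y)) (ℤ.*-identityˡ (+ (2 ^ precision y)))
          (+≤+ (ℕ.<⇒≤ (n<2^bits (suc y)))))))
      where
      subst₂ : ∀ {a b c d e : ℤ} → a ≡ b → b ≡ c → d ≡ e → c ℤ.≤ e → a ℤ.≤ d
      subst₂ refl refl refl le = le

polytime⇒definable : ∀ {ℓ} (𝒞 : RealFunction 2 → Set ℓ) → 𝒞 Approximates PolytimeComputableℤ →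
                     ∀ f → PolytimeComputable f → 𝒞 -Definable f
polytime⇒definable 𝒞 approx f (N , computes , p , runs) = finish (approx rounded rounded-polytime)
  where
  open Definable f N computes p runs
  finish : (Σ[ g̃ ∈ RealFunction 2 ] (𝒞 g̃ ×
             (∀ x y → ℝ.∣ apply₂ g̃ (fromℤ x) (fromℤ y) ℝ.- fromℤ (rounded x y) ∣ ℝ.≤ fromℚ (+ 1 ℚ./ 4)))) → 𝒞 -Definable f
  finish (g̃ , g̃∈𝒞 , close) = g̃ , g̃∈𝒞 , λ { x (suc y) → distance≤ (total x y) }
    where
    total : ∀ x y → Near (apply₂ g̃ (fromℤ x) (fromℕ (suc y))) (fromℕ (suc y) ℝ.* apply₁ f (fromℚ (x ℚ./ suc y))) (frac (+ 3) 1)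
    total x y = near-weaken (from-yes (frac (+ 1) 4 ℚ.+ frac (+ 2) 1 ℚ.≤? frac (+ 3) 1))
      (near-trans {y = fromℤ (rounded x (+ suc y))} {c = frac (+ 1) 4} {d = frac (+ 2) 1} (near (close x (+ suc y))) (rounded-near x y))

-- Digits of approximations

-- The accumulator `A` keeps the induction going: one more digit doubles both sides, whether it is
-- taken from `F` or is a padding zero.
truncation : ∀ A m F →
  msb A (padTake m F) * 2 ^ length F ≤ msb A F * 2 ^ m × msb A F * 2 ^ m ≤ suc (msb A (padTake m F)) * 2 ^ length F
truncation A zero F =
    (begin
      A * 2 ^ length F                  ≤⟨ ℕ.m≤m+n _ (msb 0 F) ⟩
      A * 2 ^ length F + msb 0 F        ≡⟨ msb-split A F ⟨
      msb A F                           ≡⟨ ℕ.*-identityʳ (msb A F) ⟨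
      msb A F * 1                       ∎)
  , (begin
      msb A F * 1                       ≡⟨ trans (ℕ.*-identityʳ (msb A F)) (msb-split A F) ⟩
      A * 2 ^ length F + msb 0 F        ≤⟨ ℕ.+-monoʳ-≤ (A * 2 ^ length F) (ℕ.<⇒≤ (msb-< F)) ⟩
      A * 2 ^ length F + 2 ^ length F   ≡⟨ ℕ.+-comm (A * 2 ^ length F) (2 ^ length F) ⟩
      suc A * 2 ^ length F              ∎)
  where open ℕ.≤-Reasoning
truncation A (suc m) [] =
  let lower , upper = truncation (2 * A) m []
  in ℕ.≤-trans lower (ℕ.≤-reflexive (shift A (2 ^ m))) , ℕ.≤-trans (ℕ.≤-reflexive (sym (shift A (2 ^ m)))) upper
  where
  shift : ∀ A M → 2 * A * M ≡ A * (2 * M)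
  shift = solve-∀
truncation A (suc m) (d ∷ F) =
  let lower , upper = truncation (digit d + 2 * A) m F
  in doubled (msb (digit d + 2 * A) (padTake m F)) (2 ^ length F) (msb (digit d + 2 * A) F) (2 ^ m) lower
   , doubled (msb (digit d + 2 * A) F) (2 ^ m) (suc (msb (digit d + 2 * A) (padTake m F))) (2 ^ length F) upper
  where
  swap : ∀ a p → a * (2 * p) ≡ 2 * (a * p)
  swap = solve-∀
  doubled : ∀ a p b q → a * p ≤ b * q → a * (2 * p) ≤ b * (2 * q)
  doubled a p b q le = ℕ.≤-trans (ℕ.≤-reflexive (swap a p)) (ℕ.≤-trans (ℕ.*-monoʳ-≤ 2 le) (ℕ.≤-reflexive (sym (swap b q))))

approximant-near : ∀ m d → ℚ.∣ toℚ d ℚ.- toℚ (approximant m d /2^ suc m) ∣ ℚ.≤ toℚ (+ 1 /2^ m)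
approximant-near m d@(a /2^ b) =
  subst (λ p → ℚ.∣ toℚ d ℚ.- toℚ (p /2^ suc m) ∣ ℚ.≤ toℚ (+ 1 /2^ m)) (sym approximant≡)
    (subst (λ c → ℚ.∣ frac c (2 ^ b) {{ℕ.m^n≢0 2 b}} ℚ.- toℚ (signed neg (suc (2 * q)) /2^ suc m) ∣ ℚ.≤ toℚ (+ 1 /2^ m))
      (signed-isNegative a)
      (half-digit neg ℤ.∣ a ∣ (2 ^ b) q m {{ℕ.m^n≢0 2 b}}
        (lower (subst (λ e → q * 2 ^ length F ≤ e * 2 ^ m) msb≡ (proj₁ (truncation (msb 0 I) m F))))
        (upper (subst (λ e → e * 2 ^ m ≤ suc q * 2 ^ length F) msb≡ (proj₂ (truncation (msb 0 I) m F))))))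
  where
  neg = isNegative a
  I = intDigits d
  F = fracDigits d
  q = msb (msb 0 I) (padTake m F)
  msb≡ : msb (msb 0 I) F ≡ ℤ.∣ a ∣
  msb≡ = trans (sym (msb-++ 0 I F)) (msb-digits d)
  length-F : length F ≡ b
  length-F = length-lowDigits b ℤ.∣ a ∣
  approximant≡ : approximant m d ≡ signed neg (suc (2 * q))
  approximant≡ = cong (signed neg) (trans (msb-++ 0 I _) (msb-++ (msb 0 I) (padTake m F) [ true ]))
  lower : q * 2 ^ length F ≤ ℤ.∣ a ∣ * 2 ^ m → q * 2 ^ b ≤ ℤ.∣ a ∣ * 2 ^ m
  lower = subst (λ l → q * 2 ^ l ≤ ℤ.∣ a ∣ * 2 ^ m) length-F
  upper : ℤ.∣ a ∣ * 2 ^ m ≤ suc q * 2 ^ length F → ℤ.∣ a ∣ * 2 ^ m ≤ suc q * 2 ^ b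
  upper = subst (λ l → ℤ.∣ a ∣ * 2 ^ m ≤ suc q * 2 ^ l) length-F

length-bits : ∀ v j → v < 2 ^ j → length (bits v) ≤ j
length-bits v j v<2^j = subst (_≤ j) (List.length-reverse (bits v))
  (go (reverse (bits v)) (strip-reverse-bits v) (msb-reverse-bits v))
  where
  go : ∀ ds → strip ds ≡ ds → msb 0 ds ≡ v → length ds ≤ j
  go []           _  _  = z≤n
  go (false ∷ ds) eq _  with () ← ℕ.<⇒≱ (ℕ.n<1+n _) (subst (λ es → length es ≤ length ds) eq (length-strip ds))
  go (true ∷ ds)  _  eq = ℕ.≰⇒> λ j≤ → ℕ.<⇒≱ v<2^j (begin
    2 ^ j                          ≤⟨ ℕ.^-monoʳ-≤ 2 j≤ ⟩
    2 ^ length ds                  ≤⟨ ℕ.m≤m+n _ (msb 0 ds) ⟩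
    2 ^ length ds + msb 0 ds       ≡⟨ cong (_+ msb 0 ds) (ℕ.*-identityˡ (2 ^ length ds)) ⟨
    1 * 2 ^ length ds + msb 0 ds   ≡⟨ msb-split 1 ds ⟨
    msb 1 ds                       ≡⟨ eq ⟩
    v                              ∎)
    where open ℕ.≤-Reasoning

abs-frac≡ : ∀ a d .{{_ : NonZero d}} → ℚ.∣ frac a d ∣ ≡ frac (+ ℤ.∣ a ∣) d
abs-frac≡ (+ n)    d = ℚ.0≤p⇒∣p∣≡p (frac-nonNeg n d)
abs-frac≡ -[1+ n ] d = trans (ℚ.∣-p∣≡∣p∣ (frac (+ suc n) d)) (ℚ.0≤p⇒∣p∣≡p (frac-nonNeg (suc n) d))

abs-frac⁻¹ : ∀ a d c .{{_ : NonZero d}} → ℚ.∣ frac a d ∣ ℚ.≤ frac (+ c) 1 → ℤ.∣ a ∣ ≤ c * d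
abs-frac⁻¹ a d c le = ℤ.drop‿+≤+ (subst₂ (ℤ.*-identityʳ (+ ℤ.∣ a ∣)) (sym (ℤ.pos-* c d))
  (frac-≤⁻¹ (+ ℤ.∣ a ∣) d (+ c) 1 (subst (ℚ._≤ frac (+ c) 1) (abs-frac≡ a d) le)))
  where
  subst₂ : ∀ {a b c d : ℤ} → a ≡ b → c ≡ d → a ℤ.≤ c → b ℤ.≤ d
  subst₂ refl refl le = le

2^-≤1 : ∀ j → toℚ (+ 1 /2^ j) ℚ.≤ frac (+ 1) 1
2^-≤1 j = frac-≤ (+ 1) (2 ^ j) (+ 1) 1 {{ℕ.m^n≢0 2 j}} (subst (+ 1 ℤ.≤_) (sym (ℤ.*-identityˡ (+ (2 ^ j)))) (+≤+ (ℕ.m^n>0 2 j)))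

frac-+1 : ∀ a b → frac (+ a) 1 ℚ.+ frac (+ b) 1 ℚ.≤ frac (+ (a + b)) 1
frac-+1 a b = frac-+-≤ (+ a) 1 (+ b) 1 (+ (a + b)) 1 (ℤ.≤-reflexive (lemma (+ a) (+ b)))
  where
  lemma : ∀ a b → (a ℤ.* + 1 ℤ.+ b ℤ.* + 1) ℤ.* + 1 ≡ (a ℤ.+ b) ℤ.* (+ 1 ℤ.* + 1)
  lemma a b = cong₂ ℤ._*_ (cong₂ ℤ._+_ (ℤ.*-identityʳ a) (ℤ.*-identityʳ b)) refl

frac-mono : ∀ {a b} → a ≤ b → frac (+ a) 1 ℚ.≤ frac (+ b) 1
frac-mono {a} {b} le = frac-≤ (+ a) 1 (+ b) 1 (ℤ.*-monoʳ-≤-nonNeg (+ 1) (+≤+ le))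

-- The 3 consists of the error 1 of the first answer and the distance, at most 2, between x and the
-- rational point at which `g̃` is used. Both points then lie in the box of index `2 + j`.
2^j+3≤ : ∀ j → 2 ^ j + 3 ≤ 2 ^ (2 + j)
2^j+3≤ j = begin
  2 ^ j + 3              ≤⟨ ℕ.+-monoʳ-≤ (2 ^ j) (ℕ.*-monoʳ-≤ 3 (ℕ.m^n>0 2 j)) ⟩
  2 ^ j + 3 * 2 ^ j      ≡⟨ lemma (2 ^ j) ⟩
  2 ^ (2 + j)            ∎
  where
  open ℕ.≤-Reasoning
  lemma : ∀ p → p + 3 * p ≡ 2 * (2 * p)
  lemma = solve-∀

-- Any admissible answer has modulus at most `2 ^ k + 1`. This links the running time, which depends
-- on the digits seen, to `k`, whichever approximations the oracle chooses.
intDigits-≤ : ∀ {x} d j k → C[ k ] x → Near x (toℝ d) (toℚ (+ 1 /2^ j)) → length (intDigits d) ≤ 2 + k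
intDigits-≤ {x} d@(a /2^ b) j k inC xd = subst (_≤ 2 + k) (sym (List.length-reverse (bits (ℤ.∣ a ∣ ÷2^ b))))
  (length-bits (ℤ.∣ a ∣ ÷2^ b) (2 + k) (begin-strict
    ℤ.∣ a ∣ ÷2^ b                    ≤⟨ ℕ./-monoˡ-≤ (2 ^ b) {{ℕ.m^n≢0 2 b}} abs≤ ⟩
    (2 ^ k + 1) * 2 ^ b ÷2^ b        ≡⟨ ℕ.m*n/n≡m (2 ^ k + 1) (2 ^ b) {{ℕ.m^n≢0 2 b}} ⟩
    2 ^ k + 1                        <⟨ ℕ.+-monoʳ-< (2 ^ k) (s≤s (s≤s z≤n)) ⟩
    2 ^ k + 3                        ≤⟨ 2^j+3≤ k ⟩
    2 ^ (2 + k)                      ∎))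
  where
  open ℕ.≤-Reasoning
  abs≤ : ℤ.∣ a ∣ ≤ (2 ^ k + 1) * 2 ^ b
  abs≤ = abs-frac⁻¹ a (2 ^ b) (2 ^ k + 1) {{ℕ.m^n≢0 2 b}}
    (ℚ.≤-trans (C⇒near k inC xd) (ℚ.≤-trans (ℚ.+-monoʳ-≤ (power k) (2^-≤1 j)) (frac-+1 (2 ^ k) 1)))

abs-intDigits : ∀ d → ℚ.∣ toℚ d ∣ ℚ.≤ power (length (intDigits d))
abs-intDigits d@(a /2^ b) = abs-frac a (2 ^ b) (2 ^ length I) {{ℕ.m^n≢0 2 b}} (begin
  ℤ.∣ a ∣                                 ≡⟨ msb-digits d ⟨
  msb 0 (I ++ F)                          ≤⟨ ℕ.<⇒≤ (msb-< (I ++ F)) ⟩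
  2 ^ length (I ++ F)                     ≡⟨ cong (2 ^_) (trans (List.length-++ I) (cong (λ l → length I + l) (length-lowDigits b ℤ.∣ a ∣))) ⟩
  2 ^ (length I + b)                      ≡⟨ ℕ.^-distribˡ-+-* 2 (length I) b ⟩
  2 ^ length I * 2 ^ b                    ∎)
  where
  open ℕ.≤-Reasoning
  I = intDigits d
  F = fracDigits d

approximant-≤ : ∀ m d → ℤ.∣ approximant m d ∣ ≤ 2 ^ (length (intDigits d) + suc m)
approximant-≤ m d = begin
  ℤ.∣ approximant m d ∣       ≡⟨ ∣signed∣ (isNegative (𝔻.numerator d)) (msb 0 D) ⟩
  msb 0 D                     ≤⟨ ℕ.<⇒≤ (msb-< D) ⟩
  2 ^ length D                ≡⟨ cong (2 ^_) (trans (List.length-++ (intDigits d)) (cong (λ l → length (intDigits d) + l)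
                                   (trans (List.length-++ (padTake m (fracDigits d))) (trans (ℕ.+-comm _ 1) (cong suc (length-padTake m (fracDigits d))))))) ⟩
  2 ^ (length (intDigits d) + suc m) ∎
  where
  open ℕ.≤-Reasoning
  D = intDigits d ++ (padTake m (fracDigits d) ++ [ true ])

frac-frac : ∀ d a e .{{_ : NonZero d}} .{{_ : NonZero e}} .{{_ : NonZero (d * e)}} → frac (+ 1) d ℚ.* frac a e ≡ frac a (d * e)
frac-frac (suc d) a (suc e) = ℚ.toℚᵘ-injective (ℚᵘ.≃-trans
  (ℚᵘ.≃-trans (ℚ.toℚᵘ-homo-* (frac (+ 1) (suc d)) (frac a (suc e))) (ℚᵘ.*-cong (toℚᵘ-frac (+ 1) d) (toℚᵘ-frac a e)))
  (ℚᵘ.≃-trans (*≡* (cong (ℤ._* + (suc d * suc e)) (ℤ.*-identityˡ a))) (ℚᵘ.≃-sym (toℚᵘ-frac a (e + d * suc e)))))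

C?-pair : ∀ p q j → Dec (∀ i → C[ j ] ((fromℚ p F.∷ fromℚ q F.∷ F.[]) i))
C?-pair p q j with C?-ℚ j p | C?-ℚ j q
... | yes c | yes d = yes λ { 0F → c ; 1F → d }
... | no ¬c | _     = no λ c → ¬c (c 0F)
... | yes _ | no ¬d = no λ c → ¬d (c 1F)

-- From definability to polytime computability

polytimeℝ : ∀ w A finA (program : StackMachine.Prog 1 w A finA ⊤) (f : RealFunction 1) (p : Polynomial 2) →
  (∀ x φ → CF (x 0F) (φ 0F) → ∀ n → Σ[ t ∈ ℕ ] Σ[ y ∈ 𝔻 ]
    (StackMachine.Outputs 1 w A finA φ program (unary n) t (encode𝔻 y) × Near (toℝ y) (Func.to f x) (toℚ (+ 1 /2^ n)))) →
  (∀ x φ → CF (x 0F) (φ 0F) → ∀ n k → C[ k ] (x 0F) → Σ[ v ∈ List Sym ]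
    StackMachine.Outputs 1 w A finA φ program (unary n) (eval p (k ∷ n ∷ [])) v) →
  PolytimeComputable f
polytimeℝ w A finA program f p correct fast = machine program , computes , p , runs
  where
  open StackMachine 1 w A finA using (machine; module Outputs)
  computes : Computes (machine program) f
  computes x φ cf n = let t , y , out , close = correct x φ (cf 0F) n in t , y , Outputs.result≡ out , distance≤ close
  runs : RunsInTime (machine program) p
  runs x φ cf n k (inC , _) = let v , out = fast x φ (cf 0F) n k (inC 0F) in subst Is-just (sym (Outputs.result≡ out)) (just tt)

module Computable
  (f : RealFunction 1)
  (K : ℕ → ℕ) (lipschitz : ∀ i → IsLipschitzConstant f C[ i ] (fromℕ (K i)))
  (KM : TuringMachine) (pK : Polynomial 1)
  (KM-computes : ∀ i → TuringMachine.result KM (unary i) (eval pK (i ∷ [])) ≡ just (binary (K i)))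
  (g̃ : RealFunction 2) (G : OracleTM 2) (G-computes : Computes G g̃) (pG : Polynomial 2) (G-runs : RunsInTime G pG)
  (defines : ∀ (x : ℤ) (y : ℕ) → .{{_ : NonZero y}} →
    ℝ.∣ apply₂ g̃ (fromℤ x) (fromℕ y) ℝ.- fromℕ y ℝ.* apply₁ f (fromℚ (x ℚ./ y)) ∣ ℝ.≤ fromℕ 3) where

  private
    module M = ComputingMachine KM G

    timeK : ℕ → ℕ
    timeK e = eval pK (2 + e ∷ [])

    -- A bound for `m`: the number of digits of the Lipschitz constant is replaced by what `KM` can
    -- write in time `timeK e` on its input of length at most `2 + e`.
    digitsBound : ℕ → ℕ → ℕ
    digitsBound n e = 3 + (n + (timeK e * 2 + (2 + e)))

    -- The integers a and y are at most 2^(e+m+1), and the precision requested from `G` is 0.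
    timeG : ℕ → ℕ → ℕ
    timeG n e = eval pG (e + suc (digitsBound n e) ∷ 0 ∷ [])

    time : ℕ → ℕ → ℕ
    time n e = M.totalTime ((2 + e) + digitsBound n e) (timeK e) (timeG n e)

  module _ (x : ℝ) (φ : Fin 1 → ℕ → 𝔻) (cf : CF x (φ 0F)) (n : ℕ) where

    private
      d₀ = φ 0F 0
      i = 2 + length (intDigits d₀)
      k = K i
      kd = reverse (bits k)
      m = M.guard n (length kd)
      d₁ = φ 0F m
      a = approximant m d₁
      Y = 2 ^ suc m
      r : ℚ
      r = toℚ (a /2^ suc m)

      instance
        Y≢0 : NonZero Y
        Y≢0 = ℕ.m^n≢0 2 (suc m)

      arguments : F.Vector ℝ 2
      arguments = fromℤ a F.∷ fromℕ Y F.∷ F.[]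

      constants : Fin 2 → ℕ → 𝔻
      constants = M.constants (a /2^ 0) (+ Y /2^ 0)

      constants-CF : ∀ j → CF (arguments j) (constants j)
      constants-CF 0F l = distance≤ (near-weaken (frac-nonNeg 1 (2 ^ l) {{ℕ.m^n≢0 2 l}}) (near-refl (a ℚ./ 1)))
      constants-CF 1F l = distance≤ (near-weaken (frac-nonNeg 1 (2 ^ l) {{ℕ.m^n≢0 2 l}}) (near-refl (+ Y ℚ./ 1)))

      computed : Σ[ t ∈ ℕ ] Σ[ z ∈ 𝔻 ] (OracleTM.result G constants [] t ≡ just (encode𝔻 z) × Near (toℝ z) (apply₂ g̃ (fromℤ a) (fromℕ Y)) (frac (+ 1) 1))
      -- The empty input is the unary numeral of the precision 0; the resulting error 1 joins the 3
      -- of definability.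
      computed = let t , z , eq , le = G-computes arguments constants constants-CF 0 in t , z , eq , near le

      z : 𝔻
      z = proj₁ (proj₂ computed)

    answer : 𝔻
    answer = M.shiftExponent (suc m) z

    private
      near₀ : Near x (toℝ d₀) (frac (+ 1) 1)
      near₀ = near (cf 0)

      near₁ : Near x (toℝ d₁) (toℚ (+ 1 /2^ m))
      near₁ = near (cf m)

      instance
        2^m≢0 : NonZero (2 ^ m)
        2^m≢0 = ℕ.m^n≢0 2 m

      near-r : Near x (fromℚ r) (frac (+ 2) (2 ^ m))
      near-r = near-weaken (frac-+-≤ (+ 1) (2 ^ m) (+ 1) (2 ^ m) (+ 2) (2 ^ m) (ℤ.≤-reflexive (lemma (+ (2 ^ m)))))
        (near-trans near₁ (near-ℚ (approximant-near m d₁)))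
        where
        lemma : ∀ M → (+ 1 ℤ.* M ℤ.+ + 1 ℤ.* M) ℤ.* M ≡ + 2 ℤ.* (M ℤ.* M)
        lemma = ℤ-Solver.solve-∀

      d₀+3≤ : ∀ {c} → c ℚ.≤ frac (+ 3) 1 → ℚ.∣ toℚ d₀ ∣ ℚ.+ c ℚ.≤ power i
      d₀+3≤ c≤3 = ℚ.≤-trans (ℚ.+-mono-≤ (abs-intDigits d₀) c≤3)
        (ℚ.≤-trans (frac-+1 (2 ^ length (intDigits d₀)) 3) (frac-mono {2 ^ length (intDigits d₀) + 3} {2 ^ i} (2^j+3≤ (length (intDigits d₀)))))

      x∈C : C[ i ] x
      x∈C = near⇒C i near₀ (d₀+3≤ (frac-mono {1} {3} (s≤s z≤n)))

      r∈C : C[ i ] (fromℚ r)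
      r∈C = near⇒C i (near-trans (near-sym near-r) near₀) (d₀+3≤ (ℚ.≤-trans (ℚ.+-monoˡ-≤ (frac (+ 1) 1) 2/2^m≤2) (frac-+1 2 1)))
        where
        2/2^m≤2 : frac (+ 2) (2 ^ m) ℚ.≤ frac (+ 2) 1
        2/2^m≤2 = frac-≤ (+ 2) (2 ^ m) (+ 2) 1 (ℤ.*-monoˡ-≤-nonNeg (+ 2) (+≤+ (ℕ.m^n>0 2 m)))

      near-values : Near (apply₁ f x) (apply₁ f (fromℚ r)) (frac (+ k) 1 ℚ.* frac (+ 2) (2 ^ m))
      near-values = near-lipschitz (frac-nonNeg k 1) (lipschitz i x (fromℚ r) x∈C r∈C) near-r

      near-answer : Near (toℝ answer) (apply₁ f (fromℚ r)) (frac (+ 1) Y ℚ.* frac (+ 4) 1)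
      near-answer = near-resp (λ _ → shifted) (λ j → unscaled (seq (apply₁ f (fromℚ r)) j))
        (near-scale {toℝ z} {fromℕ Y ℝ.* apply₁ f (fromℚ r)} {frac (+ 1) Y} {frac (+ 4) 1} (frac-nonNeg 1 Y)
          (near-weaken (frac-+1 1 3) (near-trans (proj₂ (proj₂ (proj₂ computed))) (near {c = frac (+ 3) 1} (defines a Y)))))
        where
        shifted : frac (+ 1) Y ℚ.* toℚ z ≡ toℚ answer
        shifted = trans (frac-frac Y (𝔻.numerator z) (2 ^ 𝔻.exponent z) {{Y≢0}} {{2^e≢0}} {{Y2^e≢0}})
          (ℚ./-cong {𝔻.numerator z} {p₂ = 𝔻.numerator z} {{Y2^e≢0}} {{ℕ.m^n≢0 2 (suc m + 𝔻.exponent z)}} refl (sym (ℕ.^-distribˡ-+-* 2 (suc m) (𝔻.exponent z))))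
          where
          2^e≢0 : NonZero (2 ^ 𝔻.exponent z)
          2^e≢0 = ℕ.m^n≢0 2 (𝔻.exponent z)
          Y2^e≢0 : NonZero (Y * 2 ^ 𝔻.exponent z)
          Y2^e≢0 = ℕ.m*n≢0 Y (2 ^ 𝔻.exponent z) {{Y≢0}} {{2^e≢0}}
        inverse : frac (+ 1) Y ℚ.* frac (+ Y) 1 ≡ ℚ.1ℚ
        inverse = trans (ℚ.*-comm (frac (+ 1) Y) (frac (+ Y) 1)) (trans (frac-* (+ Y) (+ 1) Y)
          (ℚ.≤-antisym (frac-≤ (+ Y ℤ.* + 1) Y (+ 1) 1 (ℤ.≤-reflexive (lemma (+ Y)))) (frac-≤ (+ 1) 1 (+ Y ℤ.* + 1) Y (ℤ.≤-reflexive (sym (lemma (+ Y)))))))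
          where
          lemma : ∀ Y → (Y ℤ.* + 1) ℤ.* + 1 ≡ + 1 ℤ.* Y
          lemma = ℤ-Solver.solve-∀
        unscaled : ∀ q → frac (+ 1) Y ℚ.* (frac (+ Y) 1 ℚ.* q) ≡ q
        unscaled q = trans (sym (ℚ.*-assoc (frac (+ 1) Y) (frac (+ Y) 1) q)) (trans (cong (ℚ._* q) inverse) (ℚ.*-identityˡ q))

      k<2^kd : suc k ≤ 2 ^ length kd
      k<2^kd = subst (λ v → v < 2 ^ length kd) (msb-reverse-bits k) (msb-< kd)

      -- With Y = 2^(m+1) the two errors add up to 2 (k + 1) / 2^m. If k has ℓ digits then k + 1 ≤
      -- 2^ℓ, and m = n + 3 + ℓ makes the sum at most a quarter of 2^-n.
      total≤ : frac (+ 1) Y ℚ.* frac (+ 4) 1 ℚ.+ frac (+ k) 1 ℚ.* frac (+ 2) (2 ^ m) ℚ.≤ toℚ (+ 1 /2^ n)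
      total≤ = subst (ℚ._≤ toℚ (+ 1 /2^ n))
        (sym (cong₂ ℚ._+_ (trans (ℚ.*-comm (frac (+ 1) Y) (frac (+ 4) 1)) (frac-* (+ 4) (+ 1) Y)) (frac-* (+ k) (+ 2) (2 ^ m))))
        (frac-+-≤ (+ 4 ℤ.* + 1) Y (+ k ℤ.* + 2) (2 ^ m) (+ 1) (2 ^ n) {{Y≢0}} {{2^m≢0}} {{ℕ.m^n≢0 2 n}}
          (subst₂ cast₁ cast₂ (+≤+ bound)))
        where
        subst₂ : ∀ {a b c d : ℤ} → a ≡ b → c ≡ d → a ℤ.≤ c → b ℤ.≤ d
        subst₂ refl refl le = le
        P = 2 ^ n
        M′ = 2 ^ m
        cast₁ : + ((4 * 1 * M′ + k * 2 * Y) * P) ≡ (+ 4 ℤ.* + 1 ℤ.* + M′ ℤ.+ + k ℤ.* + 2 ℤ.* + Y) ℤ.* + P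
        cast₁ = trans (ℤ.pos-* (4 * 1 * M′ + k * 2 * Y) P) (cong (ℤ._* + P) (trans (ℤ.pos-+ (4 * 1 * M′) (k * 2 * Y))
          (cong₂ ℤ._+_ (ℤ.pos-* 4 M′) (trans (ℤ.pos-* (k * 2) Y) (cong (ℤ._* + Y) (ℤ.pos-* k 2))))))
        cast₂ : + (1 * (Y * M′)) ≡ + 1 ℤ.* (+ Y ℤ.* + M′)
        cast₂ = trans (ℤ.pos-* 1 (Y * M′)) (cong (+ 1 ℤ.*_) (ℤ.pos-* Y M′))
        split : M′ ≡ 8 * (P * 2 ^ length kd)
        split = trans (ℕ.^-distribˡ-+-* 2 3 (n + length kd)) (cong (8 *_) (ℕ.^-distribˡ-+-* 2 n (length kd)))
        l₁ : ∀ k P Q M → (4 * 1 * M + k * 2 * (2 * M)) * P ≡ 2 * M * (2 * (P * (1 + k)))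
        l₁ = solve-∀
        l₂ : ∀ P Q → 2 * (P * Q) + 6 * (P * Q) ≡ 8 * (P * Q)
        l₂ = solve-∀
        open ℕ.≤-Reasoning
        bound : (4 * 1 * M′ + k * 2 * Y) * P ≤ 1 * (Y * M′)
        bound = begin
          (4 * 1 * M′ + k * 2 * Y) * P            ≡⟨ l₁ k P 0 M′ ⟩
          2 * M′ * (2 * (P * suc k))              ≤⟨ ℕ.*-monoʳ-≤ (2 * M′) (ℕ.*-monoʳ-≤ 2 (ℕ.*-monoʳ-≤ P k<2^kd)) ⟩
          2 * M′ * (2 * (P * 2 ^ length kd))      ≤⟨ ℕ.*-monoʳ-≤ (2 * M′) (ℕ.≤-trans (ℕ.m≤m+n _ (6 * (P * 2 ^ length kd)))
                                                       (ℕ.≤-reflexive (trans (l₂ P (2 ^ length kd)) (sym split)))) ⟩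
          2 * M′ * M′                             ≡⟨ ℕ.*-identityˡ (Y * M′) ⟨
          1 * (Y * M′)                            ∎

    answer-near : Near (toℝ answer) (apply₁ f x) (toℚ (+ 1 /2^ n))
    answer-near = near-weaken total≤ (near-trans near-answer (near-sym near-values))

    int₀ int₁ : ℕ
    int₀ = length (intDigits d₀)
    int₁ = length (intDigits d₁)

    int-≤ : ∀ j → C[ j ] x → int₀ ≤ 2 + j × int₁ ≤ 2 + j
    int-≤ j inC = intDigits-≤ d₀ 0 j inC near₀ , intDigits-≤ d₁ m j inC near₁

    module _ (e : ℕ) (int₀≤ : int₀ ≤ e) (int₁≤ : int₁ ≤ e) where

      private
        ψ : Fin 0 → ℕ → 𝔻
        ψ = proj₁ (oracle-result KM (unary i) (eval pK (i ∷ [])) (binary k) (KM-computes i))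

        K-result : OracleTM.result KM ψ (unary i) (timeK e) ≡ just (binary k)
        K-result = result-mono KM ψ {eval pK (i ∷ [])} {timeK e} {unary i} {binary k} (eval-mono₁ pK (ℕ.+-monoʳ-≤ 2 int₀≤))
          (proj₂ (oracle-result KM (unary i) (eval pK (i ∷ [])) (binary k) (KM-computes i)))

        m≤ : m ≤ digitsBound n e
        -- The digits of the Lipschitz constant are counted on the output of `KM`.
        m≤ = ℕ.+-monoʳ-≤ 3 (ℕ.+-monoʳ-≤ n (ℕ.≤-trans
          (ℕ.≤-reflexive (sym (List.length-map bit kd)))
          (ℕ.≤-trans (ComputingCorrectness.length-resultK KM G φ ψ i (timeK e) {binary k} K-result)
            (ℕ.+-monoʳ-≤ (timeK e * 2) (ℕ.+-monoʳ-≤ 2 int₀≤)))))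

        arguments-C : ∀ j → C[ int₁ + suc m ] (arguments j)
        arguments-C 0F = abs⇒C (int₁ + suc m) (abs-frac a 1 (2 ^ (int₁ + suc m))
          (ℕ.≤-trans (approximant-≤ m d₁) (ℕ.≤-reflexive (sym (ℕ.*-identityʳ _)))))
        arguments-C 1F = abs⇒C (int₁ + suc m) (abs-frac (+ Y) 1 (2 ^ (int₁ + suc m))
          (ℕ.≤-trans (ℕ.^-monoʳ-≤ 2 (ℕ.m≤n+m (suc m) int₁)) (ℕ.≤-reflexive (sym (ℕ.*-identityʳ _)))))

        G-result : OracleTM.result G constants [] (timeG n e) ≡ just (encode𝔻 z)
        G-result = finish (least {λ j → ∀ l → C[ j ] (arguments l)} (C?-pair (a ℚ./ 1) (+ Y ℚ./ 1)) (int₁ + suc m) arguments-C)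
          where
          finish : (Σ[ j ∈ ℕ ] (j ≤ int₁ + suc m × IsLeast (λ j → ∀ l → C[ j ] (arguments l)) j)) →
                   OracleTM.result G constants [] (timeG n e) ≡ just (encode𝔻 z)
          finish (j , j≤ , isLeast) = result-mono G constants {eval pG (j ∷ 0 ∷ [])} {timeG n e} {[]} {encode𝔻 z}
            (eval-mono₂ pG (ℕ.≤-trans j≤ (ℕ.+-mono-≤ int₁≤ (s≤s m≤))) z≤n)
            (halting-result G constants {[]} {proj₁ computed} {eval pG (j ∷ 0 ∷ [])} {encode𝔻 z}
              (proj₁ (proj₂ (proj₂ computed))) (G-runs arguments constants constants-CF 0 j isLeast))

      outputs-answer : StackMachine.Outputs 1 M.workTapes M.Aux M.finite-Aux φ M.program (unary n) (time n e) (encode𝔻 answer)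
      outputs-answer = ComputingCorrectness.outputs-program KM G φ n ψ k (timeK e) (timeG n e) ((2 + e) + digitsBound n e) z
        (ℕ.≤-trans (ℕ.+-monoʳ-≤ 2 int₀≤) (ℕ.m≤m+n (2 + e) _)) (ℕ.≤-trans m≤ (ℕ.m≤n+m _ (2 + e)))
        (ℕ.≤-trans (ℕ.≤-trans int₁≤ (ℕ.m≤n+m e 2)) (ℕ.m≤m+n (2 + e) _))
        K-result G-result

  private
    bound : Vec ℕ 2 → ℕ
    bound ρ = time (lookup ρ 1F) (2 + lookup ρ 0F)

    poly-bound : Poly bound
    poly-bound = 1 ₙ⊞ (magnitude ⊞ (simK ⊞ (precision ⊞ (1 ₙ⊞ (approximate ⊞ (simG ⊞ deliver))))))
      where
      n = poly-var 1F
      e = 2 ₙ⊞ poly-var 0F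
      TK = poly-eval₁ pK (2 ₙ⊞ e)
      digits = 3 ₙ⊞ (n ⊞ (TK ⊠ₙ 2 ⊞ (2 ₙ⊞ e)))
      N = (2 ₙ⊞ e) ⊞ digits
      TG = poly-eval₂ pG (e ⊞ (1 ₙ⊞ digits)) (poly-con 0)
      D = N ⊞ (1 ₙ⊞ N)
      s = D ⊞ₙ 3
      k = TG ⊠ s ⊞ₙ 0
      magnitude = 4 ₙ⊞ ((N ⊠ₙ 5 ⊞ₙ 2) ⊞ₙ 5)
      simK = (1 ₙ⊞ TK) ⊠ poly-con (OracleTM.tapes KM * 3 + (OracleTM.tapes KM * 6 + 1))
      precision = (N ⊠ₙ 5 ⊞ₙ 2) ⊞ ((N ⊠ₙ 5 ⊞ₙ 2) ⊞ (2 ₙ⊞ (2 ₙ⊞ (2 ₙ⊞ (2 ₙ⊞ (2 ₙ⊞ ((N ⊠ₙ 11 ⊞ₙ 2) ⊞ₙ 7)))))))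
      approximate = 4 ₙ⊞ ((N ⊠ₙ 5 ⊞ₙ 2) ⊞ ((N ⊠ₙ 6 ⊞ₙ 2) ⊞ (2 ₙ⊞ (2 ₙ⊞ ((D ⊠ₙ 5 ⊞ₙ 2) ⊞ ((D ⊠ₙ 2 ⊞ₙ 4) ⊞ₙ 3))))))
      refill = (k ⊠ₙ 3 ⊞ₙ 2) ⊞ ((k ⊠ₙ 3 ⊞ₙ 2) ⊞ ((s ⊠ₙ 5 ⊞ₙ 2) ⊞ (s ⊠ₙ 7 ⊞ₙ 2)))
      simG = (1 ₙ⊞ TG) ⊠ (poly-con (OracleTM.tapes G * 3) ⊞ (poly-con (OracleTM.tapes G * 6) ⊞ (refill ⊞ₙ 1)))
      deliver = 4 ₙ⊞ ((k ⊠ₙ 5 ⊞ₙ 2) ⊞ ((k ⊠ₙ 5 ⊞ₙ 2) ⊞ ((k ⊠ₙ 5 ⊞ₙ 2) ⊞ (((1 ₙ⊞ N) ⊠ₙ 6 ⊞ₙ 2) ⊞ (2 ₙ⊞ ((k ⊠ₙ 5 ⊞ₙ 2) ⊞ₙ 3))))))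

    -- Vectors are functions, so rebuilding `x` from its entry gives only a pointwise equal vector;
    -- that `f` respects equality closes the gap.
    singleton : (x : F.Vector ℝ 1) → apply₁ f (x 0F) ≈ Func.to f x
    singleton x = Func.cong f {x 0F F.∷ F.[]} {x} λ { 0F → ≈-refl {x 0F} }

  computable : PolytimeComputable f
  computable = polytimeℝ M.workTapes M.Aux M.finite-Aux M.program f (proj₁ poly-bound) correct fast
    where
    correct : ∀ x φ → CF (x 0F) (φ 0F) → ∀ n → Σ[ t ∈ ℕ ] Σ[ y ∈ 𝔻 ]
      (StackMachine.Outputs 1 M.workTapes M.Aux M.finite-Aux φ M.program (unary n) t (encode𝔻 y) × Near (toℝ y) (Func.to f x) (toℚ (+ 1 /2^ n)))
    correct x φ cf n = _ , answer (x 0F) φ cf n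
      -- Correctness comes without an index `k` for x, so the digits of the two answers at hand
      -- serve as the bound.
      , outputs-answer (x 0F) φ cf n (int₀ (x 0F) φ cf n + int₁ (x 0F) φ cf n) (ℕ.m≤m+n _ _) (ℕ.m≤n+m _ _)
      , near-weaken (ℚ.≤-reflexive (ℚ.+-identityʳ _)) (near-trans (answer-near (x 0F) φ cf n) (≈⇒near (singleton x)))
    fast : ∀ x φ → CF (x 0F) (φ 0F) → ∀ n k → C[ k ] (x 0F) → Σ[ v ∈ List Sym ]
      StackMachine.Outputs 1 M.workTapes M.Aux M.finite-Aux φ M.program (unary n) (eval (proj₁ poly-bound) (k ∷ n ∷ [])) v
    fast x φ cf n k inC = encode𝔻 (answer (x 0F) φ cf n)
      , StackMachine.outputs-mono 1 M.workTapes M.Aux M.finite-Aux (proj₂ poly-bound (k ∷ n ∷ []))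
          -- Here the bound depends on `k` alone, by `intDigits-≤`.
          (outputs-answer (x 0F) φ cf n (2 + k) (proj₁ (int-≤ (x 0F) φ cf n k inC)) (proj₂ (int-≤ (x 0F) φ cf n k inC)))

definable⇒polytime : ∀ {ℓ} (𝒞 : RealFunction 2 → Set ℓ) → (∀ g̃ → 𝒞 g̃ → PolytimeComputable g̃) →
                     ∀ f → LocallyPolyLipschitz f → 𝒞 -Definable f → PolytimeComputable f
definable⇒polytime 𝒞 polytime f (_ , K , lipschitz , KM , pK , KM-computes) (g̃ , g̃∈𝒞 , defines) =
  let G , G-computes , pG , G-runs = polytime g̃ g̃∈𝒞
  in Computable.computable f K lipschitz KM pK KM-computes g̃ G G-computes pG G-runs defines

theorem13 : ∀ {ℓ : Level} (𝒞 : Pred (RealFunction 2) ℓ) →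
    (∀ g̃ → 𝒞 g̃ → PolytimeComputable g̃) →
    𝒞 Approximates PolytimeComputableℤ →
    (f : RealFunction 1) → LocallyPolyLipschitz f →
    PolytimeComputable f ⇔ (𝒞 -Definable f)
theorem13 𝒞 polytime approx f lipschitz =
  mk⇔ (polytime⇒definable 𝒞 approx f) (definable⇒polytime 𝒞 polytime f lipschitz)
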